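{- Every combinatorial 4-PPT can be stretched to become a (geometric) pointed pseudo-triangulation with face degree at most four, realizing the given combinatorial embedding and the given assignment of reflex/convex tags to its angles. Furthermore, every combinatorial 4-PPT has the generalized Laman property.
   Context: An angle of a plane embedded graph is an incidence of a vertex with a face (the corner between two consecutive edges around the vertex in that face). A combinatorial pseudo-triangulation is a simple planar graph with a fixed combinatorial embedding in the plane (cyclic order of edges at each vertex and a designated outer face), together with an assignment of tags "reflex" or "convex" to its angles such that (1) every interior face has exactly three angles tagged convex, (2) all angles of the outer face are tagged reflex, and (3) no vertex is incident to more than one angle tagged reflex. A vertex is pointed if it is incident to exactly one reflex-tagged angle; the combinatorial pseudo-triangulation is pointed if all vertices are pointed. A combinatorial 4-PPT is a combinatorial pointed pseudo-triangulation in which every interior face is bounded by a simple cycle of length 3 or 4 (the outer face may have arbitrary size). Geometrically, a pseudo-triangle is a simple polygon with exactly three interior angles smaller than $\pi$; a pseudo-triangulation of a finite point set $S$ is a partition of the convex hull of $S$ into pseudo-triangles whose vertex set is exactly $S$; it is pointed if every vertex is incident to an angle larger than $\pi$. Stretching means finding a straight-line plane drawing of the graph with the given combinatorial embedding which is a pseudo-triangulation of its vertex set, where the angles larger than $\pi$ are exactly those tagged reflex. A combinatorial pseudo-triangulation has the generalized Laman property if every subset consisting of $x$ non-pointed and $y$ pointed vertices with $x+y\ge 2$ induces a subgraph with at most $3x+2y-3$ edges. -}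

module Defs where

open import Data.Nat using (ℕ; zero; suc; _+_; _*_; _≤_; _<_)
open import Data.Fin using (Fin; toℕ) renaming (_≟_ to _≟ᶠ_)
open import Data.Fin.Subset using (Subset; _∈_)
open import Data.Fin.Subset.Properties using (_∈?_)
open import Data.Bool using (Bool; true; false; _∧_; not)
open import Data.List using (List; length; filterᵇ)
open import Data.List.Base using ()
open import Data.Vec.Functional using ()
open import Data.Fin.Base using ()
open import Data.Product using (Σ; ∃; _×_; _,_; proj₁; proj₂)
open import Data.Sum using (_⊎_)
open import Relation.Binary.PropositionalEquality using (_≡_; _≢_)
open import Relation.Nullary using (¬_; does)
open import Function.Bundles using (_⇔_)
open import Data.Rational as Q using (ℚ; 0ℚ; 1ℚ)
import Data.Rational.Properties as QP
import Data.Nat.Properties as NP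
open import Data.List using (allFin)

iter : ∀ {A : Set} → (A → A) → ℕ → A → A
iter f zero    x = x
iter f (suc k) x = f (iter f k x)

count : ∀ {D : ℕ} → (Fin D → Bool) → ℕ
count {D} p = length (filterᵇ p (allFin D))

_=ᶠ_ : ∀ {k} → Fin k → Fin k → Bool
a =ᶠ b = does (a ≟ᶠ b)

-- Combinatorial embeddings (rotation systems on darts)
--
-- Vertices are Fin n, darts (half-edges) are Fin D.  A dart d goes from
-- tail d to head d = tail (α d); α is the edge involution.  σ is the
-- rotation: σ d is the next dart counter-clockwise around tail d.
-- Faces are the orbits of φ = σ ∘ α, labelled by  face : Fin D → Fin F.
-- The angle (corner) indexed by dart e is the corner at vertex tail e
-- between dart e and dart σ e (sweeping counter-clockwise); it lies in the
-- face  face (σ e)  (the face walk enters tail e along α e and leaves along σ e).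

record Embedding (n : ℕ) : Set where
  field
    D     : ℕ
    tail  : Fin D → Fin n
    α     : Fin D → Fin D
    σ     : Fin D → Fin D
    F     : ℕ
    face  : Fin D → Fin F
    outer : Fin F

  head : Fin D → Fin n
  head d = tail (α d)

  φ : Fin D → Fin D
  φ d = σ (α d)

  angleFace : Fin D → Fin F
  angleFace e = face (σ e)

open Embedding public

data Reach {n : ℕ} (G : Embedding n) (u : Fin n) : Fin n → Set where
  here : Reach G u u
  step : ∀ {w} (d : Fin (D G)) → Reach G u w → tail G d ≡ w → Reach G u (head G d)

record IsPlaneSimple {n : ℕ} (G : Embedding n) : Set where
  field
    α-invol    : ∀ d → α G (α G d) ≡ d
    α-nofix    : ∀ d → α G d ≢ d
    σ-inj      : ∀ d d' → σ G d ≡ σ G d' → d ≡ d'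
    σ-tail     : ∀ d → tail G (σ G d) ≡ tail G d
    σ-trans    : ∀ d d' → tail G d ≡ tail G d' → ∃ λ k → iter (σ G) k d ≡ d'
    face-φ     : ∀ d → face G (φ G d) ≡ face G d
    face-orbit : ∀ d d' → face G d ≡ face G d' → ∃ λ k → iter (φ G) k d ≡ d'
    face-surj  : ∀ f → ∃ λ d → face G d ≡ f
    no-loop    : ∀ d → head G d ≢ tail G d
    no-multi   : ∀ d d' → tail G d ≡ tail G d' → head G d ≡ head G d' → d ≡ d'
    connected  : ∀ u v → Reach G u v
    -- planar (genus 0): Euler's formula  n - D/2 + F = 2
    euler      : 2 * (n + F G) ≡ D G + 4

-- Combinatorial pseudo-triangulations; tags: reflex e ≡ true means the
-- angle indexed by dart e is tagged reflex, false means convex.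

module _ {n : ℕ} (G : Embedding n) (reflex : Fin (D G) → Bool) where

  convexIn : Fin (F G) → ℕ
  convexIn f = count (λ e → (angleFace G e =ᶠ f) ∧ not (reflex e))

  record IsCombPT : Set where
    field
      plane        : IsPlaneSimple G
      three-convex : ∀ f → f ≢ outer G → convexIn f ≡ 3
      outer-reflex : ∀ e → angleFace G e ≡ outer G → reflex e ≡ true
      one-reflex   : ∀ e e' → tail G e ≡ tail G e' → reflex e ≡ true → reflex e' ≡ true → e ≡ e'

  -- vertex v is pointed: incident to exactly one reflex-tagged angle
  -- (given IsCombPT, at most one is automatic, so this says at least one)
  Pointed : Fin n → Set
  Pointed v = (∃ λ e → tail G e ≡ v × reflex e ≡ true)
            × (∀ e e' → tail G e ≡ v → tail G e' ≡ v → reflex e ≡ true → reflex e' ≡ true → e ≡ e')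

  faceSize : Fin (F G) → ℕ
  faceSize f = count (λ d → face G d =ᶠ f)

  SimpleCycle34 : Fin (F G) → Set
  SimpleCycle34 f = (faceSize f ≡ 3 ⊎ faceSize f ≡ 4)
                  × (∀ d d' → face G d ≡ f → face G d' ≡ f → tail G d ≡ tail G d' → d ≡ d')

  record IsComb4PPT : Set where
    field
      pt       : IsCombPT
      pointed  : ∀ v → Pointed v
      faces34  : ∀ f → f ≢ outer G → SimpleCycle34 f

  -- Generalized Laman property.  For X ⊆ V, an edge {d, α d} is counted
  -- once via the dart with the smaller index.

  inducedEdges : Subset n → ℕ
  inducedEdges X = count (λ d → does (tail G d ∈? X) ∧ does (head G d ∈? X)
                                   ∧ does (NP._<?_ (toℕ d) (toℕ (α G d))))

  -- numbers of pointed / non-pointed vertices in X (pointed is decidable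
  -- via the reflex-tag count; we count vertices with exactly one reflex angle)
  reflexAt : Fin n → ℕ
  reflexAt v = count (λ e → (tail G e =ᶠ v) ∧ reflex e)

  pointedIn : Subset n → ℕ
  pointedIn X = count (λ v → does (v ∈? X) ∧ does (reflexAt v NP.≟ 1))

  nonPointedIn : Subset n → ℕ
  nonPointedIn X = count (λ v → does (v ∈? X) ∧ not (does (reflexAt v NP.≟ 1)))

  -- |E(X)| ≤ 3x + 2y - 3  whenever x + y ≥ 2 (written without truncated minus)
  GenLaman : Set
  GenLaman = ∀ (X : Subset n) →
             2 ≤ nonPointedIn X + pointedIn X →
             inducedEdges X + 3 ≤ 3 * nonPointedIn X + 2 * pointedIn X

Point : Set
Point = ℚ × ℚ

_-ᵖ_ : Point → Point → Point
(a , b) -ᵖ (c , d) = (a Q.- c , b Q.- d)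

cross : Point → Point → ℚ
cross (a , b) (c , d) = (a Q.* d) Q.- (b Q.* c)

OnSeg : Point → Point → Point → Set
OnSeg q a b = ∃ λ t → 0ℚ Q.≤ t × t Q.≤ 1ℚ
                   × q ≡ (proj₁ a Q.+ t Q.* (proj₁ b Q.- proj₁ a) ,
                          proj₂ a Q.+ t Q.* (proj₂ b Q.- proj₂ a))

-- direction c lies strictly inside the counter-clockwise sweep from
-- direction a to direction b (a, b not of the same direction)
StrictBetween : Point → Point → Point → Set
StrictBetween a c b with does (0ℚ Q.<? cross a b)
... | true  = (0ℚ Q.< cross a c) × (0ℚ Q.< cross c b)
... | false = (0ℚ Q.< cross a c) ⊎ (0ℚ Q.< cross c b)

LexLeq : Point → Point → Set
LexLeq (a , b) (c , d) = (a Q.< c) ⊎ ((a ≡ c) × (b Q.≤ d))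

module _ {n : ℕ} (G : Embedding n) (reflex : Fin (D G) → Bool) (p : Fin n → Point) where

  dir : Fin (D G) → Point
  dir d = p (head G d) -ᵖ p (tail G d)

  -- the angle indexed by e is geometrically larger than π
  -- (a degree-one vertex has a single angle of size 2π)
  GeoReflex : Fin (D G) → Set
  GeoReflex e = (σ G e ≡ e) ⊎ (cross (dir e) (dir (σ G e)) Q.< 0ℚ)

  geoConvexᵇ : Fin (D G) → Bool
  geoConvexᵇ e = does (0ℚ Q.<? cross (dir e) (dir (σ G e)))

  InAngle : Fin (D G) → Point → Set
  InAngle e c = (σ G e ≡ e) ⊎ StrictBetween (dir e) c (dir (σ G e))

  record IsStretching : Set where
    field
      injective  : ∀ u v → p u ≡ p v → u ≡ v
      noCrossing : ∀ d d' q → d' ≢ d → d' ≢ α G d →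
                   OnSeg q (p (tail G d)) (p (head G d)) →
                   OnSeg q (p (tail G d')) (p (head G d')) →
                   ∃ λ u → q ≡ p u
                         × (u ≡ tail G d ⊎ u ≡ head G d)
                         × (u ≡ tail G d' ⊎ u ≡ head G d')
      rotation   : ∀ e f → tail G f ≡ tail G e → f ≢ e → f ≢ σ G e →
                   ¬ StrictBetween (dir e) (dir f) (dir (σ G e))
      -- realizes the outer face: the leftward horizontal ray from the
      -- lexicographically smallest vertex lies in the designated outer face
      outerFace  : ∀ v e → (∀ w → LexLeq (p v) (p w)) → tail G e ≡ v →
                   InAngle e (Q.- 1ℚ , 0ℚ) → angleFace G e ≡ outer G
      -- the bounded faces cover the convex hull: every point lies weakly
      -- on the inner (left) side of every outer boundary edge
      hull       : ∀ d w → face G d ≡ outer G →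
                   0ℚ Q.≤ cross (dir d) (p w -ᵖ p (tail G d))
      pseudoTri  : ∀ f → f ≢ outer G →
                   count (λ e → (angleFace G e =ᶠ f) ∧ geoConvexᵇ e) ≡ 3
      degree≤4   : ∀ f → f ≢ outer G → count (λ d → face G d =ᶠ f) ≤ 4
      pointedGeo : ∀ v → ∃ λ e → tail G e ≡ v × GeoReflex e
      tagsMatch  : ∀ e → GeoReflex e ⇔ (reflex e ≡ true)


Stretchable : ∀ {n} (G : Embedding n) (reflex : Fin (D G) → Bool) → Set
Stretchable {n} G reflex = ∃ λ (p : Fin n → Point) → IsStretching G reflex p

{-# OPTIONS --safe #-}
-- Contract a quadrilateral c a v b with reflex vertex v by moving v onto c: its faces other than the quadrilateral keep their
-- boundary walks and tags, v loses its reflex corner and the result is a smaller 4-PPT, provided that a and b are the only common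
-- neighbours of v and c. Conversely, from a drawing of the smaller graph v is split off again at c + ε ((a − c) + (b − c)). When
-- no quadrilateral is left the graph is a triangulated convex polygon, which is reduced by cutting off ears.
--
-- A contractible quadrilateral exists: another common neighbour w closes a 4-cycle around the quadrilateral, which has one of a
-- and b strictly inside; the quadrilateral with its reflex corner there lies inside as well and is contractible or gives a
-- 4-cycle around fewer faces. An edge v c is impossible, since counting faces, edges and vertices inside a triangle shows that no
-- reflex corner of its vertices lies inside. Insides of cycles are the dual components not reached from the outer face, and
-- Euler's formula enters through the fact that the complement of a dual spanning tree is connected.
--
-- The edge bound follows along the same reductions, as a contraction removes one vertex and two edges.
module Submission where

open import Defs hiding (D; tail; α; σ; F; face; outer; head; φ; angleFace; step; here)
open import Data.Nat as ℕ using (ℕ; zero; suc; z≤n; s≤s) renaming (_+_ to _+ℕ_; _*_ to _*ℕ_; _≤_ to _≤ℕ_; _<_ to _<ℕ_)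
import Data.Nat.Properties as ℕP
open import Data.Nat.Tactic.RingSolver using (solve-∀)
open import Data.Fin using (Fin; zero; suc; toℕ; _≟_)
import Data.Fin.Properties as FinP
open import Data.Bool using (Bool; true; false; _∧_; _∨_; not; if_then_else_)
import Data.Bool.Properties as BoolP
open import Data.List using (List; []; _∷_; length; filterᵇ)
import Data.List as List
open import Data.List.Membership.Propositional using () renaming (_∈_ to _∈ˡ_; _∉_ to _∉ˡ_)
open import Data.List.Relation.Unary.Any using (here; there)
open import Data.Product using (Σ; ∃; _×_; _,_; proj₁; proj₂)
open import Data.Sum using (_⊎_; inj₁; inj₂; [_,_]′)
open import Data.Empty using (⊥; ⊥-elim)
open import Relation.Nullary using (¬_; Dec; yes; no; does)
open import Relation.Nullary.Decidable using (dec-true; dec-false)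
open import Relation.Binary.PropositionalEquality using (_≡_; _≢_; refl; sym; trans; cong; cong₂; subst; subst₂; ≢-sym)
open import Function using (_∘_; id; case_of_)
open import Function.Bundles using (mk⇔)
open import Data.Rational as ℚ using (ℚ; 0ℚ; 1ℚ; ½; _+_; _*_; _-_; -_; _<_; _≤_)
import Data.Rational.Properties as ℚP
open import Data.Rational.Solver using (module +-*-Solver)
open +-*-Solver using (solve; _:+_; _:*_; _:-_; :-_; _:=_; con)
open import Data.Fin.Subset.Properties using (_∈?_)
open import Relation.Binary.Definitions using (tri<; tri≈; tri>)

-- A vertex is put back by a small displacement, and one ε has to serve the whole drawing. The
-- induction hypothesis `Drawn` therefore contains strict inequalities only: a strictly convex outer
-- boundary, the darts of each vertex in order within an angle less than π, and strictly separating
-- lines for disjoint edges and distinct points. As everything moves along a single vector, these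
-- signs are linear in ε, and only those that vanish at ε = 0 need an argument of their own. They
-- concern the edges that were glued. Contraction leaves the face walks and the corner tags of the
-- surviving darts alone, so the tags need no recomputation. The obstacle is simplicity: moving v
-- onto c may create loops or parallel edges, and excluding them takes the separation theory.
-- Without an interior quadrilateral every reflex corner lies in the outer face. Since each vertex
-- has one, all vertices are then on the boundary, which is why only triangulated polygons remain.

true≢false : ∀ {b : Bool} → b ≡ true → b ≡ false → ⊥
true≢false refl ()

∧-intro : ∀ {a b} → a ≡ true → b ≡ true → a ∧ b ≡ true
∧-intro refl refl = refl

∧-elim₁ : ∀ {a b} → a ∧ b ≡ true → a ≡ true
∧-elim₁ {true} _ = refl

∧-elim₂ : ∀ {a b} → a ∧ b ≡ true → b ≡ true
∧-elim₂ {true} h = h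

∨-intro₁ : ∀ {a b} → a ≡ true → a ∨ b ≡ true
∨-intro₁ refl = refl

∨-intro₂ : ∀ {a b} → b ≡ true → a ∨ b ≡ true
∨-intro₂ {true} _ = refl
∨-intro₂ {false} h = h

∨-elim : ∀ {a b} → a ∨ b ≡ true → a ≡ true ⊎ b ≡ true
∨-elim {true} _ = inj₁ refl
∨-elim {false} h = inj₂ h

not-intro : ∀ {a} → a ≡ false → not a ≡ true
not-intro refl = refl

not-elim : ∀ {a} → not a ≡ true → a ≡ false
not-elim {false} _ = refl

false-intro : ∀ {a} → (a ≡ true → ⊥) → a ≡ false
false-intro {true} h = ⊥-elim (h refl)
false-intro {false} _ = refl

bool-cases : (b : Bool) → b ≡ true ⊎ b ≡ false
bool-cases true = inj₁ refl
bool-cases false = inj₂ refl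

bool-ext : ∀ {a b} → (a ≡ true → b ≡ true) → (b ≡ true → a ≡ true) → a ≡ b
bool-ext {true} {true} _ _ = refl
bool-ext {true} {false} f _ = sym (f refl)
bool-ext {false} {true} _ g = g refl
bool-ext {false} {false} _ _ = refl

does-true : ∀ {P : Set} (d : Dec P) → does d ≡ true → P
does-true (yes p) _ = p

=ᶠ-refl : ∀ {k} (a : Fin k) → (a =ᶠ a) ≡ true
=ᶠ-refl a = dec-true (a ≟ a) refl

=ᶠ-true : ∀ {k} (a b : Fin k) → (a =ᶠ b) ≡ true → a ≡ b
=ᶠ-true a b h with a ≟ b
... | yes e = e

=ᶠ-intro : ∀ {k} {a b : Fin k} → a ≡ b → (a =ᶠ b) ≡ true
=ᶠ-intro {a = a} refl = =ᶠ-refl a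

=ᶠ-false : ∀ {k} {a b : Fin k} → a ≢ b → (a =ᶠ b) ≡ false
=ᶠ-false {a = a} {b} h = dec-false (a ≟ b) h

abstract
  -- A case split that does not interact with the reduction of _≟_.
  eq? : ∀ {k} (a b : Fin k) → a ≡ b ⊎ a ≢ b
  eq? a b with a ≟ b
  ... | yes e = inj₁ e
  ... | no e = inj₂ e

-- Counting the elements of decidable subsets of `Fin k`

b2n : Bool → ℕ
b2n true = 1
b2n false = 0

# : ∀ {k} → (Fin k → Bool) → ℕ
# {zero} p = 0
# {suc k} p = b2n (p zero) +ℕ # (p ∘ suc)

length-filter-tabulate : ∀ {A : Set} {k} (p : A → Bool) (f : Fin k → A) →
  length (filterᵇ p (List.tabulate f)) ≡ # (p ∘ f)
length-filter-tabulate {k = zero} p f = refl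
length-filter-tabulate {k = suc k} p f with p (f zero)
... | true = cong suc (length-filter-tabulate p (f ∘ suc))
... | false = length-filter-tabulate p (f ∘ suc)

count≡# : ∀ {k} (p : Fin k → Bool) → count p ≡ # p
count≡# p = length-filter-tabulate p id

infixl 6 _∖_
_∖_ : ∀ {k} → (Fin k → Bool) → Fin k → Fin k → Bool
(p ∖ x) y = p y ∧ not (y =ᶠ x)

∖-intro : ∀ {k} {p : Fin k → Bool} {x y} → p y ≡ true → y ≢ x → (p ∖ x) y ≡ true
∖-intro py y≢x = ∧-intro py (not-intro (=ᶠ-false y≢x))

∖-elim : ∀ {k} {p : Fin k → Bool} {x y} → (p ∖ x) y ≡ true → p y ≡ true × y ≢ x
∖-elim {p = p} {x} {y} h = ∧-elim₁ h , λ { refl → true≢false (=ᶠ-refl y) (not-elim (∧-elim₂ {p y} h)) }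

#-cong : ∀ {k} {p q : Fin k → Bool} → (∀ x → p x ≡ q x) → # p ≡ # q
#-cong {zero} h = refl
#-cong {suc k} h = cong₂ _+ℕ_ (cong b2n (h zero)) (#-cong (h ∘ suc))

suc-=ᶠ : ∀ {k} (a b : Fin k) → (Fin.suc a =ᶠ suc b) ≡ (a =ᶠ b)
suc-=ᶠ a b with a ≟ b
... | yes _ = refl
... | no _ = refl

#-remove : ∀ {k} (p : Fin k → Bool) (x : Fin k) → p x ≡ true → # p ≡ suc (# (p ∖ x))
#-remove {suc k} p zero px rewrite px =
  cong suc (#-cong λ y → sym (BoolP.∧-identityʳ (p (suc y))))
#-remove {suc k} p (suc x) px =
  trans (cong (b2n (p zero) +ℕ_) (#-remove (p ∘ suc) x px))
  (trans (ℕP.+-suc (b2n (p zero)) _)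
    (cong suc (cong₂ _+ℕ_ (cong b2n (sym (BoolP.∧-identityʳ (p zero))))
      (#-cong λ y → cong (λ b → p (suc y) ∧ not b) (sym (suc-=ᶠ y x))))))

-- The injection is defined on the members of `p` only. The image of the first member is removed
-- from `q` before the recursive call, and injectivity keeps the remaining images in what is left.
#-inj : ∀ {k l} (p : Fin k → Bool) (q : Fin l → Bool) (f : ∀ x → p x ≡ true → Fin l) →
  (∀ x h → q (f x h) ≡ true) → (∀ x y h h' → f x h ≡ f y h' → x ≡ y) → # p ≤ℕ # q
#-inj {zero} p q f fq inj = z≤n
#-inj {suc k} p q f fq inj with p zero in eq
... | false = #-inj (p ∘ suc) q (λ x → f (suc x)) (λ x → fq (suc x))
                (λ x y h h' e → FinP.suc-injective (inj (suc x) (suc y) h h' e))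
... | true rewrite #-remove q (f zero eq) (fq zero eq) =
  s≤s (#-inj (p ∘ suc) (q ∖ f zero eq) (λ x → f (suc x))
    (λ x h → ∖-intro {p = q} (fq (suc x) h) (λ e → case inj (suc x) zero h eq e of λ ()))
    (λ x y h h' e → FinP.suc-injective (inj (suc x) (suc y) h h' e)))

#-mono : ∀ {k} {p q : Fin k → Bool} → (∀ x → p x ≡ true → q x ≡ true) → # p ≤ℕ # q
#-mono {p = p} {q} h = #-inj p q (λ x _ → x) h (λ _ _ _ _ e → e)

#-surj : ∀ {k l} (p : Fin k → Bool) (q : Fin l → Bool) (f : Fin k → Fin l) →
  (∀ y → q y ≡ true → ∃ λ x → p x ≡ true × f x ≡ y) → # q ≤ℕ # p
#-surj p q f h = #-inj q p (λ y hy → proj₁ (h y hy)) (λ y hy → proj₁ (proj₂ (h y hy)))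
  λ x y hx hy e → trans (sym (proj₂ (proj₂ (h x hx)))) (trans (cong f e) (proj₂ (proj₂ (h y hy))))

#-perm : ∀ {k} (p : Fin k → Bool) (f g : Fin k → Fin k) → (∀ x → f (g x) ≡ x) → (∀ x → g (f x) ≡ x) →
  # (p ∘ f) ≡ # p
#-perm p f g fg gf = ℕP.≤-antisym
  (#-inj (p ∘ f) p (λ x _ → f x) (λ _ h → h)
    (λ x y _ _ e → trans (sym (gf x)) (trans (cong g e) (gf y))))
  (#-inj p (p ∘ f) (λ x _ → g x) (λ x h → trans (cong p (fg x)) h)
    (λ x y _ _ e → trans (sym (fg x)) (trans (cong f e) (fg y))))

#-split : ∀ {k} (p q : Fin k → Bool) → # p ≡ # (λ x → p x ∧ q x) +ℕ # (λ x → p x ∧ not (q x))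
#-split {zero} p q = refl
#-split {suc k} p q with p zero | q zero
... | true | true = cong suc (#-split (p ∘ suc) (q ∘ suc))
... | true | false = trans (cong suc (#-split (p ∘ suc) (q ∘ suc))) (sym (ℕP.+-suc _ _))
... | false | _ = #-split (p ∘ suc) (q ∘ suc)

#-disj : ∀ {k} (p q r : Fin k → Bool) → (∀ x → p x ≡ true → r x ≡ true) →
  (∀ x → q x ≡ true → r x ≡ true) → (∀ x → p x ≡ true → q x ≡ true → ⊥) → # p +ℕ # q ≤ℕ # r
#-disj p q r pr qr d rewrite #-split r p = ℕP.+-mono-≤
  (#-mono λ x h → ∧-intro (pr x h) h)
  (#-mono λ x h → ∧-intro (qr x h) (not-intro (false-intro λ px → d x px h)))

#-cover : ∀ {k} (p q r : Fin k → Bool) → (∀ x → r x ≡ true → p x ≡ true ⊎ q x ≡ true) → # r ≤ℕ # p +ℕ # q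
#-cover p q r h rewrite #-split r p = ℕP.+-mono-≤ (#-mono λ x e → ∧-elim₂ {r x} e)
  (#-mono λ x e → case h x (∧-elim₁ e) of λ
    { (inj₁ px) → ⊥-elim (true≢false px (not-elim (∧-elim₂ {r x} e))) ; (inj₂ qx) → qx })

#-false : ∀ {k} {p : Fin k → Bool} → (∀ x → p x ≡ false) → # p ≡ 0
#-false {zero} _ = refl
#-false {suc k} {p} h rewrite h zero = #-false (h ∘ suc)

#-all : ∀ {k} {p : Fin k → Bool} → (∀ x → p x ≡ true) → # p ≡ k
#-all {zero} _ = refl
#-all {suc k} {p} h rewrite h zero = cong suc (#-all (h ∘ suc))

#-≤ : ∀ {k} (p : Fin k → Bool) → # p ≤ℕ k
#-≤ {k} p = subst (# p ≤ℕ_) (#-all {p = λ (_ : Fin k) → true} λ _ → refl) (#-mono {p = p} λ _ _ → refl)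

#-pos : ∀ {k} {p : Fin k → Bool} x → p x ≡ true → 1 ≤ℕ # p
#-pos {p = p} x px rewrite #-remove p x px = s≤s z≤n

member : ∀ {k} → List (Fin k) → Fin k → Bool
member [] x = false
member (y ∷ ys) x = (x =ᶠ y) ∨ member ys x

member-intro : ∀ {k} {ys : List (Fin k)} {x} → x ∈ˡ ys → member ys x ≡ true
member-intro {x = x} (here refl) = ∨-intro₁ (=ᶠ-refl x)
member-intro {ys = y ∷ ys} {x} (there m) = ∨-intro₂ {x =ᶠ y} (member-intro m)

member-elim : ∀ {k} (ys : List (Fin k)) {x} → member ys x ≡ true → x ∈ˡ ys
member-elim (y ∷ ys) {x} h with ∨-elim {x =ᶠ y} h
... | inj₁ e = here (=ᶠ-true x y e)
... | inj₂ e = there (member-elim ys e)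

#-list-≤ : ∀ {k} (ys : List (Fin k)) (p : Fin k → Bool) → (∀ x → p x ≡ true → x ∈ˡ ys) → # p ≤ℕ length ys
#-list-≤ [] p h = ℕP.≤-reflexive (#-false λ x → false-intro λ px → case h x px of λ ())
#-list-≤ (y ∷ ys) p h with p y in eq
... | true rewrite #-remove p y eq = s≤s (#-list-≤ ys (p ∖ y) λ x e →
        case h x (proj₁ (∖-elim {p = p} e)) of λ
          { (here r) → ⊥-elim (proj₂ (∖-elim {p = p} e) r) ; (there m) → m })
... | false = ℕP.m≤n⇒m≤1+n (#-list-≤ ys p λ x e → case h x e of λ
          { (here refl) → ⊥-elim (true≢false e eq) ; (there m) → m })

data Distinct {A : Set} : List A → Set where
  [] : Distinct []
  _∷_ : ∀ {x xs} → x ∉ˡ xs → Distinct xs → Distinct (x ∷ xs)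

#-list-≥ : ∀ {k} {ys : List (Fin k)} (p : Fin k → Bool) → Distinct ys → (∀ {x} → x ∈ˡ ys → p x ≡ true) →
  length ys ≤ℕ # p
#-list-≥ p [] h = z≤n
#-list-≥ p (_∷_ {x} {xs} n d) h rewrite #-remove p x (h (here refl)) =
  s≤s (#-list-≥ (p ∖ x) d λ m → ∖-intro {p = p} (h (there m)) λ { refl → n m })

abstract
  search : ∀ {k} (p : Fin k → Bool) → (∃ λ x → p x ≡ true) ⊎ (∀ x → p x ≡ false)
  search p with FinP.any? (λ x → p x BoolP.≟ true)
  ... | yes w = inj₁ w
  ... | no n = inj₂ λ x → false-intro λ h → n (x , h)

-- Induction on the size of `q`, splitting off one fibre at a time. It turns "three corners in each
-- interior face" into a bound on the number of darts.
#-fibres : ∀ {k l} (c : ℕ) (p : Fin k → Bool) (q : Fin l → Bool) (lab : Fin k → Fin l) →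
  (∀ f → q f ≡ true → c ≤ℕ # (λ d → p d ∧ (lab d =ᶠ f))) → c *ℕ # q ≤ℕ # p
#-fibres {k} {l} c p q lab h = go (# q) p q refl h
  where
  go : ∀ m (p : Fin k → Bool) (q : Fin l → Bool) → # q ≡ m →
    (∀ f → q f ≡ true → c ≤ℕ # (λ d → p d ∧ (lab d =ᶠ f))) → c *ℕ # q ≤ℕ # p
  go zero p q e h rewrite e | ℕP.*-zeroʳ c = z≤n
  go (suc m) p q e h with search q
  ... | inj₂ none = ⊥-elim (case trans (sym e) (#-false none) of λ ())
  ... | inj₁ (f , qf) = subst (c *ℕ # q ≤ℕ_) (sym (#-split p λ d → lab d =ᶠ f))
        (subst (λ z → c *ℕ z ≤ℕ # (λ d → p d ∧ (lab d =ᶠ f)) +ℕ # p') (sym (#-remove q f qf))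
          (subst (_≤ℕ # (λ d → p d ∧ (lab d =ᶠ f)) +ℕ # p') (sym (ℕP.*-suc c (# (q ∖ f))))
            (ℕP.+-mono-≤ (h f qf) (go m p' (q ∖ f) (ℕP.suc-injective (trans (sym (#-remove q f qf)) e)) h'))))
    where
    p' : Fin k → Bool
    p' d = p d ∧ not (lab d =ᶠ f)
    h' : ∀ g → (q ∖ f) g ≡ true → c ≤ℕ # (λ d → p' d ∧ (lab d =ᶠ g))
    h' g hg = ℕP.≤-trans (h g (proj₁ (∖-elim {p = q} hg))) (#-mono λ d e →
      ∧-intro {p' d} (∧-intro {p d} (∧-elim₁ e) (not-intro (=ᶠ-false λ le →
        proj₂ (∖-elim {p = q} hg) (trans (sym (=ᶠ-true (lab d) g (∧-elim₂ {p d} e))) le)))) (∧-elim₂ {p d} e))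

insert : ∀ {k} → (Fin k → Bool) → Fin k → Fin k → Bool
insert U x y = U y ∨ (y =ᶠ x)

insert-new : ∀ {k} (U : Fin k → Bool) x → insert U x x ≡ true
insert-new U x = ∨-intro₂ {U x} (=ᶠ-refl x)

insert-elim : ∀ {k} (U : Fin k → Bool) {x y} → insert U x y ≡ true → U y ≡ true ⊎ y ≡ x
insert-elim U {x} {y} h with ∨-elim {U y} h
... | inj₁ u = inj₁ u
... | inj₂ e = inj₂ (=ᶠ-true y x e)

insert-false : ∀ {k} (U : Fin k → Bool) {x y} → U y ≡ false → y ≢ x → insert U x y ≡ false
insert-false U e n = false-intro λ h → [ (λ u → true≢false u e) , n ]′ (insert-elim U h)

#-insert : ∀ {k} (U : Fin k → Bool) x → U x ≡ false → # (insert U x) ≡ suc (# U)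
#-insert U x e = trans (#-remove (insert U x) x (insert-new U x)) (cong suc (#-cong {p = insert U x ∖ x} {U} λ y → bool-ext
  (λ h → case insert-elim U (proj₁ (∖-elim {p = insert U x} h)) of λ
     { (inj₁ u) → u ; (inj₂ r) → ⊥-elim (proj₂ (∖-elim {p = insert U x} h) r) })
  (λ u → ∖-intro {p = insert U x} (∨-intro₁ u) λ { refl → true≢false u e })))

_⊆ᵇ_ : ∀ {k} → (Fin k → Bool) → (Fin k → Bool) → Set
U ⊆ᵇ W = ∀ x → U x ≡ true → W x ≡ true

-- Spanning forests of a graph given by darts and labels

module Graph {D N : ℕ} (α : Fin D → Fin D) (lab : Fin D → Fin N) where

  inside : (Fin N → Bool) → Fin D → Bool
  inside U d = U (lab d) ∧ U (lab (α d))

  outside : (Fin D → Bool) → (Fin N → Bool) → Fin D → Bool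
  outside τ U d = τ d ∧ not (inside U d)

  -- Connectivity is expressed by sets closed along edges instead of by paths. With `lab` the tail
  -- map this is the graph itself, with `lab` the face map its dual.
  Closed : (Fin D → Bool) → (Fin N → Bool) → Set
  Closed τ W = ∀ d → τ d ≡ true → W (lab d) ≡ true → W (lab (α d)) ≡ true

  record EdgeSet (τ : Fin D → Bool) : Set where
    field
      sym-α : ∀ d → τ d ≡ true → τ (α d) ≡ true
      invol : ∀ d → τ d ≡ true → α (α d) ≡ d
      nofix : ∀ d → τ d ≡ true → α d ≢ d

  leaving : (Fin D → Bool) → (Fin N → Bool) → Fin D → Bool
  leaving τ U d = τ d ∧ (U (lab d) ∧ not (U (lab (α d))))

  none-leaving : ∀ {τ U} → (∀ d → leaving τ U d ≡ false) → Closed τ U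
  none-leaving {τ} {U} none d τd Ud with U (lab (α d)) in eq
  ... | true = refl
  ... | false = ⊥-elim (true≢false (∧-intro τd (∧-intro Ud (not-intro eq))) (none d))

  -- While labels are missing, some edge of `τ` leaves `U`. Absorbing its other end adds one label,
  -- and both darts of that edge stop being counted by `outside`.
  tree-bound : ∀ {τ} → EdgeSet τ → ∀ U → (∀ W → U ⊆ᵇ W → Closed τ W → ∀ x → W x ≡ true) →
    2 *ℕ N ≤ℕ # (outside τ U) +ℕ 2 *ℕ # U
  tree-bound {τ} es U₀ span₀ = go N U₀ (ℕP.m≤m+n N _) span₀
    where
    open EdgeSet es
    go : ∀ m U → N ≤ℕ m +ℕ # U → (∀ W → U ⊆ᵇ W → Closed τ W → ∀ x → W x ≡ true) →
      2 *ℕ N ≤ℕ # (outside τ U) +ℕ 2 *ℕ # U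
    go m U le span with search (leaving τ U)
    ... | inj₂ none = ℕP.≤-trans (ℕP.≤-reflexive (cong (2 *ℕ_) (sym (#-all (span U (λ _ h → h) (none-leaving {τ} {U} none))))))
                        (ℕP.m≤n+m (2 *ℕ # U) (# (outside τ U)))
    -- The fuel `m` bounds the number of missing labels, so at zero one more insertion would produce
    -- more than `N` labels.
    go zero U le span | inj₁ (d , h) = ⊥-elim (ℕP.1+n≰n (ℕP.≤-trans
      (subst (_≤ℕ N) (#-insert U (lab (α d)) (not-elim (∧-elim₂ {U (lab d)} (∧-elim₂ {τ d} h)))) (#-≤ (insert U (lab (α d)))))
      le))
    go (suc m) U le span | inj₁ (d , h) = ℕP.≤-trans
      (go m U' (subst (λ z → N ≤ℕ m +ℕ z) (sym #U') (subst (N ≤ℕ_) (sym (ℕP.+-suc m (# U))) le))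
        (λ W sub → span W λ x u → sub x (∨-intro₁ u)))
      (subst (λ z → # (outside τ U') +ℕ 2 *ℕ z ≤ℕ # (outside τ U) +ℕ 2 *ℕ # U) (sym #U')
        (subst (_≤ℕ # (outside τ U) +ℕ 2 *ℕ # U) (arith (# (outside τ U')) (# U))
          (ℕP.+-monoˡ-≤ (2 *ℕ # U) two)))
      where
      τd = ∧-elim₁ {τ d} h
      Ud = ∧-elim₁ {U (lab d)} (∧-elim₂ {τ d} h)
      ¬U = not-elim (∧-elim₂ {U (lab d)} (∧-elim₂ {τ d} h))
      U' = insert U (lab (α d))
      #U' : # U' ≡ suc (# U)
      #U' = #-insert U (lab (α d)) ¬U
      arith : ∀ a b → suc (suc a) +ℕ 2 *ℕ b ≡ a +ℕ 2 *ℕ suc b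
      arith = solve-∀
      d∈ : outside τ U d ≡ true
      d∈ = ∧-intro τd (not-intro (false-intro λ e → true≢false (∧-elim₂ {U (lab d)} e) ¬U))
      αd∈ : (outside τ U ∖ d) (α d) ≡ true
      αd∈ = ∖-intro {p = outside τ U} (∧-intro (sym-α d τd) (not-intro (false-intro λ e → true≢false (∧-elim₁ e) ¬U))) (nofix d τd)
      two : suc (suc (# (outside τ U'))) ≤ℕ # (outside τ U)
      two rewrite #-remove (outside τ U) d d∈ | #-remove (outside τ U ∖ d) (α d) αd∈ = s≤s (s≤s (#-mono λ x e →
        ∖-intro {p = outside τ U ∖ d} (∖-intro {p = outside τ U}
            (∧-intro (∧-elim₁ {τ x} e) (not-intro (false-intro λ i → true≢false
              (∧-intro {U' (lab x)} (∨-intro₁ (∧-elim₁ {U (lab x)} i)) (∨-intro₁ (∧-elim₂ {U (lab x)} i)))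
              (not-elim (∧-elim₂ {τ x} e)))))
            λ { refl → true≢false (∧-intro {U' (lab x)} (∨-intro₁ Ud) (insert-new U (lab (α d)))) (not-elim (∧-elim₂ {τ x} e)) })
          λ { refl → true≢false (∧-intro {U' (lab x)} (insert-new U (lab (α d)))
                 (subst (λ z → U' (lab z) ≡ true) (sym (invol d τd)) (∨-intro₁ Ud))) (not-elim (∧-elim₂ {τ x} e)) }))

  -- A forest on `U` with roots `B`. Acyclicity is encoded by `size`: every label outside `B`
  -- accounts for exactly one edge, that is, two darts. `span` says that everything in `U` is
  -- connected to the roots.
  record Tree (B U : Fin N → Bool) (τ : Fin D → Bool) : Set where
    field
      size : # τ +ℕ 2 *ℕ # B ≡ 2 *ℕ # U
      base : B ⊆ᵇ U
      span : ∀ W → B ⊆ᵇ W → Closed τ W → U ⊆ᵇ W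
      edges : EdgeSet τ
      within : ∀ d → τ d ≡ true → U (lab d) ≡ true
    open EdgeSet edges public

  trivial-tree : ∀ B → Tree B B (λ _ → false)
  trivial-tree B = record
    { size = cong (_+ℕ 2 *ℕ # B) (#-false {D} λ _ → refl)
    ; base = λ _ h → h
    ; span = λ W h _ → h
    ; edges = record { sym-α = λ _ () ; invol = λ _ () ; nofix = λ _ () }
    ; within = λ _ ()
    }

  add-edge : ∀ {B U τ} → Tree B U τ → ∀ d → α (α d) ≡ d → α d ≢ d → U (lab d) ≡ true → U (lab (α d)) ≡ false →
    Tree B (insert U (lab (α d))) (insert (insert τ d) (α d))
  add-edge {B} {U} {τ} t d αα α≢ Ud ¬U = record
    { size = trans (cong (_+ℕ 2 *ℕ # B) (trans (#-insert (insert τ d) (α d) (insert-false τ τα α≢)) (cong suc (#-insert τ d τd))))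
        (trans (cong (λ z → suc (suc z)) size) (trans (arith (# U)) (cong (2 *ℕ_) (sym (#-insert U (lab (α d)) ¬U)))))
    ; base = λ x b → ∨-intro₁ (base x b)
    ; span = λ W b c → sp W b c
    ; edges = record
      { sym-α = sy
      ; invol = λ e h → case mem e h of λ { (inj₁ x) → invol e x ; (inj₂ (inj₁ refl)) → αα ; (inj₂ (inj₂ refl)) → cong α αα }
      ; nofix = λ e h → case mem e h of λ { (inj₁ x) → nofix e x ; (inj₂ (inj₁ refl)) → α≢ ; (inj₂ (inj₂ refl)) → λ q → α≢ (trans (sym q) αα) }
      }
    ; within = λ e h → case mem e h of λ { (inj₁ x) → ∨-intro₁ (within e x) ; (inj₂ (inj₁ refl)) → ∨-intro₁ Ud
                                        ; (inj₂ (inj₂ refl)) → insert-new U (lab (α d)) }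
    }
    where
    open Tree t
    arith : ∀ a → suc (suc (2 *ℕ a)) ≡ 2 *ℕ suc a
    arith = solve-∀
    τd : τ d ≡ false
    τd = false-intro λ h → true≢false (within (α d) (sym-α d h)) ¬U
    τα : τ (α d) ≡ false
    τα = false-intro λ h → true≢false (within (α d) h) ¬U
    τ' = insert (insert τ d) (α d)
    mem : ∀ e → τ' e ≡ true → τ e ≡ true ⊎ (e ≡ d ⊎ e ≡ α d)
    mem e h with insert-elim (insert τ d) h
    ... | inj₂ q = inj₂ (inj₂ q)
    ... | inj₁ x with insert-elim τ x
    ... | inj₁ y = inj₁ y
    ... | inj₂ q = inj₂ (inj₁ q)
    sy : ∀ e → τ' e ≡ true → τ' (α e) ≡ true
    sy e h with mem e h
    ... | inj₁ x = ∨-intro₁ (∨-intro₁ (sym-α e x))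
    ... | inj₂ (inj₁ refl) = insert-new (insert τ d) (α d)
    ... | inj₂ (inj₂ refl) = subst (λ z → τ' z ≡ true) (sym αα) (∨-intro₁ (insert-new τ d))
    sp : ∀ W → B ⊆ᵇ W → Closed τ' W → insert U (lab (α d)) ⊆ᵇ W
    sp W b c x h with span W b (λ e te → c e (∨-intro₁ (∨-intro₁ te))) | insert-elim U h
    ... | UW | inj₁ u = UW x u
    ... | UW | inj₂ refl = c d (∨-intro₁ (insert-new τ d)) (UW (lab d) Ud)

  -- The outcome of extending a forest along edges of `A` until none leaves it. Starting from an
  -- arbitrary forest matters: the dual tree is grown outside a cycle first and later continued
  -- inside.
  record Grown (A : Fin D → Bool) (B U : Fin N → Bool) (τ : Fin D → Bool) : Set where
    field
      U' : Fin N → Bool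
      τ' : Fin D → Bool
      tree : Tree B U' τ'
      closed : Closed A U'
      τ-sub : τ ⊆ᵇ τ'
      U-sub : U ⊆ᵇ U'
      τ-from : ∀ d → τ' d ≡ true → τ d ≡ true ⊎ A d ≡ true

  grow : ∀ {A B U τ} → EdgeSet A → Tree B U τ → Grown A B U τ
  grow {A} {B} {U₀} {τ₀} es t₀ = go N (ℕP.m≤m+n N _) t₀
    where
    open EdgeSet es
    go : ∀ m {U τ} → N ≤ℕ m +ℕ # U → Tree B U τ → Grown A B U τ
    go m {U} {τ} le t with search (leaving A U)
    ... | inj₂ none = record { U' = U ; τ' = τ ; tree = t ; closed = none-leaving {A} {U} none ; τ-sub = λ _ h → h
                             ; U-sub = λ _ h → h ; τ-from = λ _ h → inj₁ h }
    go zero {U} le t | inj₁ (d , h) = ⊥-elim (ℕP.1+n≰n (ℕP.≤-trans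
      (subst (_≤ℕ N) (#-insert U (lab (α d)) (not-elim (∧-elim₂ {U (lab d)} (∧-elim₂ {A d} h)))) (#-≤ (insert U (lab (α d)))))
      le))
    go (suc m) {U} {τ} le t | inj₁ (d , h) = record
      { U' = U' ; τ' = τ' ; tree = tree ; closed = closed
      ; τ-sub = λ x e → τ-sub x (∨-intro₁ (∨-intro₁ e))
      ; U-sub = λ x e → U-sub x (∨-intro₁ e)
      ; τ-from = λ e te → case τ-from e te of λ
          { (inj₂ a) → inj₂ a
          ; (inj₁ i) → case insert-elim (insert τ d) i of λ
              { (inj₂ refl) → inj₂ (sym-α d Ad)
              ; (inj₁ j) → case insert-elim τ j of λ { (inj₁ k) → inj₁ k ; (inj₂ refl) → inj₂ Ad } } }
      }
      where
      Ad = ∧-elim₁ {A d} h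
      ¬U = not-elim (∧-elim₂ {U (lab d)} (∧-elim₂ {A d} h))
      r = go m (subst (λ z → N ≤ℕ m +ℕ z) (sym (#-insert U (lab (α d)) ¬U)) (subst (N ≤ℕ_) (sym (ℕP.+-suc m (# U))) le))
            (add-edge t d (invol d Ad) (nofix d Ad) (∧-elim₁ {U (lab d)} (∧-elim₂ {A d} h)) ¬U)
      open Grown r

-- Tagged maps and their quadrilaterals

data Star {A : Set} (f : A → A) (x : A) : A → Set where
  stop : Star f x x
  next : ∀ {y} → Star f x y → Star f x (f y)

star-ind : ∀ {A : Set} {f : A → A} (P : A → Set) {x y} → (∀ z → P z → P (f z)) → P x → Star f x y → P y
star-ind P h px stop = px
star-ind P h px (next s) = h _ (star-ind P h px s)

abstract
  exists : ∀ {k} → (Fin k → Bool) → Bool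
  exists p with search p
  ... | inj₁ _ = true
  ... | inj₂ _ = false

  exists-intro : ∀ {k} (p : Fin k → Bool) x → p x ≡ true → exists p ≡ true
  exists-intro p x px with search p
  ... | inj₁ _ = refl
  ... | inj₂ none = ⊥-elim (true≢false px (none x))

  exists-elim : ∀ {k} (p : Fin k → Bool) → exists p ≡ true → ∃ λ x → p x ≡ true
  exists-elim p h with search p
  ... | inj₁ w = w

-- A tagged map: darts, vertices and faces carry flags telling which of them are still present.
-- The corner of a dart x is the one at tail x in face x; ρ x tells whether it is reflex.
record Map (D n F : ℕ) : Set where
  field
    al : Fin D → Bool
    V : Fin n → Bool
    Fc : Fin F → Bool
    α φ : Fin D → Fin D
    tail : Fin D → Fin n
    face : Fin D → Fin F
    ρ : Fin D → Bool
    quad : Fin F → Bool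
    outer : Fin F

  A : Fin D → Set
  A d = al d ≡ true

  head : Fin D → Fin n
  head d = tail (α d)

  σ : Fin D → Fin D
  σ d = φ (α d)

-- The invariant of the reductions. Connectivity is stated for closed vertex sets, so it survives a
-- renaming of vertices by pulling the set back. Interior faces are described by identities for `φ`,
-- and whether a face is a quadrilateral is a stored flag, so neither reduction has to measure faces
-- again.
record IsMap {D n F : ℕ} (M : Map D n F) : Set where
  open Map M
  field
    αA : ∀ {d} → A d → A (α d)
    φA : ∀ {d} → A d → A (φ d)
    αα : ∀ {d} → A d → α (α d) ≡ d
    tail-φ : ∀ {d} → A d → tail (φ d) ≡ head d
    face-φ : ∀ {d} → A d → face (φ d) ≡ face d
    orbit : ∀ {d e} → A d → A e → tail d ≡ tail e → Star σ d e
    tail-V : ∀ {d} → A d → V (tail d) ≡ true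
    face-Fc : ∀ {d} → A d → Fc (face d) ≡ true
    V-tail : ∀ {u} → V u ≡ true → ∃ λ d → A d × tail d ≡ u
    Fc-face : ∀ {f} → Fc f ≡ true → ∃ λ d → A d × face d ≡ f
    outer-Fc : Fc outer ≡ true
    tri : ∀ {d} → A d → face d ≢ outer → quad (face d) ≡ false → φ (φ (φ d)) ≡ d × ρ d ≡ false
    quad-φ : ∀ {d} → A d → face d ≢ outer → quad (face d) ≡ true → φ (φ (φ (φ d))) ≡ d
    quad-root : ∀ {d} → A d → face d ≢ outer → quad (face d) ≡ true → ∃ λ r → A r × face r ≡ face d × ρ r ≡ true
    face-root : ∀ {d e} → A d → A e → face d ≡ face e → face d ≢ outer → ρ d ≡ true → ρ e ≡ true → d ≡ e
    face-orbit : ∀ {d e} → A d → A e → face d ≡ face e → face d ≢ outer →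
      e ≡ d ⊎ e ≡ φ d ⊎ e ≡ φ (φ d) ⊎ e ≡ φ (φ (φ d))
    outer-ρ : ∀ {d} → A d → face d ≡ outer → ρ d ≡ true
    outer-return : ∀ {d} → A d → face d ≡ outer → Star φ (φ d) d
    root-unique : ∀ {d e} → A d → A e → tail d ≡ tail e → ρ d ≡ true → ρ e ≡ true → d ≡ e
    root : ∀ {d} → A d → ∃ λ r → A r × tail r ≡ tail d × ρ r ≡ true
    noloop : ∀ {d} → A d → head d ≢ tail d
    nomulti : ∀ {d e} → A d → A e → tail d ≡ tail e → head d ≡ head e → d ≡ e
    conn : ∀ (W : Fin n → Bool) → (∀ {d} → A d → W (tail d) ≡ true → W (head d) ≡ true) →
      ∀ {u w} → V u ≡ true → V w ≡ true → W u ≡ true → W w ≡ true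
    euler : 2 *ℕ (# V +ℕ # Fc) ≡ # al +ℕ 4

module MapFacts {D n F : ℕ} (M : Map D n F) (isMap : IsMap M) where
  open Map M public
  open IsMap isMap public

  α≢ : ∀ {d} → A d → α d ≢ d
  α≢ Ad e = noloop Ad (cong tail e)

  σA : ∀ {d} → A d → A (σ d)
  σA Ad = φA (αA Ad)

  tail-σ : ∀ {d} → A d → tail (σ d) ≡ tail d
  tail-σ Ad = trans (tail-φ (αA Ad)) (cong tail (αα Ad))

  face-σ : ∀ {d} → A d → face (σ d) ≡ face (α d)
  face-σ Ad = face-φ (αA Ad)

  head-α : ∀ {d} → A d → head (α d) ≡ tail d
  head-α Ad = cong tail (αα Ad)

  orbit-ind : (P : Fin D → Set) → ∀ {d e} → A d → A e → tail d ≡ tail e →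
    (∀ {x} → A x → tail x ≡ tail d → P x → P (σ x)) → P d → P e
  orbit-ind P {d} Ad Ae t h pd = proj₂ (proj₂ (star-ind (λ z → A z × tail z ≡ tail d × P z)
    (λ z (Az , tz , pz) → σA Az , trans (tail-σ Az) tz , h Az tz pz) (Ad , refl , pd) (orbit Ad Ae t)))

  -- Consecutive corners around a vertex lie in faces that share an edge, so a closed set of faces
  -- containing one corner of a vertex contains all of them. The vertices with a corner in `W` then
  -- form a closed set, and connectivity of the graph applies.
  conn-face : ∀ (W : Fin F → Bool) → (∀ {d} → A d → W (face d) ≡ true → W (face (α d)) ≡ true) →
    ∀ {f g} → Fc f ≡ true → Fc g ≡ true → W f ≡ true → W g ≡ true
  conn-face W cl {f} {g} Ff Fg Wf with Fc-face Ff | Fc-face Fg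
  ... | d₀ , A₀ , refl | d₁ , A₁ , refl = elim A₁ (conn W~ step (tail-V A₀) (tail-V A₁) (intro A₀ Wf))
    where
    P : Fin n → Fin D → Bool
    P u d = al d ∧ ((tail d =ᶠ u) ∧ W (face d))
    W~ : Fin n → Bool
    W~ u = exists (P u)
    intro : ∀ {d} → A d → W (face d) ≡ true → W~ (tail d) ≡ true
    intro {d} Ad Wd = exists-intro (P (tail d)) d (∧-intro Ad (∧-intro (=ᶠ-refl (tail d)) Wd))
    elim : ∀ {d} → A d → W~ (tail d) ≡ true → W (face d) ≡ true
    elim {d} Ad h with exists-elim (P (tail d)) h
    ... | e , pe = orbit-ind (λ x → W (face x) ≡ true) (∧-elim₁ {al e} pe) Ad
          (=ᶠ-true (tail e) (tail d) (∧-elim₁ {tail e =ᶠ tail d} (∧-elim₂ {al e} pe)))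
          (λ {x} Ax _ Wx → trans (cong W (face-σ Ax)) (cl Ax Wx))
          (∧-elim₂ {tail e =ᶠ tail d} (∧-elim₂ {al e} pe))
    step : ∀ {d} → A d → W~ (tail d) ≡ true → W~ (head d) ≡ true
    step Ad h = intro (αA Ad) (cl Ad (elim Ad h))

  tail-φ≢ : ∀ {d} → A d → tail (φ d) ≢ tail d
  tail-φ≢ Ad e = noloop Ad (trans (sym (tail-φ Ad)) e)

  -- The reflex corner of this vertex belongs to a dart in the orbit of `d`, and that orbit is `d`
  -- alone. This rules out degenerate quadrilaterals.
  lone : ∀ {d} → A d → σ d ≡ d → ρ d ≡ true
  lone {d} Ad e with root Ad
  ... | r , Ar , tr , ρr = trans (cong ρ (sym (orbit-ind (λ x → x ≡ d) Ad Ar (sym tr)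
        (λ { _ _ refl → e }) refl))) ρr

  inner-root-quad : ∀ {r} → A r → ρ r ≡ true → face r ≢ outer → quad (face r) ≡ true
  inner-root-quad {r} Ar ρr inner with bool-cases (quad (face r))
  ... | inj₁ e = e
  ... | inj₂ e = ⊥-elim (true≢false ρr (proj₂ (tri Ar inner e)))

-- The quadrilateral with reflex vertex v: its boundary runs c → a → v → b → c along d₁, d₂, d₃, d₄.
module Face4 {D n F : ℕ} (M : Map D n F) (isMap : IsMap M) (d₃ : Fin D)
  (A₃ : Map.A M d₃) (ρ₃ : Map.ρ M d₃ ≡ true) (inner : Map.face M d₃ ≢ Map.outer M) where
  open MapFacts M isMap

  d₄ d₁ d₂ : Fin D
  d₄ = φ d₃
  d₁ = φ d₄
  d₂ = φ d₁

  A₄ : A d₄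
  A₄ = φA A₃
  A₁ : A d₁
  A₁ = φA A₄
  A₂ : A d₂
  A₂ = φA A₁

  c a v b : Fin n
  c = tail d₁
  a = tail d₂
  v = tail d₃
  b = tail d₄

  Q : Fin F
  Q = face d₃

  φ₂ : φ d₂ ≡ d₃
  φ₂ = quad-φ A₃ inner (inner-root-quad A₃ ρ₃ inner)

  f₄ : face d₄ ≡ Q
  f₄ = face-φ A₃
  f₁ : face d₁ ≡ Q
  f₁ = trans (face-φ A₄) f₄
  f₂ : face d₂ ≡ Q
  f₂ = trans (face-φ A₁) f₁

  h₁ : head d₁ ≡ a
  h₁ = sym (tail-φ A₁)
  h₂ : head d₂ ≡ v
  h₂ = trans (sym (tail-φ A₂)) (cong tail φ₂)
  h₃ : head d₃ ≡ b
  h₃ = sym (tail-φ A₃)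
  h₄ : head d₄ ≡ c
  h₄ = sym (tail-φ A₄)

  a≢c : a ≢ c
  a≢c = tail-φ≢ A₁
  v≢a : v ≢ a
  v≢a e = tail-φ≢ A₂ (trans (cong tail φ₂) e)
  b≢v : b ≢ v
  b≢v = tail-φ≢ A₃
  c≢b : c ≢ b
  c≢b = tail-φ≢ A₄

  in-Q : ∀ {x} → A x → face x ≡ Q → x ≡ d₁ ⊎ x ≡ d₂ ⊎ x ≡ d₃ ⊎ x ≡ d₄
  in-Q Ax fx with face-orbit A₃ Ax (sym fx) inner
  ... | inj₁ e = inj₂ (inj₂ (inj₁ e))
  ... | inj₂ (inj₁ e) = inj₂ (inj₂ (inj₂ e))
  ... | inj₂ (inj₂ (inj₁ e)) = inj₁ e
  ... | inj₂ (inj₂ (inj₂ e)) = inj₂ (inj₁ e)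

  root-Q : ∀ {x} → A x → face x ≡ Q → ρ x ≡ true → x ≡ d₃
  root-Q Ax fx ρx = sym (face-root A₃ Ax (sym fx) inner ρ₃ ρx)

  -- If v were c, simplicity would identify `d₁` with `α d₂`, and a would have the single dart `d₂`.
  -- Its only corner would be a second reflex corner of Q.
  v≢c : v ≢ c
  v≢c e = v≢a (cong tail (sym (root-Q A₂ f₂ (lone A₂ (trans (cong φ (sym d₁≡)) refl)))))
    where
    d₁≡ : d₁ ≡ α d₂
    d₁≡ = nomulti A₁ (αA A₂) (sym (trans h₂ e)) (trans h₁ (sym (head-α A₂)))

  -- If a were b, the edges c a and b c would agree, c would have degree one, and its corner would
  -- be a second reflex corner of Q.
  a≢b : a ≢ b
  a≢b e = v≢c (cong tail (sym (root-Q A₁ f₁ (lone A₁ (cong φ α₁≡)))))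
    where
    α₁≡ : α d₁ ≡ d₄
    α₁≡ = nomulti (αA A₁) A₄ (trans h₁ e) (trans (head-α A₁) (sym h₄))

  ρ₁ : ρ d₁ ≡ false
  ρ₁ = false-intro λ h → v≢c (cong tail (sym (root-Q A₁ f₁ h)))
  ρ₂ : ρ d₂ ≡ false
  ρ₂ = false-intro λ h → v≢a (cong tail (sym (root-Q A₂ f₂ h)))
  ρ₄ : ρ d₄ ≡ false
  ρ₄ = false-intro λ h → b≢v (cong tail (root-Q A₄ f₄ h))

  -- An edge with Q on both sides would make two of the darts `d₁`, `d₂`, `d₃`, `d₄` inverse to each
  -- other, which the distinctness of c, a, v, b excludes case by case.
  αQ : ∀ {x} → A x → face x ≡ Q → face (α x) ≢ Q
  αQ Ax fx fα with in-Q Ax fx | in-Q (αA Ax) fα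
  ... | inj₁ refl | inj₁ e = a≢c (trans (sym h₁) (cong tail e))
  ... | inj₁ refl | inj₂ (inj₁ e) = v≢c (trans (sym h₂) (trans (cong head (sym e)) (head-α A₁)))
  ... | inj₁ refl | inj₂ (inj₂ (inj₁ e)) = v≢a (trans (cong tail (sym e)) h₁)
  ... | inj₁ refl | inj₂ (inj₂ (inj₂ e)) = a≢b (trans (sym h₁) (cong tail e))
  ... | inj₂ (inj₁ refl) | inj₁ e = v≢c (trans (sym h₂) (cong tail e))
  ... | inj₂ (inj₁ refl) | inj₂ (inj₁ e) = v≢a (trans (sym h₂) (cong tail e))
  ... | inj₂ (inj₁ refl) | inj₂ (inj₂ (inj₁ e)) = a≢b (trans (sym (head-α A₂)) (trans (cong head e) h₃))
  ... | inj₂ (inj₁ refl) | inj₂ (inj₂ (inj₂ e)) = b≢v (trans (cong tail (sym e)) h₂)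
  ... | inj₂ (inj₂ (inj₁ refl)) | inj₁ e = c≢b (trans (cong tail (sym e)) h₃)
  ... | inj₂ (inj₂ (inj₁ refl)) | inj₂ (inj₁ e) = a≢b (trans (cong tail (sym e)) h₃)
  ... | inj₂ (inj₂ (inj₁ refl)) | inj₂ (inj₂ (inj₁ e)) = b≢v (trans (sym h₃) (cong tail e))
  ... | inj₂ (inj₂ (inj₁ refl)) | inj₂ (inj₂ (inj₂ e)) = v≢c (trans (sym (head-α A₃)) (trans (cong head e) h₄))
  ... | inj₂ (inj₂ (inj₂ refl)) | inj₁ e = a≢b (trans (sym h₁) (trans (cong head (sym e)) (head-α A₄)))
  ... | inj₂ (inj₂ (inj₂ refl)) | inj₂ (inj₁ e) = a≢c (trans (cong tail (sym e)) h₄)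
  ... | inj₂ (inj₂ (inj₂ refl)) | inj₂ (inj₂ (inj₁ e)) = v≢c (trans (cong tail (sym e)) h₄)
  ... | inj₂ (inj₂ (inj₂ refl)) | inj₂ (inj₂ (inj₂ e)) = c≢b (trans (sym h₄) (cong tail e))

  σα₁ : σ (α d₁) ≡ d₂
  σα₁ = cong φ (αα A₁)
  σα₂ : σ (α d₂) ≡ d₃
  σα₂ = trans (cong φ (αα A₂)) φ₂
  σα₃ : σ (α d₃) ≡ d₄
  σα₃ = cong φ (αα A₃)
  σα₄ : σ (α d₄) ≡ d₁
  σα₄ = cong φ (αα A₄)

-- Dual trees, their complements and Euler's formula

module _ {D N : ℕ} (α : Fin D → Fin D) (lab : Fin D → Fin N) where
  open Graph α lab

  -- `tree-bound` for `W` together with everything outside `P`. Labels that are no longer present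
  -- count as reached from the start, and their number cancels.
  tree-bound-on : ∀ {τ} → EdgeSet τ → ∀ P W → (∀ Z → W ⊆ᵇ Z → Closed τ Z → P ⊆ᵇ Z) →
    2 *ℕ # P ≤ℕ # (outside τ W) +ℕ 2 *ℕ # W
  tree-bound-on {τ} es P W span = ℕP.+-cancelʳ-≤ (2 *ℕ # P̄) _ _ (subst₂ _≤ℕ_
    (trans (cong (2 *ℕ_) #N) (ℕP.*-distribˡ-+ 2 (# P) (# P̄)))
    (sym (trans (ℕP.+-assoc (# (outside τ W)) _ _) (cong (# (outside τ W) +ℕ_) (sym (ℕP.*-distribˡ-+ 2 (# W) (# P̄))))))
    (ℕP.≤-trans (tree-bound es U λ Z UZ cl x → case bool-cases (P x) of λ
        { (inj₁ p) → span Z (λ y w → UZ y (∨-intro₁ w)) cl x p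
        ; (inj₂ p) → UZ x (∨-intro₂ {W x} (not-intro p)) })
      (ℕP.+-mono-≤
        (#-mono λ d h → ∧-intro (∧-elim₁ {τ d} h) (not-intro (false-intro λ i → true≢false
          (∧-intro {U (lab d)} (∨-intro₁ (∧-elim₁ {W (lab d)} i)) (∨-intro₁ (∧-elim₂ {W (lab d)} i))) (not-elim (∧-elim₂ {τ d} h)))))
        (ℕP.*-monoʳ-≤ 2 (#-cover W P̄ U λ x h → ∨-elim h)))))
    where
    P̄ U : Fin N → Bool
    P̄ x = not (P x)
    U x = W x ∨ P̄ x
    #N : N ≡ # P +ℕ # P̄
    #N = trans (sym (#-all {p = λ (_ : Fin N) → true} λ _ → refl)) (#-split (λ _ → true) P)

data Linked {D n F : ℕ} (M : Map D n F) : List (Fin D) → Set where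
  one : ∀ {x} → Linked M (x ∷ [])
  link : ∀ {x y ks} → Map.tail M y ≡ Map.head M x → Linked M (y ∷ ks) → Linked M (x ∷ y ∷ ks)

-- `linked` gives the list order, and `closing` adds the step from the last dart back to the first.
-- `asym` excludes running along an edge in both directions.
record Cycle {D n F : ℕ} (M : Map D n F) (k₁ : Fin D) (ks' : List (Fin D)) : Set where
  open Map M
  ks = k₁ ∷ ks'
  field
    alive : ∀ {x} → x ∈ˡ ks → A x
    tail-inj : ∀ {x y} → x ∈ˡ ks → y ∈ˡ ks → tail x ≡ tail y → x ≡ y
    head-inj : ∀ {x y} → x ∈ˡ ks → y ∈ˡ ks → head x ≡ head y → x ≡ y
    linked : Linked M ks
    closing : ∀ {x} → x ∈ˡ ks → ∃ λ y → y ∈ˡ ks × tail y ≡ head x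
    asym : ∀ {x} → x ∈ˡ ks → α x ∉ˡ ks
    distinct : Distinct ks

module Dual {D n F : ℕ} (M : Map D n F) (isMap : IsMap M) where
  open MapFacts M isMap
  open Graph α face public

  -- Absent faces are roots of every dual forest beside the outer face. Sizes can thus be taken over
  -- all of `Fin F`, and the absent faces cancel.
  F̄ B : Fin F → Bool
  F̄ f = not (Fc f)
  B = insert F̄ outer

  #B : # B ≡ suc (# F̄)
  #B = #-insert F̄ outer (false-intro λ h → true≢false outer-Fc (not-elim h))

  #F : F ≡ # Fc +ℕ # F̄
  #F = trans (sym (#-all {p = λ (_ : Fin F) → true} λ _ → refl)) (#-split (λ _ → true) Fc)

  face-return : ∀ {d} → A d → Star φ (φ d) d
  face-return {d} Ad with face d ≟ outer
  ... | yes e = outer-return Ad e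
  ... | no inner with bool-cases (quad (face d))
  ...   | inj₁ q = subst (Star φ (φ d)) (quad-φ Ad inner q) (next (next (next stop)))
  ...   | inj₂ q = subst (Star φ (φ d)) (proj₁ (tri Ad inner q)) (next (next stop))

  cotree : (Fin D → Bool) → Fin D → Bool
  cotree τ d = al d ∧ not (τ d)

  module Cotree {U : Fin F → Bool} {τ : Fin D → Bool} (t : Tree B U τ) (τ-al : τ ⊆ᵇ al)
    (full : Fc ⊆ᵇ U) where
    open Tree t

    #τ : # τ +ℕ 2 ≡ 2 *ℕ # Fc
    #τ = ℕP.+-cancelʳ-≡ (2 *ℕ # F̄) _ _ (trans (ℕP.+-assoc (# τ) 2 _)
      (trans (cong (# τ +ℕ_) (trans (sym (ℕP.*-distribˡ-+ 2 1 (# F̄))) (cong (2 *ℕ_) (sym #B))))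
      (trans size (trans (cong (2 *ℕ_) (trans (#-all all) #F)) (ℕP.*-distribˡ-+ 2 (# Fc) (# F̄))))))
      where
      all : ∀ f → U f ≡ true
      all f with bool-cases (Fc f)
      ... | inj₁ h = full f h
      ... | inj₂ h = base f (∨-intro₁ (not-intro h))

    -- Euler's formula. A dual tree uses one edge less than there are faces, which leaves one edge
    -- less than there are vertices: the complement has the size of a spanning tree.
    #cotree : # (cotree τ) +ℕ 2 ≡ 2 *ℕ # V
    #cotree = ℕP.+-cancelˡ-≡ (# τ +ℕ 2) _ _ (trans (arith (# τ) (# (cotree τ)))
      (trans (cong (_+ℕ 4) (trans (cong (_+ℕ # (cotree τ)) (#-cong λ d → bool-ext
         (λ h → ∧-intro (τ-al d h) h) (λ h → ∧-elim₂ {al d} h))) (sym (#-split al τ))))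
      (trans (sym euler) (trans (ℕP.*-distribˡ-+ 2 (# V) (# Fc))
        (trans (ℕP.+-comm (2 *ℕ # V) _) (cong (_+ℕ 2 *ℕ # V) (sym #τ)))))))
      where
      arith : ∀ a b → (a +ℕ 2) +ℕ (b +ℕ 2) ≡ (a +ℕ b) +ℕ 4
      arith = solve-∀

    -- `span` speaks of sets containing the roots. If `Z` misses the outer face, its complement is
    -- closed as well and contains the outer face, hence it contains `f₀`, which is absurd.
    tree-span : ∀ {f₀} → Fc f₀ ≡ true → ∀ Z → Z f₀ ≡ true → Closed τ Z → Fc ⊆ᵇ Z
    tree-span {f₀} F₀ Z Z₀ cl f Ff with bool-cases (Z outer)
    ... | inj₁ Zo = [ id , (λ e → ⊥-elim (true≢false Ff (not-elim e))) ]′ (∨-elim (span (λ g → Z g ∨ F̄ g)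
            (λ g b → case insert-elim F̄ b of λ { (inj₁ x) → ∨-intro₂ {Z g} x ; (inj₂ refl) → ∨-intro₁ Zo })
            (λ d τd h → [ (λ z → ∨-intro₁ (cl d τd z)) , (λ e → ⊥-elim (true≢false (face-Fc (τ-al d τd)) (not-elim e))) ]′ (∨-elim h))
            f (full f Ff)))
    ... | inj₂ Zo = ⊥-elim ([ (λ e → true≢false Z₀ (not-elim e)) , (λ e → true≢false F₀ (not-elim e)) ]′ (∨-elim (span (λ g → not (Z g) ∨ F̄ g)
            (λ g b → case insert-elim F̄ b of λ { (inj₁ x) → ∨-intro₂ {not (Z g)} x ; (inj₂ refl) → ∨-intro₁ (not-intro Zo) })
            (λ d τd h → ∨-intro₁ (not-intro (false-intro λ z → [
                (λ e → true≢false (subst (λ x → Z (face x) ≡ true) (αα (τ-al d τd)) (cl (α d) (sym-α d τd) z)) (not-elim e))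
              , (λ e → true≢false (face-Fc (τ-al d τd)) (not-elim e)) ]′ (∨-elim h))))
            f₀ (full f₀ F₀))))

    module Cut (W : Fin n → Bool) where
      cut⁺ cut⁻ : Fin D → Bool
      cut⁺ d = al d ∧ (W (tail d) ∧ not (W (head d)))
      cut⁻ d = al d ∧ (not (W (tail d)) ∧ W (head d))
      Φ? : Fin F → Fin D → Bool
      Φ? f d = cut⁺ d ∧ (face d =ᶠ f)
      Φ : Fin F → Bool
      Φ f = exists (Φ? f)

      cut⁺-Φ : ∀ {d} → cut⁺ d ≡ true → Φ (face d) ≡ true
      cut⁺-Φ {d} h = exists-intro (Φ? (face d)) d (∧-intro h (=ᶠ-refl (face d)))

      α-cut : ∀ {d} → cut⁺ d ≡ true → cut⁻ (α d) ≡ true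
      α-cut {d} h = ∧-intro (αA Ad) (∧-intro (∧-elim₂ {W (tail d)} h')
          (trans (cong W (head-α Ad)) (∧-elim₁ {W (tail d)} h')))
        where
        Ad = ∧-elim₁ {al d} h
        h' = ∧-elim₂ {al d} h

      -- A face walk that enters the complement of W comes back, hence also leaves W.
      cut⁻-Φ : ∀ {d} → cut⁻ d ≡ true → Φ (face d) ≡ true
      cut⁻-Φ {d} h with proj₂ (proj₂ (star-ind P step start (face-return Ad)))
        where
        Ad = ∧-elim₁ {al d} h
        P : Fin D → Set
        P z = A z × face z ≡ face d × (Φ (face d) ≡ true ⊎ W (tail z) ≡ true)
        start : P (φ d)
        start = φA Ad , face-φ Ad , inj₂ (trans (cong W (tail-φ Ad)) (∧-elim₂ {not (W (tail d))} (∧-elim₂ {al d} h)))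
        step : ∀ z → P z → P (φ z)
        step z (Az , fz , inj₁ x) = φA Az , trans (face-φ Az) fz , inj₁ x
        step z (Az , fz , inj₂ w) with bool-cases (W (head z))
        ... | inj₁ e = φA Az , trans (face-φ Az) fz , inj₂ (trans (cong W (tail-φ Az)) e)
        ... | inj₂ e = φA Az , trans (face-φ Az) fz
                     , inj₁ (subst (λ f → Φ f ≡ true) fz (cut⁺-Φ (∧-intro Az (∧-intro w (not-intro e)))))
      ... | inj₁ x = x
      ... | inj₂ w = ⊥-elim (true≢false w (not-elim (∧-elim₁ {not (W (tail d))} (∧-elim₂ {al d} h))))

      #Φ : # Φ ≤ℕ # cut⁺
      #Φ = #-surj cut⁺ Φ face λ f h → case exists-elim (Φ? f) h of λ
        { (d , e) → d , ∧-elim₁ {cut⁺ d} e , =ᶠ-true (face d) f (∧-elim₂ {cut⁺ d} e) }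

      #cut : # cut⁺ ≤ℕ # cut⁻
      #cut = #-inj cut⁺ cut⁻ (λ d _ → α d) (λ d h → α-cut h) λ x y hx hy e →
        trans (sym (αα (∧-elim₁ {al x} hx))) (trans (cong α e) (αα (∧-elim₁ {al y} hy)))

      -- Every face of `Φ` has a dart leaving `W`, so the cut has at least as many edges as `Φ` has
      -- faces. If all these edges were in the dual tree, they would lie inside `Φ` and contain a
      -- cycle; `tree-bound-on` turns this into a contradiction of sizes.
      no-cut : ∀ {d} → cut⁺ d ≡ true → cut⁺ ⊆ᵇ τ → ⊥
      no-cut {d₀} c₀ sub = ℕP.1+n≰n (ℕP.≤-trans (ℕP.n≤1+n _)
        (subst (suc (suc (# τ)) ≤ℕ_) refl (ℕP.≤-trans (ℕP.≤-reflexive (trans (ℕP.+-comm 2 (# τ)) #τ))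
        (ℕP.≤-trans (tree-bound-on α face edges Fc Φ λ Z ΦZ cl → tree-span (face-Fc (∧-elim₁ {al d₀} c₀)) Z (ΦZ _ (cut⁺-Φ c₀)) cl)
        (ℕP.≤-trans (ℕP.+-monoʳ-≤ (# (outside τ Φ)) (ℕP.≤-trans
            (ℕP.+-mono-≤ #Φ (ℕP.≤-trans (ℕP.≤-reflexive (ℕP.+-identityʳ _)) (ℕP.≤-trans #Φ #cut)))
            (#-disj cut⁺ cut⁻ (λ d → τ d ∧ inside Φ d)
              (λ d h → ∧-intro (sub d h) (∧-intro (cut⁺-Φ h) (cut⁻-Φ (α-cut h))))
              (λ d h → ∧-intro (τ⁻ d h) (∧-intro (cut⁻-Φ h) (cut⁺-Φ (flip d h))))
              (λ d h h' → true≢false (∧-elim₁ {W (tail d)} (∧-elim₂ {al d} h)) (not-elim (∧-elim₁ {not (W (tail d))} (∧-elim₂ {al d} h')))))))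
        (ℕP.≤-reflexive (trans (ℕP.+-comm (# (outside τ Φ)) _) (sym (#-split τ (inside Φ))))))))))
        where
        flip : ∀ d → cut⁻ d ≡ true → cut⁺ (α d) ≡ true
        flip d h = ∧-intro (αA Ad) (∧-intro (∧-elim₂ {not (W (tail d))} h')
            (trans (cong (λ z → not (W z)) (head-α Ad)) (∧-elim₁ {not (W (tail d))} h')))
          where
          Ad = ∧-elim₁ {al d} h
          h' = ∧-elim₂ {al d} h
        τ⁻ : ∀ d → cut⁻ d ≡ true → τ d ≡ true
        τ⁻ d h = subst (λ x → τ x ≡ true) (αα (∧-elim₁ {al d} h)) (sym-α (α d) (sub (α d) (flip d h)))

    -- If a vertex set is closed under the complement of the dual tree, all edges that leave it are
    -- tree edges. By `no-cut` there are none, so connectivity of the whole graph applies.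
    cotree-connected : ∀ W {u} → V u ≡ true → W u ≡ true → Graph.Closed α tail (cotree τ) W → V ⊆ᵇ W
    cotree-connected W {u} Vu Wu cl w Vw with search (Cut.cut⁺ W)
    ... | inj₂ none = conn W (λ {d} Ad Wd → case bool-cases (W (head d)) of λ
            { (inj₁ e) → e ; (inj₂ e) → ⊥-elim (true≢false (∧-intro Ad (∧-intro Wd (not-intro e))) (none d)) }) Vu Vw Wu
    ... | inj₁ (d₀ , c₀) = ⊥-elim (Cut.no-cut W c₀ λ d h → case bool-cases (τ d) of λ
            { (inj₁ e) → e
            ; (inj₂ e) → ⊥-elim (true≢false
                (cl d (∧-intro (∧-elim₁ {al d} h) (not-intro e)) (∧-elim₁ {W (tail d)} (∧-elim₂ {al d} h)))
                (not-elim (∧-elim₂ {W (tail d)} (∧-elim₂ {al d} h)))) })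

    cotree-edges : Graph.EdgeSet α tail (cotree τ)
    cotree-edges = record
      { sym-α = λ d h → ∧-intro (αA (∧-elim₁ {al d} h)) (not-intro (false-intro λ e → true≢false
          (subst (λ x → τ x ≡ true) (αα (∧-elim₁ {al d} h)) (sym-α (α d) e)) (not-elim (∧-elim₂ {al d} h))))
      ; invol = λ d h → αα (∧-elim₁ {al d} h)
      ; nofix = λ d h → α≢ (∧-elim₁ {al d} h)
      }

    cotree-bound : ∀ W {u} → V u ≡ true → W u ≡ true →
      2 *ℕ # V ≤ℕ # (Graph.outside α tail (cotree τ) W) +ℕ 2 *ℕ # W
    cotree-bound W Vu Wu = tree-bound-on α tail cotree-edges V W λ Z WZ cl → cotree-connected Z Vu (WZ _ Wu) cl

-- A cycle separates the faces

module Jordan {D n F : ℕ} (M : Map D n F) (isMap : IsMap M) where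
  open MapFacts M isMap
  open Dual M isMap

  module _ {k₁ : Fin D} {ks' : List (Fin D)} (cyc : Cycle M k₁ ks') where
    open Cycle cyc

    on : Fin D → Bool
    on d = al d ∧ (member ks d ∨ member ks (α d))

    off : Fin D → Bool
    off d = al d ∧ not (on d)

    on-A : ∀ {x} → on x ≡ true → A x
    on-A = ∧-elim₁

    on-ks : ∀ {x} → x ∈ˡ ks → on x ≡ true
    on-ks m = ∧-intro (alive m) (∨-intro₁ (member-intro m))

    on-α : ∀ {x} → on x ≡ true → on (α x) ≡ true
    on-α {x} h with on-A h | ∨-elim {member ks x} (∧-elim₂ {al x} h)
    ... | Ax | inj₁ e = ∧-intro (αA Ax) (∨-intro₂ {member ks (α x)} (trans (cong (member ks) (αα Ax)) e))
    ... | Ax | inj₂ e = ∧-intro (αA Ax) (∨-intro₁ e)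

    on-cases : ∀ {x} → on x ≡ true → x ∈ˡ ks ⊎ α x ∈ˡ ks
    on-cases {x} h with ∨-elim {member ks x} (∧-elim₂ {al x} h)
    ... | inj₁ e = inj₁ (member-elim ks e)
    ... | inj₂ e = inj₂ (member-elim ks e)

    off-α : ∀ {x} → off x ≡ true → off (α x) ≡ true
    off-α {x} h = ∧-intro (αA Ax) (not-intro (false-intro λ e → true≢false
        (subst (λ z → on z ≡ true) (αα Ax) (on-α e)) (not-elim (∧-elim₂ {al x} h))))
      where Ax = ∧-elim₁ {al x} h

    off-edges : EdgeSet off
    off-edges = record { sym-α = λ _ → off-α ; invol = λ d h → αα (∧-elim₁ {al d} h) ; nofix = λ d h → α≢ (∧-elim₁ {al d} h) }

    -- Turning around a vertex of the cycle, the corners on one side all lie in the same component.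
    turn : ∀ W → Closed off W → ∀ {d d'} → A d → A d' → tail d' ≡ head d →
      (∀ {x} → A x → tail x ≡ tail d' → on x ≡ true → x ≡ α d ⊎ x ≡ d') → W (face d) ≡ W (face d')
    turn W cl {d} {d'} Ad Ad' t only with orbit-ind P (σA (αA Ad)) Ad' (trans (tail-σ (αA Ad)) (sym t)) step (inj₁ (cong W start))
      where
      start : face (σ (α d)) ≡ face d
      start = trans (cong (face ∘ φ) (αα Ad)) (face-φ Ad)
      P : Fin D → Set
      P x = W (face x) ≡ W (face d) ⊎ W (face d) ≡ W (face d')
      step : ∀ {x} → A x → tail x ≡ tail (σ (α d)) → P x → P (σ x)
      step Ax tx (inj₂ e) = inj₂ e
      step {x} Ax tx (inj₁ e) with bool-cases (on x)
      ... | inj₂ ¬on = inj₁ (trans (cong W (face-σ Ax)) (trans (sym (bool-ext (cl x off-x)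
              (λ h → subst (λ z → W (face z) ≡ true) (αα Ax) (cl (α x) (off-α off-x) h)))) e))
        where off-x = ∧-intro Ax (not-intro ¬on)
      ... | inj₁ o with only Ax (trans tx (trans (tail-σ (αA Ad)) (sym t))) o
      ...   | inj₁ refl = inj₁ (cong W start)
      ...   | inj₂ refl = inj₂ (sym e)
    ... | inj₁ e = sym e
    ... | inj₂ e = e

    module _ (W : Fin F → Bool) (cl : Closed off W) where

      -- Both equations come from turning around the common vertex, once from `x` to `y` and once
      -- from `α y` to `α x`. No other cycle darts leave this vertex, since tails and heads are
      -- distinct along the cycle.
      next-side : ∀ {x y} → x ∈ˡ ks → y ∈ˡ ks → tail y ≡ head x →
        W (face x) ≡ W (face y) × W (face (α y)) ≡ W (face (α x))
      next-side {x} {y} xk yk t =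
          turn W cl Ax Ay t (λ Az tz o → case on-cases o of λ
            { (inj₁ zk) → inj₂ (tail-inj zk yk tz)
            ; (inj₂ αzk) → inj₁ (trans (sym (αα Az)) (cong α (head-inj αzk xk (trans (head-α Az) (trans tz t))))) })
        , turn W cl (αA Ay) (αA Ax) (trans (sym t) (sym (head-α Ay))) (λ Az tz o → case on-cases o of λ
            { (inj₁ zk) → inj₁ (trans (tail-inj zk yk (trans tz (sym t))) (sym (αα Ay)))
            ; (inj₂ αzk) → inj₂ (trans (sym (αα Az)) (cong α (head-inj αzk xk (trans (head-α Az) tz)))) })
        where
        Ax = alive xk
        Ay = alive yk

      same-side : ∀ {x} → x ∈ˡ ks → W (face x) ≡ W (face k₁) × W (face (α x)) ≡ W (face (α k₁))
      same-side = go ks' linked id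
        where
        go : ∀ {k} js → Linked M (k ∷ js) → (∀ {z} → z ∈ˡ k ∷ js → z ∈ˡ ks) →
          ∀ {x} → x ∈ˡ k ∷ js → W (face x) ≡ W (face k) × W (face (α x)) ≡ W (face (α k))
        go js l sub (here refl) = refl , refl
        go (y ∷ js) (link t l) sub (there m) with go js l (sub ∘ there) m | next-side (sub (here refl)) (sub (there (here refl))) t
        ... | p , q | p' , q' = trans p (sym p') , trans q q'
        go [] one sub (there ())

    onV : Fin n → Bool
    onV u = member (List.map tail ks) u

    onV-tail : ∀ {x} → x ∈ˡ ks → onV (tail x) ≡ true
    onV-tail m = member-intro (map∈ m)
      where
      map∈ : ∀ {x xs} → x ∈ˡ xs → tail x ∈ˡ List.map tail xs
      map∈ (here refl) = here refl
      map∈ (there m) = there (map∈ m)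

    onV-on : ∀ {x} → on x ≡ true → onV (tail x) ≡ true
    onV-on {x} h with on-cases h
    ... | inj₁ m = onV-tail m
    ... | inj₂ m with closing m
    ...   | y , yk , t = subst (λ u → onV u ≡ true) (trans t (head-α (on-A h))) (onV-tail yk)

    length-map : ∀ xs → length (List.map tail xs) ≡ length xs
    length-map [] = refl
    length-map (x ∷ xs) = cong suc (length-map xs)

    #onV : # onV ≤ℕ length ks
    #onV = ℕP.≤-trans (#-list-≤ (List.map tail ks) onV λ x → member-elim (List.map tail ks)) (ℕP.≤-reflexive (length-map ks))

    #ks : length ks ≤ℕ # (member ks)
    #ks = #-list-≥ (member ks) distinct member-intro

    #αks : length ks ≤ℕ # (λ d → al d ∧ member ks (α d))
    #αks = ℕP.≤-trans #ks (#-inj (member ks) (λ d → al d ∧ member ks (α d)) (λ d _ → α d)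
      (λ x h → ∧-intro (αA (alive (member-elim ks h))) (trans (cong (member ks) (αα (alive (member-elim ks h)))) h))
      λ x y hx hy e → trans (sym (αα (alive (member-elim ks hx)))) (trans (cong α e) (αα (alive (member-elim ks hy)))))

    #on : 2 *ℕ length ks ≤ℕ # on
    #on = ℕP.≤-trans (ℕP.+-mono-≤ #ks (ℕP.≤-trans (ℕP.≤-reflexive (ℕP.+-identityʳ _)) #αks))
      (#-disj (member ks) (λ d → al d ∧ member ks (α d)) on (λ x h → on-ks (member-elim ks h))
        (λ x h → ∧-intro (∧-elim₁ h) (∨-intro₂ {member ks x} (∧-elim₂ {al x} h)))
        λ x h h' → asym (member-elim ks h) (member-elim ks (∧-elim₂ {al x} h')))

    abstract
     grown : Grown off B B (λ _ → false)
     grown = grow off-edges (trivial-tree B)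

    -- The exterior: what the outer face reaches without crossing the cycle.
    T : Fin F → Bool
    T = Grown.U' grown

    tree₀ : Tree B T (Grown.τ' grown)
    tree₀ = Grown.tree grown

    τ₀ : Fin D → Bool
    τ₀ = Grown.τ' grown

    τ₀-off : τ₀ ⊆ᵇ off
    τ₀-off d h with Grown.τ-from grown d h
    ... | inj₂ o = o

    T-closed : Closed off T
    T-closed = Grown.closed grown

    T-outer : T outer ≡ true
    T-outer = Tree.base tree₀ outer (insert-new F̄ outer)

    T-least : ∀ W → W outer ≡ true → Closed off W → ∀ {f} → Fc f ≡ true → T f ≡ true → W f ≡ true
    T-least W Wo cl {f} Ff Tf with ∨-elim {W f} (Tree.span tree₀ (λ g → W g ∨ F̄ g)
        (λ g b → case insert-elim F̄ b of λ { (inj₁ x) → ∨-intro₂ {W g} x ; (inj₂ refl) → ∨-intro₁ Wo })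
        (λ d h w → case ∨-elim {W (face d)} w of λ
          { (inj₁ x) → ∨-intro₁ (cl d (τ₀-off d h) x)
          ; (inj₂ x) → ⊥-elim (true≢false (face-Fc (∧-elim₁ {al d} (τ₀-off d h))) (not-elim x)) }) f Tf)
    ... | inj₁ w = w
    ... | inj₂ x = ⊥-elim (true≢false Ff (not-elim x))

    closed-all : ∀ W → Closed off W → (∀ {x} → A x → on x ≡ true → W (face x) ≡ true → W (face (α x)) ≡ true) →
      ∀ {f g} → Fc f ≡ true → Fc g ≡ true → W f ≡ true → W g ≡ true
    closed-all W cl c = conn-face W λ {d} Ad w → case bool-cases (on d) of λ
      { (inj₁ o) → c Ad o w ; (inj₂ o) → cl d (∧-intro Ad (not-intro o)) w }

    Separated : Set
    Separated = (∀ {x} → x ∈ˡ ks → T (face x) ≡ true × T (face (α x)) ≡ false)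
              ⊎ (∀ {x} → x ∈ˡ ks → T (face x) ≡ false × T (face (α x)) ≡ true)

    -- If the exterior were everything, `τ₀` would be a dual spanning tree that does not cross the
    -- cycle. Its complement would be connected, of the size of a spanning tree, and yet contain the
    -- cycle, whose edges are as many as its vertices.
    not-all : Fc ⊆ᵇ T → ⊥
    not-all full = ℕP.1+n≰n (ℕP.≤-trans (ℕP.≤-reflexive (ℕP.+-comm 1 (# H)))
        (ℕP.≤-trans (ℕP.+-monoʳ-≤ (# H) (s≤s {0} {1} z≤n)) (ℕP.≤-trans (ℕP.≤-reflexive C.#cotree) (ℕP.+-cancelʳ-≤ (2 *ℕ length ks) _ _ le))))
      where
      module G = Graph α tail
      module C = Cotree tree₀ (λ d h → ∧-elim₁ {al d} (τ₀-off d h)) full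
      H onH : Fin D → Bool
      H = cotree τ₀
      onH d = H d ∧ G.inside onV d
      on-onH : # on ≤ℕ # onH
      on-onH = #-mono λ d o → ∧-intro (∧-intro (on-A o) (not-intro (false-intro λ t → true≢false o (not-elim (∧-elim₂ {al d} (τ₀-off d t))))))
          (∧-intro (onV-on o) (onV-on (on-α o)))
      arith : ∀ x y z → (x +ℕ y) +ℕ z ≡ (x +ℕ z) +ℕ y
      arith = solve-∀
      le : 2 *ℕ # V +ℕ 2 *ℕ length ks ≤ℕ # H +ℕ 2 *ℕ length ks
      le = ℕP.≤-trans (ℕP.+-mono-≤ (C.cotree-bound onV (tail-V (alive {k₁} (here refl))) (onV-tail (here refl))) (ℕP.≤-trans #on on-onH))
        (ℕP.≤-trans (ℕP.≤-reflexive (arith (# (G.outside H onV)) (2 *ℕ # onV) (# onH)))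
          (ℕP.+-mono-≤ (#-disj (G.outside H onV) onH H (λ d h → ∧-elim₁ h) (λ d h → ∧-elim₁ h)
              λ d h h' → true≢false (∧-elim₂ {H d} h') (not-elim (∧-elim₂ {H d} h))) (ℕP.*-monoʳ-≤ 2 #onV)))

    -- Each side is constant along the cycle. If both sides were exterior, crossing the cycle would
    -- never leave the exterior, against `not-all`. If neither were, no crossing would lead out of
    -- the exterior, against connectivity of the dual.
    separated : Separated
    separated with bool-cases (T (face k₁)) | bool-cases (T (face (α k₁)))
    ... | inj₁ p | inj₂ q = inj₁ λ m → let (x , y) = same-side T T-closed m in trans x p , trans y q
    ... | inj₂ p | inj₁ q = inj₂ λ m → let (x , y) = same-side T T-closed m in trans x p , trans y q
    ... | inj₁ p | inj₁ q = ⊥-elim (not-all λ f Ff → closed-all T T-closed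
            (λ Ax o _ → case on-cases o of λ
              { (inj₁ m) → trans (proj₂ (same-side T T-closed m)) q
              ; (inj₂ m) → trans (proj₁ (same-side T T-closed m)) p })
            outer-Fc Ff T-outer)
    ... | inj₂ p | inj₂ q = ⊥-elim (true≢false (closed-all T T-closed
            (λ {x} Ax o h → ⊥-elim (case on-cases o of λ
              { (inj₁ m) → true≢false h (trans (proj₁ (same-side T T-closed m)) p)
              ; (inj₂ m) → true≢false h (trans (cong (T ∘ face) (sym (αα Ax))) (trans (proj₂ (same-side T T-closed m)) q)) }))
            outer-Fc (face-Fc (alive {k₁} (here refl))) T-outer) p)

    on-inside : ∀ {x} → on x ≡ true → T (face x) ≡ true → T (face (α x)) ≡ false
    on-inside {x} o h with separated | on-cases o
    ... | inj₁ s | inj₁ m = proj₂ (s m)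
    ... | inj₂ s | inj₁ m = ⊥-elim (true≢false h (proj₁ (s m)))
    ... | inj₁ s | inj₂ m = ⊥-elim (true≢false h (trans (cong (T ∘ face) (sym (αα (on-A o)))) (proj₂ (s m))))
    ... | inj₂ s | inj₂ m = proj₁ (s m)

    on-outside : ∀ {x} → on x ≡ true → T (face x) ≡ false → T (face (α x)) ≡ true
    on-outside {x} o h with separated | on-cases o
    ... | inj₁ s | inj₁ m = ⊥-elim (true≢false (proj₁ (s m)) h)
    ... | inj₂ s | inj₁ m = proj₂ (s m)
    ... | inj₁ s | inj₂ m = proj₁ (s m)
    ... | inj₂ s | inj₂ m = ⊥-elim (true≢false (trans (cong (T ∘ face) (sym (αα (on-A o)))) (proj₂ (s m))) h)

    off-vertex : ∀ {x y} → A x → A y → tail x ≡ tail y → onV (tail x) ≡ false → T (face x) ≡ false → T (face y) ≡ false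
    off-vertex {x} Ax Ay t ¬o h = orbit-ind (λ z → T (face z) ≡ false) Ax Ay t
      (λ {z} Az tz hz → false-intro λ e → true≢false
        (subst (λ w → T (face w) ≡ true) (αα Az) (T-closed (α z) (off-α {z} (offz Az tz)) (trans (cong T (sym (face-σ Az))) e))) hz) h
      where
      offz : ∀ {z} → A z → tail z ≡ tail x → off z ≡ true
      offz {z} Az tz = ∧-intro Az (not-intro (false-intro λ o → true≢false (subst (λ u → onV u ≡ true) tz (onV-on o)) ¬o))

-- No reflex corner at a vertex of a triangle lies inside it

-- Inside a triangle: s faces, r reflex corners, ds darts, e darts with both sides inside, i vertices. The dual tree has τ' darts,
-- τ₀ of them outside, ss inside; h darts are not in it, out of them leave the inside, he have both sides inside.
count-contradiction : ∀ {s r ds e ss he τ₀ τ' h out v w i fc df t} →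
  3 *ℕ s +ℕ r ≤ℕ ds → ds ≤ℕ e +ℕ 3 → e ≤ℕ ss +ℕ he → τ₀ +ℕ 2 +ℕ ss ≤ℕ τ' → out +ℕ he +ℕ 4 ≤ℕ h →
  2 *ℕ v ≤ℕ out +ℕ 2 *ℕ w → w ≤ℕ i +ℕ 3 → τ' +ℕ h +ℕ 4 ≤ℕ 2 *ℕ v +ℕ 2 *ℕ fc → 2 *ℕ t ≤ℕ τ₀ +ℕ 2 +ℕ 2 *ℕ df →
  fc +ℕ df ≤ℕ s +ℕ t → i +ℕ 1 ≤ℕ r → r ≤ℕ s → ⊥
count-contradiction {s} {r} {ds} {e} {ss} {he} {τ₀} {τ'} {h} {out} {v} {w} {i} {fc} {df} {t}
  h₁ h₂ h₃ h₄ h₅ h₆ h₇ h₈ h₉ h₁₀ h₁₁ h₁₂ =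
  ℕP.1+n≰n (subst (_≤ℕ rhs) (arith s r ds e ss he τ₀ τ' h out v w i fc df t)
    (h₁ ⊕ h₂ ⊕ h₃ ⊕ h₄ ⊕ h₅ ⊕ h₆ ⊕ ℕP.*-monoʳ-≤ 2 h₇ ⊕ h₈ ⊕ h₉ ⊕ ℕP.*-monoʳ-≤ 2 h₁₀ ⊕ ℕP.*-monoʳ-≤ 2 h₁₁ ⊕ h₁₂))
  where
  infixr 5 _⊕_
  _⊕_ : ∀ {a b c d} → a ≤ℕ b → c ≤ℕ d → a +ℕ c ≤ℕ b +ℕ d
  _⊕_ = ℕP.+-mono-≤
  rhs = ds +ℕ ((e +ℕ 3) +ℕ ((ss +ℕ he) +ℕ (τ' +ℕ (h +ℕ ((out +ℕ 2 *ℕ w) +ℕ (2 *ℕ (i +ℕ 3) +ℕ ((2 *ℕ v +ℕ 2 *ℕ fc)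
    +ℕ ((τ₀ +ℕ 2 +ℕ 2 *ℕ df) +ℕ (2 *ℕ (s +ℕ t) +ℕ (2 *ℕ r +ℕ s))))))))))
  arith : ∀ s r ds e ss he τ₀ τ' h out v w i fc df t →
    (3 *ℕ s +ℕ r) +ℕ (ds +ℕ (e +ℕ ((τ₀ +ℕ 2 +ℕ ss) +ℕ ((out +ℕ he +ℕ 4) +ℕ (2 *ℕ v +ℕ (2 *ℕ w +ℕ ((τ' +ℕ h +ℕ 4)
      +ℕ (2 *ℕ t +ℕ (2 *ℕ (fc +ℕ df) +ℕ (2 *ℕ (i +ℕ 1) +ℕ r))))))))))
    ≡ suc (ds +ℕ ((e +ℕ 3) +ℕ ((ss +ℕ he) +ℕ (τ' +ℕ (h +ℕ ((out +ℕ 2 *ℕ w) +ℕ (2 *ℕ (i +ℕ 3) +ℕ ((2 *ℕ v +ℕ 2 *ℕ fc)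
    +ℕ ((τ₀ +ℕ 2 +ℕ 2 *ℕ df) +ℕ (2 *ℕ (s +ℕ t) +ℕ (2 *ℕ r +ℕ s)))))))))))
  arith = solve-∀

-- In usual terms: s faces inside have 3s + r corners, which are the darts with their face inside.
-- Three of these belong to the triangle; Euler's formula for the disk allows at most 2 (i + s - 1)
-- others. Hence s + r ≤ 2i + 1, and r ≤ s gives r ≤ i. But each of the i inner vertices has its
-- reflex corner inside, and the assumed corner at the triangle is one more.
module Disk {D n F : ℕ} (M : Map D n F) (isMap : IsMap M) {k₁ : Fin D} {ks' : List (Fin D)} (cyc : Cycle M k₁ ks')
  (len : length ks' ≡ 2) {r : Fin D} (Ar : Map.A M r) (ρr : Map.ρ M r ≡ true)
  (r-on : Jordan.onV M isMap cyc (Map.tail M r) ≡ true) (r-in : Jordan.T M isMap cyc (Map.face M r) ≡ false) where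
  open MapFacts M isMap
  open Dual M isMap
  open Jordan M isMap hiding (on; off; T; onV; τ₀)
  open Cycle cyc
  module G = Graph α tail

  on off : Fin D → Bool
  on = Jordan.on M isMap cyc
  off = Jordan.off M isMap cyc
  T : Fin F → Bool
  T = Jordan.T M isMap cyc
  onV : Fin n → Bool
  onV = Jordan.onV M isMap cyc
  τ₀ : Fin D → Bool
  τ₀ = Jordan.τ₀ M isMap cyc

  abstract
   bridge : ∃ λ e → on e ≡ true × T (face e) ≡ true
   bridge with bool-cases (T (face k₁))
   ... | inj₁ h = k₁ , on-ks cyc (here refl) , h
   ... | inj₂ h = α k₁ , on-α cyc (on-ks cyc (here refl)) , on-outside cyc (on-ks cyc (here refl)) h

  e₁ : Fin D
  e₁ = proj₁ bridge
  e-on : on e₁ ≡ true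
  e-on = proj₁ (proj₂ bridge)
  Ae : A e₁
  Ae = on-A cyc e-on
  e-T : T (face e₁) ≡ true
  e-T = proj₂ (proj₂ bridge)
  e-S : T (face (α e₁)) ≡ false
  e-S = on-inside cyc e-on e-T

  abstract
   -- The exterior tree crosses the triangle once, along `e₁`, and is continued inside. The result
   -- spans all faces, so the remaining two edges of the triangle belong to its complement.
   g : Grown off B (insert T (face (α e₁))) (insert (insert τ₀ e₁) (α e₁))
   g = grow (off-edges cyc) (add-edge (tree₀ cyc) e₁ (αα Ae) (α≢ Ae) e-T e-S)
  open Grown g using (U'; τ'; tree; τ-from) renaming (closed to U'-closed; U-sub to U'-sub; τ-sub to τ'-sub)

  τ'-cases : ∀ {d} → τ' d ≡ true → off d ≡ true ⊎ d ≡ e₁ ⊎ d ≡ α e₁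
  τ'-cases {d} h with τ-from d h
  ... | inj₂ o = inj₁ o
  ... | inj₁ i with insert-elim (insert τ₀ e₁) i
  ...   | inj₂ e = inj₂ (inj₂ e)
  ...   | inj₁ j with insert-elim τ₀ j
  ...     | inj₁ k = inj₁ (τ₀-off cyc d k)
  ...     | inj₂ e = inj₂ (inj₁ e)

  τ'-al : τ' ⊆ᵇ al
  τ'-al d h with τ'-cases h
  ... | inj₁ o = ∧-elim₁ {al d} o
  ... | inj₂ (inj₁ refl) = Ae
  ... | inj₂ (inj₂ refl) = αA Ae

  U'-e : U' (face e₁) ≡ true × U' (face (α e₁)) ≡ true
  U'-e = U'-sub (face e₁) (∨-intro₁ e-T) , U'-sub (face (α e₁)) (insert-new T (face (α e₁)))

  U'-k : U' (face k₁) ≡ true × U' (face (α k₁)) ≡ true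
  U'-k = from (on-cases cyc e-on)
    where
    from : e₁ ∈ˡ ks ⊎ α e₁ ∈ˡ ks → U' (face k₁) ≡ true × U' (face (α k₁)) ≡ true
    from (inj₁ m) = trans (sym (proj₁ (same-side cyc U' U'-closed m))) (proj₁ U'-e)
                  , trans (sym (proj₂ (same-side cyc U' U'-closed m))) (proj₂ U'-e)
    from (inj₂ m) = trans (sym (proj₁ (same-side cyc U' U'-closed m))) (proj₂ U'-e)
                  , trans (sym (proj₂ (same-side cyc U' U'-closed m))) (trans (cong (U' ∘ face) (αα Ae)) (proj₁ U'-e))

  U'-full : Fc ⊆ᵇ U'
  U'-full f Ff = closed-all cyc U' U'-closed (λ Ax o _ → case on-cases cyc o of λ
      { (inj₁ m) → trans (proj₂ (same-side cyc U' U'-closed m)) (proj₂ U'-k)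
      ; (inj₂ m) → trans (proj₁ (same-side cyc U' U'-closed m)) (proj₁ U'-k) })
    outer-Fc Ff (Tree.base tree outer (insert-new F̄ outer))

  module C = Cotree tree τ'-al U'-full

  H : Fin D → Bool
  H = cotree τ'
  S : Fin F → Bool
  S f = Fc f ∧ not (T f)
  dS E SS HE HK rS : Fin D → Bool
  dS d = al d ∧ not (T (face d))
  E d = dS d ∧ not (T (face (α d)))
  SS d = τ' d ∧ E d
  HE d = H d ∧ E d
  HK d = on d ∧ (not (d =ᶠ e₁) ∧ not (d =ᶠ α e₁))
  rS d = dS d ∧ ρ d
  R? : Fin n → Fin D → Bool
  R? u d = rS d ∧ (tail d =ᶠ u)
  R I W : Fin n → Bool
  R u = exists (R? u)
  I u = R u ∧ not (onV u)
  W u = I u ∨ onV u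

  inner : ∀ {d} → dS d ≡ true → face d ≢ outer
  inner {d} h e = true≢false (trans (cong T e) (T-outer cyc)) (not-elim (∧-elim₂ {al d} h))

  R-intro : ∀ {d} → rS d ≡ true → R (tail d) ≡ true
  R-intro {d} h = exists-intro (R? (tail d)) d (∧-intro h (=ᶠ-refl (tail d)))

  -- `I` records inner vertices through their reflex corners. This catches all of them: at a vertex
  -- off the cycle every corner, the reflex one included, is on the same side.
  W-dS : ∀ {d} → dS d ≡ true → W (tail d) ≡ true
  W-dS {d} h with bool-cases (onV (tail d))
  ... | inj₁ o = ∨-intro₂ {I (tail d)} o
  ... | inj₂ ¬o with ∧-elim₁ {al d} h
  ...   | Ad with root Ad
  ...     | q , Aq , tq , ρq = ∨-intro₁ (∧-intro (subst (λ u → R u ≡ true) tq (R-intro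
              (∧-intro (∧-intro Aq (not-intro (off-vertex cyc Ad Aq (sym tq) ¬o (not-elim (∧-elim₂ {al d} h))))) ρq))) (not-intro ¬o))

  E-α : ∀ {d} → E d ≡ true → E (α d) ≡ true
  E-α {d} h = ∧-intro (∧-intro (αA Ad) (∧-elim₂ {dS d} h)) (trans (cong (not ∘ T ∘ face) (αα Ad)) (∧-elim₂ {al d} (∧-elim₁ {dS d} h)))
    where Ad = ∧-elim₁ {al d} (∧-elim₁ {dS d} h)

  E-inside : ∀ {d} → E d ≡ true → G.inside W d ≡ true
  E-inside {d} h = ∧-intro (W-dS (∧-elim₁ {dS d} h)) (W-dS (∧-elim₁ {dS (α d)} (E-α h)))

  three : ∀ f → S f ≡ true → 3 ≤ℕ # (λ d → (dS d ∧ not (ρ d)) ∧ (face d =ᶠ f))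
  three f h with Fc-face (∧-elim₁ {Fc f} h)
  ... | d , Ad , refl = go
    where
    nout : face d ≢ outer
    nout = inner (∧-intro Ad (∧-elim₂ {Fc f} h))
    P : Fin D → Bool
    P x = (dS x ∧ not (ρ x)) ∧ (face x =ᶠ f)
    mk : ∀ {x} → A x → face x ≡ f → ρ x ≡ false → P x ≡ true
    mk {x} Ax fx ρx = ∧-intro (∧-intro (∧-intro Ax (trans (cong (not ∘ T) fx) (∧-elim₂ {Fc f} h))) (not-intro ρx)) (=ᶠ-intro fx)
    go : 3 ≤ℕ # P
    go with bool-cases (quad (face d))
    ... | inj₂ q = #-list-≥ {ys = d ∷ φ d ∷ φ (φ d) ∷ []} P
          ((λ { (here e) → tail-φ≢ Ad (cong tail (sym e)) ; (there (here e)) → tail-φ≢ A₂ (trans (cong tail (proj₁ (tri Ad nout q))) (cong tail e)) })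
            ∷ (λ { (here e) → tail-φ≢ A₁ (cong tail (sym e)) }) ∷ (λ ()) ∷ [])
          (λ { (here refl) → mk Ad refl (t Ad refl) ; (there (here refl)) → mk A₁ f₁ (t A₁ f₁) ; (there (there (here refl))) → mk A₂ f₂ (t A₂ f₂) })
        where
        A₁ = φA Ad
        A₂ = φA A₁
        f₁ = face-φ Ad
        f₂ = trans (face-φ A₁) f₁
        t : ∀ {x} → A x → face x ≡ face d → ρ x ≡ false
        t Ax e = proj₂ (tri Ax (λ e' → nout (trans (sym e) e')) (trans (cong quad e) q))
    ... | inj₁ q with quad-root Ad nout q
    ...   | q₃ , Aq , fq , ρq = #-list-≥ {ys = d₁ ∷ d₂ ∷ d₄ ∷ []} P
          ((λ { (here e) → a≢c (cong tail (sym e)) ; (there (here e)) → c≢b (cong tail e) }) ∷ (λ { (here e) → a≢b (cong tail e) }) ∷ (λ ()) ∷ [])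
          (λ { (here refl) → mk A₁ (trans f₁ fq) ρ₁ ; (there (here refl)) → mk A₂ (trans f₂ fq) ρ₂ ; (there (there (here refl))) → mk A₄ (trans f₄ fq) ρ₄ })
      where open Face4 M isMap q₃ Aq ρq (λ e → nout (trans (sym fq) e))

  K' : Fin D → Bool
  K' d = dS d ∧ T (face (α d))

  #K' : # K' ≤ℕ 3
  #K' = ℕP.≤-trans cases (ℕP.≤-reflexive (cong suc len))
    where
    o : ∀ {d} → K' d ≡ true → on d ≡ true
    o {d} h with bool-cases (on d)
    ... | inj₁ e = e
    ... | inj₂ e = ⊥-elim (true≢false
          (subst (λ z → T (face z) ≡ true) (αα Ad) (T-closed cyc (α d) (off-α cyc {d} (∧-intro Ad (not-intro e))) (∧-elim₂ {dS d} h)))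
          (not-elim (∧-elim₂ {al d} (∧-elim₁ {dS d} h))))
      where Ad = ∧-elim₁ {al d} (∧-elim₁ {dS d} h)
    cases : # K' ≤ℕ length ks
    cases with separated cyc
    ... | inj₂ s = #-list-≤ ks K' λ d h → case on-cases cyc (o h) of λ
          { (inj₁ m) → m ; (inj₂ m) → ⊥-elim (true≢false (∧-elim₂ {dS d} h) (proj₁ (s m))) }
    ... | inj₁ s = ℕP.≤-trans (#-inj K' (member ks) (λ d _ → α d) (λ d h → member-intro (case on-cases cyc (o h) of λ
          { (inj₂ m) → m ; (inj₁ m) → ⊥-elim (true≢false (proj₁ (s m)) (not-elim (∧-elim₂ {al d} (∧-elim₁ {dS d} h)))) }))
          (λ x y hx hy e → trans (sym (αα (on-A cyc (o hx)))) (trans (cong α e) (αα (on-A cyc (o hy))))))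
          (#-list-≤ ks (member ks) λ x → member-elim ks)

  -- A triangle has six darts, two of which belong to the edge crossed by the dual tree.
  HK-4 : 4 ≤ℕ # HK
  HK-4 = ℕP.+-cancelˡ-≤ 2 _ _ (ℕP.≤-trans (ℕP.≤-reflexive (sym (cong (λ z → 2 *ℕ suc z) len))) (ℕP.≤-trans (#on cyc) (ℕP.≤-trans
    (#-cover (member (e₁ ∷ α e₁ ∷ [])) HK on λ d h → c d h)
    (ℕP.+-monoˡ-≤ (# HK) (#-list-≤ (e₁ ∷ α e₁ ∷ []) (member (e₁ ∷ α e₁ ∷ [])) λ x → member-elim (e₁ ∷ α e₁ ∷ []))))))
    where
    c : ∀ d → on d ≡ true → member (e₁ ∷ α e₁ ∷ []) d ≡ true ⊎ HK d ≡ true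
    c d h with d ≟ e₁ | d ≟ α e₁
    ... | yes e | _ = inj₁ refl
    ... | no _ | yes e = inj₁ refl
    ... | no e | no e' = inj₂ (∧-intro h refl)

  disk : ⊥
  disk = count-contradiction {# S} {# rS} {# dS} {# E} {# SS} {# HE} {# τ₀} {# τ'} {# H} {# (G.outside H W)} {# V} {# W} {# I} {# Fc} {# F̄} {# T}
    h₁ h₂ h₃ h₄ h₅ (C.cotree-bound W (tail-V Ar) (∨-intro₂ {I (tail r)} r-on)) h₇ h₈ h₉ h₁₀ h₁₁ h₁₂
    where
    h₁ : 3 *ℕ # S +ℕ # rS ≤ℕ # dS
    h₁ = subst (3 *ℕ # S +ℕ # rS ≤ℕ_) (sym (trans (#-split dS ρ) (ℕP.+-comm (# rS) _)))
      (ℕP.+-monoˡ-≤ (# rS) (#-fibres 3 (λ d → dS d ∧ not (ρ d)) S face three))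
    h₂ : # dS ≤ℕ # E +ℕ 3
    h₂ = subst (_≤ℕ # E +ℕ 3) (sym (trans (#-split dS (λ d → T (face (α d)))) (ℕP.+-comm (# K') (# E)))) (ℕP.+-monoʳ-≤ (# E) #K')
    h₃ : # E ≤ℕ # SS +ℕ # HE
    h₃ = #-cover SS HE E λ d h → case bool-cases (τ' d) of λ
      { (inj₁ e) → inj₁ (∧-intro e h) ; (inj₂ e) → inj₂ (∧-intro (∧-intro (∧-elim₁ {al d} (∧-elim₁ {dS d} h)) (not-intro e)) h) }
    τ₀e : # (insert (insert τ₀ e₁) (α e₁)) ≡ suc (suc (# τ₀))
    τ₀e = trans (#-insert (insert τ₀ e₁) (α e₁) (insert-false τ₀ (not₀ (on-α cyc e-on)) (α≢ Ae))) (cong suc (#-insert τ₀ e₁ (not₀ e-on)))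
      where
      not₀ : ∀ {x} → on x ≡ true → τ₀ x ≡ false
      not₀ {x} o = false-intro λ t → true≢false o (not-elim (∧-elim₂ {al x} (τ₀-off cyc x t)))
    h₄ : # τ₀ +ℕ 2 +ℕ # SS ≤ℕ # τ'
    h₄ = subst (λ z → z +ℕ # SS ≤ℕ # τ') (trans τ₀e (ℕP.+-comm 2 (# τ₀)))
      (#-disj (insert (insert τ₀ e₁) (α e₁)) SS τ' τ'-sub (λ d h → ∧-elim₁ h) λ d i h → dis d i (∧-elim₂ {τ' d} h))
      where
      dis : ∀ d → insert (insert τ₀ e₁) (α e₁) d ≡ true → E d ≡ true → ⊥
      dis d i h with insert-elim (insert τ₀ e₁) i
      ... | inj₂ refl = true≢false (trans (cong (T ∘ face) (αα Ae)) e-T) (not-elim (∧-elim₂ {dS d} h))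
      ... | inj₁ j with insert-elim τ₀ j
      ...   | inj₁ t = true≢false (Tree.within (tree₀ cyc) d t) (not-elim (∧-elim₂ {al d} (∧-elim₁ {dS d} h)))
      ...   | inj₂ refl = true≢false e-T (not-elim (∧-elim₂ {al d} (∧-elim₁ {dS d} h)))
    -- Three disjoint kinds of darts outside the dual tree: those not contained in `W`, those
    -- between two inner faces, and those of the two triangle edges that the tree does not cross.
    h₅ : # (G.outside H W) +ℕ # HE +ℕ 4 ≤ℕ # H
    h₅ = ℕP.≤-trans (ℕP.≤-trans (ℕP.≤-reflexive (ℕP.+-assoc (# (G.outside H W)) _ _)) (ℕP.+-monoʳ-≤ (# (G.outside H W))
        (ℕP.≤-trans (ℕP.+-monoʳ-≤ (# HE) HK-4) (#-disj HE HK in-W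
          (λ d h → ∧-intro {H d} (∧-elim₁ {H d} h) (E-inside (∧-elim₂ {H d} h))) HK-in
          (λ d h k → on-E d (∧-elim₁ k) (∧-elim₂ {H d} h))))))
      (#-disj (G.outside H W) in-W H (λ d h → ∧-elim₁ h) (λ d h → ∧-elim₁ h)
        λ d h k → true≢false (∧-elim₂ {H d} k) (not-elim (∧-elim₂ {H d} h)))
      where
      in-W : Fin D → Bool
      in-W d = H d ∧ G.inside W d
      HK-in : ∀ d → HK d ≡ true → in-W d ≡ true
      HK-in d h = ∧-intro (∧-intro (on-A cyc o) (not-intro (false-intro λ t → case τ'-cases t of λ
          { (inj₁ f) → true≢false o (not-elim (∧-elim₂ {al d} f))
          ; (inj₂ (inj₁ e)) → true≢false (=ᶠ-intro e) (not-elim (∧-elim₁ {not (d =ᶠ e₁)} (∧-elim₂ {on d} h)))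
          ; (inj₂ (inj₂ e)) → true≢false (=ᶠ-intro e) (not-elim (∧-elim₂ {not (d =ᶠ e₁)} (∧-elim₂ {on d} h))) })))
          (∧-intro (∨-intro₂ {I (tail d)} (onV-on cyc o)) (∨-intro₂ {I (head d)} (onV-on cyc (on-α cyc o))))
        where o = ∧-elim₁ {on d} h
      on-E : ∀ d → on d ≡ true → E d ≡ true → ⊥
      on-E d o h = true≢false (on-outside cyc o (not-elim (∧-elim₂ {al d} (∧-elim₁ {dS d} h)))) (not-elim (∧-elim₂ {dS d} h))
    h₇ : # W ≤ℕ # I +ℕ 3
    h₇ = ℕP.≤-trans (#-cover I onV W λ u → ∨-elim) (ℕP.+-monoʳ-≤ (# I) (ℕP.≤-trans (#onV cyc) (ℕP.≤-reflexive (cong suc len))))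
    h₈ : # τ' +ℕ # H +ℕ 4 ≤ℕ 2 *ℕ # V +ℕ 2 *ℕ # Fc
    h₈ = ℕP.≤-reflexive (trans (arith (# τ') (# H)) (trans (cong₂ _+ℕ_ C.#cotree C.#τ) refl))
      where
      arith : ∀ a b → a +ℕ b +ℕ 4 ≡ (b +ℕ 2) +ℕ (a +ℕ 2)
      arith = solve-∀
    h₉ : 2 *ℕ # T ≤ℕ # τ₀ +ℕ 2 +ℕ 2 *ℕ # F̄
    h₉ = ℕP.≤-reflexive (trans (sym (Tree.size (tree₀ cyc))) (trans (cong (λ z → # τ₀ +ℕ 2 *ℕ z) #B) (arith (# τ₀) (# F̄))))
      where
      arith : ∀ a b → a +ℕ 2 *ℕ suc b ≡ a +ℕ 2 +ℕ 2 *ℕ b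
      arith = solve-∀
    h₁₀ : # Fc +ℕ # F̄ ≤ℕ # S +ℕ # T
    h₁₀ = #-disj Fc F̄ (λ _ → true) (λ _ _ → refl) (λ _ _ → refl) (λ f h k → true≢false h (not-elim k))
      ▹ #-cover S T (λ _ → true) (λ f _ → case bool-cases (T f) of λ
          { (inj₁ t) → inj₂ t
          ; (inj₂ t) → case bool-cases (Fc f) of λ
              { (inj₁ h) → inj₁ (∧-intro h (not-intro t))
              ; (inj₂ h) → inj₂ (Tree.base (tree₀ cyc) f (∨-intro₁ (not-intro h))) } })
      where
      _▹_ : ∀ {x y z} → x ≤ℕ y → y ≤ℕ z → x ≤ℕ z
      _▹_ = ℕP.≤-trans
    -- The vertex of `r` lies on the cycle, so its reflex corner is counted in addition to those of
    -- the inner vertices.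
    h₁₁ : # I +ℕ 1 ≤ℕ # rS
    h₁₁ = ℕP.≤-trans (ℕP.≤-reflexive (ℕP.+-comm (# I) 1)) (ℕP.≤-trans
      (subst (suc (# I) ≤ℕ_) (sym (#-remove R (tail r) (R-intro (∧-intro (∧-intro Ar (not-intro r-in)) ρr))))
        (s≤s (#-mono {p = I} {R ∖ tail r} λ u h → ∖-intro {p = R} (∧-elim₁ {R u} h) λ { refl → true≢false r-on (not-elim (∧-elim₂ {R u} h)) })))
      (#-surj rS R tail λ u h → case exists-elim (R? u) h of λ
        { (d , e) → d , ∧-elim₁ {rS d} e , =ᶠ-true (tail d) u (∧-elim₂ {rS d} e) }))
    h₁₂ : # rS ≤ℕ # S
    h₁₂ = #-inj rS S (λ d _ → face d)
      (λ d h → ∧-intro (face-Fc (∧-elim₁ {al d} (∧-elim₁ {dS d} h))) (∧-elim₂ {al d} (∧-elim₁ {dS d} h)))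
      (λ x y hx hy e → face-root (∧-elim₁ {al x} (∧-elim₁ {dS x} hx)) (∧-elim₁ {al y} (∧-elim₁ {dS y} hy)) e
        (inner (∧-elim₁ {dS x} hx)) (∧-elim₂ {dS x} hx) (∧-elim₂ {dS y} hy))

-- Short cycles around a quadrilateral

module Cycles {D n F : ℕ} (M : Map D n F) (isMap : IsMap M) where
  open MapFacts M isMap

  map∈ : ∀ (f : Fin D → Fin n) {x xs} → x ∈ˡ xs → f x ∈ˡ List.map f xs
  map∈ f (here refl) = here refl
  map∈ f (there m) = there (map∈ f m)

  distinct-inj : ∀ (f : Fin D → Fin n) {xs x y} → Distinct (List.map f xs) → x ∈ˡ xs → y ∈ˡ xs → f x ≡ f y → x ≡ y
  distinct-inj f d (here refl) (here refl) e = refl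
  distinct-inj f {_ ∷ xs} (h ∷ d) (here refl) (there m) e = ⊥-elim (h (subst (_∈ˡ List.map f xs) (sym e) (map∈ f m)))
  distinct-inj f {_ ∷ xs} (h ∷ d) (there m) (here refl) e = ⊥-elim (h (subst (_∈ˡ List.map f xs) e (map∈ f m)))
  distinct-inj f (h ∷ d) (there m) (there m') e = distinct-inj f d m m' e

  distinct-map : ∀ (f : Fin D → Fin n) {xs} → Distinct (List.map f xs) → Distinct xs
  distinct-map f {[]} [] = []
  distinct-map f {x ∷ xs} (h ∷ d) = (λ m → h (map∈ f m)) ∷ distinct-map f d

  distinct₃ : ∀ {x y z : Fin n} → x ≢ y → x ≢ z → y ≢ z → Distinct (x ∷ y ∷ z ∷ [])
  distinct₃ p q r = (λ { (here e) → p e ; (there (here e)) → q e }) ∷ (λ { (here e) → r e }) ∷ (λ ()) ∷ []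

  distinct₄ : ∀ {w x y z : Fin n} → w ≢ x → w ≢ y → w ≢ z → x ≢ y → x ≢ z → y ≢ z → Distinct (w ∷ x ∷ y ∷ z ∷ [])
  distinct₄ p q r s t u = (λ { (here e) → p e ; (there (here e)) → q e ; (there (there (here e))) → r e }) ∷ distinct₃ s t u

  -- The successor of each dart must not return to its tail. This gives `asym`: if `α x` were on the
  -- cycle, it would be the successor of `x`, as tails are distinct.
  mkCycle : ∀ {k ks} → (∀ {x} → x ∈ˡ k ∷ ks → A x) → Distinct (List.map tail (k ∷ ks)) → Distinct (List.map head (k ∷ ks)) →
    Linked M (k ∷ ks) → (∀ {x} → x ∈ˡ k ∷ ks → ∃ λ y → y ∈ˡ k ∷ ks × tail y ≡ head x × head y ≢ tail x) → Cycle M k ks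
  mkCycle al dt dh l far = record
    { alive = al ; tail-inj = distinct-inj tail dt ; head-inj = distinct-inj head dh ; linked = l
    ; closing = λ m → let (y , m' , t , _) = far m in y , m' , t
    ; asym = λ m αm → let (y , m' , t , ne) = far m in
        ne (trans (cong head (distinct-inj tail dt m' αm t)) (head-α (al m)))
    ; distinct = distinct-map tail dt }

  cycle₃ : ∀ {x y z} → A x → A y → A z → tail y ≡ head x → tail z ≡ head y → tail x ≡ head z →
    tail x ≢ tail y → tail x ≢ tail z → tail y ≢ tail z → Cycle M x (y ∷ z ∷ [])
  cycle₃ {x} {y} {z} Ax Ay Az xy yz zx p q r = mkCycle
    (λ { (here refl) → Ax ; (there (here refl)) → Ay ; (there (there (here refl))) → Az })
    (distinct₃ p q r)
    (distinct₃ (λ e → r (trans xy (trans e (sym yz)))) (λ e → p (trans zx (trans (sym e) (sym xy)))) (λ e → q (trans zx (trans (sym e) (sym yz)))))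
    (link xy (link yz one))
    (λ { (here refl) → y , there (here refl) , xy , (λ e → q (sym (trans yz e)))
       ; (there (here refl)) → z , there (there (here refl)) , yz , (λ e → p (trans zx e))
       ; (there (there (here refl))) → x , here refl , zx , (λ e → r (trans xy e)) })

  cycle₄ : ∀ {x y z w} → A x → A y → A z → A w → tail y ≡ head x → tail z ≡ head y → tail w ≡ head z → tail x ≡ head w →
    tail x ≢ tail y → tail x ≢ tail z → tail x ≢ tail w → tail y ≢ tail z → tail y ≢ tail w → tail z ≢ tail w →
    Cycle M x (y ∷ z ∷ w ∷ [])
  cycle₄ {x} {y} {z} {w} Ax Ay Az Aw xy yz zw wx p q r s t u = mkCycle
    (λ { (here refl) → Ax ; (there (here refl)) → Ay ; (there (there (here refl))) → Az ; (there (there (there (here refl)))) → Aw })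
    (distinct₄ p q r s t u)
    (distinct₄ (λ e → s (trans xy (trans e (sym yz)))) (λ e → t (trans xy (trans e (sym zw)))) (λ e → p (trans wx (trans (sym e) (sym xy))))
       (λ e → u (trans yz (trans e (sym zw)))) (λ e → q (trans wx (trans (sym e) (sym yz)))) (λ e → r (trans wx (trans (sym e) (sym zw)))))
    (link xy (link yz (link zw one)))
    (λ { (here refl) → y , there (here refl) , xy , (λ e → q (sym (trans yz e)))
       ; (there (here refl)) → z , there (there (here refl)) , yz , (λ e → t (sym (trans zw e)))
       ; (there (there (here refl))) → w , there (there (there (here refl))) , zw , (λ e → q (trans wx e))
       ; (there (there (there (here refl)))) → x , here refl , wx , (λ e → t (trans xy e)) })

module Bad {D n F : ℕ} (M : Map D n F) (isMap : IsMap M) (d₃ : Fin D)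
  (A₃ : Map.A M d₃) (ρ₃ : Map.ρ M d₃ ≡ true) (inner : Map.face M d₃ ≢ Map.outer M) where
  open MapFacts M isMap
  open Face4 M isMap d₃ A₃ ρ₃ inner
  open Dual M isMap
  open Jordan M isMap
  open Cycles M isMap

  -- A path from v to c closes up along either side of the quadrilateral; one of the two cycles has Q inside.
  theta : ∀ {p ps p' ps'} (cyc : Cycle M p ps) (cyc' : Cycle M p' ps') (P : Fin D → Set) →
    (∀ {x} → x ∈ˡ p ∷ ps → P x ⊎ x ≡ d₁ ⊎ x ≡ d₂) → (∀ {x} → P x → x ∈ˡ p ∷ ps) → d₁ ∈ˡ p ∷ ps → d₂ ∈ˡ p ∷ ps →
    (∀ {x} → x ∈ˡ p' ∷ ps' → P x ⊎ x ≡ α d₄ ⊎ x ≡ α d₃) → (∀ {x} → P x → x ∈ˡ p' ∷ ps') → α d₄ ∈ˡ p' ∷ ps' → α d₃ ∈ˡ p' ∷ ps' →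
    T cyc Q ≡ true → T cyc' Q ≡ true → ⊥
  theta {p} {ps} {p'} {ps'} cyc cyc' P to from m₁ m₂ to' from' m₄ m₃ h h' =
    true≢false (=ᶠ-refl Q) (not-elim (∧-elim₂ {T' Q} (∧-elim₂ {T₁ Q} (conn-face Z Z-closed outer-Fc (face-Fc A₃)
      (∧-intro (T-outer cyc) (∧-intro (T-outer cyc') (not-intro (=ᶠ-false (≢-sym inner)))))))))
    where
    T₁ T' Z : Fin F → Bool
    T₁ = T cyc
    T' = T cyc'
    -- Suppose that Q is exterior to both cycles. Each side of a path dart is then inside one of
    -- them, and each edge of Q has the interior of one of them on its far side. So no edge leads
    -- out of `Z`, which contains the outer face but not Q, against connectivity of the dual.
    Z f = T₁ f ∧ (T' f ∧ not (f =ᶠ Q))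
    L : ∀ {x} → x ∈ˡ p ∷ ps → T₁ (face x) ≡ true × T₁ (face (α x)) ≡ false
    L m = [ (λ s → s m) , (λ s → ⊥-elim (true≢false h (trans (cong T₁ (sym f₁)) (proj₁ (s m₁))))) ]′ (separated cyc)
    R : ∀ {x} → x ∈ˡ p' ∷ ps' → T' (face x) ≡ false × T' (face (α x)) ≡ true
    R m = [ (λ s → ⊥-elim (true≢false h' (trans (cong T' (sym f₄)) (trans (cong (T' ∘ face) (sym (αα A₄))) (proj₂ (s m₄)))))) , (λ s → s m) ]′ (separated cyc')
    Z-closed : ∀ {d} → A d → Z (face d) ≡ true → Z (face (α d)) ≡ true
    Z-closed {d} Ad z = ∧-intro c₁ (∧-intro c₂ (not-intro (=ᶠ-false λ e → c₃ (in-Q (αA Ad) e))))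
      where
      t₁ = ∧-elim₁ {T₁ (face d)} z
      t₂ = ∧-elim₁ {T' (face d)} (∧-elim₂ {T₁ (face d)} z)
      t₃ : face d ≢ Q
      t₃ e = true≢false (=ᶠ-intro e) (not-elim (∧-elim₂ {T' (face d)} (∧-elim₂ {T₁ (face d)} z)))
      c₁ : T₁ (face (α d)) ≡ true
      c₁ with bool-cases (on cyc d)
      ... | inj₂ o = T-closed cyc d (∧-intro Ad (not-intro o)) t₁
      ... | inj₁ o with on-cases cyc o
      ...   | inj₂ m = ⊥-elim (true≢false t₁ (trans (cong (T₁ ∘ face) (sym (αα Ad))) (proj₂ (L m))))
      ...   | inj₁ m with to m
      ...     | inj₁ x = ⊥-elim (true≢false t₂ (proj₁ (R (from' x))))
      ...     | inj₂ (inj₁ refl) = ⊥-elim (t₃ f₁)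
      ...     | inj₂ (inj₂ refl) = ⊥-elim (t₃ f₂)
      α≡ : ∀ {x} → α d ≡ α x → A x → d ≡ x
      α≡ e Ax = trans (sym (αα Ad)) (trans (cong α e) (αα Ax))
      c₂ : T' (face (α d)) ≡ true
      c₂ with bool-cases (on cyc' d)
      ... | inj₂ o = T-closed cyc' d (∧-intro Ad (not-intro o)) t₂
      ... | inj₁ o with on-cases cyc' o
      ...   | inj₁ m = ⊥-elim (true≢false t₂ (proj₁ (R m)))
      ...   | inj₂ m with to' m
      ...     | inj₁ x = ⊥-elim (true≢false t₁ (trans (cong (T₁ ∘ face) (sym (αα Ad))) (proj₂ (L (from x)))))
      ...     | inj₂ (inj₁ e) = ⊥-elim (t₃ (trans (cong face (α≡ e A₄)) f₄))
      ...     | inj₂ (inj₂ e) = ⊥-elim (t₃ (cong face (α≡ e A₃)))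
      αd≡ : ∀ {x} → α d ≡ x → d ≡ α x
      αd≡ e = trans (sym (αα Ad)) (cong α e)
      c₃ : α d ≡ d₁ ⊎ α d ≡ d₂ ⊎ α d ≡ d₃ ⊎ α d ≡ d₄ → ⊥
      c₃ (inj₁ e) = true≢false t₁ (trans (cong (T₁ ∘ face) (αd≡ e)) (proj₂ (L m₁)))
      c₃ (inj₂ (inj₁ e)) = true≢false t₁ (trans (cong (T₁ ∘ face) (αd≡ e)) (proj₂ (L m₂)))
      c₃ (inj₂ (inj₂ (inj₁ e))) = true≢false t₂ (trans (cong (T' ∘ face) (αd≡ e)) (proj₁ (R m₃)))
      c₃ (inj₂ (inj₂ (inj₂ e))) = true≢false t₂ (trans (cong (T' ∘ face) (αd≡ e)) (proj₁ (R m₄)))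

  A₃' = αA A₃
  A₄' = αA A₄

  module _ {g} (Ag : A g) (tg : tail g ≡ v) (hg : head g ≡ c) where
    abstract
      chord₁ : Cycle M g (d₁ ∷ d₂ ∷ [])
      chord₁ = cycle₃ Ag A₁ A₂ (sym hg) (sym h₁) (trans tg (sym h₂))
        (λ e → v≢c (trans (sym tg) e)) (λ e → v≢a (trans (sym tg) e)) (≢-sym a≢c)

      chord₂ : Cycle M g (α d₄ ∷ α d₃ ∷ [])
      chord₂ = cycle₃ Ag A₄' A₃' (trans h₄ (sym hg)) (trans h₃ (sym (head-α A₄))) (trans tg (sym (head-α A₃)))
        (λ e → v≢c (trans (sym tg) (trans e h₄))) (λ e → b≢v (sym (trans (sym tg) (trans e h₃)))) (λ e → c≢b (trans (sym h₄) (trans e h₃)))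

    -- An edge from v to c would split the boundary of Q into two triangles through v. By `theta`
    -- one of them has Q inside, hence also the reflex corner of its vertex v, which `Disk`
    -- excludes.
    nonadjacent : ⊥
    nonadjacent = by (bool-cases (T chord₁ Q)) (bool-cases (T chord₂ Q))
      where
      by : T chord₁ Q ≡ true ⊎ T chord₁ Q ≡ false → T chord₂ Q ≡ true ⊎ T chord₂ Q ≡ false → ⊥
      by (inj₂ e) _ = Disk.disk M isMap chord₁ refl A₃ ρ₃ (subst (λ u → onV chord₁ u ≡ true) tg (onV-tail chord₁ (here refl))) e
      by (inj₁ _) (inj₂ e) = Disk.disk M isMap chord₂ refl A₃ ρ₃ (subst (λ u → onV chord₂ u ≡ true) tg (onV-tail chord₂ (here refl))) e
      by (inj₁ e) (inj₁ e') = theta chord₁ chord₂ (_≡ g)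
          (λ { (here x) → inj₁ x ; (there (here x)) → inj₂ (inj₁ x) ; (there (there (here x))) → inj₂ (inj₂ x) })
          here (there (here refl)) (there (there (here refl)))
          (λ { (here x) → inj₁ x ; (there (here x)) → inj₂ (inj₁ x) ; (there (there (here x))) → inj₂ (inj₂ x) })
          here (there (here refl)) (there (there (here refl))) e e'

-- Existence of a contractible quadrilateral

-- The quadrilateral can be contracted (v moved onto c) when a and b are the only common neighbours of v and c.
Contractible : ∀ {D n F : ℕ} (M : Map D n F) → Fin D → Set
Contractible M d₃ = ∀ {x y} → A x → A y → tail x ≡ tail d₃ → head x ≡ tail y → head y ≡ tail (φ (φ d₃)) →
    head x ≡ tail (φ (φ (φ d₃))) ⊎ head x ≡ tail (φ d₃)
  where open Map M

record Reducible {D n F : ℕ} (M : Map D n F) : Set where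
  open Map M
  field
    r : Fin D
    Ar : A r
    ρr : ρ r ≡ true
    inner : face r ≢ outer
    contractible : Contractible M r

-- A path v → w → c avoiding a and b closes up to a 4-cycle around the quadrilateral Q. One of a and b, called s, is on the
-- cycle, the other one, s̄, is strictly inside; ds and z are the darts of Q starting there.
record Config {D n F : ℕ} (M : Map D n F) (isMap : IsMap M) : Set where
  open MapFacts M isMap
  field
    d₃ : Fin D
    A₃ : A d₃
    ρ₃ : ρ d₃ ≡ true
    inner : face d₃ ≢ outer
  open Face4 M isMap d₃ A₃ ρ₃ inner public
  open Jordan M isMap
  field
    {g₁ g₂} : Fin D
    {ks} : List (Fin D)
    cyc : Cycle M g₁ ks
    Ag₁ : A g₁
    Ag₂ : A g₂
    t₁ : tail g₁ ≡ v
    w : tail g₂ ≡ head g₁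
    hc : head g₂ ≡ c
    on₂ : on cyc g₂ ≡ true
    edges : ∀ {x} → x ∈ˡ g₁ ∷ ks → x ≡ g₁ ⊎ x ≡ g₂ ⊎ face x ≡ Q ⊎ face (α x) ≡ Q
    ds z : Fin D
    Ads : A ds
    Az : A z
    fz : face z ≡ Q
    fds : face ds ≡ Q
    ρds : ρ ds ≡ false
    verts : ∀ {u} → onV cyc u ≡ true → u ≡ v ⊎ u ≡ tail g₂ ⊎ u ≡ c ⊎ u ≡ tail ds
    z-off : onV cyc (tail z) ≡ false
    Q-in : T cyc Q ≡ false
    corner : ∀ {x} → A x → tail x ≡ tail ds → T cyc (face x) ≡ false → x ≡ ds

module Descent {D n F : ℕ} (M : Map D n F) (isMap : IsMap M) where
  open MapFacts M isMap
  open Jordan M isMap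
  open Cycles M isMap

  S : Config M isMap → Fin F → Bool
  S C f = Fc f ∧ not (T (Config.cyc C) f)

  -- Turning on from `d` crosses the cycle to the outside at once. The inside is entered again only
  -- across a cycle dart, and the only one left at this vertex leads back to `d`.
  unique-corner : ∀ {k ks} (cyc : Cycle M k ks) {d} → on cyc d ≡ true → T cyc (face d) ≡ false →
    (∀ {x} → tail x ≡ tail d → on cyc x ≡ true → x ≡ d ⊎ σ x ≡ d) →
    ∀ {x} → A x → tail x ≡ tail d → T cyc (face x) ≡ false → x ≡ d
  unique-corner cyc {d} o h only {x} Ax tx hx with orbit-ind P Ad Ax (sym tx) step (inj₁ refl)
    where
    Ad = on-A cyc o
    P : Fin D → Set
    P y = y ≡ d ⊎ T cyc (face y) ≡ true
    step : ∀ {y} → A y → tail y ≡ tail d → P y → P (σ y)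
    step Ay ty (inj₁ refl) = inj₂ (trans (cong (T cyc) (face-σ Ay)) (on-outside cyc o h))
    step {y} Ay ty (inj₂ e) with bool-cases (on cyc y)
    ... | inj₂ f = inj₂ (trans (cong (T cyc) (face-σ Ay)) (T-closed cyc y (∧-intro Ay (not-intro f)) e))
    ... | inj₁ f with only ty f
    ...   | inj₁ refl = inj₂ (trans (cong (T cyc) (face-σ Ay)) (on-outside cyc o h))
    ...   | inj₂ g = inj₁ g
  ... | inj₁ e = e
  ... | inj₂ e = ⊥-elim (true≢false e hx)

  module Step {d₃ : Fin D} (A₃ : A d₃) (ρ₃ : ρ d₃ ≡ true) (inner : face d₃ ≢ outer) where
    open Face4 M isMap d₃ A₃ ρ₃ inner
    open Bad M isMap d₃ A₃ ρ₃ inner hiding (A₃'; A₄')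

    module _ {g₁ g₂ : Fin D} (Ag₁ : A g₁) (Ag₂ : A g₂) (t₁ : tail g₁ ≡ v) (w : head g₁ ≡ tail g₂) (hc : head g₂ ≡ c)
      (w≢a : head g₁ ≢ a) (w≢b : head g₁ ≢ b) where

      private
        Aα₃ = αA A₃
        Aα₄ = αA A₄
        v≢w : v ≢ tail g₂
        v≢w e = noloop Ag₁ (trans w (trans (sym e) (sym t₁)))
        w≢c : tail g₂ ≢ c
        w≢c e = noloop Ag₂ (trans hc (sym e))
        g₁≢ : ∀ {x} → v ≢ tail x → tail g₁ ≢ tail x
        g₁≢ p e = p (trans (sym t₁) e)
        hα₃ : head (α d₃) ≡ v
        hα₃ = head-α A₃
        hα₄ : head (α d₄) ≡ b
        hα₄ = head-α A₄

      abstract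
        bad₁ : Cycle M g₁ (g₂ ∷ d₁ ∷ d₂ ∷ [])
        bad₁ = cycle₄ Ag₁ Ag₂ A₁ A₂ (sym w) (sym hc) (sym h₁) (trans t₁ (sym h₂))
          (g₁≢ {g₂} v≢w) (g₁≢ {d₁} v≢c) (g₁≢ {d₂} v≢a) w≢c (λ e → w≢a (trans w e)) (≢-sym a≢c)

        bad₂ : Cycle M g₁ (g₂ ∷ α d₄ ∷ α d₃ ∷ [])
        bad₂ = cycle₄ Ag₁ Ag₂ Aα₄ Aα₃ (sym w) (trans h₄ (sym hc)) (trans h₃ (sym hα₄)) (trans t₁ (sym hα₃))
          (g₁≢ {g₂} v≢w) (g₁≢ {α d₄} (λ e → v≢c (trans e h₄))) (g₁≢ {α d₃} (λ e → b≢v (sym (trans e h₃))))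
          (λ e → w≢c (trans e h₄)) (λ e → w≢b (trans w (trans e h₃))) (λ e → c≢b (trans (sym h₄) (trans e h₃)))

      private
        L₁ L₂ : List (Fin D)
        L₁ = g₁ ∷ g₂ ∷ d₁ ∷ d₂ ∷ []
        L₂ = g₁ ∷ g₂ ∷ α d₄ ∷ α d₃ ∷ []

        vs₁ : ∀ {u} → u ∈ˡ List.map tail L₁ → u ≡ v ⊎ u ≡ tail g₂ ⊎ u ≡ c ⊎ u ≡ a
        vs₁ (here x) = inj₁ (trans x t₁)
        vs₁ (there (here x)) = inj₂ (inj₁ x)
        vs₁ (there (there (here x))) = inj₂ (inj₂ (inj₁ x))
        vs₁ (there (there (there (here x)))) = inj₂ (inj₂ (inj₂ x))

        vs₂ : ∀ {u} → u ∈ˡ List.map tail L₂ → u ≡ v ⊎ u ≡ tail g₂ ⊎ u ≡ c ⊎ u ≡ b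
        vs₂ (here x) = inj₁ (trans x t₁)
        vs₂ (there (here x)) = inj₂ (inj₁ x)
        vs₂ (there (there (here x))) = inj₂ (inj₂ (inj₁ (trans x h₄)))
        vs₂ (there (there (there (here x)))) = inj₂ (inj₂ (inj₂ (trans x h₃)))

        only₁ : ∀ {x} → tail x ≡ a → A x → x ∈ˡ L₁ ⊎ α x ∈ˡ L₁ → x ≡ d₂ ⊎ σ x ≡ d₂
        only₁ tx Ax (inj₁ m) = inj₁ (Cycle.tail-inj bad₁ m (there (there (there (here refl)))) tx)
        only₁ tx Ax (inj₂ m) = inj₂ (cong φ (Cycle.head-inj bad₁ m (there (there (here refl))) (trans (head-α Ax) (trans tx (sym h₁)))))

        only₂ : ∀ {x} → tail x ≡ b → A x → x ∈ˡ L₂ ⊎ α x ∈ˡ L₂ → x ≡ d₄ ⊎ σ x ≡ d₄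
        only₂ tx Ax (inj₁ m) = inj₂ (trans (cong σ (Cycle.tail-inj bad₂ m (there (there (there (here refl)))) (trans tx (sym h₃)))) σα₃)
        only₂ {x} tx Ax (inj₂ m) = inj₁ (trans (sym (αα Ax)) (trans (cong α (Cycle.head-inj bad₂ m (there (there (here refl)))
          (trans (head-α Ax) (trans tx (sym hα₄))))) (αα A₄)))

        on-d₄ : on bad₂ d₄ ≡ true
        on-d₄ = ∧-intro A₄ (∨-intro₂ {member L₂ d₄} (member-intro {ys = L₂} (there (there (here refl)))))

        config₁ : T bad₁ Q ≡ false → Config M isMap
        config₁ e = record
          { d₃ = d₃ ; A₃ = A₃ ; ρ₃ = ρ₃ ; inner = inner ; cyc = bad₁ ; Ag₁ = Ag₁ ; Ag₂ = Ag₂ ; t₁ = t₁ ; w = sym w ; hc = hc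
          ; on₂ = on-ks bad₁ (there (here refl))
          ; edges = λ { (here x) → inj₁ x ; (there (here x)) → inj₂ (inj₁ x) ; (there (there (here refl))) → inj₂ (inj₂ (inj₁ f₁))
                      ; (there (there (there (here refl)))) → inj₂ (inj₂ (inj₁ f₂)) }
          ; ds = d₂ ; z = d₄ ; Ads = A₂ ; Az = A₄ ; fz = f₄ ; fds = f₂ ; ρds = ρ₂
          ; verts = λ o → vs₁ (member-elim (List.map tail L₁) o)
          ; z-off = false-intro λ o → case vs₁ (member-elim (List.map tail L₁) o) of λ
              { (inj₁ x) → b≢v x ; (inj₂ (inj₁ x)) → w≢b (trans w (sym x)) ; (inj₂ (inj₂ (inj₁ x))) → c≢b (sym x) ; (inj₂ (inj₂ (inj₂ x))) → a≢b (sym x) }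
          ; Q-in = e
          ; corner = unique-corner bad₁ (on-ks bad₁ (there (there (there (here refl))))) (trans (cong (T bad₁) f₂) e)
              λ {x} tx o → only₁ tx (on-A bad₁ o) (on-cases bad₁ o)
          }

        config₂ : T bad₂ Q ≡ false → Config M isMap
        config₂ e = record
          { d₃ = d₃ ; A₃ = A₃ ; ρ₃ = ρ₃ ; inner = inner ; cyc = bad₂ ; Ag₁ = Ag₁ ; Ag₂ = Ag₂ ; t₁ = t₁ ; w = sym w ; hc = hc
          ; on₂ = on-ks bad₂ (there (here refl))
          ; edges = λ { (here x) → inj₁ x ; (there (here x)) → inj₂ (inj₁ x) ; (there (there (here refl))) → inj₂ (inj₂ (inj₂ (trans (cong face (αα A₄)) f₄)))
                      ; (there (there (there (here refl)))) → inj₂ (inj₂ (inj₂ (cong face (αα A₃)))) }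
          ; ds = d₄ ; z = d₂ ; Ads = A₄ ; Az = A₂ ; fz = f₂ ; fds = f₄ ; ρds = ρ₄
          ; verts = λ o → vs₂ (member-elim (List.map tail L₂) o)
          ; z-off = false-intro λ o → case vs₂ (member-elim (List.map tail L₂) o) of λ
              { (inj₁ x) → v≢a (sym x) ; (inj₂ (inj₁ x)) → w≢a (trans w (sym x)) ; (inj₂ (inj₂ (inj₁ x))) → a≢c x ; (inj₂ (inj₂ (inj₂ x))) → a≢b x }
          ; Q-in = e
          ; corner = unique-corner bad₂ on-d₄ (trans (cong (T bad₂) f₄) e) λ {x} tx o → only₂ tx (on-A bad₂ o) (on-cases bad₂ o)
          }

        via : ∀ {y z x} → x ∈ˡ g₁ ∷ g₂ ∷ y ∷ z ∷ [] → (x ≡ g₁ ⊎ x ≡ g₂) ⊎ x ≡ y ⊎ x ≡ z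
        via (here x) = inj₁ (inj₁ x)
        via (there (here x)) = inj₁ (inj₂ x)
        via (there (there (here x))) = inj₂ (inj₁ x)
        via (there (there (there (here x)))) = inj₂ (inj₂ x)

        via⁻ : ∀ {y z x} → x ≡ g₁ ⊎ x ≡ g₂ → x ∈ˡ g₁ ∷ g₂ ∷ y ∷ z ∷ []
        via⁻ (inj₁ x) = here x
        via⁻ (inj₂ x) = there (here x)

      -- `theta` puts Q inside one of the two 4-cycles. In the cycle through a the enclosed vertex
      -- is b, and conversely.
      config : Σ (Config M isMap) λ C → Config.d₃ C ≡ d₃
      config = by (bool-cases (T bad₁ Q)) (bool-cases (T bad₂ Q))
        where
        by : T bad₁ Q ≡ true ⊎ T bad₁ Q ≡ false → T bad₂ Q ≡ true ⊎ T bad₂ Q ≡ false → Σ (Config M isMap) λ C → Config.d₃ C ≡ d₃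
        by (inj₂ e) _ = config₁ e , refl
        by (inj₁ _) (inj₂ e) = config₂ e , refl
        by (inj₁ e) (inj₁ e') = ⊥-elim (theta bad₁ bad₂ (λ x → x ≡ g₁ ⊎ x ≡ g₂) via via⁻ (there (there (here refl))) (there (there (there (here refl))))
          via via⁻ (there (there (here refl))) (there (there (there (here refl)))) e e')

    bad? : Fin D → Fin D → Bool
    bad? x y = (al x ∧ (al y ∧ ((tail x =ᶠ v) ∧ ((head x =ᶠ tail y) ∧ (head y =ᶠ c))))) ∧ (not (head x =ᶠ a) ∧ not (head x =ᶠ b))

    check : Contractible M d₃ ⊎ Σ (Config M isMap) λ C → Config.d₃ C ≡ d₃
    check with search (λ x → exists (bad? x))
    ... | inj₂ none = inj₁ λ {x} {y} Ax Ay tx m hc → case bool-cases (head x =ᶠ a) of λ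
          { (inj₁ e) → inj₁ (=ᶠ-true (head x) a e)
          ; (inj₂ e) → case bool-cases (head x =ᶠ b) of λ
              { (inj₁ e') → inj₂ (=ᶠ-true (head x) b e')
              ; (inj₂ e') → ⊥-elim (true≢false (exists-intro (bad? x) y (∧-intro (∧-intro Ax (∧-intro Ay (∧-intro (=ᶠ-intro tx)
                   (∧-intro (=ᶠ-intro m) (=ᶠ-intro hc))))) (∧-intro (not-intro e) (not-intro e')))) (none x)) } }
    ... | inj₁ (x , h) with exists-elim (bad? x) h
    ...   | y , e = inj₂ (config (∧-elim₁ {al x} e₁) (∧-elim₁ {al y} e₂) (=ᶠ-true (tail x) v (∧-elim₁ {tail x =ᶠ v} e₃))
              (=ᶠ-true (head x) (tail y) (∧-elim₁ {head x =ᶠ tail y} e₄)) (=ᶠ-true (head y) c (∧-elim₂ {head x =ᶠ tail y} e₄))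
              (λ q → true≢false (=ᶠ-intro q) (not-elim (∧-elim₁ {not (head x =ᶠ a)} e₅)))
              (λ q → true≢false (=ᶠ-intro q) (not-elim (∧-elim₂ {not (head x =ᶠ a)} e₅))))
      where
      e₀ = al x ∧ (al y ∧ ((tail x =ᶠ v) ∧ ((head x =ᶠ tail y) ∧ (head y =ᶠ c))))
      e₁ = ∧-elim₁ {e₀} e
      e₂ = ∧-elim₂ {al x} e₁
      e₃ = ∧-elim₂ {al y} e₂
      e₄ = ∧-elim₂ {tail x =ᶠ v} e₃
      e₅ = ∧-elim₂ {e₀} e

module Down {D n F : ℕ} (M : Map D n F) (isMap : IsMap M) (C C' : Config M isMap)
  (v≡ : Config.v C' ≡ Map.tail M (Config.z C)) (Q'-in : Jordan.T M isMap (Config.cyc C) (Config.Q C') ≡ false) where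
  open MapFacts M isMap
  open Jordan M isMap hiding (T)
  open Descent M isMap using (S)
  open Config C

  module C' = Config C'

  TC TC' : Fin F → Bool
  TC = Jordan.T M isMap cyc
  TC' = Jordan.T M isMap C'.cyc

  at-z : ∀ {x} → A x → tail x ≡ tail z → TC (face x) ≡ false
  at-z Ax t = off-vertex cyc Az Ax (sym t) z-off (trans (cong TC fz) Q-in)

  tg₁ : tail C'.g₁ ≡ tail z
  tg₁ = trans C'.t₁ v≡

  Aα : A (α C'.g₁)
  Aα = αA C'.Ag₁

  in-g₁ : TC (face C'.g₁) ≡ false
  in-g₁ = at-z C'.Ag₁ tg₁

  in-αg₁ : TC (face (α C'.g₁)) ≡ false
  in-αg₁ = trans (cong TC (sym (face-σ C'.Ag₁))) (at-z (σA C'.Ag₁) (trans (tail-σ C'.Ag₁) tg₁))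

  has-side : ∀ {x} → on cyc x ≡ true → TC (face x) ≡ false ⊎ TC (face (α x)) ≡ false
  has-side {x} o with bool-cases (TC (face x))
  ... | inj₁ e = inj₂ (on-inside cyc o e)
  ... | inj₂ e = inj₁ e

  Inside : Fin D → Set
  Inside x = TC (face x) ≡ false ⊎ TC (face (α x)) ≡ false

  Inside-α : ∀ {x} → A x → Inside (α x) → Inside x
  Inside-α Ax (inj₁ e) = inj₂ e
  Inside-α Ax (inj₂ e) = inj₁ (trans (cong (TC ∘ face) (sym (αα Ax))) e)

  -- The middle vertex of the second path is not s, which has a single corner inside.
  w'≢s : tail C'.g₂ ≢ tail ds
  w'≢s e = true≢false (trans (sym (cong ρ (corner Aα t (in-αg₁)))) (lone Aα σ≡)) ρds
    where
    t : tail (α C'.g₁) ≡ tail ds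
    t = trans (sym C'.w) e
    σ≡ : σ (α C'.g₁) ≡ α C'.g₁
    σ≡ = trans (corner (σA Aα) (trans (tail-σ Aα) t) (trans (cong TC (trans (face-σ Aα) (cong face (αα C'.Ag₁)))) in-g₁))
               (sym (corner Aα t in-αg₁))

  -- Q' lies inside the old cycle, where s has only its corner in Q. So Q' would be Q, with the same
  -- reflex vertex, but v is on the old cycle and `tail z` is not.
  c'≢s : C'.c ≢ tail ds
  c'≢s e = true≢false (subst (λ u → onV cyc u ≡ true) (trans t₁ (trans (cong tail (sym r≡)) v≡)) (onV-tail cyc (here refl))) z-off
    where
    d₁≡ : C'.d₁ ≡ ds
    d₁≡ = corner C'.A₁ e (trans (cong TC C'.f₁) Q'-in)
    r≡ : C'.d₃ ≡ d₃
    r≡ = root-Q C'.A₃ (trans (sym C'.f₁) (trans (cong face d₁≡) fds)) C'.ρ₃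

  edge₁ : Inside g₁
  edge₁ = has-side (on-ks cyc (here refl))
  edge₂ : Inside g₂
  edge₂ = has-side on₂

  -- The second edge of the new path is not a chord outside the old cycle.
  side-g₂ : Inside C'.g₂
  side-g₂ with bool-cases (onV cyc (tail C'.g₂)) | bool-cases (onV cyc C'.c)
  ... | inj₂ o | _ = inj₁ (off-vertex cyc Aα C'.Ag₂ (sym C'.w) (trans (cong (onV cyc) (sym C'.w)) o) in-αg₁)
  ... | inj₁ _ | inj₂ o = inj₂ (off-vertex cyc C'.A₁ (αA C'.Ag₂) (sym C'.hc) o (trans (cong TC C'.f₁) Q'-in))
  ... | inj₁ o | inj₁ o' = go (verts o) (verts o')
    where
    hg : head C'.g₂ ≡ C'.c
    hg = C'.hc
    α₂ : ∀ {u} → tail C'.g₂ ≡ u → head (α C'.g₂) ≡ u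
    α₂ = trans (head-α C'.Ag₂)
    same : ∀ {u} → tail C'.g₂ ≡ u → C'.c ≡ u → Inside C'.g₂
    same e e' = ⊥-elim (noloop C'.Ag₂ (trans hg (trans e' (sym e))))
    go : tail C'.g₂ ≡ v ⊎ tail C'.g₂ ≡ tail g₂ ⊎ tail C'.g₂ ≡ c ⊎ tail C'.g₂ ≡ tail ds →
         C'.c ≡ v ⊎ C'.c ≡ tail g₂ ⊎ C'.c ≡ c ⊎ C'.c ≡ tail ds → Inside C'.g₂
    go (inj₂ (inj₂ (inj₂ e))) _ = ⊥-elim (w'≢s e)
    go _ (inj₂ (inj₂ (inj₂ e))) = ⊥-elim (c'≢s e)
    go (inj₁ e) (inj₁ e') = same e e'
    go (inj₂ (inj₁ e)) (inj₂ (inj₁ e')) = same e e'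
    go (inj₂ (inj₂ (inj₁ e))) (inj₂ (inj₂ (inj₁ e'))) = same e e'
    go (inj₁ e) (inj₂ (inj₁ e')) = subst Inside (nomulti Ag₁ C'.Ag₂ (trans t₁ (sym e)) (trans (sym w) (trans (sym e') (sym hg)))) edge₁
    go (inj₂ (inj₁ e)) (inj₁ e') = Inside-α C'.Ag₂ (subst Inside (nomulti Ag₁ (αA C'.Ag₂) (trans t₁ (trans (sym e') (sym hg)))
      (trans (sym w) (sym (α₂ e)))) edge₁)
    go (inj₂ (inj₁ e)) (inj₂ (inj₂ (inj₁ e'))) = subst Inside (nomulti Ag₂ C'.Ag₂ (sym e) (trans hc (trans (sym e') (sym hg)))) edge₂
    go (inj₂ (inj₂ (inj₁ e))) (inj₂ (inj₁ e')) = Inside-α C'.Ag₂ (subst Inside (nomulti Ag₂ (αA C'.Ag₂) (trans (sym e') (sym hg))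
      (trans hc (sym (α₂ e)))) edge₂)
    go (inj₁ e) (inj₂ (inj₂ (inj₁ e'))) = ⊥-elim (Bad.nonadjacent M isMap d₃ A₃ ρ₃ inner C'.Ag₂ e (trans hg e'))
    go (inj₂ (inj₂ (inj₁ e))) (inj₁ e') = ⊥-elim (Bad.nonadjacent M isMap d₃ A₃ ρ₃ inner (αA C'.Ag₂) (trans hg e') (α₂ e))

  side : ∀ {x} → on C'.cyc x ≡ true → Inside x
  side {x} o = [ list , (λ m → Inside-α (on-A C'.cyc o) (list m)) ]′ (on-cases C'.cyc o)
    where
    list : ∀ {y} → y ∈ˡ C'.g₁ ∷ C'.ks → Inside y
    list m with C'.edges m
    ... | inj₁ refl = inj₁ in-g₁
    ... | inj₂ (inj₁ refl) = side-g₂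
    ... | inj₂ (inj₂ (inj₁ e)) = inj₁ (trans (cong TC e) Q'-in)
    ... | inj₂ (inj₂ (inj₂ e)) = inj₂ (trans (cong TC e) Q'-in)

  -- Every edge of the new cycle has a side inside the old one, so moving around in the old exterior
  -- never crosses the new cycle. Minimality of the old exterior concludes.
  T⊆T' : ∀ {f} → Fc f ≡ true → TC f ≡ true → TC' f ≡ true
  T⊆T' {f} Ff Tf with ∨-elim {TC' f} (T-least cyc W (∨-intro₁ (T-outer C'.cyc)) W-closed Ff Tf)
    where
    W : Fin F → Bool
    W g = TC' g ∨ not (TC g)
    W-closed : ∀ d → off cyc d ≡ true → W (face d) ≡ true → W (face (α d)) ≡ true
    W-closed d o h with bool-cases (TC (face (α d)))
    ... | inj₂ e = ∨-intro₂ {TC' (face (α d))} (not-intro e)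
    ... | inj₁ e = ∨-intro₁ (T-closed C'.cyc d (∧-intro Ad (not-intro (false-intro λ i →
            [ true≢false Td , true≢false e ]′ (side i)))) ([ id , (λ x → ⊥-elim (true≢false Td (not-elim x))) ]′ (∨-elim h)))
      where
      Ad = ∧-elim₁ {al d} o
      Td : TC (face d) ≡ true
      Td = trans (cong (TC ∘ face) (sym (αα Ad))) (T-closed cyc (α d) (off-α cyc {d} o) e)
  ... | inj₁ t = t
  ... | inj₂ t = ⊥-elim (true≢false Tf (not-elim t))

  -- The first edge of the new path starts at a vertex strictly inside the old cycle, so both its
  -- faces are inside. As it belongs to the new cycle, one of them is now exterior.
  shrink : # (S C') ℕ.< # (S C)
  shrink = by (bool-cases (TC' (face C'.g₁)))
    where
    less : ∀ f → Fc f ≡ true → TC f ≡ false → TC' f ≡ true → # (S C') ℕ.< # (S C)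
    less f Ff p q = subst (# (S C') ℕ.<_) (sym (#-remove (S C) f (∧-intro Ff (not-intro p)))) (s≤s (#-mono {p = S C'} {S C ∖ f} λ g h →
      ∖-intro {p = S C} (∧-intro (∧-elim₁ {Fc g} h) (not-intro (false-intro λ t →
          true≢false (T⊆T' (∧-elim₁ {Fc g} h) t) (not-elim (∧-elim₂ {Fc g} h)))))
        λ { refl → true≢false q (not-elim (∧-elim₂ {Fc g} h)) }))
    by : TC' (face C'.g₁) ≡ true ⊎ TC' (face C'.g₁) ≡ false → # (S C') ℕ.< # (S C)
    by (inj₁ e) = less (face C'.g₁) (face-Fc C'.Ag₁) in-g₁ e
    by (inj₂ e) = less (face (α C'.g₁)) (face-Fc Aα) in-αg₁ (on-outside C'.cyc (on-ks C'.cyc (here refl)) e)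

module _ {D n F : ℕ} (M : Map D n F) (isMap : IsMap M) where
  open MapFacts M isMap
  open Jordan M isMap
  open Descent M isMap

  private
    -- The enclosed vertex `tail z` has all its corners inside the cycle. Its reflex corner is
    -- therefore in an interior face, which is the next quadrilateral to try.
    descend : ∀ m (C : Config M isMap) → # (S C) ≤ℕ m → Reducible M
    descend m C le = go (root Az)
      where
      open Config C
      go : (∃ λ r → A r × tail r ≡ tail z × ρ r ≡ true) → Reducible M
      go (r , Ar , tr , ρr) = by m le (Step.check Ar ρr nout)
        where
        r-in : T cyc (face r) ≡ false
        r-in = off-vertex cyc Az Ar (sym tr) z-off (trans (cong (T cyc) fz) Q-in)
        nout : face r ≢ outer
        nout e = true≢false (trans (cong (T cyc) e) (T-outer cyc)) r-in
        by : ∀ m → # (S C) ≤ℕ m → Contractible M r ⊎ (Σ (Config M isMap) λ C' → Config.d₃ C' ≡ r) → Reducible M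
        by m le (inj₁ k) = record { r = r ; Ar = Ar ; ρr = ρr ; inner = nout ; contractible = k }
        by zero le (inj₂ (C' , e)) = ⊥-elim (case ℕP.≤-trans (shr C' e) le of λ ())
          where
          shr : ∀ C' → Config.d₃ C' ≡ r → # (S C') ℕ.< # (S C)
          shr C' e = Down.shrink M isMap C C' (trans (cong tail e) tr) (trans (cong (T cyc ∘ face) e) r-in)
        by (suc m) le (inj₂ (C' , e)) = descend m C' (ℕP.≤-pred (ℕP.≤-trans
          (Down.shrink M isMap C C' (trans (cong tail e) tr) (trans (cong (T cyc ∘ face) e) r-in)) le))

  reducible : ∀ {r} → A r → ρ r ≡ true → face r ≢ outer → Reducible M
  reducible {r} Ar ρr inner with Step.check Ar ρr inner
  ... | inj₁ k = record { r = r ; Ar = Ar ; ρr = ρr ; inner = inner ; contractible = k }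
  ... | inj₂ (C , _) = descend _ C ℕP.≤-refl

-- Contraction of a quadrilateral

-- Contracting the quadrilateral Q: its darts disappear, the outer sides of its edges are glued in pairs (a v with a c, b v with
-- b c) and v is renamed c. Faces, their corners and the face walks do not change.
module Contract {D n F : ℕ} (M : Map D n F) (isMap : IsMap M) (red : Reducible M) where
  open MapFacts M isMap public
  open Reducible red public renaming (r to d₃; Ar to A₃; ρr to ρ₃)
  open Face4 M isMap d₃ A₃ ρ₃ inner public

  nonadjacent : ∀ {g} → A g → tail g ≡ v → head g ≡ c → ⊥
  nonadjacent = Bad.nonadjacent M isMap d₃ A₃ ρ₃ inner

  abstract
    π : Fin D → Fin D
    -- The last branch is meant for `d₄`; on darts outside Q its value is junk, since `π` is applied
    -- to darts of Q only.
    π x = if x =ᶠ d₁ then d₂ else if x =ᶠ d₂ then d₁ else if x =ᶠ d₃ then d₄ else d₃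

    π₁ : π d₁ ≡ d₂
    π₁ rewrite =ᶠ-refl d₁ = refl
    π₂ : π d₂ ≡ d₁
    π₂ rewrite =ᶠ-false {a = d₂} {d₁} (λ e → a≢c (cong tail e)) | =ᶠ-refl d₂ = refl
    π₃ : π d₃ ≡ d₄
    π₃ rewrite =ᶠ-false {a = d₃} {d₁} (λ e → v≢c (cong tail e)) | =ᶠ-false {a = d₃} {d₂} (λ e → v≢a (cong tail e)) | =ᶠ-refl d₃ = refl
    π₄ : π d₄ ≡ d₃
    π₄ rewrite =ᶠ-false {a = d₄} {d₁} (λ e → c≢b (cong tail (sym e))) | =ᶠ-false {a = d₄} {d₂} (λ e → a≢b (cong tail (sym e)))
      | =ᶠ-false {a = d₄} {d₃} (λ e → b≢v (cong tail e)) = refl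

  abstract
    rn : Fin n → Fin n
    rn u = if u =ᶠ v then c else u

    rn-v : rn v ≡ c
    rn-v rewrite =ᶠ-refl v = refl
    rn-≢ : ∀ {u} → u ≢ v → rn u ≡ u
    rn-≢ h rewrite =ᶠ-false h = refl
  rn-c : rn c ≡ c
  rn-c = rn-≢ (≢-sym v≢c)

  abstract
    rn-inv : ∀ {p q} → rn p ≡ rn q → p ≡ q ⊎ (p ≡ v × q ≡ c) ⊎ (p ≡ c × q ≡ v)
    rn-inv {p} {q} e with p ≟ v | q ≟ v
    ... | yes refl | yes refl = inj₁ refl
    ... | yes refl | no _ = inj₂ (inj₁ (refl , sym e))
    ... | no _ | yes refl = inj₂ (inj₂ (e , refl))
    ... | no _ | no _ = inj₁ e

  abstract
    glue : Fin D → Fin D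
    glue x = if face (α x) =ᶠ Q then α (π (α x)) else α x

    -- Sends every old dart to a surviving dart that represents it: a dart of Q is replaced by the
    -- outer side of the edge to which its own edge is glued. Facts about the old rotations are
    -- transported along this map.
    ι : Fin D → Fin D
    ι x = if face x =ᶠ Q then α (π x) else x

    α'-Q : ∀ {x} → face (α x) ≡ Q → glue x ≡ α (π (α x))
    α'-Q e rewrite =ᶠ-intro e = refl

    α'-≢ : ∀ {x} → face (α x) ≢ Q → glue x ≡ α x
    α'-≢ e rewrite =ᶠ-false e = refl

    ι-Q : ∀ {x} → face x ≡ Q → ι x ≡ α (π x)
    ι-Q e rewrite =ᶠ-intro e = refl

    ι-≢ : ∀ {x} → face x ≢ Q → ι x ≡ x
    ι-≢ e rewrite =ᶠ-false e = refl

  M' : Map D n F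
  M' = record
    { al = λ x → al x ∧ not (face x =ᶠ Q)
    ; V = V ∖ v ; Fc = Fc ∖ Q
    ; α = glue
    ; φ = φ ; tail = λ x → rn (tail x) ; face = face ; ρ = ρ ; quad = quad ; outer = outer }

  module ′ = Map M'

  A' : ∀ {x} → ′.A x → A x
  A' = ∧-elim₁

  A'-Q : ∀ {x} → ′.A x → face x ≢ Q
  A'-Q {x} h e = true≢false (=ᶠ-intro e) (not-elim (∧-elim₂ {al x} h))

  mkA' : ∀ {x} → A x → face x ≢ Q → ′.A x
  mkA' Ax h = ∧-intro Ax (not-intro (=ᶠ-false h))

  record PairedQ (y : Fin D) : Set where
    field
      Aπ : A (π y)
      fπ : face (π y) ≡ Q
      ππ : π (π y) ≡ y
      tπ : rn (head (π y)) ≡ rn (tail y)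
      hπ : rn (tail (π y)) ≡ rn (head y)

  paired : ∀ {y} → A y → face y ≡ Q → PairedQ y
  paired Ay fy with in-Q Ay fy
  ... | inj₁ refl = record { Aπ = subst A (sym π₁) A₂ ; fπ = trans (cong face π₁) f₂ ; ππ = trans (cong π π₁) π₂
        ; tπ = trans (cong (rn ∘ head) π₁) (trans (cong rn h₂) (trans rn-v (sym rn-c))) ; hπ = cong rn (trans (cong tail π₁) (sym h₁)) }
  ... | inj₂ (inj₁ refl) = record { Aπ = subst A (sym π₂) A₁ ; fπ = trans (cong face π₂) f₁ ; ππ = trans (cong π π₂) π₁
        ; tπ = cong rn (trans (cong head π₂) h₁) ; hπ = trans (cong (rn ∘ tail) π₂) (trans rn-c (sym (trans (cong rn h₂) rn-v))) }
  ... | inj₂ (inj₂ (inj₁ refl)) = record { Aπ = subst A (sym π₃) A₄ ; fπ = trans (cong face π₃) f₄ ; ππ = trans (cong π π₃) π₄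
        ; tπ = trans (cong (rn ∘ head) π₃) (trans (cong rn h₄) (trans rn-c (sym rn-v))) ; hπ = cong rn (trans (cong tail π₃) (sym h₃)) }
  ... | inj₂ (inj₂ (inj₂ refl)) = record { Aπ = subst A (sym π₄) A₃ ; fπ = cong face π₄ ; ππ = trans (cong π π₄) π₃
        ; tπ = cong rn (trans (cong head π₄) h₃) ; hπ = trans (cong (rn ∘ tail) π₄) (trans rn-v (sym (trans (cong rn h₄) rn-c))) }

  ι-A' : ∀ {x} → A x → ′.A (ι x)
  ι-A' {x} Ax with eq? (face x) Q
  ... | inj₂ h = subst ′.A (sym (ι-≢ h)) (mkA' Ax h)
  ... | inj₁ h = subst ′.A (sym (ι-Q h)) (mkA' (αA Aπ) (αQ Aπ fπ))
    where open PairedQ (paired Ax h)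

  tail-ι : ∀ {x} → A x → ′.tail (ι x) ≡ rn (tail x)
  tail-ι {x} Ax with eq? (face x) Q
  ... | inj₂ h = cong (rn ∘ tail) (ι-≢ h)
  ... | inj₁ h = trans (cong (rn ∘ tail) (ι-Q h)) (PairedQ.tπ (paired Ax h))

  head' : ∀ {x} → A x → ′.head x ≡ rn (head x)
  head' {x} Ax with eq? (face (α x)) Q
  ... | inj₂ h = cong (rn ∘ tail) (α'-≢ h)
  ... | inj₁ h = trans (cong (rn ∘ tail) (α'-Q h)) (PairedQ.tπ (paired (αA Ax) h))

  head-ι : ∀ {x} → A x → ′.head (ι x) ≡ rn (head x)
  head-ι {x} Ax with eq? (face x) Q
  ... | inj₂ h = trans (cong ′.head (ι-≢ h)) (head' Ax)
  ... | inj₁ h = trans (cong ′.head (ι-Q h)) (trans (head' (αA Aπ)) (trans (cong rn (head-α Aπ)) hπ))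
    where open PairedQ (paired Ax h)

  ι₁ : ι d₁ ≡ α d₂
  ι₁ = trans (ι-Q f₁) (cong α π₁)
  ι₂ : ι d₂ ≡ α d₁
  ι₂ = trans (ι-Q f₂) (cong α π₂)
  ι₃ : ι d₃ ≡ α d₄
  ι₃ = trans (ι-Q refl) (cong α π₃)
  ι₄ : ι d₄ ≡ α d₃
  ι₄ = trans (ι-Q f₄) (cong α π₄)

  ια : ∀ {x} → A x → face x ≡ Q → ι (α x) ≡ α x
  ια Ax f = ι-≢ (αQ Ax f)

  -- How one step of the old rotation appears after gluing. Around a and b two consecutive darts
  -- become one (`stays₁`, `stays₃`). At v and c the rotation jumps where Q was, and there the two
  -- rotations are spliced (`wraps₂`, `wraps₄`).
  data ι-Step (z : Fin D) : Set where
    moves : ′.σ (ι z) ≡ ι (σ z) → ι (σ z) ≡ σ z → ι-Step z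
    stays₁ : z ≡ α d₁ → ι-Step z
    stays₃ : z ≡ α d₃ → ι-Step z
    wraps₂ : z ≡ α d₂ → ι-Step z
    wraps₄ : z ≡ α d₄ → ι-Step z

  ι-step : ∀ {z} → A z → ι-Step z
  ι-step {z} Az with eq? (face (α z)) Q
  ... | inj₁ h with in-Q (αA Az) h
  ...   | inj₁ e = stays₁ (trans (sym (αα Az)) (cong α e))
  ...   | inj₂ (inj₁ e) = wraps₂ (trans (sym (αα Az)) (cong α e))
  ...   | inj₂ (inj₂ (inj₁ e)) = stays₃ (trans (sym (αα Az)) (cong α e))
  ...   | inj₂ (inj₂ (inj₂ e)) = wraps₄ (trans (sym (αα Az)) (cong α e))
  ι-step {z} Az | inj₂ h with eq? (face z) Q | ι-≢ {σ z} (λ e → h (trans (sym (face-σ Az)) e))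
  ...   | inj₂ k | e = moves (trans (cong ′.σ (ι-≢ k)) (trans (cong φ (α'-≢ h)) (sym e))) e
  ...   | inj₁ k | e = moves (trans (cong ′.σ (ι-Q k)) (trans (cong φ (trans (α'-Q (trans (cong face (αα Aπ)) fπ))
            (cong α (trans (cong π (αα Aπ)) ππ)))) (sym e))) e
    where open PairedQ (paired Az k)

  ι-stay₁ : ι (σ (α d₁)) ≡ ι (α d₁)
  ι-stay₁ = trans (cong ι σα₁) (trans ι₂ (sym (ια A₁ f₁)))
  ι-stay₃ : ι (σ (α d₃)) ≡ ι (α d₃)
  ι-stay₃ = trans (cong ι σα₃) (trans ι₄ (sym (ια A₃ refl)))
  ι-wrap₂ : ι (σ (α d₂)) ≡ ι (α d₄)
  ι-wrap₂ = trans (cong ι σα₂) (trans ι₃ (sym (ια A₄ f₄)))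
  ι-wrap₄ : ι (σ (α d₄)) ≡ ι (α d₂)
  ι-wrap₄ = trans (cong ι σα₄) (trans ι₁ (sym (ια A₂ f₂)))

  module _ {x : Fin D} where
    private
      P : Fin D → Set
      P z = Star ′.σ x (ι z)

      step : ∀ {z} → A z → P z → z ≡ α d₂ ⊎ z ≡ α d₄ ⊎ P (σ z)
      step Az pz with ι-step Az
      ... | moves e _ = inj₂ (inj₂ (subst (Star ′.σ x) e (next pz)))
      ... | stays₁ refl = inj₂ (inj₂ (subst (Star ′.σ x) (sym ι-stay₁) pz))
      ... | stays₃ refl = inj₂ (inj₂ (subst (Star ′.σ x) (sym ι-stay₃) pz))
      ... | wraps₂ e = inj₁ e
      ... | wraps₄ e = inj₂ (inj₁ e)

      elsewhere : ∀ {z y} → A z → A y → tail z ≡ tail y → tail z ≢ v → tail z ≢ c → P z → P y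
      elsewhere {z} Az Ay t nv nc = orbit-ind P Az Ay t λ {w} Aw tw pw → case step Aw pw of λ
        { (inj₁ refl) → ⊥-elim (nv (trans (sym tw) h₂)) ; (inj₂ (inj₁ refl)) → ⊥-elim (nc (trans (sym tw) h₄)) ; (inj₂ (inj₂ p)) → p }

      to-α₂ : ∀ {z} → A z → tail z ≡ v → P z → P (α d₂)
      to-α₂ Az tz pz = [ id , id ]′ (orbit-ind (λ w → P w ⊎ P (α d₂)) Az (αA A₂) (trans tz (sym h₂))
        (λ { Aw tw (inj₂ q) → inj₂ q
           ; Aw tw (inj₁ p) → case step Aw p of λ
               { (inj₁ refl) → inj₂ p ; (inj₂ (inj₁ refl)) → ⊥-elim (v≢c (trans (sym tz) (trans (sym tw) h₄))) ; (inj₂ (inj₂ q)) → inj₁ q } })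
        (inj₁ pz))

      to-α₄ : ∀ {z} → A z → tail z ≡ c → P z → P (α d₄)
      to-α₄ Az tz pz = [ id , id ]′ (orbit-ind (λ w → P w ⊎ P (α d₄)) Az (αA A₄) (trans tz (sym h₄))
        (λ { Aw tw (inj₂ q) → inj₂ q
           ; Aw tw (inj₁ p) → case step Aw p of λ
               { (inj₁ refl) → ⊥-elim (v≢c (trans (sym h₂) (trans tw tz))) ; (inj₂ (inj₁ refl)) → inj₂ p ; (inj₂ (inj₂ q)) → inj₁ q } })
        (inj₁ pz))

      all-v : P (α d₄) → ∀ {y} → A y → tail y ≡ v → P y
      all-v p Ay ty = orbit-ind P A₃ Ay (sym ty) (λ Aw tw pw → case step Aw pw of λ
          { (inj₁ refl) → subst (Star ′.σ x) (sym ι-wrap₂) p ; (inj₂ (inj₁ refl)) → ⊥-elim (v≢c (trans (sym tw) h₄)) ; (inj₂ (inj₂ q)) → q })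
        (subst (Star ′.σ x) (trans (ια A₄ f₄) (sym ι₃)) p)

      all-c : P (α d₂) → ∀ {y} → A y → tail y ≡ c → P y
      all-c p Ay ty = orbit-ind P A₁ Ay (sym ty) (λ Aw tw pw → case step Aw pw of λ
          { (inj₁ refl) → ⊥-elim (v≢c (trans (sym h₂) tw)) ; (inj₂ (inj₁ refl)) → subst (Star ′.σ x) (sym ι-wrap₄) p ; (inj₂ (inj₂ q)) → q })
        (subst (Star ′.σ x) (trans (ια A₂ f₂) (sym ι₁)) p)

      vc : ∀ {z} → A z → P z → tail z ≡ v ⊎ tail z ≡ c → P (α d₂) × P (α d₄)
      vc Az pz (inj₁ e) = let p = to-α₂ Az e pz in p , all-c p (αA A₄) h₄
      vc Az pz (inj₂ e) = let p = to-α₄ Az e pz in all-v p (αA A₂) h₂ , p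

      reach : ∀ {z y} → A z → A y → P z → rn (tail z) ≡ rn (tail y) → P y
      reach {z} {y} Az Ay pz t with rn-inv {tail z} {tail y} t | eq? (tail z) v | eq? (tail z) c
      ... | inj₁ e | inj₁ h | _ = all-v (proj₂ (vc Az pz (inj₁ h))) Ay (trans (sym e) h)
      ... | inj₁ e | inj₂ _ | inj₁ h = all-c (proj₁ (vc Az pz (inj₂ h))) Ay (trans (sym e) h)
      ... | inj₁ e | inj₂ nv | inj₂ nc = elsewhere Az Ay e nv nc pz
      ... | inj₂ (inj₁ (e , e')) | _ | _ = all-c (proj₁ (vc Az pz (inj₁ e))) Ay e'
      ... | inj₂ (inj₂ (e , e')) | _ | _ = all-v (proj₂ (vc Az pz (inj₂ e))) Ay e'

    -- Turning around v reaches `α d₂`, which also represents `d₁` at c; turning around c reaches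
    -- `α d₄`, which also represents `d₃` at v. So either rotation leads on into the other.
    orbit' : ∀ {y} → ′.A x → ′.A y → ′.tail x ≡ ′.tail y → Star ′.σ x y
    orbit' {y} Ax Ay t = subst (Star ′.σ x) (ι-≢ (A'-Q Ay)) (reach (A' Ax) (A' Ay) (subst (Star ′.σ x) (sym (ι-≢ (A'-Q Ax))) stop) t)

  noloop' : ∀ {x} → ′.A x → ′.head x ≢ ′.tail x
  noloop' {x} Ax e with rn-inv {head x} {tail x} (trans (sym (head' (A' Ax))) e)
  ... | inj₁ h = noloop (A' Ax) h
  ... | inj₂ (inj₁ (h , t)) = nonadjacent (αA (A' Ax)) h (trans (head-α (A' Ax)) t)
  ... | inj₂ (inj₂ (h , t)) = nonadjacent (A' Ax) t h

  no-vc : ∀ {x} → A x → tail x ≡ v ⊎ tail x ≡ c → head x ≡ v ⊎ head x ≡ c → ⊥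
  no-vc Ax (inj₁ t) (inj₁ h) = noloop Ax (trans h (sym t))
  no-vc Ax (inj₁ t) (inj₂ h) = nonadjacent Ax t h
  no-vc Ax (inj₂ t) (inj₁ h) = nonadjacent (αA Ax) h (trans (head-α Ax) t)
  no-vc Ax (inj₂ t) (inj₂ h) = noloop Ax (trans h (sym t))

  -- By `contractible` the common neighbour is a or b. The edge c a was present only as `d₁` among
  -- darts from c, and the edge v b only as `d₃` among darts from v; both have been removed.
  tails-vc : ∀ {x y} → ′.A x → ′.A y → tail x ≡ v → tail y ≡ c → head x ≡ head y → ⊥
  tails-vc Ax Ay tx ty h with contractible (A' Ax) (αA (A' Ay)) tx h (trans (head-α (A' Ay)) ty)
  ... | inj₁ e = A'-Q Ay (trans (cong face (nomulti (A' Ay) A₁ ty (trans (sym h) (trans e (sym h₁))))) f₁)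
  ... | inj₂ e = A'-Q Ax (cong face (nomulti (A' Ax) A₃ tx (trans e (sym h₃))))

  heads-vc : ∀ {x y} → ′.A x → ′.A y → head x ≡ v → head y ≡ c → tail x ≡ tail y → ⊥
  heads-vc Ax Ay hx hy t with contractible (αA (A' Ax)) (A' Ay) hx (trans (head-α (A' Ax)) t) hy
  ... | inj₁ e = A'-Q Ax (trans (cong face (nomulti (A' Ax) A₂ (trans (sym (head-α (A' Ax))) e) (trans hx (sym h₂)))) f₂)
  ... | inj₂ e = A'-Q Ay (trans (cong face (nomulti (A' Ay) A₄ (trans (sym t) (trans (sym (head-α (A' Ax))) e)) (trans hy (sym h₄)))) f₄)

  nomulti' : ∀ {x y} → ′.A x → ′.A y → ′.tail x ≡ ′.tail y → ′.head x ≡ ′.head y → x ≡ y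
  nomulti' {x} {y} Ax Ay t h with rn-inv {tail x} {tail y} t | rn-inv {head x} {head y} (trans (sym (head' (A' Ax))) (trans h (head' (A' Ay))))
  ... | inj₁ p | inj₁ q = nomulti (A' Ax) (A' Ay) p q
  ... | inj₁ p | inj₂ (inj₁ (q , q')) = ⊥-elim (heads-vc Ax Ay q q' p)
  ... | inj₁ p | inj₂ (inj₂ (q , q')) = ⊥-elim (heads-vc Ay Ax q' q (sym p))
  ... | inj₂ (inj₁ (p , p')) | inj₁ q = ⊥-elim (tails-vc Ax Ay p p' q)
  ... | inj₂ (inj₂ (p , p')) | inj₁ q = ⊥-elim (tails-vc Ay Ax p' p (sym q))
  ... | inj₂ (inj₁ (p , _)) | inj₂ (inj₁ (q , _)) = ⊥-elim (no-vc (A' Ax) (inj₁ p) (inj₁ q))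
  ... | inj₂ (inj₁ (p , _)) | inj₂ (inj₂ (q , _)) = ⊥-elim (no-vc (A' Ax) (inj₁ p) (inj₂ q))
  ... | inj₂ (inj₂ (p , _)) | inj₂ (inj₁ (q , _)) = ⊥-elim (no-vc (A' Ax) (inj₂ p) (inj₁ q))
  ... | inj₂ (inj₂ (p , _)) | inj₂ (inj₂ (q , _)) = ⊥-elim (no-vc (A' Ax) (inj₂ p) (inj₂ q))

  #V : # V ≡ suc (# ′.V)
  #V = #-remove V v (tail-V A₃)
  #Fc : # Fc ≡ suc (# ′.Fc)
  #Fc = #-remove Fc Q (face-Fc A₃)
  #al : # al ≡ # ′.al +ℕ 4
  #al = trans (#-remove al d₁ A₁) (trans (cong suc (trans (#-remove (al ∖ d₁) d₂ a₂) (cong suc (trans (#-remove (al ∖ d₁ ∖ d₂) d₃ a₃)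
      (cong suc (#-remove (al ∖ d₁ ∖ d₂ ∖ d₃) d₄ a₄)))))) (trans (cong (λ z → suc (suc (suc (suc z)))) (#-cong {p = al ∖ d₁ ∖ d₂ ∖ d₃ ∖ d₄} {′.al} same)) (ℕP.+-comm 4 _)))
    where
    a₂ : (al ∖ d₁) d₂ ≡ true
    a₂ = ∖-intro {p = al} A₂ (λ e → a≢c (cong tail e))
    a₃ : (al ∖ d₁ ∖ d₂) d₃ ≡ true
    a₃ = ∖-intro {p = al ∖ d₁} (∖-intro {p = al} A₃ (λ e → v≢c (cong tail e))) (λ e → v≢a (cong tail e))
    a₄ : (al ∖ d₁ ∖ d₂ ∖ d₃) d₄ ≡ true
    a₄ = ∖-intro {p = al ∖ d₁ ∖ d₂} (∖-intro {p = al ∖ d₁} (∖-intro {p = al} A₄ (λ e → c≢b (cong tail (sym e)))) (λ e → a≢b (cong tail (sym e)))) (λ e → b≢v (cong tail e))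
    same : ∀ x → (al ∖ d₁ ∖ d₂ ∖ d₃ ∖ d₄) x ≡ ′.al x
    same x = bool-ext
      (λ h → let (h₄ , n₄) = ∖-elim {p = al ∖ d₁ ∖ d₂ ∖ d₃} h ; (h₃ , n₃) = ∖-elim {p = al ∖ d₁ ∖ d₂} h₄ ; (h₂ , n₂) = ∖-elim {p = al ∖ d₁} h₃
                 (h₁ , n₁) = ∖-elim {p = al} h₂ in mkA' h₁ λ f → case in-Q h₁ f of λ
                   { (inj₁ e) → n₁ e ; (inj₂ (inj₁ e)) → n₂ e ; (inj₂ (inj₂ (inj₁ e))) → n₃ e ; (inj₂ (inj₂ (inj₂ e))) → n₄ e })
      (λ h → ∖-intro {p = al ∖ d₁ ∖ d₂ ∖ d₃} (∖-intro {p = al ∖ d₁ ∖ d₂} (∖-intro {p = al ∖ d₁} (∖-intro {p = al} (A' h)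
        (λ { refl → A'-Q h f₁ })) (λ { refl → A'-Q h f₂ })) (λ { refl → A'-Q h refl })) (λ { refl → A'-Q h f₄ }))

  V'-elim : ∀ {u} → ′.V u ≡ true → V u ≡ true × u ≢ v
  V'-elim = ∖-elim {p = V}

  isMap' : IsMap M'
  isMap' = record
    { αA = λ {x} h → αA' h
    ; φA = λ h → mkA' (φA (A' h)) (λ e → A'-Q h (trans (sym (face-φ (A' h))) e))
    ; αα = λ {x} h → αα' h
    ; tail-φ = λ {x} h → trans (cong rn (tail-φ (A' h))) (sym (head' (A' h)))
    ; face-φ = λ h → face-φ (A' h)
    ; orbit = orbit'
    ; tail-V = λ {x} h → tail-V' h
    ; face-Fc = λ {x} h → ∖-intro {p = Fc} (face-Fc (A' h)) (A'-Q h)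
    ; V-tail = λ {u} h → let (Vu , nu) = V'-elim h ; (d , Ad , td) = V-tail Vu in
        ι d , ι-A' Ad , trans (tail-ι Ad) (trans (cong rn td) (rn-≢ nu))
    ; Fc-face = λ {f} h → let (Ff , nf) = ∖-elim {p = Fc} h ; (d , Ad , fd) = Fc-face Ff in d , mkA' Ad (λ e → nf (trans (sym fd) e)) , fd
    ; outer-Fc = ∖-intro {p = Fc} outer-Fc (≢-sym inner)
    ; tri = λ h → tri (A' h)
    ; quad-φ = λ h → quad-φ (A' h)
    ; quad-root = λ h o q → let (r , Ar , fr , ρr) = quad-root (A' h) o q in r , mkA' Ar (λ e → A'-Q h (trans (sym fr) e)) , fr , ρr
    ; face-root = λ h k → face-root (A' h) (A' k)
    ; face-orbit = λ h k → face-orbit (A' h) (A' k)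
    ; outer-ρ = λ h → outer-ρ (A' h)
    ; outer-return = λ h → outer-return (A' h)
    ; root-unique = λ {x} {y} h k t → root-unique' h k t
    ; root = λ {x} h → root' h
    ; noloop = noloop'
    ; nomulti = nomulti'
    ; conn = λ W cl {u} {w} Vu Vw Wu → subst (λ z → W z ≡ true) (rn-≢ (proj₂ (V'-elim Vw)))
        (conn (W ∘ rn) (λ Ad h → subst (λ z → W z ≡ true) (head-ι Ad) (cl (ι-A' Ad) (subst (λ z → W z ≡ true) (sym (tail-ι Ad)) h)))
          (proj₁ (V'-elim Vu)) (proj₁ (V'-elim Vw)) (subst (λ z → W z ≡ true) (sym (rn-≢ (proj₂ (V'-elim Vu)))) Wu))
    ; euler = ℕP.+-cancelʳ-≡ 4 _ _ (trans (arith (# ′.V) (# ′.Fc)) (trans (cong (2 *ℕ_) (sym (cong₂ _+ℕ_ #V #Fc)))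
        (trans euler (trans (cong (_+ℕ 4) #al) refl))))
    }
    where
    arith : ∀ a b → 2 *ℕ (a +ℕ b) +ℕ 4 ≡ 2 *ℕ (suc a +ℕ suc b)
    arith = solve-∀
    αA' : ∀ {x} → ′.A x → ′.A (′.α x)
    αA' {x} h with eq? (face (α x)) Q
    ... | inj₂ k = subst ′.A (sym (α'-≢ k)) (mkA' (αA (A' h)) k)
    ... | inj₁ k = subst ′.A (sym (α'-Q k)) (mkA' (αA Aπ) (αQ Aπ fπ))
      where open PairedQ (paired (αA (A' h)) k)
    αα' : ∀ {x} → ′.A x → ′.α (′.α x) ≡ x
    αα' {x} h with eq? (face (α x)) Q
    ... | inj₂ k = trans (cong ′.α (α'-≢ k)) (trans (α'-≢ (λ e → A'-Q h (trans (cong face (sym (αα (A' h)))) e))) (αα (A' h)))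
    ... | inj₁ k = trans (cong ′.α (α'-Q k)) (trans (α'-Q (trans (cong face (αα Aπ)) fπ))
            (trans (cong α (trans (cong π (αα Aπ)) ππ)) (αα (A' h))))
      where open PairedQ (paired (αA (A' h)) k)
    tail-V' : ∀ {x} → ′.A x → ′.V (rn (tail x)) ≡ true
    tail-V' {x} h with eq? (tail x) v
    ... | inj₁ e = subst (λ u → ′.V u ≡ true) (sym (trans (cong rn e) rn-v)) (∖-intro {p = V} (tail-V A₁) (≢-sym v≢c))
    ... | inj₂ e = subst (λ u → ′.V u ≡ true) (sym (rn-≢ e)) (∖-intro {p = V} (tail-V (A' h)) e)
    -- The reflex corner of v is the one in Q, which disappears. The merged vertex keeps exactly the
    -- reflex corner of c.
    root-unique' : ∀ {x y} → ′.A x → ′.A y → rn (tail x) ≡ rn (tail y) → ρ x ≡ true → ρ y ≡ true → x ≡ y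
    root-unique' {x} {y} h k t ρx ρy with rn-inv {tail x} {tail y} t
    ... | inj₁ e = root-unique (A' h) (A' k) e ρx ρy
    ... | inj₂ (inj₁ (e , _)) = ⊥-elim (A'-Q h (cong face (root-unique (A' h) A₃ e ρx ρ₃)))
    ... | inj₂ (inj₂ (_ , e)) = ⊥-elim (A'-Q k (cong face (root-unique (A' k) A₃ e ρy ρ₃)))
    alive-root : ∀ {x} → A x → tail x ≢ v → ∃ λ r → ′.A r × rn (tail r) ≡ rn (tail x) × ρ r ≡ true
    alive-root Ax n with root Ax
    ... | r , Ar , tr , ρr = r , mkA' Ar (λ e → n (trans (sym tr) (cong tail (root-Q Ar e ρr)))) , cong rn tr , ρr
    root' : ∀ {x} → ′.A x → ∃ λ r → ′.A r × rn (tail r) ≡ rn (tail x) × ρ r ≡ true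
    root' {x} h with eq? (tail x) v
    ... | inj₂ n = case alive-root (A' h) n of λ { (r , Ar , tr , ρr) → r , Ar , tr , ρr }
    ... | inj₁ e = case alive-root A₁ (≢-sym v≢c) of λ { (r , Ar , tr , ρr) → r , Ar , trans tr (trans rn-c (sym (trans (cong rn e) rn-v))) , ρr }

-- The linear order of the darts at a vertex

-- The darts at a vertex, listed counterclockwise from its reflex corner on: e comes before f.
data Before {D n F : ℕ} (M : Map D n F) (e : Fin D) : Fin D → Set where
  base : Map.A M e → Map.ρ M (Map.σ M e) ≡ false → Before M e (Map.σ M e)
  more : ∀ {f} → Before M e f → Map.ρ M (Map.σ M f) ≡ false → Before M e (Map.σ M f)

module Order {D n F : ℕ} (M : Map D n F) (isMap : IsMap M) where
  open MapFacts M isMap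

  A-left : ∀ {e f} → Before M e f → A e
  A-left (base Ae _) = Ae
  A-left (more b _) = A-left b

  A-right : ∀ {e f} → Before M e f → A f
  A-right (base Ae _) = σA Ae
  A-right (more b _) = σA (A-right b)

  same-tail : ∀ {e f} → Before M e f → tail e ≡ tail f
  same-tail (base Ae _) = sym (tail-σ Ae)
  same-tail (more b _) = trans (same-tail b) (sym (tail-σ (A-right b)))

  not-root : ∀ {e f} → Before M e f → ρ f ≡ false
  not-root (base _ h) = h
  not-root (more _ h) = h

  before-trans : ∀ {e f g} → Before M e f → Before M f g → Before M e g
  before-trans b (base _ h) = more b h
  before-trans b (more c h) = more (before-trans b c) h

  front : ∀ {e f} → Before M e f → ρ (σ e) ≡ false × (σ e ≡ f ⊎ Before M (σ e) f)
  front (base Ae h) = h , inj₁ refl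
  front (more b h) with front b
  ... | r , inj₁ refl = r , inj₂ (base (A-right b) h)
  ... | r , inj₂ c = r , inj₂ (more c h)

  no-after-last : ∀ {e f} → ρ (σ e) ≡ true → Before M e f → ⊥
  no-after-last h b = true≢false h (proj₁ (front b))

  from-root : ∀ {r e} → A r → ρ r ≡ true → A e → tail r ≡ tail e → r ≡ e ⊎ Before M r e
  from-root {r} Ar ρr Ae t = orbit-ind (λ x → r ≡ x ⊎ Before M r x) Ar Ae t step (inj₁ refl)
    where
    step : ∀ {x} → A x → tail x ≡ tail r → r ≡ x ⊎ Before M r x → r ≡ σ x ⊎ Before M r (σ x)
    step {x} Ax tx h with bool-cases (ρ (σ x))
    ... | inj₁ e = inj₁ (root-unique Ar (σA Ax) (sym (trans (tail-σ Ax) tx)) ρr e)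
    step Ax tx (inj₁ refl) | inj₂ e = inj₂ (base Ax e)
    step Ax tx (inj₂ b) | inj₂ e = inj₂ (more b e)

  compare : ∀ {r e f} → Before M r f → r ≡ e ⊎ Before M r e → e ≡ f ⊎ Before M e f ⊎ Before M f e
  compare b (inj₁ refl) = inj₂ (inj₁ b)
  compare {r} (base Ar h) (inj₂ c) with front c
  ... | _ , inj₁ e = inj₁ (sym e)
  ... | _ , inj₂ d = inj₂ (inj₂ d)
  compare (more b h) (inj₂ c) with compare b (inj₂ c)
  ... | inj₁ refl = inj₂ (inj₁ (base (A-right b) h))
  ... | inj₂ (inj₁ d) = inj₂ (inj₁ (more d h))
  ... | inj₂ (inj₂ d) with front d
  ...   | _ , inj₁ e = inj₁ (sym e)
  ...   | _ , inj₂ d' = inj₂ (inj₂ d')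

  total : ∀ {e f} → A e → A f → tail e ≡ tail f → e ≡ f ⊎ Before M e f ⊎ Before M f e
  total {e} {f} Ae Af t with root Ae
  ... | r , Ar , tr , ρr with from-root Ar ρr Ae tr | from-root Ar ρr Af (trans tr t)
  ...   | inj₁ refl | inj₁ e = inj₁ e
  ...   | inj₂ b | inj₁ refl = inj₂ (inj₂ b)
  ...   | p | inj₂ b = compare b p

module ContractOrder {D n F : ℕ} (M : Map D n F) (isMap : IsMap M) (red : Reducible M) where
  open Contract M isMap red
  open Order M isMap
  module O′ = Order M' isMap'

  -- At v the rotation is irregular only in the step from `α d₂` to `d₃`. That step passes the
  -- reflex corner and hence does not occur in a chain of `Before`.
  v-chain : ∀ {e f} → Before M e f → tail e ≡ v → Before M' (ι e) (ι f)
  v-chain {e} b te = go b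
    where
    at-v : ∀ {x y} → tail x ≡ v → x ≡ y → tail y ≢ v → ⊥
    at-v t refl h = h t
    step : ∀ {z} → A z → tail z ≡ v → ρ (σ z) ≡ false → (′.σ (ι z) ≡ ι (σ z)) × ρ (ι (σ z)) ≡ false
    step Az tz h with ι-step Az
    ... | moves e e' = e , trans (cong ρ e') h
    ... | stays₁ e = ⊥-elim (at-v tz e λ t → v≢a (trans (sym t) h₁))
    ... | stays₃ e = ⊥-elim (at-v tz e λ t → b≢v (trans (sym h₃) t))
    ... | wraps₂ refl = ⊥-elim (true≢false (trans (cong ρ σα₂) ρ₃) h)
    ... | wraps₄ e = ⊥-elim (at-v tz e λ t → v≢c (trans (sym t) h₄))
    go : ∀ {f} → Before M e f → Before M' (ι e) (ι f)
    go (base Ae h) with step Ae te h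
    ... | q , r = subst (Before M' (ι e)) q (base (ι-A' Ae) (trans (cong ρ q) r))
    go (more {f} c h) with step (A-right c) (trans (sym (same-tail c)) te) h
    ... | q , r = subst (Before M' (ι e)) q (more (go c) (trans (cong ρ q) r))

  before-α₂ : ∀ {e} → A e → tail e ≡ v → e ≡ α d₂ ⊎ Before M e (α d₂)
  before-α₂ Ae te with total Ae (αA A₂) (trans te (sym h₂))
  ... | inj₁ e = inj₁ e
  ... | inj₂ (inj₁ b) = inj₂ b
  ... | inj₂ (inj₂ b) = ⊥-elim (no-after-last (trans (cong ρ σα₂) ρ₃) b)

  after-d₃ : ∀ {e} → A e → tail e ≡ v → e ≢ d₃ → Before M d₃ e
  after-d₃ Ae te ne with from-root A₃ ρ₃ Ae (sym te)
  ... | inj₁ e = ⊥-elim (ne (sym e))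
  ... | inj₂ b = b

  ια₂ : ι (α d₂) ≡ α d₂
  ια₂ = ια A₂ f₂
  ια₄ : ι (α d₄) ≡ α d₄
  ια₄ = ια A₄ f₄

  α₂≢d₃ : α d₂ ≢ d₃
  α₂≢d₃ e = a≢b (trans (sym (head-α A₂)) (trans (cong head e) h₃))

  α₄-before : ∀ {e} → A e → tail e ≡ v → e ≢ d₃ → Before M' (α d₄) (ι e)
  α₄-before Ae te ne = subst (λ z → Before M' z (ι _)) ι₃ (v-chain (after-d₃ Ae te ne) refl)

  α₄-α₂ : Before M' (α d₄) (α d₂)
  α₄-α₂ = subst (Before M' (α d₄)) ια₂ (α₄-before (αA A₂) h₂ α₂≢d₃)

  Merged : Fin D → Fin D → Set
  Merged e f = (e ≡ α d₁ × f ≡ d₂) ⊎ (e ≡ α d₃ × f ≡ d₄)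

  merged-ι : ∀ {e f} → Merged e f → ι e ≡ ι f
  merged-ι (inj₁ (refl , refl)) = trans (ια A₁ f₁) (sym ι₂)
  merged-ι (inj₂ (refl , refl)) = trans (ια A₃ refl) (sym ι₄)

  not-twice : ∀ {e f g} → Merged e f → Merged f g → ⊥
  not-twice (inj₁ (refl , refl)) (inj₁ (e , _)) = αQ A₁ f₁ (trans (cong face (sym e)) f₂)
  not-twice (inj₁ (refl , refl)) (inj₂ (e , _)) = αQ A₃ refl (trans (cong face (sym e)) f₂)
  not-twice (inj₂ (refl , refl)) (inj₁ (e , _)) = αQ A₁ f₁ (trans (cong face (sym e)) f₄)
  not-twice (inj₂ (refl , refl)) (inj₂ (e , _)) = αQ A₃ refl (trans (cong face (sym e)) f₄)

  order-step : ∀ {z} → A z → ρ (σ z) ≡ false → Before M' (ι z) (ι (σ z)) ⊎ Merged z (σ z)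
  order-step Az h with ι-step Az
  ... | moves e e' = inj₁ (subst (Before M' (ι _)) e (base (ι-A' Az) (trans (cong ρ (trans e e')) h)))
  ... | stays₁ refl = inj₂ (inj₁ (refl , σα₁))
  ... | stays₃ refl = inj₂ (inj₂ (refl , σα₃))
  ... | wraps₂ refl = ⊥-elim (true≢false (trans (cong ρ σα₂) ρ₃) h)
  ... | wraps₄ refl = inj₁ (subst₂ (Before M') (sym ια₄) (trans (sym ια₂) (sym ι-wrap₄)) α₄-α₂)

  -- Order can be lost only between two darts glued to each other, which happens once at a and once
  -- at b. At c it is merely refined: the darts of v come in between `α d₄` and `d₁`.
  order : ∀ {e f} → Before M e f → Before M' (ι e) (ι f) ⊎ Merged e f
  order (base Ae h) = order-step Ae h
  order {e} (more {f} b h) with order b | order-step (A-right b) h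
  ... | inj₁ p | inj₁ q = inj₁ (O′.before-trans p q)
  ... | inj₁ p | inj₂ m = inj₁ (subst (Before M' (ι e)) (merged-ι m) p)
  ... | inj₂ m | inj₁ q = inj₁ (subst (λ z → Before M' z (ι (σ f))) (sym (merged-ι m)) q)
  ... | inj₂ m | inj₂ m' = ⊥-elim (not-twice m m')

-- Inequalities that hold for all small ε

pos-+ : ∀ {x y} → 0ℚ < x → 0ℚ < y → 0ℚ < x + y
pos-+ {x} {y} hx hy = subst (_< x + y) (ℚP.+-identityˡ 0ℚ) (ℚP.+-mono-< hx hy)

pos-+-nonneg : ∀ {x y} → 0ℚ < x → 0ℚ ≤ y → 0ℚ < x + y
pos-+-nonneg {x} {y} hx hy = subst (_< x + y) (ℚP.+-identityˡ 0ℚ) (ℚP.+-mono-<-≤ hx hy)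

nonneg-+ : ∀ {x y} → 0ℚ ≤ x → 0ℚ ≤ y → 0ℚ ≤ x + y
nonneg-+ {x} {y} hx hy = subst (_≤ x + y) (ℚP.+-identityˡ 0ℚ) (ℚP.+-mono-≤ hx hy)

pos-* : ∀ {x y} → 0ℚ < x → 0ℚ < y → 0ℚ < x * y
pos-* {x} {y} hx hy = ℚP.positive⁻¹ (x * y) {{ℚP.pos*pos⇒pos x {{ℚ.positive hx}} y {{ℚ.positive hy}}}}

nonneg-* : ∀ {x y} → 0ℚ ≤ x → 0ℚ ≤ y → 0ℚ ≤ x * y
nonneg-* {x} {y} hx hy = ℚP.nonNegative⁻¹ (x * y) {{ℚP.nonNeg*nonNeg⇒nonNeg x {{ℚ.nonNegative hx}} y {{ℚ.nonNegative hy}}}}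

diff-pos : ∀ {x y} → x < y → 0ℚ < y - x
diff-pos {x} {y} h = subst (_< y - x) (ℚP.+-inverseʳ x) (ℚP.+-monoˡ-< (- x) h)

diff-nonneg : ∀ {x y} → x ≤ y → 0ℚ ≤ y - x
diff-nonneg {x} {y} h = subst (_≤ y - x) (ℚP.+-inverseʳ x) (ℚP.+-mono-≤ h (ℚP.≤-refl { - x}))

not-both : ∀ {x} → 0ℚ < x → 0ℚ < - x → ⊥
not-both {x} h k = ℚP.<-irrefl (sym (ℚP.+-inverseʳ x)) (pos-+ h k)

inverse : ∀ {x} → 0ℚ < x → ∃ λ y → 0ℚ < y × x * y ≡ 1ℚ
inverse {x} h = (ℚ.1/ x) {{nz}} , ℚP.positive⁻¹ _ {{ℚP.1/pos⇒pos x {{px}}}} , ℚP.*-inverseʳ x {{nz}}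
  where
  px = ℚ.positive h
  nz = ℚP.pos⇒nonZero x {{px}}

-- Requiring the property below the bound, and not only at it, makes the notion closed under finite
-- conjunctions, so one ε can be chosen for all pairs of darts and vertices.
Eventually : (ℚ → Set) → Set
Eventually P = ∃ λ δ → 0ℚ < δ × (∀ ε → 0ℚ < ε → ε ≤ δ → P ε)

0<1 : 0ℚ < 1ℚ
0<1 = ℚP.positive⁻¹ 1ℚ

ev-always : ∀ {P} → (∀ ε → 0ℚ < ε → P ε) → Eventually P
ev-always h = 1ℚ , 0<1 , λ ε p _ → h ε p

ev-map : ∀ {P Q : ℚ → Set} → (∀ ε → 0ℚ < ε → P ε → Q ε) → Eventually P → Eventually Q
ev-map f (δ , p , h) = δ , p , λ ε q l → f ε q (h ε q l)

ev-× : ∀ {P Q : ℚ → Set} → Eventually P → Eventually Q → Eventually (λ ε → P ε × Q ε)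
ev-× (δ , p , h) (δ' , p' , h') with ℚP.≤-total δ δ'
... | inj₁ l = δ , p , λ ε q m → h ε q m , h' ε q (ℚP.≤-trans m l)
... | inj₂ l = δ' , p' , λ ε q m → h ε q (ℚP.≤-trans m l) , h' ε q m

ev-∀ : ∀ {k} {P : Fin k → ℚ → Set} → (∀ i → Eventually (P i)) → Eventually (λ ε → ∀ i → P i ε)
ev-∀ {zero} h = ev-always λ _ _ ()
ev-∀ {suc k} {P} h = ev-map (λ { ε _ (x , f) zero → x ; ε _ (x , f) (suc i) → f i }) (ev-× (h zero) (ev-∀ {k} {P ∘ suc} (h ∘ suc)))

ev-linear : ∀ {x} y → 0ℚ < x → Eventually (λ ε → 0ℚ < x + ε * y)
ev-linear {x} y hx with ℚP.≤-total 0ℚ y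
... | inj₁ l = ev-always λ ε hε → pos-+-nonneg hx (nonneg-* (ℚP.<⇒≤ hε) l)
... | inj₂ l with inverse {x + - y} (pos-+-nonneg hx (subst (_≤ - y) refl (ℚP.neg-antimono-≤ l)))
-- For y ≤ 0 the bound is x / (x - y), and x + ε y is rewritten as ε x plus the slack of the bound
-- times x - y.
...   | z , hz , e = x * z , pos-* hx hz , λ ε hε le → subst (0ℚ <_) (eq ε) (pos-+-nonneg (pos-* hε hx) (slack ε le))
  where
  k = x + - y
  hk : 0ℚ ≤ k
  hk = ℚP.<⇒≤ (pos-+-nonneg hx (ℚP.neg-antimono-≤ l))
  eq : ∀ ε → ε * x + (x * z - ε) * k ≡ x + ε * y
  eq ε = trans (solve 4 (λ x y z ε → ε :* x :+ (x :* z :- ε) :* (x :+ :- y) := (x :* ((x :+ :- y) :* z) :+ ε :* y)) refl x y z ε)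
    (cong (_+ ε * y) (trans (cong (x *_) e) (ℚP.*-identityʳ x)))
  slack : ∀ ε → ε ≤ x * z → 0ℚ ≤ (x * z - ε) * k
  slack ε le = nonneg-* (diff-nonneg le) hk

ev-linear-eq : ∀ {f : ℚ → ℚ} x y → (∀ ε → f ε ≡ x + ε * y) → 0ℚ < x → Eventually (λ ε → 0ℚ < f ε)
ev-linear-eq x y e h = ev-map (λ ε _ q → subst (0ℚ <_) (sym (e ε)) q) (ev-linear y h)

lin : Point → Point → ℚ
lin f x = proj₁ f * proj₁ x + proj₂ f * proj₂ x

lin-self : ∀ f x → lin f (x -ᵖ x) ≡ 0ℚ
lin-self (f , g) (x , y) = solve 4 (λ f g x y → f :* (x :- x) :+ g :* (y :- y) := con 0ℚ) refl f g x y

-- The segment `u₁ u₂` lies strictly below the segment `u₃ u₄` with respect to `f`. Unlike bare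
-- disjointness this is an open condition on the four ends; taking `u u t t` expresses that two
-- points differ.
Separates : ∀ {n} → Point → (Fin n → Point) → Fin n → Fin n → Fin n → Fin n → Set
Separates f p u₁ u₂ u₃ u₄ = (0ℚ < lin f (p u₃ -ᵖ p u₁) × 0ℚ < lin f (p u₄ -ᵖ p u₁))
                          × (0ℚ < lin f (p u₃ -ᵖ p u₂) × 0ℚ < lin f (p u₄ -ᵖ p u₂))

Separated₄ : ∀ {n} → (Fin n → Point) → Fin n → Fin n → Fin n → Fin n → Set
Separated₄ p u₁ u₂ u₃ u₄ = ∃ λ f → Separates f p u₁ u₂ u₃ u₄

negᵖ : Point → Point
negᵖ f = - proj₁ f , - proj₂ f

lin-neg : ∀ f x y → lin (negᵖ f) (x -ᵖ y) ≡ lin f (y -ᵖ x)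
lin-neg (f , g) (x , x') (y , y') = solve 6 (λ f g x x' y y' → (:- f) :* (x :- y) :+ (:- g) :* (x' :- y') := f :* (y :- x) :+ g :* (y' :- x')) refl f g x x' y y'

separated-swap : ∀ {n} {p : Fin n → Point} {u₁ u₂ u₃ u₄} → Separated₄ p u₁ u₂ u₃ u₄ → Separated₄ p u₃ u₄ u₁ u₂
separated-swap {p = p} {u₁} {u₂} {u₃} {u₄} (f , (a , b) , (c , d)) = negᵖ f , (fl u₁ u₃ a , fl u₂ u₃ c) , (fl u₁ u₄ b , fl u₂ u₄ d)
  where
  fl : ∀ u w → 0ℚ < lin f (p w -ᵖ p u) → 0ℚ < lin (negᵖ f) (p u -ᵖ p w)
  fl u w = subst (0ℚ <_) (sym (lin-neg f (p u) (p w)))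

separated-cong : ∀ {n} {p : Fin n → Point} {u₁ u₂ u₃ u₄ t₁ t₂ t₃ t₄} → u₁ ≡ t₁ → u₂ ≡ t₂ → u₃ ≡ t₃ → u₄ ≡ t₄ →
  Separated₄ p u₁ u₂ u₃ u₄ → Separated₄ p t₁ t₂ t₃ t₄
separated-cong refl refl refl refl h = h

separated-left : ∀ {n} {p : Fin n → Point} {u₁ u₂ u₃ u₄} → Separated₄ p u₁ u₂ u₃ u₄ → Separated₄ p u₂ u₁ u₃ u₄
separated-left (f , x , y) = f , y , x

separated-right : ∀ {n} {p : Fin n → Point} {u₁ u₂ u₃ u₄} → Separated₄ p u₁ u₂ u₃ u₄ → Separated₄ p u₁ u₂ u₄ u₃
separated-right (f , (a , b) , (c , d)) = f , (b , a) , (d , c)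

module Perturb {n : ℕ} (p₀ : Fin n → Point) (k : Fin n → ℚ) (w : Point) where

  abstract
    pε : ℚ → Fin n → Point
    pε ε u = proj₁ (p₀ u) + ε * (k u * proj₁ w) , proj₂ (p₀ u) + ε * (k u * proj₂ w)

    pε-≡ : ∀ ε u → pε ε u ≡ (proj₁ (p₀ u) + ε * (k u * proj₁ w) , proj₂ (p₀ u) + ε * (k u * proj₂ w))
    pε-≡ ε u = refl

    move : ∀ x y k l w ε → (x + ε * (k * w)) - (y + ε * (l * w)) ≡ (x - y) + ε * ((k - l) * w)
    move x y k l w ε = solve 6 (λ x y k l w ε → (x :+ ε :* (k :* w)) :- (y :+ ε :* (l :* w)) := (x :- y) :+ ε :* ((k :- l) :* w)) refl x y k l w ε

    diffε : ∀ ε u t → pε ε u -ᵖ pε ε t ≡ (proj₁ (p₀ u -ᵖ p₀ t) + ε * ((k u - k t) * proj₁ w) , proj₂ (p₀ u -ᵖ p₀ t) + ε * ((k u - k t) * proj₂ w))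
    diffε ε u t = cong₂ _,_ (move (proj₁ (p₀ u)) (proj₁ (p₀ t)) (k u) (k t) (proj₁ w) ε) (move (proj₂ (p₀ u)) (proj₂ (p₀ t)) (k u) (k t) (proj₂ w) ε)

  -- All points move along the same vector `w`, so the quadratic term is a multiple of `cross w w`
  -- and vanishes.
  crossε : ∀ ε u₁ u₂ u₃ u₄ → cross (pε ε u₂ -ᵖ pε ε u₁) (pε ε u₄ -ᵖ pε ε u₃) ≡
    cross (p₀ u₂ -ᵖ p₀ u₁) (p₀ u₄ -ᵖ p₀ u₃) + ε * ((k u₄ - k u₃) * cross (p₀ u₂ -ᵖ p₀ u₁) w + (k u₂ - k u₁) * cross w (p₀ u₄ -ᵖ p₀ u₃))
  crossε ε u₁ u₂ u₃ u₄ = trans (cong₂ cross (diffε ε u₂ u₁) (diffε ε u₄ u₃))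
    (expand (p₀ u₂ -ᵖ p₀ u₁) (p₀ u₄ -ᵖ p₀ u₃) (k u₂ - k u₁) (k u₄ - k u₃))
    where
    expand : ∀ x y r s → cross (proj₁ x + ε * (r * proj₁ w) , proj₂ x + ε * (r * proj₂ w)) (proj₁ y + ε * (s * proj₁ w) , proj₂ y + ε * (s * proj₂ w))
      ≡ cross x y + ε * (s * cross x w + r * cross w y)
    expand (a , b) (c , d) r s = solve 9 (λ a b c d r s w w' ε →
      (a :+ ε :* (r :* w)) :* (d :+ ε :* (s :* w')) :- (b :+ ε :* (r :* w')) :* (c :+ ε :* (s :* w))
      := (a :* d :- b :* c) :+ ε :* (s :* (a :* w' :- b :* w) :+ r :* (w :* d :- w' :* c))) refl a b c d r s (proj₁ w) (proj₂ w) ε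

  linε : ∀ f ε u t → lin f (pε ε u -ᵖ pε ε t) ≡ lin f (p₀ u -ᵖ p₀ t) + ε * ((k u - k t) * lin f w)
  linε f ε u t = trans (cong (lin f) (diffε ε u t)) (expand (p₀ u -ᵖ p₀ t) (k u - k t))
    where
    expand : ∀ x r → lin f (proj₁ x + ε * (r * proj₁ w) , proj₂ x + ε * (r * proj₂ w)) ≡ lin f x + ε * (r * lin f w)
    expand (a , b) r = solve 8 (λ f g a b r w w' ε → f :* (a :+ ε :* (r :* w)) :+ g :* (b :+ ε :* (r :* w'))
      := (f :* a :+ g :* b) :+ ε :* (r :* (f :* w :+ g :* w'))) refl (proj₁ f) (proj₂ f) a b r (proj₁ w) (proj₂ w) ε

  ev-cross : ∀ u₁ u₂ u₃ u₄ → 0ℚ < cross (p₀ u₂ -ᵖ p₀ u₁) (p₀ u₄ -ᵖ p₀ u₃) →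
    Eventually (λ ε → 0ℚ < cross (pε ε u₂ -ᵖ pε ε u₁) (pε ε u₄ -ᵖ pε ε u₃))
  ev-cross u₁ u₂ u₃ u₄ h = ev-linear-eq _ _ (λ ε → crossε ε u₁ u₂ u₃ u₄) h

  -- Unlike ev-cross, this form can be required of all u₁ u₂ u₃ u₄ at once.
  ev-cross? : ∀ u₁ u₂ u₃ u₄ → Eventually (λ ε → 0ℚ < cross (p₀ u₂ -ᵖ p₀ u₁) (p₀ u₄ -ᵖ p₀ u₃) →
    0ℚ < cross (pε ε u₂ -ᵖ pε ε u₁) (pε ε u₄ -ᵖ pε ε u₃))
  ev-cross? u₁ u₂ u₃ u₄ with 0ℚ ℚP.<? cross (p₀ u₂ -ᵖ p₀ u₁) (p₀ u₄ -ᵖ p₀ u₃)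
  ... | yes h = ev-map (λ _ _ q _ → q) (ev-cross u₁ u₂ u₃ u₄ h)
  ... | no h = ev-always λ _ _ q → ⊥-elim (h q)

  ev-separated : ∀ {u₁ u₂ u₃ u₄} → Separated₄ p₀ u₁ u₂ u₃ u₄ → Eventually (λ ε → Separated₄ (pε ε) u₁ u₂ u₃ u₄)
  ev-separated {u₁} {u₂} {u₃} {u₄} (f , (a , b) , (c , d)) =
    ev-map (λ ε _ h → f , h) (ev-× (ev-× (part u₃ u₁ a) (part u₄ u₁ b)) (ev-× (part u₃ u₂ c) (part u₄ u₂ d)))
    where
    part : ∀ u t → 0ℚ < lin f (p₀ u -ᵖ p₀ t) → Eventually (λ ε → 0ℚ < lin f (pε ε u -ᵖ pε ε t))
    part u t h = ev-linear-eq _ _ (λ ε → linε f ε u t) h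

-- Drawings, and splitting a contracted vertex

-- A straight-line drawing with strictly convex outer boundary in which the darts at every vertex span an angle less than π, in
-- the prescribed order.
record Drawn {D n F : ℕ} (M : Map D n F) (p : Fin n → Point) : Set where
  open Map M
  vec : Fin D → Point
  vec d = p (head d) -ᵖ p (tail d)
  field
    ordered : ∀ {e f} → Before M e f → 0ℚ < cross (vec e) (vec f)
    hull : ∀ {d u} → A d → face d ≡ outer → V u ≡ true → u ≢ tail d → u ≢ head d → 0ℚ < cross (vec d) (p u -ᵖ p (tail d))
    apart : ∀ {e f} → A e → A f → tail e ≢ tail f → tail e ≢ head f → head e ≢ tail f → head e ≢ head f →
      Separated₄ p (tail e) (head e) (tail f) (head f)
    distinct : ∀ {u t} → V u ≡ true → V t ≡ true → u ≢ t → Separated₄ p u u t t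

cross-self : ∀ x → cross x x ≡ 0ℚ
cross-self (a , b) = solve 2 (λ a b → a :* b :- b :* a := con 0ℚ) refl a b

cross-null : ∀ x y → cross x (y -ᵖ y) ≡ 0ℚ
cross-null (x , x') (y , y') = solve 4 (λ x x' y y' → x :* (y' :- y') :- x' :* (y :- y) := con 0ℚ) refl x x' y y'

cross-anti : ∀ x y → cross x y ≡ - cross y x
cross-anti (a , b) (c , d) = solve 4 (λ a b c d → a :* d :- b :* c := :- (c :* b :- d :* a)) refl a b c d

-- Undoing the contraction: v is placed at c + ε ((a − c) + (b − c)).
module Split {D n F : ℕ} (M : Map D n F) (isMap : IsMap M) (red : Reducible M)
  (p' : Fin n → Point) (drawn' : Drawn (Contract.M' M isMap red) p') where
  open Contract M isMap red
  open Order M isMap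
  open ContractOrder M isMap red
  open Drawn drawn' renaming (vec to vec'; ordered to ordered'; hull to hull'; apart to apart'; distinct to distinct')

  p₀ : Fin n → Point
  p₀ u = p' (rn u)

  abstract
    k : Fin n → ℚ
    k u = if u =ᶠ v then 1ℚ else 0ℚ

    k-v : k v ≡ 1ℚ
    k-v rewrite =ᶠ-refl v = refl
    k-≢ : ∀ {u} → u ≢ v → k u ≡ 0ℚ
    k-≢ h rewrite =ᶠ-false h = refl

  ca cb w : Point
  ca = p₀ a -ᵖ p₀ c
  cb = p₀ b -ᵖ p₀ c
  w = proj₁ ca + proj₁ cb , proj₂ ca + proj₂ cb

  p₀-v : p₀ v ≡ p₀ c
  p₀-v = cong p' (trans rn-v (sym rn-c))

  open Perturb p₀ k w

  cross-w : ∀ x → cross x w ≡ cross x ca + cross x cb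
  cross-w (x , y) = solve 6 (λ x y a b c d → x :* (b :+ d) :- y :* (a :+ c) := (x :* b :- y :* a) :+ (x :* d :- y :* c)) refl
    x y (proj₁ ca) (proj₂ ca) (proj₁ cb) (proj₂ cb)

  vec₀ : Fin D → Point
  vec₀ e = p₀ (head e) -ᵖ p₀ (tail e)

  vec-ι : ∀ {e} → A e → vec' (ι e) ≡ vec₀ e
  vec-ι Ae = cong₂ _-ᵖ_ (cong p' (head-ι Ae)) (cong p' (tail-ι Ae))

  ordered₀ : ∀ {e f} → A e → A f → Before M' (ι e) (ι f) → 0ℚ < cross (vec₀ e) (vec₀ f)
  ordered₀ Ae Af b = subst₂ (λ x y → 0ℚ < cross x y) (vec-ι Ae) (vec-ι Af) (ordered' b)

  Aα₂ = αA A₂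
  Aα₄ = αA A₄

  vec-α₂ : vec₀ (α d₂) ≡ ca
  vec-α₂ = cong₂ _-ᵖ_ (cong p₀ (head-α A₂)) (trans (cong p₀ h₂) p₀-v)
  vec-α₄ : vec₀ (α d₄) ≡ cb
  vec-α₄ = cong₂ _-ᵖ_ (cong p₀ (head-α A₄)) (cong p₀ h₄)
  vec-d₁ : vec₀ d₁ ≡ ca
  vec-d₁ = cong (λ z → p₀ z -ᵖ p₀ c) h₁

  -- The wedge from b to a at c, into which v is moved, is convex. This sign is the coefficient of ε
  -- in `merged₁`, `merged₃` and `split-vc`, where the values at ε = 0 vanish.
  wide : 0ℚ < cross cb ca
  wide = subst₂ (λ x y → 0ℚ < cross x y) vec-α₄ vec-α₂ (ordered₀ Aα₄ Aα₂ (subst₂ (Before M') (sym ια₄) (sym ια₂) α₄-α₂))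

  module _ (ε : ℚ) (0<ε : 0ℚ < ε) where

    -- The edges from a to c and to v coincide at ε = 0, so the sign is that of the coefficient of
    -- ε, which is the area spanned by the wedge at c.
    merged₁ : 0ℚ < cross (pε ε c -ᵖ pε ε a) (pε ε v -ᵖ pε ε a)
    merged₁ = subst (0ℚ <_) (sym (trans (crossε ε a c a v) (trans (cong₂ _+_
        (trans (cong (λ z → cross (p₀ c -ᵖ p₀ a) (z -ᵖ p₀ a)) p₀-v) (cross-self (p₀ c -ᵖ p₀ a)))
        (cong (ε *_) (trans (cong₂ _+_ (cong₂ (λ x y → (x - y) * cross (p₀ c -ᵖ p₀ a) w) k-v (k-≢ (≢-sym v≢a)))
           (cong₂ (λ x y → (x - y) * cross w (p₀ v -ᵖ p₀ a)) (k-≢ (≢-sym v≢c)) (k-≢ (≢-sym v≢a)))) (fin (p₀ a) (p₀ b) (p₀ c) (cross w (p₀ v -ᵖ p₀ a))))))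
        (ℚP.+-identityˡ _)))) (pos-* 0<ε wide)
      where
      fin : ∀ a b c z → (1ℚ - 0ℚ) * cross (c -ᵖ a) (proj₁ (a -ᵖ c) + proj₁ (b -ᵖ c) , proj₂ (a -ᵖ c) + proj₂ (b -ᵖ c)) + (0ℚ - 0ℚ) * z
        ≡ cross (b -ᵖ c) (a -ᵖ c)
      fin (a , a') (b , b') (c , c') z = solve 7 (λ a a' b b' c c' z →
        (con 1ℚ :- con 0ℚ) :* ((c :- a) :* ((a' :- c') :+ (b' :- c')) :- (c' :- a') :* ((a :- c) :+ (b :- c))) :+ (con 0ℚ :- con 0ℚ) :* z
        := (b :- c) :* (a' :- c') :- (b' :- c') :* (a :- c)) refl a a' b b' c c' z

    merged₃ : 0ℚ < cross (pε ε v -ᵖ pε ε b) (pε ε c -ᵖ pε ε b)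
    merged₃ = subst (0ℚ <_) (sym (trans (crossε ε b v b c) (trans (cong₂ _+_
        (trans (cong (λ z → cross (z -ᵖ p₀ b) (p₀ c -ᵖ p₀ b)) p₀-v) (cross-self (p₀ c -ᵖ p₀ b)))
        (cong (ε *_) (trans (cong₂ _+_ (cong₂ (λ x y → (x - y) * cross (p₀ v -ᵖ p₀ b) w) (k-≢ (≢-sym v≢c)) (k-≢ b≢v))
           (cong₂ (λ x y → (x - y) * cross w (p₀ c -ᵖ p₀ b)) k-v (k-≢ b≢v))) (fin (p₀ a) (p₀ b) (p₀ c) (cross (p₀ v -ᵖ p₀ b) w)))))
        (ℚP.+-identityˡ _)))) (pos-* 0<ε wide)
      where
      fin : ∀ a b c z → (0ℚ - 0ℚ) * z + (1ℚ - 0ℚ) * cross (proj₁ (a -ᵖ c) + proj₁ (b -ᵖ c) , proj₂ (a -ᵖ c) + proj₂ (b -ᵖ c)) (c -ᵖ b)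
        ≡ cross (b -ᵖ c) (a -ᵖ c)
      fin (a , a') (b , b') (c , c') z = solve 7 (λ a a' b b' c c' z →
        (con 0ℚ :- con 0ℚ) :* z :+ (con 1ℚ :- con 0ℚ) :* (((a :- c) :+ (b :- c)) :* (c' :- b') :- ((a' :- c') :+ (b' :- c')) :* (c :- b))
        := (b :- c) :* (a' :- c') :- (b' :- c') :* (a :- c)) refl a a' b b' c c' z

    -- f vanishes on the edge c y and is negative on the edge v x and on the displacement of v.
    fan : ∀ f {x y} → x ≢ v → y ≢ v → lin f (p₀ y -ᵖ p₀ c) ≡ 0ℚ → 0ℚ < - lin f (p₀ x -ᵖ p₀ c) → 0ℚ < - lin f w →
      Separates f (pε ε) v x c y
    fan f {x} {y} nx ny l₀ lx lw =
        ( subst (0ℚ <_) (sym (e₁ c c≢v (trans (cong (λ z → lin f (p₀ c -ᵖ z)) p₀-v) (lin-self f (p₀ c))))) (pos-* 0<ε lw)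
        , subst (0ℚ <_) (sym (e₁ y ny (trans (cong (λ z → lin f (p₀ y -ᵖ z)) p₀-v) l₀))) (pos-* 0<ε lw) )
      , ( subst (0ℚ <_) (sym (e₂ c c≢v (trans (lin-flip f (p₀ c) (p₀ x)) refl))) lx
        , subst (0ℚ <_) (sym (e₂ y ny (trans (lin-split f (p₀ y) (p₀ x) (p₀ c)) (trans (cong (_+ - lin f (p₀ x -ᵖ p₀ c)) l₀) (ℚP.+-identityˡ _))))) lx )
      where
      c≢v = ≢-sym v≢c
      lin-flip : ∀ f x y → lin f (x -ᵖ y) ≡ - lin f (y -ᵖ x)
      lin-flip (f , g) (x , x') (y , y') = solve 6 (λ f g x x' y y' → f :* (x :- y) :+ g :* (x' :- y') := :- (f :* (y :- x) :+ g :* (y' :- x'))) refl f g x x' y y'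
      lin-split : ∀ f x y z → lin f (x -ᵖ y) ≡ lin f (x -ᵖ z) + - lin f (y -ᵖ z)
      lin-split (f , g) (x , x') (y , y') (z , z') = solve 8 (λ f g x x' y y' z z' → f :* (x :- y) :+ g :* (x' :- y') :=
        (f :* (x :- z) :+ g :* (x' :- z')) :+ :- (f :* (y :- z) :+ g :* (y' :- z'))) refl f g x x' y y' z z'
      e₁ : ∀ t → t ≢ v → lin f (p₀ t -ᵖ p₀ v) ≡ 0ℚ → lin f (pε ε t -ᵖ pε ε v) ≡ ε * (- lin f w)
      e₁ t nt h = trans (linε f ε t v) (trans (cong₂ (λ x y → x + ε * (y * lin f w)) h (cong₂ _-_ (k-≢ nt) k-v))
        (solve 2 (λ ε l → con 0ℚ :+ ε :* ((con 0ℚ :- con 1ℚ) :* l) := ε :* (:- l)) refl ε (lin f w)))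
      e₂ : ∀ t → t ≢ v → lin f (p₀ t -ᵖ p₀ x) ≡ - lin f (p₀ x -ᵖ p₀ c) → lin f (pε ε t -ᵖ pε ε x) ≡ - lin f (p₀ x -ᵖ p₀ c)
      e₂ t nt h = trans (linε f ε t x) (trans (cong₂ (λ x y → x + ε * (y * lin f w)) h (cong₂ _-_ (k-≢ nt) (k-≢ nx)))
        (solve 3 (λ ε l m → m :+ ε :* ((con 0ℚ :- con 0ℚ) :* l) := m) refl ε (lin f w) (- lin f (p₀ x -ᵖ p₀ c))))

    perp : Point → Point
    perp h = proj₂ h , - proj₁ h

    lin-perp : ∀ h z → - lin (perp h) z ≡ cross h z
    lin-perp (h , h') (z , z') = solve 4 (λ h h' z z' → :- (h' :* z :+ (:- h) :* z') := h :* z' :- h' :* z) refl h h' z z'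

    lin-perp-neg : ∀ h z → - lin (negᵖ (perp h)) z ≡ cross z h
    lin-perp-neg (h , h') (z , z') = solve 4 (λ h h' z z' → :- ((:- h') :* z :+ (:- (:- h)) :* z') := z :* h' :- z' :* h) refl h h' z z'

    neg-zero : ∀ {x} → - x ≡ 0ℚ → x ≡ 0ℚ
    neg-zero {x} e = trans (solve 1 (λ x → x := :- (:- x)) refl x) (cong -_ e)

    -- At ε = 0 both edges start at c. In the order at c the edge of `h` is outside the wedge or on
    -- its border, while the edge of `g` is within. The line through the edge of `h` thus has both
    -- the edge of `g` and the displacement of v on one side; which side depends on whether `h`
    -- precedes or follows the wedge.
    split-pair : ∀ {g h} → A g → A h → tail g ≡ v → tail h ≡ c → head g ≢ head h →
      Separated₄ (pε ε) v (head g) c (head h)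
    split-pair {g} {h} Ag Ah tg th ne = go side
      where
      G H : Point
      G = p₀ (head g) -ᵖ p₀ c
      H = p₀ (head h) -ᵖ p₀ c
      vg : vec₀ g ≡ G
      vg = cong (p₀ (head g) -ᵖ_) (trans (cong p₀ tg) p₀-v)
      vh : vec₀ h ≡ H
      vh = cong (λ z → p₀ (head h) -ᵖ p₀ z) th
      hg≢v : head g ≢ v
      hg≢v e = noloop Ag (trans e (sym tg))
      hh≢v : head h ≢ v
      hh≢v e = no-vc Ah (inj₂ th) (inj₁ e)
      early : 0ℚ < cross H G → 0ℚ < cross H w → Separated₄ (pε ε) v (head g) c (head h)
      early p q = perp H , fan (perp H) hg≢v hh≢v (neg-zero (trans (lin-perp H H) (cross-self H)))
        (subst (0ℚ <_) (sym (lin-perp H G)) p) (subst (0ℚ <_) (sym (lin-perp H w)) q)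
      late : 0ℚ < cross G H → 0ℚ < cross w H → Separated₄ (pε ε) v (head g) c (head h)
      late p q = negᵖ (perp H) , fan (negᵖ (perp H)) hg≢v hh≢v (neg-zero (trans (lin-perp-neg H H) (cross-self H)))
        (subst (0ℚ <_) (sym (lin-perp-neg H G)) p) (subst (0ℚ <_) (sym (lin-perp-neg H w)) q)
      w-cross : ∀ x → cross w x ≡ cross ca x + cross cb x
      w-cross (x , y) = solve 6 (λ x y a b c d → (a :+ c) :* y :- (b :+ d) :* x := (a :* y :- b :* x) :+ (c :* y :- d :* x)) refl
        x y (proj₁ ca) (proj₂ ca) (proj₁ cb) (proj₂ cb)
      side : (h ≡ α d₄ ⊎ Before M h (α d₄)) ⊎ (d₁ ≡ h ⊎ Before M d₁ h)
      side with total Ah Aα₄ (trans th (sym h₄))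
      ... | inj₁ e = inj₁ (inj₁ e)
      ... | inj₂ (inj₁ b) = inj₁ (inj₂ b)
      ... | inj₂ (inj₂ b) = inj₂ (subst (λ z → z ≡ h ⊎ Before M z h) σα₄ (proj₂ (front b)))
      unmerged : ∀ {e f} → tail e ≡ c → Before M e f → Before M' (ι e) (ι f)
      unmerged te b with order b
      ... | inj₁ x = x
      ... | inj₂ (inj₁ (refl , _)) = ⊥-elim (a≢c (trans (sym h₁) te))
      ... | inj₂ (inj₂ (refl , _)) = ⊥-elim (c≢b (trans (sym te) h₃))
      crossHG : Before M' (ι h) (ι g) → 0ℚ < cross H G
      crossHG b = subst₂ (λ x y → 0ℚ < cross x y) vh vg (ordered₀ Ah Ag b)
      crossGH : Before M' (ι g) (ι h) → 0ℚ < cross G H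
      crossGH b = subst₂ (λ x y → 0ℚ < cross x y) vg vh (ordered₀ Ag Ah b)
      go : (h ≡ α d₄ ⊎ Before M h (α d₄)) ⊎ (d₁ ≡ h ⊎ Before M d₁ h) → Separated₄ (pε ε) v (head g) c (head h)
      go (inj₁ (inj₁ e)) = early (crossHG (subst (λ z → Before M' z (ι g)) (sym (trans (cong ι e) ια₄)) (α₄-before Ag tg g≢)))
          (subst (0ℚ <_) (sym (trans (cross-w H) (trans (cong (cross H ca +_) (trans (cong (cross H) (sym Hcb)) (cross-self H)))
             (trans (ℚP.+-identityʳ _) (cong (λ z → cross z ca) Hcb))))) wide)
        where
        g≢ : g ≢ d₃
        g≢ e' = ne (trans (cong head e') (trans h₃ (trans (sym (head-α A₄)) (cong head (sym e)))))
        Hcb : H ≡ cb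
        Hcb = trans (sym vh) (trans (cong vec₀ e) vec-α₄)
      go (inj₁ (inj₂ b)) = early (crossHG (to-g (eq? g d₃)))
          (subst (0ℚ <_) (sym (cross-w H)) (pos-+
            (subst₂ (λ x y → 0ℚ < cross x y) vh vec-α₂ (ordered₀ Ah Aα₂ (O′.before-trans b' (subst₂ (Before M') (sym ια₄) (sym ια₂) α₄-α₂))))
            (subst₂ (λ x y → 0ℚ < cross x y) vh vec-α₄ (ordered₀ Ah Aα₄ b'))))
        where
        b' : Before M' (ι h) (ι (α d₄))
        b' = unmerged th b
        to-g : g ≡ d₃ ⊎ g ≢ d₃ → Before M' (ι h) (ι g)
        to-g (inj₁ refl) = subst (Before M' (ι h)) (trans ια₄ (sym ι₃)) b'
        to-g (inj₂ n) = O′.before-trans (subst (Before M' (ι h)) ια₄ b') (α₄-before Ag tg n)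
      go (inj₂ (inj₁ e)) = late (crossGH (to-h (before-α₂ Ag tg)))
          (subst (0ℚ <_) (sym (trans (w-cross H) (trans (cong (_+ cross cb H) (trans (cong (λ z → cross z H) (sym Hca)) (cross-self H)))
             (trans (ℚP.+-identityˡ _) (cong (cross cb) Hca))))) wide)
        where
        Hca : H ≡ ca
        Hca = trans (sym vh) (trans (cong vec₀ (sym e)) vec-d₁)
        to-h : g ≡ α d₂ ⊎ Before M g (α d₂) → Before M' (ι g) (ι h)
        to-h (inj₁ e') = ⊥-elim (ne (trans (cong head e') (trans (head-α A₂) (trans (sym h₁) (cong head e)))))
        to-h (inj₂ b) = subst (Before M' (ι g)) (trans ια₂ (trans (sym ι₁) (cong ι e))) (v-chain b tg)
      go (inj₂ (inj₂ b)) = late (crossGH (to-h (before-α₂ Ag tg)))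
          (subst (0ℚ <_) (sym (w-cross H)) (pos-+
            (subst₂ (λ x y → 0ℚ < cross x y) vec-α₂ vh (ordered₀ Aα₂ Ah b'))
            (subst₂ (λ x y → 0ℚ < cross x y) vec-α₄ vh (ordered₀ Aα₄ Ah (O′.before-trans (subst₂ (Before M') (sym ια₄) (sym ια₂) α₄-α₂) b')))))
        where
        b' : Before M' (ι (α d₂)) (ι h)
        b' = subst (λ z → Before M' z (ι h)) (trans ι₁ (sym ια₂)) (unmerged refl b)
        to-h : g ≡ α d₂ ⊎ Before M g (α d₂) → Before M' (ι g) (ι h)
        to-h (inj₁ refl) = b'
        to-h (inj₂ c) = O′.before-trans (v-chain c tg) b'

    split-vc : Separated₄ (pε ε) c c v v
    split-vc = f , (x , x) , (x , x)
      where
      f : Point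
      f = negᵖ (perp cb)
      lin-f : ∀ z → lin f z ≡ cross cb z
      lin-f z = trans (solve 1 (λ x → x := :- (:- x)) refl (lin f z)) (trans (cong -_ (lin-perp-neg cb z)) (sym (cross-anti cb z)))
      x : 0ℚ < lin f (pε ε v -ᵖ pε ε c)
      x = subst (0ℚ <_) (sym (trans (linε f ε v c) (trans (cong₂ (λ x y → x + ε * (y * lin f w))
            (trans (cong (λ z → lin f (z -ᵖ p₀ c)) p₀-v) (lin-self f (p₀ c))) (cong₂ _-_ k-v (k-≢ (≢-sym v≢c))))
            (trans (solve 2 (λ ε l → con 0ℚ :+ ε :* ((con 1ℚ :- con 0ℚ) :* l) := ε :* l) refl ε (lin f w))
              (cong (ε *_) (trans (lin-f w) (trans (cross-w cb) (trans (cong (cross cb ca +_) (cross-self cb)) (ℚP.+-identityʳ _)))))))))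
          (pos-* 0<ε wide)

module SplitDrawn {D n F : ℕ} (M : Map D n F) (isMap : IsMap M) (red : Reducible M)
  (p' : Fin n → Point) (drawn' : Drawn (Contract.M' M isMap red) p') where
  open Contract M isMap red
  open ContractOrder M isMap red
  open Split M isMap red p' drawn'
  open Drawn drawn' using () renaming (hull to hull'; apart to apart'; distinct to distinct')
  open Perturb p₀ k w

  keep-apart : Fin D → Fin D → Bool
  keep-apart e f = (al e ∧ al f) ∧ ((not (rn (tail e) =ᶠ rn (tail f)) ∧ not (rn (tail e) =ᶠ rn (head f)))
    ∧ (not (rn (head e) =ᶠ rn (tail f)) ∧ not (rn (head e) =ᶠ rn (head f))))

  keep-distinct : Fin n → Fin n → Bool
  keep-distinct u t = (V u ∧ V t) ∧ not (rn u =ᶠ rn t)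

  not-= : ∀ {x y : Fin n} → not (x =ᶠ y) ≡ true → x ≢ y
  not-= h e = true≢false (=ᶠ-intro e) (not-elim h)

  V' : ∀ {u} → V u ≡ true → ′.V (rn u) ≡ true
  V' {u} Vu with eq? u v
  ... | inj₁ refl = subst (λ z → ′.V z ≡ true) (sym rn-v) (∖-intro {p = V} (tail-V A₁) (≢-sym v≢c))
  ... | inj₂ h = subst (λ z → ′.V z ≡ true) (sym (rn-≢ h)) (∖-intro {p = V} Vu h)

  apart₀ : ∀ {e f} → keep-apart e f ≡ true → Separated₄ p₀ (tail e) (head e) (tail f) (head f)
  apart₀ {e} {f} h = separated-cong {p = p'} (tail-ι Ae) (head-ι Ae) (tail-ι Af) (head-ι Af) (apart' (ι-A' Ae) (ι-A' Af)
      (λ q → not-= (∧-elim₁ (∧-elim₁ h')) (trans (sym (tail-ι Ae)) (trans q (tail-ι Af))))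
      (λ q → not-= (∧-elim₂ {not (rn (tail e) =ᶠ rn (tail f))} (∧-elim₁ h')) (trans (sym (tail-ι Ae)) (trans q (head-ι Af))))
      (λ q → not-= (∧-elim₁ (∧-elim₂ {x₁} h')) (trans (sym (head-ι Ae)) (trans q (tail-ι Af))))
      (λ q → not-= (∧-elim₂ {not (rn (head e) =ᶠ rn (tail f))} (∧-elim₂ {x₁} h')) (trans (sym (head-ι Ae)) (trans q (head-ι Af)))))
    where
    x₁ = not (rn (tail e) =ᶠ rn (tail f)) ∧ not (rn (tail e) =ᶠ rn (head f))
    h' = ∧-elim₂ {al e ∧ al f} h
    Ae = ∧-elim₁ {al e} (∧-elim₁ h)
    Af = ∧-elim₂ {al e} (∧-elim₁ h)

  distinct₀ : ∀ {u t} → keep-distinct u t ≡ true → Separated₄ p₀ u u t t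
  distinct₀ {u} {t} h = distinct' (V' (∧-elim₁ {V u} (∧-elim₁ h))) (V' (∧-elim₂ {V u} (∧-elim₁ h))) (not-= (∧-elim₂ {V u ∧ V t} h))

  ev-if : ∀ {b u₁ u₂ u₃ u₄} → (b ≡ true → Separated₄ p₀ u₁ u₂ u₃ u₄) → Eventually (λ ε → b ≡ true → Separated₄ (pε ε) u₁ u₂ u₃ u₄)
  ev-if {true} {u₁} {u₂} {u₃} {u₄} h = ev-map {λ ε → Separated₄ (pε ε) u₁ u₂ u₃ u₄} (λ _ _ s _ → s) (ev-separated (h refl))
  ev-if {false} h = ev-always λ _ _ ()

  Good : ℚ → Set
  Good ε = (∀ u₁ u₂ u₃ u₄ → 0ℚ < cross (p₀ u₂ -ᵖ p₀ u₁) (p₀ u₄ -ᵖ p₀ u₃) → 0ℚ < cross (pε ε u₂ -ᵖ pε ε u₁) (pε ε u₄ -ᵖ pε ε u₃))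
    × (∀ e f → keep-apart e f ≡ true → Separated₄ (pε ε) (tail e) (head e) (tail f) (head f))
    × (∀ u t → keep-distinct u t ≡ true → Separated₄ (pε ε) u u t t)

  good : Eventually Good
  good = ev-× (ev-∀ λ u₁ → ev-∀ λ u₂ → ev-∀ λ u₃ → ev-∀ λ u₄ → ev-cross? u₁ u₂ u₃ u₄)
    (ev-× (ev-∀ λ e → ev-∀ λ f → ev-if (apart₀ {e} {f})) (ev-∀ λ u → ev-∀ λ t → ev-if (distinct₀ {u} {t})))

  -- Outer corners are reflex, and the only reflex corner of v lies in the interior face Q.
  outer≢v : ∀ {d} → A d → face d ≡ outer → tail d ≢ v
  outer≢v Ad fd t = inner (trans (cong face (sym (root-unique Ad A₃ t (outer-ρ Ad fd) ρ₃))) fd)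

  outer-head≢v : ∀ {d} → A d → face d ≡ outer → head d ≢ v
  outer-head≢v Ad fd t = outer≢v (φA Ad) (trans (face-φ Ad) fd) (trans (tail-φ Ad) t)

  pos⇒nonneg : ∀ {x} → 0ℚ < x → 0ℚ ≤ x
  pos⇒nonneg = ℚP.<⇒≤

  nonneg-pos-+ : ∀ {x y} → 0ℚ ≤ x → 0ℚ < y → 0ℚ < x + y
  nonneg-pos-+ {x} {y} hx hy = subst (0ℚ <_) (ℚP.+-comm y x) (pos-+-nonneg hy hx)

  module At (ε : ℚ) (0<ε : 0ℚ < ε) (g : Good ε) where
    stable = proj₁ g

    CV : Fin n → Fin n → Fin n → Fin n → Set
    CV u₁ u₂ u₃ u₄ = 0ℚ < cross (pε ε u₂ -ᵖ pε ε u₁) (pε ε u₄ -ᵖ pε ε u₃)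

    cv : ∀ {u₁ u₂ u₃ u₄ t₁ t₂ t₃ t₄} → t₁ ≡ u₁ → t₂ ≡ u₂ → t₃ ≡ u₃ → t₄ ≡ u₄ → CV u₁ u₂ u₃ u₄ → CV t₁ t₂ t₃ t₄
    cv refl refl refl refl h = h

    ordered-ε : ∀ {e f} → Before M e f → CV (tail e) (head e) (tail f) (head f)
    ordered-ε {e} {f} bf with order bf
    ... | inj₁ b' = stable (tail e) (head e) (tail f) (head f) (ordered₀ (Order.A-left M isMap bf) (Order.A-right M isMap bf) b')
    ... | inj₂ (inj₁ (refl , refl)) = cv h₁ (head-α A₁) refl h₂ (merged₁ ε 0<ε)
    ... | inj₂ (inj₂ (refl , refl)) = cv h₃ (head-α A₃) refl h₄ (merged₃ ε 0<ε)

    -- The delicate case is v when c is an end of `d`: the value at ε = 0 vanishes, and the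
    -- coefficient of ε is the sum of the values of a and b. These are nonnegative, and not both
    -- zero because `d` has only two ends.
    hull-ε : ∀ {d u} → A d → face d ≡ outer → V u ≡ true → u ≢ tail d → u ≢ head d →
      0ℚ < cross (pε ε (head d) -ᵖ pε ε (tail d)) (pε ε u -ᵖ pε ε (tail d))
    hull-ε {d} {u} Ad fd Vu nt nh = by (eq? u v)
      where
      A'd : ′.A d
      A'd = mkA' Ad (λ e → inner (trans (sym e) fd))
      tv = outer≢v Ad fd
      hv = outer-head≢v Ad fd
      rt = rn-≢ tv
      rh = rn-≢ hv
      X : Fin n → ℚ
      X t = cross (p₀ (head d) -ᵖ p₀ (tail d)) (p₀ t -ᵖ p₀ (tail d))
      hull₀ : ∀ {t} → V t ≡ true → t ≢ v → t ≢ tail d → t ≢ head d → 0ℚ < X t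
      hull₀ {t} Vt tv' n₁ n₂ = subst (0ℚ <_) (cong (λ z → cross (p' z -ᵖ p₀ (tail d)) (p₀ t -ᵖ p₀ (tail d))) (head' Ad))
        (hull' A'd fd (V' Vt) (λ e → n₁ (trans (sym (rn-≢ tv')) (trans e rt))) (λ e → n₂ (trans (sym (rn-≢ tv')) (trans e (trans (head' Ad) rh)))))
      End : Fin n → Set
      End t = t ≡ tail d ⊎ t ≡ head d
      end? : ∀ t → End t ⊎ (t ≢ tail d × t ≢ head d)
      end? t with eq? t (tail d) | eq? t (head d)
      ... | inj₁ e | _ = inj₁ (inj₁ e)
      ... | inj₂ _ | inj₁ e = inj₁ (inj₂ e)
      ... | inj₂ n₁ | inj₂ n₂ = inj₂ (n₁ , n₂)
      end-0 : ∀ {t} → End t → X t ≡ 0ℚ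
      end-0 (inj₁ refl) = cross-null (p₀ (head d) -ᵖ p₀ (tail d)) (p₀ (tail d))
      end-0 (inj₂ refl) = cross-self (p₀ (head d) -ᵖ p₀ (tail d))
      pigeon : End a → End b → End c → ⊥
      pigeon (inj₁ e) (inj₁ e') _ = a≢b (trans e (sym e'))
      pigeon (inj₂ e) (inj₂ e') _ = a≢b (trans e (sym e'))
      pigeon (inj₁ e) (inj₂ e') (inj₁ e'') = a≢c (trans e (sym e''))
      pigeon (inj₁ e) (inj₂ e') (inj₂ e'') = c≢b (trans e'' (sym e'))
      pigeon (inj₂ e) (inj₁ e') (inj₁ e'') = c≢b (trans e'' (sym e'))
      pigeon (inj₂ e) (inj₁ e') (inj₂ e'') = a≢c (trans e (sym e''))
      Va = tail-V A₂
      Vb = tail-V A₄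
      Vc = tail-V A₁
      nonneg : ∀ t → V t ≡ true → t ≢ v → 0ℚ ≤ X t
      nonneg t Vt tv' = [ (λ e → ℚP.≤-reflexive (sym (end-0 e))) , (λ { (n₁ , n₂) → pos⇒nonneg (hull₀ Vt tv' n₁ n₂) }) ]′ (end? t)
      positive : End c → 0ℚ < X a + X b
      positive ec with end? a | end? b
      ... | inj₂ (n₁ , n₂) | _ = pos-+-nonneg (hull₀ Va (≢-sym v≢a) n₁ n₂) (nonneg b Vb b≢v)
      ... | inj₁ _ | inj₂ (n₁ , n₂) = nonneg-pos-+ (nonneg a Va (≢-sym v≢a)) (hull₀ Vb b≢v n₁ n₂)
      ... | inj₁ ea | inj₁ eb = ⊥-elim (pigeon ea eb ec)
      move-v : 0ℚ < cross (p₀ (head d) -ᵖ p₀ (tail d)) (p₀ v -ᵖ p₀ (tail d)) ⊎ End c →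
        0ℚ < cross (pε ε (head d) -ᵖ pε ε (tail d)) (pε ε v -ᵖ pε ε (tail d))
      move-v (inj₁ q) = stable (tail d) (head d) (tail d) v q
      move-v (inj₂ ec) = subst (0ℚ <_) (sym (trans (crossε ε (tail d) (head d) (tail d) v)
          (trans (cong₂ (λ x y → x + ε * y) (trans (cong (λ z → cross (p₀ (head d) -ᵖ p₀ (tail d)) (z -ᵖ p₀ (tail d))) p₀-v) (end-0 ec))
              (trans (cong₂ _+_ (cong (_* cross (p₀ (head d) -ᵖ p₀ (tail d)) w) (cong₂ _-_ k-v (k-≢ tv)))
                (cong (_* cross w (p₀ v -ᵖ p₀ (tail d))) (cong₂ _-_ (k-≢ hv) (k-≢ tv))))
                (trans (fin (cross (p₀ (head d) -ᵖ p₀ (tail d)) w) (cross w (p₀ v -ᵖ p₀ (tail d)))) (w-sum (p₀ (head d) -ᵖ p₀ (tail d)) (p₀ a) (p₀ b) (p₀ c) (p₀ (tail d))))))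
            (cong (λ z → 0ℚ + ε * ((X a - z) + (X b - z))) (end-0 ec)))))
          (subst (0ℚ <_) (sym (tidy ε (X a) (X b))) (pos-* 0<ε (positive ec)))
        where
        fin : ∀ x y → (1ℚ - 0ℚ) * x + (0ℚ - 0ℚ) * y ≡ x
        fin = solve 2 (λ x y → (con 1ℚ :- con 0ℚ) :* x :+ (con 0ℚ :- con 0ℚ) :* y := x) refl
        tidy : ∀ ε x y → 0ℚ + ε * ((x - 0ℚ) + (y - 0ℚ)) ≡ ε * (x + y)
        tidy = solve 3 (λ ε x y → con 0ℚ :+ ε :* ((x :- con 0ℚ) :+ (y :- con 0ℚ)) := ε :* (x :+ y)) refl
        w-sum : ∀ x a b c t → cross x (proj₁ (a -ᵖ c) + proj₁ (b -ᵖ c) , proj₂ (a -ᵖ c) + proj₂ (b -ᵖ c))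
          ≡ (cross x (a -ᵖ t) - cross x (c -ᵖ t)) + (cross x (b -ᵖ t) - cross x (c -ᵖ t))
        w-sum (x , x') (a , a') (b , b') (c , c') (t , t') = solve 10 (λ x x' a a' b b' c c' t t' →
          x :* ((a' :- c') :+ (b' :- c')) :- x' :* ((a :- c) :+ (b :- c)) :=
          ((x :* (a' :- t') :- x' :* (a :- t)) :- (x :* (c' :- t') :- x' :* (c :- t)))
          :+ ((x :* (b' :- t') :- x' :* (b :- t)) :- (x :* (c' :- t') :- x' :* (c :- t)))) refl x x' a a' b b' c c' t t'
      by : u ≡ v ⊎ u ≢ v → 0ℚ < cross (pε ε (head d) -ᵖ pε ε (tail d)) (pε ε u -ᵖ pε ε (tail d))
      by (inj₂ nv) = stable (tail d) (head d) (tail d) u (hull₀ Vu nv nt nh)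
      by (inj₁ refl) with end? c
      ... | inj₁ e = move-v (inj₂ e)
      ... | inj₂ (n₁ , n₂) = move-v (inj₁ (subst (λ z → 0ℚ < cross (p₀ (head d) -ᵖ p₀ (tail d)) (z -ᵖ p₀ (tail d))) (sym p₀-v)
              (hull₀ Vc (≢-sym v≢c) n₁ n₂)))

    pair : ∀ {e f} → A e → A f → head e ≢ head f → tail e ≢ tail f → rn (tail e) ≡ rn (tail f) →
      Separated₄ (pε ε) (tail e) (head e) (tail f) (head f)
    pair {e} {f} Ae Af nh nt r with rn-inv {tail e} {tail f} r
    ... | inj₁ q = ⊥-elim (nt q)
    ... | inj₂ (inj₁ (q , q')) = subst₂ (λ x y → Separated₄ (pε ε) x (head e) y (head f)) (sym q) (sym q') (split-pair ε 0<ε Ae Af q q' nh)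
    ... | inj₂ (inj₂ (q , q')) = separated-swap {p = pε ε} (subst₂ (λ x y → Separated₄ (pε ε) x (head f) y (head e)) (sym q') (sym q)
            (split-pair ε 0<ε Af Ae q' q (≢-sym nh)))

    -- If gluing identifies no ends of the two edges, their separation at ε = 0 persists. Otherwise
    -- one edge ends at v and the other at c, and reversing darts brings them into the form of
    -- `split-pair`.
    apart-ε : ∀ {e f} → A e → A f → tail e ≢ tail f → tail e ≢ head f → head e ≢ tail f → head e ≢ head f →
      Separated₄ (pε ε) (tail e) (head e) (tail f) (head f)
    apart-ε {e} {f} Ae Af tt th ht hh with eq? (rn (tail e)) (rn (tail f)) | eq? (rn (tail e)) (rn (head f))
      | eq? (rn (head e)) (rn (tail f)) | eq? (rn (head e)) (rn (head f))
    ... | inj₁ q | _ | _ | _ = pair Ae Af hh tt q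
    ... | inj₂ _ | inj₁ q | _ | _ = separated-right {p = pε ε} (subst (λ z → Separated₄ (pε ε) (tail e) (head e) (head f) z) (head-α Af)
            (pair Ae (αA Af) (λ x → ht (trans x (head-α Af))) th q))
    ... | inj₂ _ | inj₂ _ | inj₁ q | _ = separated-left {p = pε ε} (subst (λ z → Separated₄ (pε ε) (head e) z (tail f) (head f)) (head-α Ae)
            (pair (αA Ae) Af (λ x → th (trans (sym (head-α Ae)) x)) ht q))
    ... | inj₂ _ | inj₂ _ | inj₂ _ | inj₁ q = separated-left {p = pε ε} (separated-right {p = pε ε}
            (subst₂ (λ z z' → Separated₄ (pε ε) (head e) z (head f) z') (head-α Ae) (head-α Af)
            (pair (αA Ae) (αA Af) (λ x → tt (trans (sym (head-α Ae)) (trans x (head-α Af)))) hh q)))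
    ... | inj₂ q₁ | inj₂ q₂ | inj₂ q₃ | inj₂ q₄ = proj₁ (proj₂ g) e f (∧-intro (∧-intro Ae Af)
            (∧-intro (∧-intro (not-intro (=ᶠ-false q₁)) (not-intro (=ᶠ-false q₂))) (∧-intro (not-intro (=ᶠ-false q₃)) (not-intro (=ᶠ-false q₄)))))

    distinct-ε : ∀ {u t} → V u ≡ true → V t ≡ true → u ≢ t → Separated₄ (pε ε) u u t t
    distinct-ε {u} {t} Vu Vt ne with eq? (rn u) (rn t)
    ... | inj₂ q = proj₂ (proj₂ g) u t (∧-intro (∧-intro Vu Vt) (not-intro (=ᶠ-false q)))
    ... | inj₁ q with rn-inv {u} {t} q
    ...   | inj₁ e = ⊥-elim (ne e)
    ...   | inj₂ (inj₁ (refl , refl)) = separated-swap {p = pε ε} (split-vc ε 0<ε)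
    ...   | inj₂ (inj₂ (refl , refl)) = split-vc ε 0<ε

  drawn-at : ∀ ε → 0ℚ < ε → Good ε → Drawn M (pε ε)
  drawn-at ε 0<ε g = record { ordered = ordered-ε ; hull = hull-ε ; apart = apart-ε ; distinct = distinct-ε }
    where open At ε 0<ε g

  drawn : ∃ λ p → Drawn M p
  drawn = pε (proj₁ good) , drawn-at (proj₁ good) (proj₁ (proj₂ good)) (proj₂ (proj₂ good) (proj₁ good) (proj₁ (proj₂ good)) ℚP.≤-refl)

-- Ears of a triangulated polygon

-- An ear: a triangle x → a → y → x whose sides at a lie on the outer face.
record Ear {D n F : ℕ} (M : Map D n F) : Set where
  open Map M
  field
    t₁ : Fin D
    At₁ : A t₁
    inner : face t₁ ≢ outer
    out₁ : face (α t₁) ≡ outer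
    out₂ : face (α (φ t₁)) ≡ outer

module EarExists {D n F : ℕ} (M : Map D n F) (isMap : IsMap M)
  (noquad : ∀ {d} → Map.A M d → Map.face M d ≢ Map.outer M → Map.quad M (Map.face M d) ≡ false)
  {d₀ : Fin D} (A₀ : Map.A M d₀) (inner₀ : Map.face M d₀ ≢ Map.outer M) where
  open MapFacts M isMap

  φ³ : ∀ {d} → A d → face d ≢ outer → φ (φ (φ d)) ≡ d
  φ³ Ad nd = proj₁ (tri Ad nd (noquad Ad nd))

  root-outer : ∀ {r} → A r → ρ r ≡ true → face r ≡ outer
  root-outer {r} Ar ρr with eq? (face r) outer
  ... | inj₁ e = e
  ... | inj₂ h = ⊥-elim (true≢false (inner-root-quad Ar ρr h) (noquad Ar h))

  -- If both sides of an edge were outer, that edge would be the whole graph.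
  other-side : ∀ {d} → A d → face d ≡ outer → face (α d) ≢ outer
  other-side {d} Ad fd fα = by (∨-elim (conn W closed (tail-V Ad) (tail-V A₀) (∨-intro₁ (=ᶠ-refl (tail d)))))
    where
    W : Fin n → Bool
    W u = (u =ᶠ tail d) ∨ (u =ᶠ head d)
    fixed : ∀ {e} → A e → face e ≡ outer → face (α e) ≡ outer → ∀ {f} → A f → tail f ≡ tail e → f ≡ e
    fixed {e} Ae fe fαe {f} Af t = orbit-ind (_≡ e) Ae Af (sym t)
      (λ { _ _ refl → root-unique (σA Ae) Ae (tail-σ Ae) (outer-ρ (σA Ae) (trans (face-σ Ae) fαe)) (outer-ρ Ae fe) }) refl
    at-tail : ∀ {f} → A f → tail f ≡ tail d → f ≡ d
    at-tail = fixed Ad fd fα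
    at-head : ∀ {f} → A f → tail f ≡ head d → f ≡ α d
    at-head = fixed (αA Ad) fα (trans (cong face (αα Ad)) fd)
    closed : ∀ {f} → A f → W (tail f) ≡ true → W (head f) ≡ true
    closed {f} Af h with ∨-elim {tail f =ᶠ tail d} h
    ... | inj₁ e = ∨-intro₂ {head f =ᶠ tail d} (=ᶠ-intro (cong head (at-tail Af (=ᶠ-true (tail f) (tail d) e))))
    ... | inj₂ e = ∨-intro₁ (=ᶠ-intro (trans (cong head (at-head Af (=ᶠ-true (tail f) (head d) e))) (head-α Ad)))
    by : (tail d₀ =ᶠ tail d) ≡ true ⊎ (tail d₀ =ᶠ head d) ≡ true → ⊥
    by (inj₁ e) = inner₀ (trans (cong face (at-tail A₀ (=ᶠ-true (tail d₀) (tail d) e))) fd)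
    by (inj₂ e) = inner₀ (trans (cong face (at-head A₀ (=ᶠ-true (tail d₀) (head d) e))) fα)

  ear? : Fin D → Bool
  ear? t = al t ∧ (not (face t =ᶠ outer) ∧ ((face (α t) =ᶠ outer) ∧ (face (α (φ t)) =ᶠ outer)))

  O I : Fin D → Bool
  O d = al d ∧ (face d =ᶠ outer)
  I d = al d ∧ not (face d =ᶠ outer)
  Ts : Fin F → Bool
  Ts = Fc ∖ outer

  V≤O : # V ≤ℕ # O
  V≤O = #-surj O V tail λ u Vu → let (d , Ad , td) = V-tail Vu ; (r , Ar , tr , ρr) = root Ad in
    r , ∧-intro Ar (=ᶠ-intro (root-outer Ar ρr)) , trans tr td

  three : ∀ f → Ts f ≡ true → 3 ≤ℕ # (λ d → I d ∧ (face d =ᶠ f))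
  three f h with ∖-elim {p = Fc} {outer} {f} h
  ... | Ff , nf with Fc-face Ff
  ...   | d , Ad , refl = #-list-≥ {ys = d ∷ φ d ∷ φ (φ d) ∷ []} (λ e → I e ∧ (face e =ᶠ f))
        ((λ { (here e) → tail-φ≢ Ad (cong tail (sym e)) ; (there (here e)) → tail-φ≢ B₂ (trans (cong tail (φ³ Ad nf)) (cong tail e)) })
            ∷ (λ { (here e) → tail-φ≢ B₁ (cong tail (sym e)) }) ∷ (λ ()) ∷ [])
        (λ { (here refl) → mk Ad refl ; (there (here refl)) → mk B₁ (face-φ Ad) ; (there (there (here refl))) → mk B₂ (trans (face-φ B₁) (face-φ Ad)) })
    where
    B₁ = φA Ad
    B₂ = φA B₁
    mk : ∀ {e} → A e → face e ≡ face d → I e ∧ (face e =ᶠ face d) ≡ true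
    mk Ae fe = ∧-intro (∧-intro Ae (not-intro (=ᶠ-false λ q → nf (trans (sym fe) q)))) (=ᶠ-intro fe)

  -- Each vertex has its reflex corner in the outer face, so the number of vertices is at most the
  -- number O of outer darts. With T triangles of three darts each, Euler's formula gives O + 3T + 4
  -- ≤ 2 (O + T + 1).
  many-outer : # Ts +ℕ 2 ≤ℕ # O
  many-outer = ℕP.+-cancelʳ-≤ (# O +ℕ 2 *ℕ # Ts +ℕ 2) _ _ (subst₂ _≤ℕ_ (arith₁ (# O) (# Ts)) (arith₂ (# O) (# Ts))
    (ℕP.≤-trans (ℕP.+-monoˡ-≤ 4 (ℕP.≤-trans (ℕP.+-monoʳ-≤ (# O) (#-fibres 3 I Ts face three)) (ℕP.≤-reflexive (sym (#-split al (λ d → face d =ᶠ outer))))))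
      (ℕP.≤-trans (ℕP.≤-reflexive (sym euler)) (ℕP.*-monoʳ-≤ 2 (ℕP.+-mono-≤ V≤O (ℕP.≤-reflexive (#-remove Fc outer outer-Fc)))))))
    where
    arith₁ : ∀ o t → o +ℕ 3 *ℕ t +ℕ 4 ≡ (t +ℕ 2) +ℕ (o +ℕ 2 *ℕ t +ℕ 2)
    arith₁ = solve-∀
    arith₂ : ∀ o t → 2 *ℕ (o +ℕ suc t) ≡ o +ℕ (o +ℕ 2 *ℕ t +ℕ 2)
    arith₂ = solve-∀

  -- Outer darts outnumber triangles, so two of them border the same triangle. Two sides of a
  -- triangle are consecutive, and they form the ear.
  ear : Ear M
  ear with search ear?
  ... | inj₁ (t , h) = record
    { t₁ = t ; At₁ = ∧-elim₁ {al t} h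
    ; inner = λ e → true≢false (=ᶠ-intro e) (not-elim (∧-elim₁ {not (face t =ᶠ outer)} (∧-elim₂ {al t} h)))
    ; out₁ = =ᶠ-true (face (α t)) outer (∧-elim₁ {face (α t) =ᶠ outer} (∧-elim₂ {not (face t =ᶠ outer)} (∧-elim₂ {al t} h)))
    ; out₂ = =ᶠ-true (face (α (φ t))) outer (∧-elim₂ {face (α t) =ᶠ outer} (∧-elim₂ {not (face t =ᶠ outer)} (∧-elim₂ {al t} h))) }
  ... | inj₂ none = ⊥-elim (ℕP.1+n≰n (ℕP.≤-trans (ℕP.≤-reflexive (ℕP.+-comm 1 (# Ts))) (ℕP.≤-trans (ℕP.+-monoʳ-≤ (# Ts) (s≤s {0} {1} z≤n))
      (ℕP.≤-trans many-outer (#-inj O Ts (λ d _ → face (α d))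
        (λ d h → ∖-intro {p = Fc} (face-Fc (αA (∧-elim₁ {al d} h))) (other-side (∧-elim₁ {al d} h) (fo h)))
        (λ x y hx hy e → same (∧-elim₁ {al x} hx) (∧-elim₁ {al y} hy) (fo hx) (fo hy) e))))))
    where
    fo : ∀ {d} → O d ≡ true → face d ≡ outer
    fo {d} h = =ᶠ-true (face d) outer (∧-elim₂ {al d} h)
    mk : ∀ {t} → A t → face t ≢ outer → face (α t) ≡ outer → face (α (φ t)) ≡ outer → ⊥
    mk {t} At nt e₁ e₂ = true≢false (∧-intro At (∧-intro (not-intro (=ᶠ-false nt)) (∧-intro (=ᶠ-intro e₁) (=ᶠ-intro e₂)))) (none t)
    same : ∀ {x y} → A x → A y → face x ≡ outer → face y ≡ outer → face (α x) ≡ face (α y) → x ≡ y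
    same {x} {y} Ax Ay fx fy e with face-orbit (αA Ax) (αA Ay) e (other-side Ax fx)
    ... | inj₁ q = trans (sym (αα Ax)) (trans (cong α (sym q)) (αα Ay))
    ... | inj₂ (inj₁ q) = ⊥-elim (mk (αA Ax) (other-side Ax fx) (trans (cong face (αα Ax)) fx) (trans (cong (face ∘ α) (sym q)) (trans (cong face (αα Ay)) fy)))
    ... | inj₂ (inj₂ (inj₂ q)) = trans (sym (αα Ax)) (trans (cong α (sym (trans q (φ³ (αA Ax) (other-side Ax fx))))) (αα Ay))
    ... | inj₂ (inj₂ (inj₁ q)) = ⊥-elim (mk (αA Ay) (other-side Ay fy) (trans (cong face (αα Ay)) fy)
            (trans (cong (face ∘ α) (trans (cong φ q) (φ³ (αA Ax) (other-side Ax fx)))) (trans (cong face (αα Ax)) fx)))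

-- Cutting off an ear

-- Removing an ear: the vertex a, the triangle and the outer dart a → x disappear; y → a becomes the outer dart y → x.
module RemoveEar {D n F : ℕ} (M : Map D n F) (isMap : IsMap M) (ear : Ear M)
  (noquad : ∀ {d} → Map.A M d → Map.face M d ≢ Map.outer M → Map.quad M (Map.face M d) ≡ false) where
  open MapFacts M isMap public
  open Ear ear public

  t₂ t₃ o₁ o₂ s : Fin D
  t₂ = φ t₁
  t₃ = φ t₂
  o₁ = α t₁
  o₂ = α t₂
  s = α t₃

  f₀ : Fin F
  f₀ = face t₁

  At₂ : A t₂
  At₂ = φA At₁
  At₃ : A t₃
  At₃ = φA At₂
  Ao₁ : A o₁
  Ao₁ = αA At₁
  Ao₂ : A o₂
  Ao₂ = αA At₂
  As : A s
  As = αA At₃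

  φ³ : ∀ {d} → A d → face d ≢ outer → φ (φ (φ d)) ≡ d
  φ³ Ad nd = proj₁ (tri Ad nd (noquad Ad nd))

  φ₃ : φ t₃ ≡ t₁
  φ₃ = φ³ At₁ inner

  ff₂ : face t₂ ≡ f₀
  ff₂ = face-φ At₁
  ff₃ : face t₃ ≡ f₀
  ff₃ = trans (face-φ At₂) ff₂

  x a y : Fin n
  x = tail t₁
  a = tail t₂
  y = tail t₃

  hd₁ : head t₁ ≡ a
  hd₁ = sym (tail-φ At₁)
  hd₂ : head t₂ ≡ y
  hd₂ = sym (tail-φ At₂)
  hd₃ : head t₃ ≡ x
  hd₃ = trans (sym (tail-φ At₃)) (cong tail φ₃)

  a≢x : a ≢ x
  a≢x = tail-φ≢ At₁
  y≢a : y ≢ a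
  y≢a = tail-φ≢ At₂
  x≢y : x ≢ y
  x≢y e = tail-φ≢ At₃ (trans (cong tail φ₃) e)

  in-f₀ : ∀ {d} → A d → face d ≡ f₀ → d ≡ t₁ ⊎ d ≡ t₂ ⊎ d ≡ t₃
  in-f₀ Ad fd with face-orbit At₁ Ad (sym fd) inner
  ... | inj₁ e = inj₁ e
  ... | inj₂ (inj₁ e) = inj₂ (inj₁ e)
  ... | inj₂ (inj₂ (inj₁ e)) = inj₂ (inj₂ e)
  ... | inj₂ (inj₂ (inj₂ e)) = inj₁ (trans e φ₃)

  ho₁ : head o₁ ≡ x
  ho₁ = head-α At₁
  ho₂ : head o₂ ≡ a
  ho₂ = head-α At₂
  hs : head s ≡ y
  hs = head-α At₃

  -- Both darts start at a and have the outer face, so both corners are reflex. Since a has only one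
  -- reflex corner they agree, and a has degree two.
  o₂-o₁ : φ o₂ ≡ o₁
  o₂-o₁ = root-unique (φA Ao₂) Ao₁ (trans (tail-φ Ao₂) (trans ho₂ (sym hd₁))) (outer-ρ (φA Ao₂) (trans (face-φ Ao₂) out₂)) (outer-ρ Ao₁ out₁)

  σt₂ : σ t₂ ≡ o₁
  σt₂ = o₂-o₁
  σo₁ : σ o₁ ≡ t₂
  σo₁ = cong φ (αα At₁)
  σo₂ : σ o₂ ≡ t₃
  σo₂ = cong φ (αα At₂)
  σs : σ s ≡ t₁
  σs = trans (cong φ (αα At₃)) φ₃

  at-a : ∀ {d} → A d → tail d ≡ a → d ≡ o₁ ⊎ d ≡ t₂
  at-a {d} Ad td = orbit-ind (λ z → z ≡ o₁ ⊎ z ≡ t₂) At₂ Ad (sym td)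
    (λ { _ _ (inj₁ refl) → inj₂ σo₁ ; _ _ (inj₂ refl) → inj₁ σt₂ }) (inj₂ refl)

  s≢o₂ : s ≢ o₂
  s≢o₂ e = x≢y (trans (sym hd₃) (trans (cong tail e) hd₂))
  s≢o₁ : s ≢ o₁
  s≢o₁ e = a≢x (trans (sym hd₁) (trans (cong tail (sym e)) hd₃))
  o₁≢o₂ : o₁ ≢ o₂
  o₁≢o₂ e = y≢a (trans (sym hd₂) (trans (cong tail (sym e)) hd₁))
  o₂≢o₁ : o₂ ≢ o₁
  o₂≢o₁ = ≢-sym o₁≢o₂

  s-f₀ : face s ≢ f₀
  s-f₀ e with in-f₀ As e
  ... | inj₁ q = y≢a (trans (sym hs) (trans (cong head q) hd₁))
  ... | inj₂ (inj₁ q) = a≢x (trans (cong tail (sym q)) hd₃)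
  ... | inj₂ (inj₂ q) = x≢y (trans (sym hd₃) (cong tail q))

  o₁-f₀ : face o₁ ≢ f₀
  o₁-f₀ e = inner (trans (sym e) out₁)
  o₂-f₀ : face o₂ ≢ f₀
  o₂-f₀ e = inner (trans (sym e) out₂)

  α-inj : ∀ {d e} → A d → A e → α d ≡ α e → d ≡ e
  α-inj Ad Ae q = trans (sym (αα Ad)) (trans (cong α q) (αα Ae))

  abstract
    -- The dart `o₂` from y to a is reused as the outer dart from y to x, so it becomes the partner
    -- of `s`, and the outer walk skips `o₁` after it. `ι` sends `t₃` and `t₁` to the surviving
    -- darts next to which they stood in the rotations at y and x.
    glue φ' ι : Fin D → Fin D
    glue z = if z =ᶠ o₂ then s else if z =ᶠ s then o₂ else α z
    φ' z = if z =ᶠ o₂ then φ o₁ else φ z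
    ι z = if z =ᶠ t₃ then o₂ else if z =ᶠ t₁ then s else z

    glue-o₂ : glue o₂ ≡ s
    glue-o₂ rewrite =ᶠ-refl o₂ = refl
    glue-s : glue s ≡ o₂
    glue-s rewrite =ᶠ-false s≢o₂ | =ᶠ-refl s = refl
    glue-≢ : ∀ {z} → z ≢ o₂ → z ≢ s → glue z ≡ α z
    glue-≢ p q rewrite =ᶠ-false p | =ᶠ-false q = refl
    φ'-o₂ : φ' o₂ ≡ φ o₁
    φ'-o₂ rewrite =ᶠ-refl o₂ = refl
    φ'-≢ : ∀ {z} → z ≢ o₂ → φ' z ≡ φ z
    φ'-≢ p rewrite =ᶠ-false p = refl
    ι-t₃ : ι t₃ ≡ o₂
    ι-t₃ rewrite =ᶠ-refl t₃ = refl
    ι-t₁ : ι t₁ ≡ s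
    ι-t₁ rewrite =ᶠ-false {a = t₁} {t₃} (λ e → x≢y (cong tail e)) | =ᶠ-refl t₁ = refl
    ι-≢ : ∀ {z} → z ≢ t₃ → z ≢ t₁ → ι z ≡ z
    ι-≢ p q rewrite =ᶠ-false p | =ᶠ-false q = refl

  M' : Map D n F
  M' = record
    { al = λ z → al z ∧ (not (face z =ᶠ f₀) ∧ not (z =ᶠ o₁))
    ; V = V ∖ a ; Fc = Fc ∖ f₀ ; α = glue ; φ = φ' ; tail = tail ; face = face ; ρ = ρ ; quad = quad ; outer = outer }

  module ′ = Map M'

  A' : ∀ {z} → ′.A z → A z
  A' = ∧-elim₁

  A'-f₀ : ∀ {z} → ′.A z → face z ≢ f₀
  A'-f₀ {z} h e = true≢false (=ᶠ-intro e) (not-elim (∧-elim₁ {not (face z =ᶠ f₀)} (∧-elim₂ {al z} h)))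

  A'-o₁ : ∀ {z} → ′.A z → z ≢ o₁
  A'-o₁ {z} h e = true≢false (=ᶠ-intro e) (not-elim (∧-elim₂ {not (face z =ᶠ f₀)} (∧-elim₂ {al z} h)))

  mkA' : ∀ {z} → A z → face z ≢ f₀ → z ≢ o₁ → ′.A z
  mkA' Az p q = ∧-intro Az (∧-intro (not-intro (=ᶠ-false p)) (not-intro (=ᶠ-false q)))

  A'o₂ : ′.A o₂
  A'o₂ = mkA' Ao₂ o₂-f₀ o₂≢o₁
  A's : ′.A s
  A's = mkA' As s-f₀ s≢o₁

  A'-a : ∀ {z} → ′.A z → tail z ≢ a
  A'-a h t with at-a (A' h) t
  ... | inj₁ e = A'-o₁ h e
  ... | inj₂ e = A'-f₀ h (trans (cong face e) ff₂)

  α-f₀ : ∀ {z} → A z → face (α z) ≡ f₀ → z ≡ o₁ ⊎ z ≡ o₂ ⊎ z ≡ s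
  α-f₀ Az e with in-f₀ (αA Az) e
  ... | inj₁ q = inj₁ (trans (sym (αα Az)) (cong α q))
  ... | inj₂ (inj₁ q) = inj₂ (inj₁ (trans (sym (αα Az)) (cong α q)))
  ... | inj₂ (inj₂ q) = inj₂ (inj₂ (trans (sym (αα Az)) (cong α q)))

  ι-A' : ∀ {z} → A z → tail z ≢ a → ′.A (ι z)
  ι-A' {z} Az na with eq? z t₃ | eq? z t₁
  ... | inj₁ refl | _ = subst ′.A (sym ι-t₃) A'o₂
  ... | inj₂ _ | inj₁ refl = subst ′.A (sym ι-t₁) A's
  ... | inj₂ p | inj₂ q = subst ′.A (sym (ι-≢ p q)) (mkA' Az (λ e → case in-f₀ Az e of λ
          { (inj₁ k) → q k ; (inj₂ (inj₁ k)) → na (cong tail k) ; (inj₂ (inj₂ k)) → p k }) (λ e → na (trans (cong tail e) hd₁)))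

  tail-ι : ∀ z → tail (ι z) ≡ tail z
  tail-ι z with eq? z t₃ | eq? z t₁
  ... | inj₁ refl | _ = trans (cong tail ι-t₃) hd₂
  ... | inj₂ _ | inj₁ refl = trans (cong tail ι-t₁) hd₃
  ... | inj₂ p | inj₂ q = cong tail (ι-≢ p q)

  head'-o₂ : ′.head o₂ ≡ x
  head'-o₂ = trans (cong tail glue-o₂) hd₃

  head' : ∀ {z} → z ≢ o₂ → ′.head z ≡ head z
  head' {z} p with eq? z s
  ... | inj₁ refl = trans (cong tail glue-s) (trans hd₂ (sym hs))
  ... | inj₂ q = cong tail (glue-≢ p q)

  head-ι : ∀ {d} → A d → tail d ≢ a → head d ≢ a → ′.head (ι d) ≡ head d
  head-ι {d} Ad ta ha with eq? d t₃ | eq? d t₁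
  ... | inj₁ refl | _ = trans (cong ′.head ι-t₃) (trans head'-o₂ (sym hd₃))
  ... | inj₂ _ | inj₁ refl = ⊥-elim (ha hd₁)
  ... | inj₂ p | inj₂ q = trans (cong ′.head (ι-≢ p q)) (head' λ { refl → ha ho₂ })

  id-ι : ∀ {z} → ′.A z → ι z ≡ z
  id-ι h = ι-≢ (λ { refl → A'-f₀ h ff₃ }) (λ { refl → A'-f₀ h refl })

  data ι-Step (z : Fin D) : Set where
    moves : ′.σ (ι z) ≡ ι (σ z) → ι (σ z) ≡ σ z → ι-Step z
    stays-o₂ : z ≡ o₂ → ι-Step z
    stays-s : z ≡ s → ι-Step z

  ι-step : ∀ {z} → A z → tail z ≢ a → ι-Step z
  ι-step {z} Az na with eq? z o₂ | eq? z s
  ... | inj₁ e | _ = stays-o₂ e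
  ... | inj₂ _ | inj₁ e = stays-s e
  ... | inj₂ p | inj₂ q = moves (trans (lhs (eq? z t₃) (eq? z t₁)) (sym ισ)) ισ
    where
    fα : face (α z) ≢ f₀
    fα e with α-f₀ Az e
    ... | inj₁ k = na (trans (cong tail k) hd₁)
    ... | inj₂ (inj₁ k) = p k
    ... | inj₂ (inj₂ k) = q k
    ισ : ι (σ z) ≡ σ z
    ισ = ι-≢ (λ e → fα (trans (sym (face-σ Az)) (trans (cong face e) ff₃))) (λ e → fα (trans (sym (face-σ Az)) (cong face e)))
    lhs : z ≡ t₃ ⊎ z ≢ t₃ → z ≡ t₁ ⊎ z ≢ t₁ → ′.σ (ι z) ≡ σ z
    lhs (inj₁ refl) _ = trans (cong ′.σ ι-t₃) (trans (cong φ' glue-o₂) (φ'-≢ s≢o₂))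
    lhs (inj₂ _) (inj₁ refl) = trans (cong ′.σ ι-t₁) (trans (cong φ' glue-s) φ'-o₂)
    lhs (inj₂ k) (inj₂ l) = trans (cong ′.σ (ι-≢ k l)) (trans (cong φ' (glue-≢ p q)) (φ'-≢ λ e → na (cong tail (α-inj Az At₂ e))))

  ι-stay-o₂ : ι (σ o₂) ≡ ι o₂
  ι-stay-o₂ = trans (cong ι σo₂) (trans ι-t₃ (sym (id-ι A'o₂)))
  ι-stay-s : ι (σ s) ≡ ι s
  ι-stay-s = trans (cong ι σs) (trans ι-t₁ (sym (id-ι A's)))

  orbit' : ∀ {z w} → ′.A z → ′.A w → tail z ≡ tail w → Star ′.σ z w
  orbit' {z} {w} Az Aw t = subst (Star ′.σ z) (id-ι Aw) (orbit-ind (λ k → Star ′.σ z (ι k)) (A' Az) (A' Aw) t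
    (λ {k} Ak tk p → case ι-step Ak (λ e → A'-a Az (trans (sym tk) e)) of λ
      { (moves e _) → subst (Star ′.σ z) e (next p)
      ; (stays-o₂ refl) → subst (Star ′.σ z) (sym ι-stay-o₂) p
      ; (stays-s refl) → subst (Star ′.σ z) (sym ι-stay-s) p })
    (subst (Star ′.σ z) (sym (id-ι Az)) stop))

  inner≢o₂ : ∀ {d} → face d ≢ outer → d ≢ o₂
  inner≢o₂ h refl = h out₂

  φ'-inner : ∀ {d} → A d → face d ≢ outer → φ' d ≡ φ d × φ' (φ' d) ≡ φ (φ d) × φ' (φ' (φ' d)) ≡ φ (φ (φ d))
  φ'-inner {d} Ad nd = e₁ , e₂ , trans (cong φ' e₂) (φ'-≢ (inner≢o₂ (λ e → nd (trans (sym (face-φ Ad)) (trans (sym (face-φ (φA Ad))) e)))))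
    where
    e₁ = φ'-≢ (inner≢o₂ nd)
    e₂ = trans (cong φ' e₁) (φ'-≢ (inner≢o₂ (λ e → nd (trans (sym (face-φ Ad)) e))))

  root-outer : ∀ {r} → A r → ρ r ≡ true → face r ≡ outer
  root-outer {r} Ar ρr with eq? (face r) outer
  ... | inj₁ e = e
  ... | inj₂ h = ⊥-elim (true≢false (inner-root-quad Ar ρr h) (noquad Ar h))

  #al : # al ≡ # ′.al +ℕ 4
  #al = trans (#-remove al t₁ At₁) (trans (cong suc (trans (#-remove (al ∖ t₁) t₂ b₂) (cong suc (trans (#-remove (al ∖ t₁ ∖ t₂) t₃ b₃)
      (cong suc (#-remove (al ∖ t₁ ∖ t₂ ∖ t₃) o₁ b₄)))))) (trans (cong (λ z → suc (suc (suc (suc z)))) (#-cong {p = al ∖ t₁ ∖ t₂ ∖ t₃ ∖ o₁} {′.al} same)) (ℕP.+-comm 4 _)))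
    where
    b₂ : (al ∖ t₁) t₂ ≡ true
    b₂ = ∖-intro {p = al} At₂ (λ e → a≢x (cong tail e))
    b₃ : (al ∖ t₁ ∖ t₂) t₃ ≡ true
    b₃ = ∖-intro {p = al ∖ t₁} (∖-intro {p = al} At₃ (λ e → x≢y (cong tail (sym e)))) (λ e → y≢a (cong tail e))
    b₄ : (al ∖ t₁ ∖ t₂ ∖ t₃) o₁ ≡ true
    b₄ = ∖-intro {p = al ∖ t₁ ∖ t₂} (∖-intro {p = al ∖ t₁} (∖-intro {p = al} Ao₁ (λ e → o₁-f₀ (cong face e))) (λ e → o₁-f₀ (trans (cong face e) ff₂)))
      (λ e → o₁-f₀ (trans (cong face e) ff₃))
    same : ∀ z → (al ∖ t₁ ∖ t₂ ∖ t₃ ∖ o₁) z ≡ ′.al z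
    same z = bool-ext
      (λ h → let (k₄ , n₄) = ∖-elim {p = al ∖ t₁ ∖ t₂ ∖ t₃} h ; (k₃ , n₃) = ∖-elim {p = al ∖ t₁ ∖ t₂} k₄ ; (k₂ , n₂) = ∖-elim {p = al ∖ t₁} k₃
                 (k₁ , n₁) = ∖-elim {p = al} k₂ in mkA' k₁ (λ f → case in-f₀ k₁ f of λ
                   { (inj₁ e) → n₁ e ; (inj₂ (inj₁ e)) → n₂ e ; (inj₂ (inj₂ e)) → n₃ e }) n₄)
      (λ h → ∖-intro {p = al ∖ t₁ ∖ t₂ ∖ t₃} (∖-intro {p = al ∖ t₁ ∖ t₂} (∖-intro {p = al ∖ t₁} (∖-intro {p = al} (A' h)
        (λ { refl → A'-f₀ h refl })) (λ { refl → A'-f₀ h ff₂ })) (λ { refl → A'-f₀ h ff₃ })) (A'-o₁ h))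

  #V : # V ≡ suc (# ′.V)
  #V = #-remove V a (tail-V At₂)
  #Fc : # Fc ≡ suc (# ′.Fc)
  #Fc = #-remove Fc f₀ (face-Fc At₁)

  outer-return' : ∀ {d} → ′.A d → face d ≡ outer → Star φ' (φ' d) d
  outer-return' {d} Ad fd = proj₁ (proj₂ (star-ind P step start (outer-return (A' Ad) fd))) (A'-o₁ Ad)
    where
    P : Fin D → Set
    -- While the old walk stands on `o₁`, the new one is still at `o₂`; if the walk began with `d`
    -- equal to `o₂`, the new one starts right behind, at `φ o₁`.
    P z = A z × (z ≢ o₁ → Star φ' (φ' d) z) × (z ≡ o₁ → Star φ' (φ' d) o₂ ⊎ φ' d ≡ φ o₁)
    back : ∀ {z} → A z → φ z ≡ o₁ → z ≡ o₂
    back {z} Az e with at-a (αA Az) (trans (sym (tail-φ Az)) (trans (cong tail e) hd₁))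
    ... | inj₁ q = ⊥-elim (x≢t₁ (α-inj Az At₁ q))
      where
      x≢t₁ : z ≢ t₁
      x≢t₁ refl = o₁-f₀ (trans (cong face (sym e)) ff₂)
    ... | inj₂ q = trans (sym (αα Az)) (cong α q)
    start : P (φ d)
    start = φA (A' Ad)
      , (λ n → subst (Star φ' (φ' d)) (φ'-≢ (λ { refl → n o₂-o₁ })) stop)
      , (λ e → inj₂ (trans (cong φ' (back (A' Ad) e)) φ'-o₂))
    step : ∀ z → P z → P (φ z)
    step z (Az , p , q) with eq? z o₁
    ... | inj₁ refl = φA Az , (λ _ → [ (λ st → subst (Star φ' (φ' d)) φ'-o₂ (next st)) , (λ e → subst (Star φ' (φ' d)) e stop) ]′ (q refl))
                    , (λ e → ⊥-elim (o₁≢o₂ (back Az e)))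
    ... | inj₂ n = φA Az , (λ k → subst (Star φ' (φ' d)) (φ'-≢ (λ { refl → k o₂-o₁ })) (next (p n)))
                 , (λ e → inj₁ (subst (Star φ' (φ' d)) (back Az e) (p n)))

  isMap' : IsMap M'
  isMap' = record
    { αA = αA'
    ; φA = φA'
    ; αα = αα'
    ; tail-φ = tail-φ'
    ; face-φ = face-φ'
    ; orbit = orbit'
    ; tail-V = λ h → ∖-intro {p = V} (tail-V (A' h)) (A'-a h)
    ; face-Fc = λ h → ∖-intro {p = Fc} (face-Fc (A' h)) (A'-f₀ h)
    ; V-tail = λ {u} h → let (Vu , nu) = ∖-elim {p = V} h ; (d , Ad , td) = V-tail Vu in
        ι d , ι-A' Ad (λ e → nu (trans (sym td) e)) , trans (tail-ι d) td
    ; Fc-face = λ {f} h → Fc-face' h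
    ; outer-Fc = ∖-intro {p = Fc} outer-Fc (≢-sym inner)
    ; tri = λ h nd q → trans (proj₂ (proj₂ (φ'-inner (A' h) nd))) (proj₁ (tri (A' h) nd q)) , proj₂ (tri (A' h) nd q)
    ; quad-φ = λ h nd q → ⊥-elim (true≢false q (noquad (A' h) nd))
    ; quad-root = λ h nd q → ⊥-elim (true≢false q (noquad (A' h) nd))
    ; face-root = λ h k → face-root (A' h) (A' k)
    ; face-orbit = λ h k e nd → let (e₁ , e₂ , e₃) = φ'-inner (A' h) nd in
        subst₂ (λ p q → _ ≡ _ ⊎ _ ≡ p ⊎ _ ≡ q ⊎ _ ≡ φ' (φ' (φ' _))) (sym e₁) (sym e₂)
          (subst (λ r → _ ≡ _ ⊎ _ ≡ φ _ ⊎ _ ≡ φ (φ _) ⊎ _ ≡ r) (sym e₃) (face-orbit (A' h) (A' k) e nd))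
    ; outer-ρ = λ h → outer-ρ (A' h)
    ; outer-return = outer-return'
    ; root-unique = λ h k → root-unique (A' h) (A' k)
    ; root = λ h → let (r , Ar , tr , ρr) = root (A' h) in
        r , mkA' Ar (λ e → inner (trans (sym e) (root-outer Ar ρr))) (λ e → A'-a h (trans (sym tr) (trans (cong tail e) hd₁))) , tr , ρr
    ; noloop = noloop'
    ; nomulti = nomulti'
    ; conn = conn'
    ; euler = ℕP.+-cancelʳ-≡ 4 _ _ (trans (arith (# ′.V) (# ′.Fc)) (trans (cong (2 *ℕ_) (sym (cong₂ _+ℕ_ #V #Fc)))
        (trans euler (cong (_+ℕ 4) #al))))
    }
    where
    arith : ∀ a b → 2 *ℕ (a +ℕ b) +ℕ 4 ≡ 2 *ℕ (suc a +ℕ suc b)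
    arith = solve-∀
    αA' : ∀ {z} → ′.A z → ′.A (glue z)
    αA' {z} h with eq? z o₂ | eq? z s
    ... | inj₁ refl | _ = subst ′.A (sym glue-o₂) A's
    ... | inj₂ _ | inj₁ refl = subst ′.A (sym glue-s) A'o₂
    ... | inj₂ p | inj₂ q = subst ′.A (sym (glue-≢ p q)) (mkA' (αA (A' h)) (λ e → case α-f₀ (A' h) e of λ
            { (inj₁ k) → A'-o₁ h k ; (inj₂ (inj₁ k)) → p k ; (inj₂ (inj₂ k)) → q k })
            (λ e → A'-f₀ h (cong face (α-inj (A' h) At₁ e))))
    φA' : ∀ {z} → ′.A z → ′.A (φ' z)
    φA' {z} h with eq? z o₂
    ... | inj₁ refl = subst ′.A (sym φ'-o₂) (mkA' (φA Ao₁) (λ e → o₁-f₀ (trans (sym (face-φ Ao₁)) e))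
            (λ e → a≢x (trans (trans (sym hd₁) (cong tail (sym e))) (trans (tail-φ Ao₁) ho₁))))
    ... | inj₂ p = subst ′.A (sym (φ'-≢ p)) (mkA' (φA (A' h)) (λ e → A'-f₀ h (trans (sym (face-φ (A' h))) e))
            (λ e → case at-a (αA (A' h)) (trans (sym (tail-φ (A' h))) (trans (cong tail e) hd₁)) of λ
              { (inj₁ q) → A'-f₀ h (cong face (α-inj (A' h) At₁ q)) ; (inj₂ q) → p (trans (sym (αα (A' h))) (cong α q)) }))
    αα' : ∀ {z} → ′.A z → glue (glue z) ≡ z
    αα' {z} h with eq? z o₂ | eq? z s
    ... | inj₁ refl | _ = trans (cong glue glue-o₂) glue-s
    ... | inj₂ _ | inj₁ refl = trans (cong glue glue-s) glue-o₂
    ... | inj₂ p | inj₂ q = trans (cong glue (glue-≢ p q)) (trans (glue-≢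
            (λ e → A'-f₀ h (trans (cong face (α-inj (A' h) At₂ e)) ff₂)) (λ e → A'-f₀ h (trans (cong face (α-inj (A' h) At₃ e)) ff₃))) (αα (A' h)))
    tail-φ' : ∀ {z} → ′.A z → tail (φ' z) ≡ ′.head z
    tail-φ' {z} h with eq? z o₂
    ... | inj₁ refl = trans (cong tail φ'-o₂) (trans (tail-φ Ao₁) (trans ho₁ (sym head'-o₂)))
    ... | inj₂ p = trans (cong tail (φ'-≢ p)) (trans (tail-φ (A' h)) (sym (head' p)))
    face-φ' : ∀ {z} → ′.A z → face (φ' z) ≡ face z
    face-φ' {z} h with eq? z o₂
    ... | inj₁ refl = trans (cong face φ'-o₂) (trans (face-φ Ao₁) (trans out₁ (sym out₂)))
    ... | inj₂ p = trans (cong face (φ'-≢ p)) (face-φ (A' h))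
    Fc-face' : ∀ {f} → ′.Fc f ≡ true → ∃ λ d → ′.A d × face d ≡ f
    Fc-face' {f} h with ∖-elim {p = Fc} {f₀} {f} h
    ... | Ff , nf with Fc-face Ff
    ...   | d , Ad , fd with eq? d o₁
    ...     | inj₂ p = d , mkA' Ad (λ e → nf (trans (sym fd) e)) p , fd
    ...     | inj₁ refl = o₂ , A'o₂ , trans out₂ (trans (sym out₁) fd)
    noloop' : ∀ {z} → ′.A z → ′.head z ≢ tail z
    noloop' {z} h with eq? z o₂
    ... | inj₁ refl = λ e → x≢y (trans (sym head'-o₂) (trans e hd₂))
    ... | inj₂ p = λ e → noloop (A' h) (trans (sym (head' p)) e)
    alone : ∀ {z} → ′.A z → z ≢ o₂ → tail z ≡ tail o₂ → ′.head z ≡ ′.head o₂ → ⊥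
    alone h p t e = A'-f₀ h (trans (cong face (nomulti (A' h) At₃ (trans t hd₂) (trans (sym (head' p)) (trans e (trans head'-o₂ (sym hd₃)))))) ff₃)
    nomulti' : ∀ {z w} → ′.A z → ′.A w → tail z ≡ tail w → ′.head z ≡ ′.head w → z ≡ w
    nomulti' {z} {w} h k t e with eq? z o₂ | eq? w o₂
    ... | inj₁ refl | inj₁ refl = refl
    ... | inj₁ refl | inj₂ q = ⊥-elim (alone k q (sym t) (sym e))
    ... | inj₂ p | inj₁ refl = ⊥-elim (alone h p t e)
    ... | inj₂ p | inj₂ q = nomulti (A' h) (A' k) t (trans (sym (head' p)) (trans e (head' q)))
    conn' : ∀ (W : Fin n → Bool) → (∀ {d} → ′.A d → W (tail d) ≡ true → W (′.head d) ≡ true) →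
      ∀ {u w} → ′.V u ≡ true → ′.V w ≡ true → W u ≡ true → W w ≡ true
    conn' W cl {u} {w} Vu Vw Wu = unrn (proj₂ (∖-elim {p = V} Vw)) (conn W~ step (proj₁ (∖-elim {p = V} Vu)) (proj₁ (∖-elim {p = V} Vw))
        (rn≢ (proj₂ (∖-elim {p = V} Vu)) Wu))
      where
      -- The vertex a gets the value of x. Closedness along the old edges at a then follows from
      -- closedness along x y.
      W~ : Fin n → Bool
      W~ v = if v =ᶠ a then W x else W v
      unrn : ∀ {v} → v ≢ a → W~ v ≡ true → W v ≡ true
      unrn h e rewrite =ᶠ-false h = e
      rn≢ : ∀ {v} → v ≢ a → W v ≡ true → W~ v ≡ true
      rn≢ h e rewrite =ᶠ-false h = e
      una : W~ a ≡ true → W x ≡ true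
      una e rewrite =ᶠ-refl a = e
      rna : W x ≡ true → W~ a ≡ true
      rna e rewrite =ᶠ-refl a = e
      wx : ∀ {v} → v ≡ x → W~ v ≡ true → W x ≡ true
      wx refl h = unrn (≢-sym a≢x) h
      wx' : ∀ {v} → v ≡ x → W x ≡ true → W~ v ≡ true
      wx' refl h = rn≢ (≢-sym a≢x) h
      wy : ∀ {v} → v ≡ y → W y ≡ true → W~ v ≡ true
      wy refl h = rn≢ y≢a h
      wy' : ∀ {v} → v ≡ y → W~ v ≡ true → W y ≡ true
      wy' refl h = unrn y≢a h
      wa : ∀ {v} → v ≡ a → W x ≡ true → W~ v ≡ true
      wa refl h = rna h
      x→y : W x ≡ true → W y ≡ true
      x→y h = subst (λ v → W v ≡ true) (trans (head' s≢o₂) hs) (cl A's (subst (λ v → W v ≡ true) (sym hd₃) h))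
      y→x : W y ≡ true → W x ≡ true
      y→x h = subst (λ v → W v ≡ true) head'-o₂ (cl A'o₂ (subst (λ v → W v ≡ true) (sym hd₂) h))
      step : ∀ {d} → A d → W~ (tail d) ≡ true → W~ (head d) ≡ true
      step {d} Ad h with eq? (face d) f₀ | eq? d o₁ | eq? d o₂
      ... | inj₂ _ | inj₁ refl | _ = wx' ho₁ (una (subst (λ v → W~ v ≡ true) hd₁ h))
      ... | inj₂ _ | inj₂ _ | inj₁ refl = wa ho₂ (y→x (wy' hd₂ h))
      ... | inj₂ p | inj₂ q | inj₂ r = rn≢ (λ e → case at-a (αA Ad) e of λ
              { (inj₁ k) → p (cong face (α-inj Ad At₁ k)) ; (inj₂ k) → r (trans (sym (αα Ad)) (cong α k)) })
              (subst (λ v → W v ≡ true) (head' r) (cl (mkA' Ad p q) (unrn (A'-a (mkA' Ad p q)) h)))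
      ... | inj₁ p | _ | _ with in-f₀ Ad p
      ...   | inj₁ refl = wa hd₁ (wx refl h)
      ...   | inj₂ (inj₁ refl) = wy hd₂ (x→y (una h))
      ...   | inj₂ (inj₂ refl) = wx' hd₃ (y→x (wy' refl h))

module EarOrder {D n F : ℕ} (M : Map D n F) (isMap : IsMap M) (ear : Ear M)
  (noquad : ∀ {d} → Map.A M d → Map.face M d ≢ Map.outer M → Map.quad M (Map.face M d) ≡ false) where
  open RemoveEar M isMap ear noquad
  open Order M isMap
  module O′ = Order M' isMap'

  Merged : Fin D → Fin D → Set
  Merged e f = (e ≡ o₂ × f ≡ t₃) ⊎ (e ≡ s × f ≡ t₁)

  merged-ι : ∀ {e f} → Merged e f → ι e ≡ ι f
  merged-ι (inj₁ (refl , refl)) = trans (id-ι A'o₂) (sym ι-t₃)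
  merged-ι (inj₂ (refl , refl)) = trans (id-ι A's) (sym ι-t₁)

  not-twice : ∀ {e f g} → Merged e f → Merged f g → ⊥
  not-twice (inj₁ (refl , refl)) (inj₁ (e , _)) = o₂-f₀ (trans (cong face (sym e)) ff₃)
  not-twice (inj₁ (refl , refl)) (inj₂ (e , _)) = s-f₀ (trans (cong face (sym e)) ff₃)
  not-twice (inj₂ (refl , refl)) (inj₁ (e , _)) = o₂-f₀ (cong face (sym e))
  not-twice (inj₂ (refl , refl)) (inj₂ (e , _)) = s-f₀ (cong face (sym e))

  order-step : ∀ {z} → A z → tail z ≢ a → ρ (σ z) ≡ false → Before M' (ι z) (ι (σ z)) ⊎ Merged z (σ z)
  order-step Az na h with ι-step Az na
  ... | moves e e' = inj₁ (subst (Before M' (ι _)) e (base (ι-A' Az na) (trans (cong ρ (trans e e')) h)))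
  ... | stays-o₂ refl = inj₂ (inj₁ (refl , σo₂))
  ... | stays-s refl = inj₂ (inj₂ (refl , σs))

  order : ∀ {e f} → Before M e f → tail e ≢ a → Before M' (ι e) (ι f) ⊎ Merged e f
  order (base Ae h) na = order-step Ae na h
  order {e} (more {f} b h) na with order b na | order-step (A-right b) (λ q → na (trans (same-tail b) q)) h
  ... | inj₁ p | inj₁ q = inj₁ (O′.before-trans p q)
  ... | inj₁ p | inj₂ m = inj₁ (subst (Before M' (ι e)) (merged-ι m) p)
  ... | inj₂ m | inj₁ q = inj₁ (subst (λ z → Before M' z (ι (σ f))) (sym (merged-ι m)) q)
  ... | inj₂ m | inj₂ m' = ⊥-elim (not-twice m m')

  order-a : ∀ {e f} → Before M e f → tail e ≡ a → e ≡ o₁ × f ≡ t₂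
  order-a {e} {f} b te with at-a (A-left b) te | at-a (A-right b) (trans (sym (same-tail b)) te)
  ... | _ | inj₁ refl = ⊥-elim (true≢false (outer-ρ Ao₁ out₁) (not-root b))
  ... | inj₂ refl | inj₂ _ = ⊥-elim (no-after-last (trans (cong ρ σt₂) (outer-ρ Ao₁ out₁)) b)
  ... | inj₁ p | inj₂ q = p , q

-- Putting the ear back

midpoint : Point → Point → Point
midpoint (x , x') (y , y') = ½ * (x + y) , ½ * (x' + y')

cross-midpoint : ∀ d x y t → cross d (midpoint x y -ᵖ t) ≡ ½ * (cross d (x -ᵖ t) + cross d (y -ᵖ t))
cross-midpoint (d , d') (x , x') (y , y') (t , t') = solve 8 (λ d d' x x' y y' t t' →
  d :* (con ½ :* (x' :+ y') :- t') :- d' :* (con ½ :* (x :+ y) :- t) :=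
  con ½ :* ((d :* (x' :- t') :- d' :* (x :- t)) :+ (d :* (y' :- t') :- d' :* (y :- t)))) refl d d' x x' y y' t t'

-- Putting the ear back: a is placed near the midpoint of the outer edge y x, on its outer side.
module EarDrawn {D n F : ℕ} (M : Map D n F) (isMap : IsMap M) (ear : Ear M)
  (noquad : ∀ {d} → Map.A M d → Map.face M d ≢ Map.outer M → Map.quad M (Map.face M d) ≡ false)
  (p' : Fin n → Point) (drawn' : Drawn (RemoveEar.M' M isMap ear noquad) p') where
  open RemoveEar M isMap ear noquad
  open Order M isMap
  open EarOrder M isMap ear noquad hiding (module O′)
  open Drawn drawn' renaming (vec to vec'; ordered to ordered'; hull to hull'; apart to apart'; distinct to distinct')

  X Y Δ : Point
  X = p' x
  Y = p' y
  Δ = X -ᵖ Y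

  Vx' : ′.V x ≡ true
  Vx' = ∖-intro {p = V} (tail-V At₁) (≢-sym a≢x)
  Vy' : ′.V y ≡ true
  Vy' = ∖-intro {p = V} (tail-V At₃) y≢a

  sep-xy : Separated₄ p' x x y y
  sep-xy = distinct' Vx' Vy' x≢y

  -- f₁ increases from x to y; the displacement of a is f₁ turned by a right angle.
  f₁ : Point
  f₁ = proj₁ sep-xy
  κ : ℚ
  κ = lin f₁ (Y -ᵖ X)
  0<κ : 0ℚ < κ
  0<κ = proj₁ (proj₁ (proj₂ sep-xy))
  w mid : Point
  w = - proj₂ f₁ , proj₁ f₁
  mid = midpoint X Y

  abstract
    p₀ : Fin n → Point
    p₀ u = if u =ᶠ a then mid else p' u
    k : Fin n → ℚ
    k u = if u =ᶠ a then 1ℚ else 0ℚ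
    p₀-a : p₀ a ≡ mid
    p₀-a rewrite =ᶠ-refl a = refl
    p₀-≢ : ∀ {u} → u ≢ a → p₀ u ≡ p' u
    p₀-≢ h rewrite =ᶠ-false h = refl
    k-a : k a ≡ 1ℚ
    k-a rewrite =ᶠ-refl a = refl
    k-≢ : ∀ {u} → u ≢ a → k u ≡ 0ℚ
    k-≢ h rewrite =ᶠ-false h = refl

  open Perturb p₀ k w

  apex : ℚ → Point
  apex ε = proj₁ mid + ε * proj₁ w , proj₂ mid + ε * proj₂ w

  pε-a : ∀ ε → pε ε a ≡ apex ε
  pε-a ε = trans (pε-≡ ε a) (trans (cong₂ (λ p k → proj₁ p + ε * (k * proj₁ w) , proj₂ p + ε * (k * proj₂ w)) p₀-a k-a)
    (cong₂ _,_ (cong (λ z → proj₁ mid + ε * z) (ℚP.*-identityˡ _)) (cong (λ z → proj₂ mid + ε * z) (ℚP.*-identityˡ _))))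

  pε-≢ : ∀ ε {u} → u ≢ a → pε ε u ≡ p' u
  pε-≢ ε {u} h = trans (pε-≡ ε u) (trans (cong₂ (λ p k → proj₁ p + ε * (k * proj₁ w) , proj₂ p + ε * (k * proj₂ w)) (p₀-≢ h) (k-≢ h))
    (cong₂ _,_ (z (proj₁ (p' u)) ε (proj₁ w)) (z (proj₂ (p' u)) ε (proj₂ w))))
    where
    z : ∀ x ε w → x + ε * (0ℚ * w) ≡ x
    z = solve 3 (λ x ε w → x :+ ε :* (con 0ℚ :* w) := x) refl

  x≢a = ≢-sym a≢x

  half-pos : ∀ {z} → 0ℚ < z → 0ℚ < ½ * z
  half-pos h = pos-* (ℚP.positive⁻¹ ½) h

  -- Like `at-x` and `at-apex` below, this is twice the area of the triangle x a y, computed at one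
  -- of its corners.
  at-y : ∀ ε → cross (apex ε -ᵖ Y) (X -ᵖ Y) ≡ ε * κ
  at-y ε = go (proj₁ X) (proj₂ X) (proj₁ Y) (proj₂ Y) (proj₁ f₁) (proj₂ f₁) ε
    where
    go : ∀ x x' y y' f g ε → ((½ * (x + y) + ε * (- g)) - y) * (x' - y') - ((½ * (x' + y') + ε * f) - y') * (x - y) ≡ ε * (f * (y - x) + g * (y' - x'))
    go = solve 7 (λ x x' y y' f g ε → ((con ½ :* (x :+ y) :+ ε :* (:- g)) :- y) :* (x' :- y') :- ((con ½ :* (x' :+ y') :+ ε :* f) :- y') :* (x :- y)
      := ε :* (f :* (y :- x) :+ g :* (y' :- x'))) refl

  at-x : ∀ ε → cross (Y -ᵖ X) (apex ε -ᵖ X) ≡ ε * κ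
  at-x ε = go (proj₁ X) (proj₂ X) (proj₁ Y) (proj₂ Y) (proj₁ f₁) (proj₂ f₁) ε
    where
    go : ∀ x x' y y' f g ε → (y - x) * ((½ * (x' + y') + ε * f) - x') - (y' - x') * ((½ * (x + y) + ε * (- g)) - x) ≡ ε * (f * (y - x) + g * (y' - x'))
    go = solve 7 (λ x x' y y' f g ε → (y :- x) :* ((con ½ :* (x' :+ y') :+ ε :* f) :- x') :- (y' :- x') :* ((con ½ :* (x :+ y) :+ ε :* (:- g)) :- x)
      := ε :* (f :* (y :- x) :+ g :* (y' :- x'))) refl

  at-apex : ∀ ε → cross (X -ᵖ apex ε) (Y -ᵖ apex ε) ≡ ε * κ
  at-apex ε = go (proj₁ X) (proj₂ X) (proj₁ Y) (proj₂ Y) (proj₁ f₁) (proj₂ f₁) ε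
    where
    go : ∀ x x' y y' f g ε → (x - (½ * (x + y) + ε * (- g))) * (y' - (½ * (x' + y') + ε * f)) - (x' - (½ * (x' + y') + ε * f)) * (y - (½ * (x + y) + ε * (- g)))
      ≡ ε * (f * (y - x) + g * (y' - x'))
    go = solve 7 (λ x x' y y' f g ε → (x :- (con ½ :* (x :+ y) :+ ε :* (:- g))) :* (y' :- (con ½ :* (x' :+ y') :+ ε :* f))
      :- (x' :- (con ½ :* (x' :+ y') :+ ε :* f)) :* (y :- (con ½ :* (x :+ y) :+ ε :* (:- g)))
      := ε :* (f :* (y :- x) :+ g :* (y' :- x'))) refl

  beyond : ∀ {u} → ′.V u ≡ true → u ≢ x → u ≢ y → 0ℚ < cross Δ (p' u -ᵖ Y)
  beyond {u} Vu nx ny = subst₂ (λ p q → 0ℚ < cross (p' p -ᵖ p' q) (p' u -ᵖ p' q)) head'-o₂ hd₂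
    (hull' A'o₂ out₂ Vu (λ e → ny (trans e hd₂)) (λ e → nx (trans e head'-o₂)))

  vec₀ : Fin D → Point
  vec₀ e = p₀ (head e) -ᵖ p₀ (tail e)

  scale : ℚ → Point → Point
  scale s z = s * proj₁ z , s * proj₂ z

  -- The reason for starting at the midpoint: at ε = 0 the edges from x and y to a have the
  -- directions of the edge x y that represents them in the smaller map, with half its length.
  vec-ι : ∀ {e} → A e → tail e ≢ a → ∃ λ s → 0ℚ < s × vec₀ e ≡ scale s (vec' (ι e))
  vec-ι {e} Ae ta with eq? (head e) a
  ... | inj₂ ha = 1ℚ , 0<1 , trans (cong₂ _-ᵖ_ (p₀-≢ ha) (p₀-≢ ta)) (trans (sym (one-* (p' (head e) -ᵖ p' (tail e))))
          (cong (scale 1ℚ) (cong₂ (λ u t → p' u -ᵖ p' t) (sym (head-ι Ae ta ha)) (sym (tail-ι e)))))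
    where
    one-* : ∀ z → scale 1ℚ z ≡ z
    one-* (z , z') = cong₂ _,_ (ℚP.*-identityˡ z) (ℚP.*-identityˡ z')
  ... | inj₁ ha with at-a (αA Ae) ha
  ...   | inj₁ q = ½ , ℚP.positive⁻¹ ½ , trans (cong₂ _-ᵖ_ (trans (cong p₀ ha) p₀-a) (trans (p₀-≢ ta) (cong (p' ∘ tail) e≡)))
            (trans (half Y X) (cong (scale ½) (sym vs)))
    where
    e≡ : e ≡ t₁
    e≡ = α-inj Ae At₁ q
    vs : vec' (ι e) ≡ Y -ᵖ X
    vs = cong₂ (λ u t → p' u -ᵖ p' t) (trans (cong (′.head ∘ ι) e≡) (trans (cong ′.head ι-t₁) (trans (head' s≢o₂) hs)))
           (trans (tail-ι e) (cong tail e≡))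
    half : ∀ y x → (½ * (proj₁ x + proj₁ y) , ½ * (proj₂ x + proj₂ y)) -ᵖ x ≡ scale ½ (y -ᵖ x)
    half (y , y') (x , x') = cong₂ _,_ (h y x) (h y' x')
      where
      h : ∀ y x → ½ * (x + y) - x ≡ ½ * (y - x)
      h = solve 2 (λ y x → con ½ :* (x :+ y) :- x := con ½ :* (y :- x)) refl
  ...   | inj₂ q = ½ , ℚP.positive⁻¹ ½ , trans (cong₂ _-ᵖ_ (trans (cong p₀ ha) p₀-a) (trans (p₀-≢ ta) (cong p' te)))
            (trans (half X Y) (cong (scale ½) (sym vs)))
    where
    e≡ : e ≡ o₂
    e≡ = trans (sym (αα Ae)) (cong α q)
    te : tail e ≡ y
    te = trans (cong tail e≡) hd₂
    vs : vec' (ι e) ≡ X -ᵖ Y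
    vs = cong₂ (λ u t → p' u -ᵖ p' t) (trans (cong (′.head ∘ ι) e≡) (trans (cong ′.head (id-ι A'o₂)) head'-o₂)) (trans (tail-ι e) te)
    half : ∀ x y → (½ * (proj₁ x + proj₁ y) , ½ * (proj₂ x + proj₂ y)) -ᵖ y ≡ scale ½ (x -ᵖ y)
    half (x , x') (y , y') = cong₂ _,_ (h x y) (h x' y')
      where
      h : ∀ x y → ½ * (x + y) - y ≡ ½ * (x - y)
      h = solve 2 (λ x y → con ½ :* (x :+ y) :- y := con ½ :* (x :- y)) refl

  cross-scale : ∀ s t z z' → cross (scale s z) (scale t z') ≡ s * t * cross z z'
  cross-scale s t (a , b) (c , d) = solve 6 (λ s t a b c d → (s :* a) :* (t :* d) :- (s :* b) :* (t :* c) := s :* t :* (a :* d :- b :* c)) refl s t a b c d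

  ordered₀ : ∀ {e f} → A e → A f → tail e ≢ a → tail f ≢ a → Before M' (ι e) (ι f) → 0ℚ < cross (vec₀ e) (vec₀ f)
  ordered₀ Ae Af te tf b with vec-ι Ae te | vec-ι Af tf
  ... | s₁ , p , q | s₂ , p₂ , q₂ = subst (0ℚ <_) (sym (trans (cong₂ cross q q₂) (cross-scale s₁ s₂ _ _))) (pos-* (pos-* p p₂) (ordered' b))

  mid-cross : ∀ z → cross (mid -ᵖ Y) (z -ᵖ Y) ≡ ½ * cross Δ (z -ᵖ Y)
  mid-cross (z , z') = go (proj₁ X) (proj₂ X) (proj₁ Y) (proj₂ Y) z z'
    where
    go : ∀ x x' y y' z z' → (½ * (x + y) - y) * (z' - y') - (½ * (x' + y') - y') * (z - y) ≡ ½ * ((x - y) * (z' - y') - (x' - y') * (z - y))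
    go = solve 6 (λ x x' y y' z z' → (con ½ :* (x :+ y) :- y) :* (z' :- y') :- (con ½ :* (x' :+ y') :- y') :* (z :- y)
      := con ½ :* ((x :- y) :* (z' :- y') :- (x' :- y') :* (z :- y))) refl

  mid-cross' : ∀ z → cross (X -ᵖ mid) (z -ᵖ mid) ≡ ½ * cross Δ (z -ᵖ Y)
  mid-cross' (z , z') = go (proj₁ X) (proj₂ X) (proj₁ Y) (proj₂ Y) z z'
    where
    go : ∀ x x' y y' z z' → (x - ½ * (x + y)) * (z' - ½ * (x' + y')) - (x' - ½ * (x' + y')) * (z - ½ * (x + y)) ≡ ½ * ((x - y) * (z' - y') - (x' - y') * (z - y))
    go = solve 6 (λ x x' y y' z z' → (x :- con ½ :* (x :+ y)) :* (z' :- con ½ :* (x' :+ y')) :- (x' :- con ½ :* (x' :+ y')) :* (z :- con ½ :* (x :+ y))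
      := con ½ :* ((x :- y) :* (z' :- y') :- (x' :- y') :* (z :- y))) refl

  Stable : ℚ → Set
  Stable ε = ∀ u₁ u₂ u₃ u₄ → 0ℚ < cross (p₀ u₂ -ᵖ p₀ u₁) (p₀ u₄ -ᵖ p₀ u₃) → 0ℚ < cross (pε ε u₂ -ᵖ pε ε u₁) (pε ε u₄ -ᵖ pε ε u₃)

  module At (ε : ℚ) (0<ε : 0ℚ < ε) (stable : Stable ε) where

    εκ : 0ℚ < ε * κ
    εκ = pos-* 0<ε 0<κ

    to : ∀ {u₁ u₂ u₃ q₁ q₂ q₃} → pε ε u₁ ≡ q₁ → pε ε u₂ ≡ q₂ → pε ε u₃ ≡ q₃ →
      cross (q₂ -ᵖ q₁) (q₃ -ᵖ q₁) ≡ ε * κ → 0ℚ < cross (pε ε u₂ -ᵖ pε ε u₁) (pε ε u₃ -ᵖ pε ε u₁)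
    to refl refl refl e = subst (0ℚ <_) (sym e) εκ

    apex-y : 0ℚ < cross (pε ε a -ᵖ pε ε y) (pε ε x -ᵖ pε ε y)
    apex-y = to (pε-≢ ε y≢a) (pε-a ε) (pε-≢ ε x≢a) (at-y ε)
    apex-x : 0ℚ < cross (pε ε y -ᵖ pε ε x) (pε ε a -ᵖ pε ε x)
    apex-x = to (pε-≢ ε x≢a) (pε-≢ ε y≢a) (pε-a ε) (at-x ε)
    apex-a : 0ℚ < cross (pε ε x -ᵖ pε ε a) (pε ε y -ᵖ pε ε a)
    apex-a = to (pε-a ε) (pε-≢ ε x≢a) (pε-≢ ε y≢a) (at-apex ε)

    CV : Fin n → Fin n → Fin n → Fin n → Set
    CV u₁ u₂ u₃ u₄ = 0ℚ < cross (pε ε u₂ -ᵖ pε ε u₁) (pε ε u₄ -ᵖ pε ε u₃)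

    cv : ∀ {u₁ u₂ u₃ u₄ t₁ t₂ t₃ t₄} → t₁ ≡ u₁ → t₂ ≡ u₂ → t₃ ≡ u₃ → t₄ ≡ u₄ → CV u₁ u₂ u₃ u₄ → CV t₁ t₂ t₃ t₄
    cv refl refl refl refl h = h

    ordered-ε : ∀ {e f} → Before M e f → CV (tail e) (head e) (tail f) (head f)
    ordered-ε {e} {f} bf with eq? (tail e) a
    ... | inj₁ te with order-a bf te
    ...   | refl , refl = cv hd₁ ho₁ refl hd₂ apex-a
    ordered-ε {e} {f} bf | inj₂ te with order bf te
    ...   | inj₁ b' = stable (tail e) (head e) (tail f) (head f) (ordered₀ (A-left bf) (A-right bf) te (λ q → te (trans (same-tail bf) q)) b')
    ...   | inj₂ (inj₁ (refl , refl)) = cv hd₂ ho₂ refl hd₃ apex-y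
    ...   | inj₂ (inj₂ (refl , refl)) = cv hd₃ hs refl hd₁ apex-x

    hull-ε : ∀ {d u} → A d → face d ≡ outer → V u ≡ true → u ≢ tail d → u ≢ head d → CV (tail d) (head d) (tail d) u
    hull-ε {d} {u} Ad fd Vu nt nh with eq? d o₁ | eq? d o₂
    ... | inj₁ refl | _ = cv hd₁ ho₁ hd₁ refl (by (eq? u y))
      where
      na : u ≢ a
      na e = nt (trans e (sym hd₁))
      nx : u ≢ x
      nx e = nh (trans e (sym ho₁))
      by : u ≡ y ⊎ u ≢ y → CV a x a u
      by (inj₁ refl) = apex-a
      by (inj₂ ny) = stable a x a u (subst (0ℚ <_) (sym (trans (cong₂ cross (cong₂ _-ᵖ_ (p₀-≢ x≢a) p₀-a) (cong₂ _-ᵖ_ (p₀-≢ na) p₀-a)) (mid-cross' (p' u))))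
        (half-pos (beyond (∖-intro {p = V} Vu na) nx ny)))
    ... | inj₂ _ | inj₁ refl = cv hd₂ ho₂ hd₂ refl (by (eq? u x))
      where
      na : u ≢ a
      na e = nh (trans e (sym ho₂))
      ny : u ≢ y
      ny e = nt (trans e (sym hd₂))
      by : u ≡ x ⊎ u ≢ x → CV y a y u
      by (inj₁ refl) = apex-y
      by (inj₂ nx) = stable y a y u (subst (0ℚ <_) (sym (trans (cong₂ cross (cong₂ _-ᵖ_ p₀-a (p₀-≢ y≢a)) (cong₂ _-ᵖ_ (p₀-≢ na) (p₀-≢ y≢a))) (mid-cross (p' u))))
        (half-pos (beyond (∖-intro {p = V} Vu na) nx ny)))
    ... | inj₂ n₁ | inj₂ n₂ = by (eq? u a)
      where
      A'd : ′.A d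
      A'd = mkA' Ad (λ e → inner (trans (sym e) fd)) n₁
      ta = A'-a A'd
      ha : head d ≢ a
      ha e with at-a (αA Ad) e
      ... | inj₁ q = inner (trans (cong face (sym (α-inj Ad At₁ q))) fd)
      ... | inj₂ q = n₂ (trans (sym (αα Ad)) (cong α q))
      Z : Point → ℚ
      Z z = cross (p' (head d) -ᵖ p' (tail d)) (z -ᵖ p' (tail d))
      hull₁ : ∀ {t} → ′.V t ≡ true → t ≢ tail d → t ≢ head d → 0ℚ < Z (p' t)
      hull₁ {t} Vt p q = subst (λ z → 0ℚ < cross (p' z -ᵖ p' (tail d)) (p' t -ᵖ p' (tail d))) (head' n₂) (hull' A'd fd Vt p (λ e → q (trans e (head' n₂))))
      Z₀ : ∀ {t} → t ≡ tail d ⊎ t ≡ head d → Z (p' t) ≡ 0ℚ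
      Z₀ (inj₁ refl) = cross-null (p' (head d) -ᵖ p' (tail d)) (p' (tail d))
      Z₀ (inj₂ refl) = cross-self (p' (head d) -ᵖ p' (tail d))
      vec-d : ∀ {q} t → p₀ t ≡ q → cross (p₀ (head d) -ᵖ p₀ (tail d)) (p₀ t -ᵖ p₀ (tail d)) ≡ Z q
      vec-d t e = cong₂ cross (cong₂ _-ᵖ_ (p₀-≢ ha) (p₀-≢ ta)) (cong₂ _-ᵖ_ e (p₀-≢ ta))
      Z-mid : Z mid ≡ ½ * (Z X + Z Y)
      Z-mid = cross-midpoint (p' (head d) -ᵖ p' (tail d)) X Y (p' (tail d))
      from-mid : 0ℚ < Z X + Z Y → CV (tail d) (head d) (tail d) a
      from-mid h = stable (tail d) (head d) (tail d) a (subst (0ℚ <_) (sym (trans (vec-d a p₀-a) Z-mid)) (half-pos h))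
      End : Fin n → Set
      End t = t ≡ tail d ⊎ t ≡ head d
      end? : ∀ t → End t ⊎ (t ≢ tail d × t ≢ head d)
      end? t with eq? t (tail d) | eq? t (head d)
      ... | inj₁ e | _ = inj₁ (inj₁ e)
      ... | inj₂ _ | inj₁ e = inj₁ (inj₂ e)
      ... | inj₂ p | inj₂ q = inj₂ (p , q)
      -- The value at the midpoint is the mean of those at x and y, so it vanishes only if `d` joins
      -- the two. From y to x it would be `o₂`; from x to y the area of the ear decides.
      at-mid : End x ⊎ (x ≢ tail d × x ≢ head d) → End y ⊎ (y ≢ tail d × y ≢ head d) → CV (tail d) (head d) (tail d) a
      at-mid (inj₂ (p , q)) (inj₂ (p₂ , q₂)) = from-mid (pos-+ (hull₁ Vx' p q) (hull₁ Vy' p₂ q₂))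
      at-mid (inj₂ (p , q)) (inj₁ e) = from-mid (pos-+-nonneg (hull₁ Vx' p q) (ℚP.≤-reflexive (sym (Z₀ e))))
      at-mid (inj₁ e) (inj₂ (p , q)) = from-mid (subst (0ℚ <_) (ℚP.+-comm (Z Y) (Z X)) (pos-+-nonneg (hull₁ Vy' p q) (ℚP.≤-reflexive (sym (Z₀ e)))))
      at-mid (inj₁ (inj₁ e)) (inj₁ (inj₁ e')) = ⊥-elim (x≢y (trans e (sym e')))
      at-mid (inj₁ (inj₂ e)) (inj₁ (inj₂ e')) = ⊥-elim (x≢y (trans e (sym e')))
      at-mid (inj₁ (inj₁ e)) (inj₁ (inj₂ e')) = cv (sym e) (sym e') (sym e) refl apex-x
      at-mid (inj₁ (inj₂ e)) (inj₁ (inj₁ e')) = ⊥-elim (n₂ (root-unique Ad Ao₂ (trans (sym e') (sym hd₂)) (outer-ρ Ad fd) (outer-ρ Ao₂ out₂)))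
      by : u ≡ a ⊎ u ≢ a → CV (tail d) (head d) (tail d) u
      by (inj₂ na) = stable (tail d) (head d) (tail d) u (subst (0ℚ <_) (sym (vec-d u (p₀-≢ na))) (hull₁ (∖-intro {p = V} Vu na) nt nh))
      by (inj₁ refl) = at-mid (end? x) (end? y)

module EarApart {D n F : ℕ} (M : Map D n F) (isMap : IsMap M) (ear : Ear M)
  (noquad : ∀ {d} → Map.A M d → Map.face M d ≢ Map.outer M → Map.quad M (Map.face M d) ≡ false)
  (p' : Fin n → Point) (drawn' : Drawn (RemoveEar.M' M isMap ear noquad) p') where
  open RemoveEar M isMap ear noquad
  open EarDrawn M isMap ear noquad p' drawn'
  open Drawn drawn' using () renaming (apart to apart'; distinct to distinct')
  open Perturb p₀ k w

  Sepε : Fin n → Fin n → Fin n → Fin n → ℚ → Set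
  Sepε u₁ u₂ u₃ u₄ ε = Separated₄ (pε ε) u₁ u₂ u₃ u₄

  cong-sep : ∀ {p q : Fin n → Point} {u₁ u₂ u₃ u₄} → p u₁ ≡ q u₁ → p u₂ ≡ q u₂ → p u₃ ≡ q u₃ → p u₄ ≡ q u₄ →
    Separated₄ p u₁ u₂ u₃ u₄ → Separated₄ q u₁ u₂ u₃ u₄
  cong-sep e₁ e₂ e₃ e₄ (f , (p , q) , (r , s)) = f , (t e₁ e₃ p , t e₁ e₄ q) , (t e₂ e₃ r , t e₂ e₄ s)
    where
    t : ∀ {x x' y y'} → x ≡ x' → y ≡ y' → 0ℚ < lin f (y -ᵖ x) → 0ℚ < lin f (y' -ᵖ x')
    t refl refl h = h

  lin-mid : ∀ f z → lin f (z -ᵖ mid) ≡ ½ * (lin f (z -ᵖ X) + lin f (z -ᵖ Y))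
  lin-mid (f , g) (z , z') = go f g z z' (proj₁ X) (proj₂ X) (proj₁ Y) (proj₂ Y)
    where
    go : ∀ f g z z' x x' y y' → f * (z - ½ * (x + y)) + g * (z' - ½ * (x' + y')) ≡ ½ * ((f * (z - x) + g * (z' - x')) + (f * (z - y) + g * (z' - y')))
    go = solve 8 (λ f g z z' x x' y y' → f :* (z :- con ½ :* (x :+ y)) :+ g :* (z' :- con ½ :* (x' :+ y'))
      := con ½ :* ((f :* (z :- x) :+ g :* (z' :- x')) :+ (f :* (z :- y) :+ g :* (z' :- y')))) refl

  -- The vector of the functional z ↦ cross Δ z.
  Δ⊥ : Point
  Δ⊥ = - proj₂ Δ , proj₁ Δ

  -- cross Δ z + r lin f₁ z: the tilt breaks the tie between x and y, which decides on which side of the line a lies.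
  tilt : ℚ → Point
  tilt r = proj₁ Δ⊥ + r * proj₁ f₁ , proj₂ Δ⊥ + r * proj₂ f₁

  tilt-Y-apex : ∀ ε r → lin (tilt r) (Y -ᵖ apex ε) ≡ ε * κ + ½ * (r * κ)
  tilt-Y-apex ε r = go (proj₁ X) (proj₂ X) (proj₁ Y) (proj₂ Y) (proj₁ f₁) (proj₂ f₁) ε r
    where
    go : ∀ x x' y y' f g ε r → (- (x' - y') + r * f) * (y - (½ * (x + y) + ε * (- g))) + ((x - y) + r * g) * (y' - (½ * (x' + y') + ε * f))
      ≡ ε * (f * (y - x) + g * (y' - x')) + ½ * (r * (f * (y - x) + g * (y' - x')))
    go = solve 8 (λ x x' y y' f g ε r → (:- (x' :- y') :+ r :* f) :* (y :- (con ½ :* (x :+ y) :+ ε :* (:- g))) :+ ((x :- y) :+ r :* g) :* (y' :- (con ½ :* (x' :+ y') :+ ε :* f))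
      := ε :* (f :* (y :- x) :+ g :* (y' :- x')) :+ con ½ :* (r :* (f :* (y :- x) :+ g :* (y' :- x')))) refl

  tilt-X-apex : ∀ ε r → lin (tilt (- r)) (X -ᵖ apex ε) ≡ ε * κ + ½ * (r * κ)
  tilt-X-apex ε r = go (proj₁ X) (proj₂ X) (proj₁ Y) (proj₂ Y) (proj₁ f₁) (proj₂ f₁) ε r
    where
    go : ∀ x x' y y' f g ε r → (- (x' - y') + (- r) * f) * (x - (½ * (x + y) + ε * (- g))) + ((x - y) + (- r) * g) * (x' - (½ * (x' + y') + ε * f))
      ≡ ε * (f * (y - x) + g * (y' - x')) + ½ * (r * (f * (y - x) + g * (y' - x')))
    go = solve 8 (λ x x' y y' f g ε r → (:- (x' :- y') :+ (:- r) :* f) :* (x :- (con ½ :* (x :+ y) :+ ε :* (:- g))) :+ ((x :- y) :+ (:- r) :* g) :* (x' :- (con ½ :* (x' :+ y') :+ ε :* f))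
      := ε :* (f :* (y :- x) :+ g :* (y' :- x')) :+ con ½ :* (r :* (f :* (y :- x) :+ g :* (y' :- x')))) refl

  tilt-YX : ∀ r → lin (tilt r) (Y -ᵖ X) ≡ r * κ
  tilt-YX r = go (proj₁ X) (proj₂ X) (proj₁ Y) (proj₂ Y) (proj₁ f₁) (proj₂ f₁) r
    where
    go : ∀ x x' y y' f g r → (- (x' - y') + r * f) * (y - x) + ((x - y) + r * g) * (y' - x') ≡ r * (f * (y - x) + g * (y' - x'))
    go = solve 7 (λ x x' y y' f g r → (:- (x' :- y') :+ r :* f) :* (y :- x) :+ ((x :- y) :+ r :* g) :* (y' :- x') := r :* (f :* (y :- x) :+ g :* (y' :- x'))) refl

  tilt-XY : ∀ r → lin (tilt (- r)) (X -ᵖ Y) ≡ r * κ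
  tilt-XY r = go (proj₁ X) (proj₂ X) (proj₁ Y) (proj₂ Y) (proj₁ f₁) (proj₂ f₁) r
    where
    go : ∀ x x' y y' f g r → (- (x' - y') + (- r) * f) * (x - y) + ((x - y) + (- r) * g) * (x' - y') ≡ r * (f * (y - x) + g * (y' - x'))
    go = solve 7 (λ x x' y y' f g r → (:- (x' :- y') :+ (:- r) :* f) :* (x :- y) :+ ((x :- y) :+ (:- r) :* g) :* (x' :- y') := r :* (f :* (y :- x) :+ g :* (y' :- x'))) refl

  tilt-X : ∀ r z → lin (tilt r) (z -ᵖ X) ≡ cross Δ (z -ᵖ Y) + r * lin f₁ (z -ᵖ X)
  tilt-X r (z , z') = go (proj₁ X) (proj₂ X) (proj₁ Y) (proj₂ Y) (proj₁ f₁) (proj₂ f₁) r z z'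
    where
    go : ∀ x x' y y' f g r z z' → (- (x' - y') + r * f) * (z - x) + ((x - y) + r * g) * (z' - x')
      ≡ ((x - y) * (z' - y') - (x' - y') * (z - y)) + r * (f * (z - x) + g * (z' - x'))
    go = solve 9 (λ x x' y y' f g r z z' → (:- (x' :- y') :+ r :* f) :* (z :- x) :+ ((x :- y) :+ r :* g) :* (z' :- x')
      := ((x :- y) :* (z' :- y') :- (x' :- y') :* (z :- y)) :+ r :* (f :* (z :- x) :+ g :* (z' :- x'))) refl

  tilt-Y : ∀ r z → lin (tilt (- r)) (z -ᵖ Y) ≡ cross Δ (z -ᵖ Y) + r * (- lin f₁ (z -ᵖ Y))
  tilt-Y r (z , z') = go (proj₁ X) (proj₂ X) (proj₁ Y) (proj₂ Y) (proj₁ f₁) (proj₂ f₁) r z z'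
    where
    go : ∀ x x' y y' f g r z z' → (- (x' - y') + (- r) * f) * (z - y) + ((x - y) + (- r) * g) * (z' - y')
      ≡ ((x - y) * (z' - y') - (x' - y') * (z - y)) + r * (- (f * (z - y) + g * (z' - y')))
    go = solve 9 (λ x x' y y' f g r z z' → (:- (x' :- y') :+ (:- r) :* f) :* (z :- y) :+ ((x :- y) :+ (:- r) :* g) :* (z' :- y')
      := ((x :- y) :* (z' :- y') :- (x' :- y') :* (z :- y)) :+ r :* (:- (f :* (z :- y) :+ g :* (z' :- y')))) refl

  lin-via : ∀ f z y t → lin f (z -ᵖ t) ≡ lin f (z -ᵖ y) + lin f (y -ᵖ t)
  lin-via (f , g) (z , z') (y , y') (t , t') = solve 8 (λ f g z z' y y' t t' → f :* (z :- t) :+ g :* (z' :- t')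
    := (f :* (z :- y) :+ g :* (z' :- y')) :+ (f :* (y :- t) :+ g :* (y' :- t'))) refl f g z z' y y' t t'

  sepε-intro : ∀ {ε u₁ u₂ u₃ u₄ q₁ q₂ q₃ q₄} → pε ε u₁ ≡ q₁ → pε ε u₂ ≡ q₂ → pε ε u₃ ≡ q₃ → pε ε u₄ ≡ q₄ → ∀ f →
    0ℚ < lin f (q₃ -ᵖ q₁) → 0ℚ < lin f (q₄ -ᵖ q₁) → 0ℚ < lin f (q₃ -ᵖ q₂) → 0ℚ < lin f (q₄ -ᵖ q₂) → Sepε u₁ u₂ u₃ u₄ ε
  sepε-intro refl refl refl refl f a b c d = f , (a , b) , (c , d)

  far : ∀ {u} → V u ≡ true → u ≢ a → u ≢ x → u ≢ y → 0ℚ < cross Δ (p' u -ᵖ Y)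
  far Vu na nx ny = beyond (∖-intro {p = V} Vu na) nx ny

  apex-side : ∀ {ε} → 0ℚ < ε → 0ℚ < ε * κ + ½ * (ε * κ)
  apex-side h = pos-+ (pos-* h 0<κ) (half-pos (pos-* h 0<κ))

  -- At ε = 0 the points a, x, y are collinear, with a between x and y. No fixed line can separate
  -- the edges a x and y u for all small ε, so the separating functional is tilted by the same ε by
  -- which a is displaced.
  special-x : ∀ {u} → V u ≡ true → u ≢ a → u ≢ x → u ≢ y → Eventually (Sepε a x y u)
  special-x {u} Vu na nx ny = ev-map (λ ε 0<ε h → sepε-intro (pε-a ε) (pε-≢ ε x≢a) (pε-≢ ε y≢a) (pε-≢ ε na) (tilt ε)
      (subst (0ℚ <_) (sym (tilt-Y-apex ε ε)) (apex-side 0<ε))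
      (subst (0ℚ <_) (sym (eq ε)) (pos-+ h (half-pos (pos-* 0<ε 0<κ))))
      (subst (0ℚ <_) (sym (tilt-YX ε)) (pos-* 0<ε 0<κ))
      (subst (0ℚ <_) (sym (tilt-X ε (p' u))) h))
    (ev-linear (lin f₁ (p' u -ᵖ X)) (far Vu na nx ny))
    where
    eq : ∀ ε → lin (tilt ε) (p' u -ᵖ apex ε) ≡ (cross Δ (p' u -ᵖ Y) + ε * lin f₁ (p' u -ᵖ X)) + ½ * (ε * κ)
    eq ε = trans (lin-via (tilt ε) (p' u) X (apex ε)) (cong₂ _+_ (tilt-X ε (p' u)) (trans (rest (lin (tilt ε) (Y -ᵖ apex ε)) (lin (tilt ε) (Y -ᵖ X)) _
        (lin-via (tilt ε) Y X (apex ε))) (trans (cong₂ _-_ (tilt-Y-apex ε ε) (tilt-YX ε)) (tidy (ε * κ)))))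
      where
      rest : ∀ a b c → a ≡ b + c → c ≡ a - b
      rest a b c refl = solve 2 (λ b c → c := (b :+ c) :- b) refl b c
      tidy : ∀ z → (z + ½ * z) - z ≡ ½ * z
      tidy = solve 1 (λ z → (z :+ con ½ :* z) :- z := con ½ :* z) refl

  special-y : ∀ {u} → V u ≡ true → u ≢ a → u ≢ x → u ≢ y → Eventually (Sepε a y x u)
  special-y {u} Vu na nx ny = ev-map (λ ε 0<ε h → sepε-intro (pε-a ε) (pε-≢ ε y≢a) (pε-≢ ε x≢a) (pε-≢ ε na) (tilt (- ε))
      (subst (0ℚ <_) (sym (tilt-X-apex ε ε)) (apex-side 0<ε))
      (subst (0ℚ <_) (sym (eq ε)) (pos-+ h (half-pos (pos-* 0<ε 0<κ))))
      (subst (0ℚ <_) (sym (tilt-XY ε)) (pos-* 0<ε 0<κ))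
      (subst (0ℚ <_) (sym (tilt-Y ε (p' u))) h))
    (ev-linear (- lin f₁ (p' u -ᵖ Y)) (far Vu na nx ny))
    where
    eq : ∀ ε → lin (tilt (- ε)) (p' u -ᵖ apex ε) ≡ (cross Δ (p' u -ᵖ Y) + ε * (- lin f₁ (p' u -ᵖ Y))) + ½ * (ε * κ)
    eq ε = trans (lin-via (tilt (- ε)) (p' u) Y (apex ε)) (cong₂ _+_ (tilt-Y ε (p' u)) (trans (rest (lin (tilt (- ε)) (X -ᵖ apex ε)) (lin (tilt (- ε)) (X -ᵖ Y)) _
        (lin-via (tilt (- ε)) X Y (apex ε))) (trans (cong₂ _-_ (tilt-X-apex ε ε) (tilt-XY ε)) (tidy (ε * κ)))))
      where
      rest : ∀ a b c → a ≡ b + c → c ≡ a - b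
      rest a b c refl = solve 2 (λ b c → c := (b :+ c) :- b) refl b c
      tidy : ∀ z → (z + ½ * z) - z ≡ ½ * z
      tidy = solve 1 (λ z → (z :+ con ½ :* z) :- z := con ½ :* z) refl

  ι-apart : ∀ {e f} → A e → A f → tail e ≢ a → head e ≢ a → tail f ≢ a → head f ≢ a →
    tail e ≢ tail f → tail e ≢ head f → head e ≢ tail f → head e ≢ head f → Separated₄ p' (tail e) (head e) (tail f) (head f)
  ι-apart {e} {f} Ae Af te he tf hf n₁ n₂ n₃ n₄ = separated-cong {p = p'} (tail-ι e) (head-ι Ae te he) (tail-ι f) (head-ι Af tf hf)
      (apart' (ι-A' Ae te) (ι-A' Af tf)
        (λ q → n₁ (trans (sym (tail-ι e)) (trans q (tail-ι f)))) (λ q → n₂ (trans (sym (tail-ι e)) (trans q (head-ι Af tf hf))))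
        (λ q → n₃ (trans (sym (head-ι Ae te he)) (trans q (tail-ι f)))) (λ q → n₄ (trans (sym (head-ι Ae te he)) (trans q (head-ι Af tf hf)))))

  away : ∀ {e f} → A e → A f → tail e ≢ a → head e ≢ a → tail f ≢ a → head f ≢ a →
    tail e ≢ tail f → tail e ≢ head f → head e ≢ tail f → head e ≢ head f → Eventually (Sepε (tail e) (head e) (tail f) (head f))
  away {e} {f} Ae Af te he tf hf n₁ n₂ n₃ n₄ = ev-separated (cong-sep {p'} {p₀} {tail e} {head e} {tail f} {head f} (sym (p₀-≢ te)) (sym (p₀-≢ he)) (sym (p₀-≢ tf)) (sym (p₀-≢ hf))
    (ι-apart Ae Af te he tf hf n₁ n₂ n₃ n₄))

  -- The other edge avoids x and y, so it is separated from the edge x y in the smaller drawing. The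
  -- same functional serves here, since a starts on that edge.
  both : ∀ {z f} → z ≡ x ⊎ z ≡ y → A f → tail f ≢ a → head f ≢ a → tail f ≢ x → tail f ≢ y → head f ≢ x → head f ≢ y →
    Eventually (Sepε a z (tail f) (head f))
  both {z} {f} zc Af tf hf tx ty hx hy with subst (λ u → Separated₄ p' y u (tail f) (head f)) hd₃
    (ι-apart At₃ Af y≢a (λ e → x≢a (trans (sym hd₃) e)) tf hf (≢-sym ty) (≢-sym hy) (λ e → tx (trans (sym e) hd₃)) (λ e → hx (trans (sym e) hd₃)))
  ... | g , (c₁ , c₂) , (c₃ , c₄) = ev-separated (g , (from-mid (p₀-≢ tf) c₁ c₃ , from-mid (p₀-≢ hf) c₂ c₄) , (from-z zc (p₀-≢ tf) c₁ c₃ , from-z zc (p₀-≢ hf) c₂ c₄))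
    where
    from-mid : ∀ {u q} → p₀ u ≡ q → 0ℚ < lin g (q -ᵖ Y) → 0ℚ < lin g (q -ᵖ X) → 0ℚ < lin g (p₀ u -ᵖ p₀ a)
    from-mid {u} {q} e h h' = subst (0ℚ <_) (sym (trans (cong₂ (λ r t → lin g (r -ᵖ t)) e p₀-a) (lin-mid g q))) (half-pos (pos-+ h' h))
    from-z : ∀ {z u q} → z ≡ x ⊎ z ≡ y → p₀ u ≡ q → 0ℚ < lin g (q -ᵖ Y) → 0ℚ < lin g (q -ᵖ X) → 0ℚ < lin g (p₀ u -ᵖ p₀ z)
    from-z (inj₁ refl) e h h' = subst (0ℚ <_) (sym (cong₂ (λ r t → lin g (r -ᵖ t)) e (p₀-≢ x≢a))) h'
    from-z (inj₂ refl) e h h' = subst (0ℚ <_) (sym (cong₂ (λ r t → lin g (r -ᵖ t)) e (p₀-≢ y≢a))) h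

  touching : ∀ {e f} → A e → A f → tail e ≡ a → tail f ≢ a → head f ≢ a → head e ≢ tail f → head e ≢ head f →
    Eventually (Sepε (tail e) (head e) (tail f) (head f))
  touching {e} {f} Ae Af te tf hf n₁ n₂ = by (at-a Ae te)
    where
    Vh = tail-V (αA Af)
    Vt = tail-V Af
    reorder : ∀ {z u} → Eventually (Sepε a z u (tail f)) → head f ≡ u → Eventually (Sepε a z (tail f) (head f))
    reorder {z} ev refl = ev-map {Sepε a z (head f) (tail f)} (λ ε _ → separated-right {p = pε ε} {a} {z} {head f} {tail f}) ev
    is-x : head e ≡ x → Eventually (Sepε a x (tail f) (head f))
    is-x he with eq? (tail f) y | eq? (head f) y
    ... | inj₁ q | _ = subst (λ u → Eventually (Sepε a x u (head f))) (sym q)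
            (special-x Vh hf (λ e' → n₂ (trans he (sym e'))) (λ e' → noloop Af (trans e' (sym q))))
    ... | inj₂ r | inj₁ q = reorder (special-x Vt tf (λ e' → n₁ (trans he (sym e'))) r) q
    ... | inj₂ r | inj₂ r' = both (inj₁ refl) Af tf hf (λ e' → n₁ (trans he (sym e'))) r (λ e' → n₂ (trans he (sym e'))) r'
    is-y : head e ≡ y → Eventually (Sepε a y (tail f) (head f))
    is-y he with eq? (tail f) x | eq? (head f) x
    ... | inj₁ q | _ = subst (λ u → Eventually (Sepε a y u (head f))) (sym q)
            (special-y Vh hf (λ e' → noloop Af (trans e' (sym q))) (λ e' → n₂ (trans he (sym e'))))
    ... | inj₂ r | inj₁ q = reorder (special-y Vt tf r (λ e' → n₁ (trans he (sym e')))) q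
    ... | inj₂ r | inj₂ r' = both (inj₂ refl) Af tf hf r (λ e' → n₁ (trans he (sym e'))) r' (λ e' → n₂ (trans he (sym e')))
    by : e ≡ o₁ ⊎ e ≡ t₂ → Eventually (Sepε (tail e) (head e) (tail f) (head f))
    by (inj₁ q) = subst₂ (λ u t → Eventually (Sepε u t (tail f) (head f))) (sym te) (sym (trans (cong head q) ho₁)) (is-x (trans (cong head q) ho₁))
    by (inj₂ q) = subst₂ (λ u t → Eventually (Sepε u t (tail f) (head f))) (sym te) (sym (trans (cong head q) hd₂)) (is-y (trans (cong head q) hd₂))

  swap-ev : ∀ {u₁ u₂ u₃ u₄} → Eventually (Sepε u₁ u₂ u₃ u₄) → Eventually (Sepε u₃ u₄ u₁ u₂)
  swap-ev {u₁} {u₂} {u₃} {u₄} = ev-map {Sepε u₁ u₂ u₃ u₄} λ ε _ → separated-swap {p = pε ε} {u₁} {u₂} {u₃} {u₄}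

  left-ev : ∀ {u₁ u₂ u₃ u₄} → Eventually (Sepε u₁ u₂ u₃ u₄) → Eventually (Sepε u₂ u₁ u₃ u₄)
  left-ev {u₁} {u₂} {u₃} {u₄} = ev-map {Sepε u₁ u₂ u₃ u₄} λ ε _ → separated-left {p = pε ε} {u₁} {u₂} {u₃} {u₄}

  touching' : ∀ {e f} → A e → A f → tail e ≡ a ⊎ head e ≡ a → tail f ≢ a → head f ≢ a →
    tail e ≢ tail f → tail e ≢ head f → head e ≢ tail f → head e ≢ head f → Eventually (Sepε (tail e) (head e) (tail f) (head f))
  touching' Ae Af (inj₁ te) tf hf n₁ n₂ n₃ n₄ = touching Ae Af te tf hf n₃ n₄
  touching' {e} {f} Ae Af (inj₂ he) tf hf n₁ n₂ n₃ n₄ = left-ev (subst (λ u → Eventually (Sepε (head e) u (tail f) (head f))) (head-α Ae)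
    (touching (αA Ae) Af he tf hf (λ q → n₁ (trans (sym (head-α Ae)) q)) (λ q → n₂ (trans (sym (head-α Ae)) q))))

  Touch : Fin D → Set
  Touch e = tail e ≡ a ⊎ head e ≡ a

  touch? : ∀ e → Touch e ⊎ (tail e ≢ a × head e ≢ a)
  touch? e with eq? (tail e) a | eq? (head e) a
  ... | inj₁ p | _ = inj₁ (inj₁ p)
  ... | inj₂ _ | inj₁ p = inj₁ (inj₂ p)
  ... | inj₂ p | inj₂ q = inj₂ (p , q)

  ev-apart : ∀ {e f} → A e → A f → tail e ≢ tail f → tail e ≢ head f → head e ≢ tail f → head e ≢ head f →
    Eventually (Sepε (tail e) (head e) (tail f) (head f))
  ev-apart {e} {f} Ae Af n₁ n₂ n₃ n₄ = by (touch? e) (touch? f)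
    where
    clash : Touch e → Touch f → ⊥
    clash (inj₁ t) (inj₁ t') = n₁ (trans t (sym t'))
    clash (inj₁ t) (inj₂ t') = n₂ (trans t (sym t'))
    clash (inj₂ t) (inj₁ t') = n₃ (trans t (sym t'))
    clash (inj₂ t) (inj₂ t') = n₄ (trans t (sym t'))
    by : Touch e ⊎ (tail e ≢ a × head e ≢ a) → Touch f ⊎ (tail f ≢ a × head f ≢ a) → Eventually (Sepε (tail e) (head e) (tail f) (head f))
    by (inj₂ (h₁ , h₂)) (inj₂ (h₃ , h₄)) = away Ae Af h₁ h₂ h₃ h₄ n₁ n₂ n₃ n₄
    by (inj₁ t) (inj₂ (h₁ , h₂)) = touching' Ae Af t h₁ h₂ n₁ n₂ n₃ n₄
    by (inj₂ (h₁ , h₂)) (inj₁ t) = swap-ev (touching' Af Ae t h₁ h₂ (≢-sym n₁) (≢-sym n₃) (≢-sym n₂) (≢-sym n₄))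
    by (inj₁ t) (inj₁ t') = ⊥-elim (clash t t')

  from-apex : ∀ {u} → V u ≡ true → u ≢ a → Eventually (Sepε a a u u)
  from-apex {u} Vu na = ev-separated (by (eq? u x) (eq? u y))
    where
    mk : ∀ f → 0ℚ < lin f (p' u -ᵖ mid) → Separated₄ p₀ a a u u
    mk f h = f , (h' , h') , (h' , h')
      where
      h' : 0ℚ < lin f (p₀ u -ᵖ p₀ a)
      h' = subst₂ (λ r t → 0ℚ < lin f (r -ᵖ t)) (sym (p₀-≢ na)) (sym p₀-a) h
    by : u ≡ x ⊎ u ≢ x → u ≡ y ⊎ u ≢ y → Separated₄ p₀ a a u u
    by (inj₁ refl) _ = mk (negᵖ f₁) (subst (0ℚ <_) (sym (go (proj₁ X) (proj₂ X) (proj₁ Y) (proj₂ Y) (proj₁ f₁) (proj₂ f₁))) (half-pos 0<κ))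
      where
      go : ∀ x x' y y' f g → (- f) * (x - ½ * (x + y)) + (- g) * (x' - ½ * (x' + y')) ≡ ½ * (f * (y - x) + g * (y' - x'))
      go = solve 6 (λ x x' y y' f g → (:- f) :* (x :- con ½ :* (x :+ y)) :+ (:- g) :* (x' :- con ½ :* (x' :+ y')) := con ½ :* (f :* (y :- x) :+ g :* (y' :- x'))) refl
    by (inj₂ _) (inj₁ refl) = mk f₁ (subst (0ℚ <_) (sym (go (proj₁ X) (proj₂ X) (proj₁ Y) (proj₂ Y) (proj₁ f₁) (proj₂ f₁))) (half-pos 0<κ))
      where
      go : ∀ x x' y y' f g → f * (y - ½ * (x + y)) + g * (y' - ½ * (x' + y')) ≡ ½ * (f * (y - x) + g * (y' - x'))
      go = solve 6 (λ x x' y y' f g → f :* (y :- con ½ :* (x :+ y)) :+ g :* (y' :- con ½ :* (x' :+ y')) := con ½ :* (f :* (y :- x) :+ g :* (y' :- x'))) refl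
    by (inj₂ nx) (inj₂ ny) = mk Δ⊥ (subst (0ℚ <_) (sym (go (proj₁ X) (proj₂ X) (proj₁ Y) (proj₂ Y) (proj₁ (p' u)) (proj₂ (p' u)))) (far Vu na nx ny))
      where
      go : ∀ x x' y y' z z' → (- (x' - y')) * (z - ½ * (x + y)) + (x - y) * (z' - ½ * (x' + y')) ≡ (x - y) * (z' - y') - (x' - y') * (z - y)
      go = solve 6 (λ x x' y y' z z' → (:- (x' :- y')) :* (z :- con ½ :* (x :+ y)) :+ (x :- y) :* (z' :- con ½ :* (x' :+ y')) := (x :- y) :* (z' :- y') :- (x' :- y') :* (z :- y)) refl

  ev-distinct : ∀ {u t} → V u ≡ true → V t ≡ true → u ≢ t → Eventually (Sepε u u t t)
  ev-distinct {u} {t} Vu Vt n = by (eq? u a) (eq? t a)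
    where
    by : u ≡ a ⊎ u ≢ a → t ≡ a ⊎ t ≢ a → Eventually (Sepε u u t t)
    by (inj₁ e) (inj₁ e') = ⊥-elim (n (trans e (sym e')))
    by (inj₁ refl) (inj₂ na) = from-apex Vt na
    by (inj₂ na) (inj₁ refl) = swap-ev (from-apex Vu na)
    by (inj₂ p) (inj₂ q) = ev-separated (cong-sep {p'} {p₀} {u} {u} {t} {t} (sym (p₀-≢ p)) (sym (p₀-≢ p)) (sym (p₀-≢ q)) (sym (p₀-≢ q))
      (distinct' (∖-intro {p = V} Vu p) (∖-intro {p = V} Vt q) n))

  ApartAt : Fin D → Fin D → ℚ → Set
  ApartAt e f ε = A e → A f → tail e ≢ tail f → tail e ≢ head f → head e ≢ tail f → head e ≢ head f → Sepε (tail e) (head e) (tail f) (head f) ε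

  DistinctAt : Fin n → Fin n → ℚ → Set
  DistinctAt u t ε = V u ≡ true → V t ≡ true → u ≢ t → Sepε u u t t ε

  ev-imp : ∀ {A : Set} {P : ℚ → Set} → A ⊎ (A → ⊥) → (A → Eventually P) → Eventually (λ ε → A → P ε)
  ev-imp (inj₁ h) f = ev-map (λ _ _ q _ → q) (f h)
  ev-imp (inj₂ h) f = ev-always λ _ _ h' → ⊥-elim (h h')

  is-true : ∀ b → b ≡ true ⊎ (b ≡ true → ⊥)
  is-true true = inj₁ refl
  is-true false = inj₂ λ ()

  is-≢ : ∀ (u t : Fin n) → u ≢ t ⊎ (u ≢ t → ⊥)
  is-≢ u t = [ (λ e → inj₂ (λ n → n e)) , inj₁ ]′ (eq? u t)

  ev-apart? : ∀ e f → Eventually (ApartAt e f)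
  ev-apart? e f = ev-imp (is-true (al e)) λ Ae → ev-imp (is-true (al f)) λ Af → ev-imp (is-≢ (tail e) (tail f)) λ n₁ →
    ev-imp (is-≢ (tail e) (head f)) λ n₂ → ev-imp (is-≢ (head e) (tail f)) λ n₃ → ev-imp (is-≢ (head e) (head f)) λ n₄ →
    ev-apart Ae Af n₁ n₂ n₃ n₄

  ev-distinct? : ∀ u t → Eventually (DistinctAt u t)
  ev-distinct? u t = ev-imp (is-true (V u)) λ Vu → ev-imp (is-true (V t)) λ Vt → ev-imp (is-≢ u t) λ n → ev-distinct Vu Vt n

  Good : ℚ → Set
  Good ε = Stable ε × (∀ e f → ApartAt e f ε) × (∀ u t → DistinctAt u t ε)

  good : Eventually Good
  good = ev-× (ev-∀ λ u₁ → ev-∀ λ u₂ → ev-∀ λ u₃ → ev-∀ λ u₄ → ev-cross? u₁ u₂ u₃ u₄)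
      (ev-× (ev-∀ λ e → ev-∀ λ f → ev-apart? e f) (ev-∀ λ u → ev-∀ λ t → ev-distinct? u t))

  drawn-at : ∀ ε → 0ℚ < ε → Good ε → Drawn M (pε ε)
  drawn-at ε 0<ε (st , ap , ds) = record
    { ordered = ordered-ε ; hull = hull-ε ; apart = λ {e} {f} → ap e f ; distinct = λ {u} {t} → ds u t }
    where open At ε 0<ε st

  drawn : ∃ λ p → Drawn M p
  drawn = pε (proj₁ good) , drawn-at (proj₁ good) (proj₁ (proj₂ good)) (proj₂ (proj₂ good) (proj₁ good) (proj₁ (proj₂ good)) ℚP.≤-refl)

-- The edge bound under the reductions

induced : ∀ {D n F : ℕ} (M : Map D n F) → (Fin n → Bool) → Fin D → Bool
induced M X d = Map.al M d ∧ (X (Map.tail M d) ∧ X (Map.head M d))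

-- Twice the inequality |E(X)| + 3 ≤ 2 |X|, as every edge has two darts.
Sparse : ∀ {D n F : ℕ} → Map D n F → Set
Sparse {n = n} M = ∀ (X : Fin n → Bool) → X ⊆ᵇ Map.V M → 2 ≤ℕ # X → # (induced M X) +ℕ 6 ≤ℕ 4 *ℕ # X

module Induced {D n F : ℕ} (M : Map D n F) (isMap : IsMap M) where
  open MapFacts M isMap

  E : (Fin n → Bool) → Fin D → Bool
  E = induced M

  E-A : ∀ {X d} → E X d ≡ true → A d
  E-A = ∧-elim₁
  E-tail : ∀ {X d} → E X d ≡ true → X (tail d) ≡ true
  E-tail {X} {d} h = ∧-elim₁ {X (tail d)} (∧-elim₂ {al d} h)
  E-head : ∀ {X d} → E X d ≡ true → X (head d) ≡ true
  E-head {X} {d} h = ∧-elim₂ {X (tail d)} (∧-elim₂ {al d} h)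

  -- Within a set of two vertices a dart is determined by its tail, so there are at most two darts,
  -- and 2 + 6 is 4 times 2.
  pair-sparse : ∀ X → # X ≡ 2 → # (E X) +ℕ 6 ≤ℕ 4 *ℕ # X
  pair-sparse X e = ℕP.≤-trans (ℕP.+-monoˡ-≤ 6 (ℕP.≤-trans (#-inj (E X) X (λ d _ → tail d) (λ d h → E-tail {X} h) inj) (ℕP.≤-reflexive e)))
      (ℕP.≤-reflexive (sym (cong (4 *ℕ_) e)))
    where
    three : ∀ {u h k} → X u ≡ true → X h ≡ true → X k ≡ true → u ≢ h → u ≢ k → h ≡ k
    three {u} {h} {k} Xu Xh Xk p q with eq? h k
    ... | inj₁ r = r
    ... | inj₂ r = ⊥-elim (ℕP.1+n≰n (ℕP.≤-trans (#-list-≥ {ys = u ∷ h ∷ k ∷ []} X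
        ((λ { (here x) → p x ; (there (here x)) → q x }) ∷ (λ { (here x) → r x }) ∷ (λ ()) ∷ [])
        (λ { (here refl) → Xu ; (there (here refl)) → Xh ; (there (there (here refl))) → Xk })) (ℕP.≤-reflexive e)))
    inj : ∀ d d' → E X d ≡ true → E X d' ≡ true → tail d ≡ tail d' → d ≡ d'
    inj d d' h h' t = nomulti (E-A {X} h) (E-A {X} h') t (three (E-tail {X} h) (E-head {X} h) (E-head {X} h')
      (λ q → noloop (E-A {X} h) (sym q)) (λ q → noloop (E-A {X} h') (sym (trans (sym t) q))))

two-or-more : ∀ {m} → 2 ≤ℕ suc m → suc m ≡ 2 ⊎ 2 ≤ℕ m
two-or-more {suc zero} _ = inj₁ refl
two-or-more {suc (suc m)} _ = inj₂ (s≤s (s≤s z≤n))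
two-or-more {zero} (s≤s ())

grow-sparse : ∀ {e e' m} → e ≤ℕ e' +ℕ 4 → e' +ℕ 6 ≤ℕ 4 *ℕ m → e +ℕ 6 ≤ℕ 4 *ℕ suc m
grow-sparse {e} {e'} {m} h h' = ℕP.≤-trans (ℕP.+-monoˡ-≤ 6 h) (ℕP.≤-trans (ℕP.≤-reflexive (arith₁ e'))
  (ℕP.≤-trans (ℕP.+-monoˡ-≤ 4 h') (ℕP.≤-reflexive (arith₂ m))))
  where
  arith₁ : ∀ e → (e +ℕ 4) +ℕ 6 ≡ (e +ℕ 6) +ℕ 4
  arith₁ = solve-∀
  arith₂ : ∀ m → 4 *ℕ m +ℕ 4 ≡ 4 *ℕ suc m
  arith₂ = solve-∀

module ContractSparse {D n F : ℕ} (M : Map D n F) (isMap : IsMap M) (red : Reducible M)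
  (sparse' : Sparse (Contract.M' M isMap red)) where
  open Contract M isMap red
  open Induced M isMap
  E' : (Fin n → Bool) → Fin D → Bool
  E' = induced M'

  -- If v and c are not both in `X`, renaming is injective on `X`. Then `ι` is injective on the
  -- induced darts, as these are determined by their ends.
  rename-sparse : ∀ X Y → Y ⊆ᵇ ′.V → (∀ {u} → X u ≡ true → Y (rn u) ≡ true) → (X v ≡ true → X c ≡ true → ⊥) →
    # X ≡ # Y → 2 ≤ℕ # X → # (E X) +ℕ 6 ≤ℕ 4 *ℕ # X
  rename-sparse X Y YV XY not-both-vc eq le = ℕP.≤-trans (ℕP.+-monoˡ-≤ 6 (#-inj (E X) (E' Y) (λ d _ → ι d)
      (λ d h → ∧-intro (ι-A' (E-A {X} h)) (∧-intro (trans (cong Y (tail-ι (E-A {X} h))) (XY (E-tail {X} h)))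
        (trans (cong Y (head-ι (E-A {X} h))) (XY (E-head {X} h)))))
      inj)) (ℕP.≤-trans (sparse' Y YV (subst (2 ≤ℕ_) eq le)) (ℕP.≤-reflexive (cong (4 *ℕ_) (sym eq))))
    where
    rn-inj : ∀ {p q} → X p ≡ true → X q ≡ true → rn p ≡ rn q → p ≡ q
    rn-inj {p} {q} Xp Xq e = [ id , [ (λ { (refl , refl) → ⊥-elim (not-both-vc Xp Xq) }) , (λ { (refl , refl) → ⊥-elim (not-both-vc Xq Xp) }) ]′ ]′ (rn-inv {p} {q} e)
    inj : ∀ d d' → E X d ≡ true → E X d' ≡ true → ι d ≡ ι d' → d ≡ d'
    inj d d' h h' e = nomulti (E-A {X} h) (E-A {X} h')
      (rn-inj (E-tail {X} h) (E-tail {X} h') (trans (sym (tail-ι (E-A {X} h))) (trans (cong ′.tail e) (tail-ι (E-A {X} h')))))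
      (rn-inj (E-head {X} h) (E-head {X} h') (trans (sym (head-ι (E-A {X} h))) (trans (cong ′.head e) (head-ι (E-A {X} h')))))

  sparse : Sparse M
  sparse X XV le = by (bool-cases (X v)) (bool-cases (X c))
    where
    by : X v ≡ true ⊎ X v ≡ false → X c ≡ true ⊎ X c ≡ false → # (E X) +ℕ 6 ≤ℕ 4 *ℕ # X
    by (inj₂ ¬v) _ = rename-sparse X X (λ u Xu → ∖-intro {p = V} (XV u Xu) (nv Xu)) (λ {u} Xu → trans (cong X (rn-≢ (nv Xu))) Xu)
        (λ Xv _ → true≢false Xv ¬v) refl le
      where
      nv : ∀ {u} → X u ≡ true → u ≢ v
      nv Xu refl = true≢false Xu ¬v
    by (inj₁ Xv) (inj₂ ¬c) = rename-sparse X Y YV' XY (λ _ Xc → true≢false Xc ¬c)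
        (trans (#-remove X v Xv) (sym (#-insert (X ∖ v) c (false-intro λ h → true≢false (proj₁ (∖-elim {p = X} h)) ¬c)))) le
      where
      Y : Fin n → Bool
      Y = insert (X ∖ v) c
      YV' : Y ⊆ᵇ ′.V
      YV' u h with insert-elim (X ∖ v) h
      ... | inj₁ k = ∖-intro {p = V} (XV u (proj₁ (∖-elim {p = X} k))) (proj₂ (∖-elim {p = X} k))
      ... | inj₂ refl = ∖-intro {p = V} (tail-V A₁) (≢-sym v≢c)
      XY : ∀ {u} → X u ≡ true → Y (rn u) ≡ true
      XY {u} Xu with eq? u v
      ... | inj₁ refl = trans (cong Y rn-v) (insert-new (X ∖ v) c)
      ... | inj₂ nv = trans (cong Y (rn-≢ nv)) (∨-intro₁ (∖-intro {p = X} Xu nv))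
    by (inj₁ Xv) (inj₁ Xc) = merge (two-or-more (subst (2 ≤ℕ_) #X le))
      where
      Y : Fin n → Bool
      Y = X ∖ v
      #X : # X ≡ suc (# Y)
      #X = #-remove X v Xv
      XY : ∀ {u} → X u ≡ true → Y (rn u) ≡ true
      XY {u} Xu with eq? u v
      ... | inj₁ refl = trans (cong Y rn-v) (∖-intro {p = X} Xc (≢-sym v≢c))
      ... | inj₂ nv = trans (cong Y (rn-≢ nv)) (∖-intro {p = X} Xu nv)
      q : List (Fin D)
      q = d₁ ∷ d₂ ∷ d₃ ∷ d₄ ∷ []
      -- When both v and c are in `X`, the only darts lost are the four of Q, and the lost vertex
      -- pays for exactly four.
      E-le : # (E X) ≤ℕ # (E' Y) +ℕ 4
      E-le = ℕP.≤-trans (#-cover (E' Y) (member q) (E X) cov) (ℕP.+-monoʳ-≤ (# (E' Y)) (#-list-≤ q (member q) λ _ → member-elim q))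
        where
        cov : ∀ d → E X d ≡ true → E' Y d ≡ true ⊎ member q d ≡ true
        cov d h with eq? (face d) Q
        ... | inj₂ n = inj₁ (∧-intro (mkA' (E-A {X} h) n) (∧-intro (XY (E-tail {X} h)) (trans (cong Y (head' (E-A {X} h))) (XY (E-head {X} h)))))
        ... | inj₁ f = inj₂ (member-intro {ys = q} (case in-Q (E-A {X} h) f of λ
              { (inj₁ e) → here e ; (inj₂ (inj₁ e)) → there (here e) ; (inj₂ (inj₂ (inj₁ e))) → there (there (here e))
              ; (inj₂ (inj₂ (inj₂ e))) → there (there (there (here e))) }))
      merge : suc (# Y) ≡ 2 ⊎ 2 ≤ℕ # Y → # (E X) +ℕ 6 ≤ℕ 4 *ℕ # X
      merge (inj₁ e) = pair-sparse X (trans #X e)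
      merge (inj₂ l) = subst (λ z → # (E X) +ℕ 6 ≤ℕ 4 *ℕ z) (sym #X) (grow-sparse E-le
        (sparse' Y (λ u h → ∖-intro {p = V} (XV u (proj₁ (∖-elim {p = X} h))) (proj₂ (∖-elim {p = X} h))) l))

module EarSparse {D n F : ℕ} (M : Map D n F) (isMap : IsMap M) (ear : Ear M)
  (noquad : ∀ {d} → Map.A M d → Map.face M d ≢ Map.outer M → Map.quad M (Map.face M d) ≡ false)
  (sparse' : Sparse (RemoveEar.M' M isMap ear noquad)) where
  open RemoveEar M isMap ear noquad
  open Induced M isMap
  E' : (Fin n → Bool) → Fin D → Bool
  E' = induced M'

  E-E' : ∀ X → (X a ≡ true → ⊥) → # (E X) ≤ℕ # (E' X)
  E-E' X na = #-inj (E X) (E' X) (λ d _ → ι d)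
      (λ d h → ∧-intro (ι-A' (E-A {X} h) (ta h)) (∧-intro (trans (cong X (tail-ι d)) (E-tail {X} h))
        (trans (cong X (head-ι (E-A {X} h) (ta h) (ha h))) (E-head {X} h))))
      (λ d d' h h' e → nomulti (E-A {X} h) (E-A {X} h') (trans (sym (tail-ι d)) (trans (cong tail e) (tail-ι d')))
        (trans (sym (head-ι (E-A {X} h) (ta h) (ha h))) (trans (cong ′.head e) (head-ι (E-A {X} h') (ta h') (ha h')))))
    where
    ta : ∀ {d} → E X d ≡ true → tail d ≢ a
    ta h e = na (subst (λ u → X u ≡ true) e (E-tail {X} h))
    ha : ∀ {d} → E X d ≡ true → head d ≢ a
    ha h e = na (subst (λ u → X u ≡ true) e (E-head {X} h))

  sparse : Sparse M
  sparse X XV le = by (bool-cases (X a))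
    where
    by : X a ≡ true ⊎ X a ≡ false → # (E X) +ℕ 6 ≤ℕ 4 *ℕ # X
    by (inj₂ ¬a) = ℕP.≤-trans (ℕP.+-monoˡ-≤ 6 (E-E' X λ h → true≢false h ¬a))
        (sparse' X (λ u h → ∖-intro {p = V} (XV u h) λ { refl → true≢false h ¬a }) le)
    by (inj₁ Xa) = merge (two-or-more (subst (2 ≤ℕ_) #X le))
      where
      Y : Fin n → Bool
      Y = X ∖ a
      #X : # X ≡ suc (# Y)
      #X = #-remove X a Xa
      q : List (Fin D)
      q = o₁ ∷ t₂ ∷ t₁ ∷ o₂ ∷ []
      cov : ∀ d → E X d ≡ true → E Y d ≡ true ⊎ member q d ≡ true
      cov d h with eq? (tail d) a | eq? (head d) a
      ... | inj₁ e | _ = inj₂ (member-intro {ys = q} (case at-a (E-A {X} h) e of λ { (inj₁ k) → here k ; (inj₂ k) → there (here k) }))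
      ... | inj₂ _ | inj₁ e = inj₂ (member-intro {ys = q} (case at-a (αA (E-A {X} h)) e of λ
            { (inj₁ k) → there (there (here (α-inj (E-A {X} h) At₁ k))) ; (inj₂ k) → there (there (there (here (trans (sym (αα (E-A {X} h))) (cong α k))))) }))
      ... | inj₂ n | inj₂ n' = inj₁ (∧-intro (E-A {X} h) (∧-intro (∖-intro {p = X} (E-tail {X} h) n) (∖-intro {p = X} (E-head {X} h) n')))
      E-le : # (E X) ≤ℕ # (E' Y) +ℕ 4
      E-le = ℕP.≤-trans (#-cover (E Y) (member q) (E X) cov)
        (ℕP.+-mono-≤ (E-E' Y λ h → proj₂ (∖-elim {p = X} h) refl) (#-list-≤ q (member q) λ _ → member-elim q))
      merge : suc (# Y) ≡ 2 ⊎ 2 ≤ℕ # Y → # (E X) +ℕ 6 ≤ℕ 4 *ℕ # X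
      merge (inj₁ e) = pair-sparse X (trans #X e)
      merge (inj₂ l) = subst (λ z → # (E X) +ℕ 6 ≤ℕ 4 *ℕ z) (sym #X) (grow-sparse E-le
        (sparse' Y (λ u h → ∖-intro {p = V} (XV u (proj₁ (∖-elim {p = X} h))) (proj₂ (∖-elim {p = X} h))) l))

-- The base case

module OneEdge {D n F : ℕ} (M : Map D n F) (isMap : IsMap M) (all-outer : ∀ {d} → Map.A M d → Map.face M d ≡ Map.outer M) where
  open MapFacts M isMap
  open Induced M isMap

  d₀ : Fin D
  d₀ = proj₁ (Fc-face outer-Fc)
  A₀ : A d₀
  A₀ = proj₁ (proj₂ (Fc-face outer-Fc))

  -- Without interior faces all corners are outer, hence reflex, and a vertex has only one reflex
  -- corner. So every vertex has degree one, and the connected graph is a single edge.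
  fixed : ∀ {e} → A e → ∀ {f} → A f → tail f ≡ tail e → f ≡ e
  fixed Ae Af t = root-unique Af Ae t (outer-ρ Af (all-outer Af)) (outer-ρ Ae (all-outer Ae))

  End : Fin n → Set
  End u = u ≡ tail d₀ ⊎ u ≡ head d₀

  ends : ∀ {u} → V u ≡ true → End u
  ends {u} Vu with ∨-elim (conn W closed (tail-V A₀) Vu (∨-intro₁ (=ᶠ-refl (tail d₀))))
    where
    W : Fin n → Bool
    W u = (u =ᶠ tail d₀) ∨ (u =ᶠ head d₀)
    closed : ∀ {f} → A f → W (tail f) ≡ true → W (head f) ≡ true
    closed {f} Af h with ∨-elim {tail f =ᶠ tail d₀} h
    ... | inj₁ e = ∨-intro₂ {head f =ᶠ tail d₀} (=ᶠ-intro (cong head (fixed A₀ Af (=ᶠ-true (tail f) (tail d₀) e))))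
    ... | inj₂ e = ∨-intro₁ (=ᶠ-intro (trans (cong head (fixed (αA A₀) Af (=ᶠ-true (tail f) (head d₀) e))) (head-α A₀)))
  ... | inj₁ e = inj₁ (=ᶠ-true u (tail d₀) e)
  ... | inj₂ e = inj₂ (=ᶠ-true u (head d₀) e)

  pigeon : ∀ {x y z} → V x ≡ true → V y ≡ true → V z ≡ true → x ≢ y → x ≢ z → y ≢ z → ⊥
  pigeon Vx Vy Vz p q r with ends Vx | ends Vy | ends Vz
  ... | inj₁ e | inj₁ f | _ = p (trans e (sym f))
  ... | inj₂ e | inj₂ f | _ = p (trans e (sym f))
  ... | inj₁ e | inj₂ f | inj₁ g = q (trans e (sym g))
  ... | inj₁ e | inj₂ f | inj₂ g = r (trans f (sym g))
  ... | inj₂ e | inj₁ f | inj₁ g = r (trans f (sym g))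
  ... | inj₂ e | inj₁ f | inj₂ g = q (trans e (sym g))

  p : Fin n → Point
  p u = if u =ᶠ tail d₀ then (0ℚ , 0ℚ) else (1ℚ , 0ℚ)

  p-tail : p (tail d₀) ≡ (0ℚ , 0ℚ)
  p-tail rewrite =ᶠ-refl (tail d₀) = refl
  p-head : p (head d₀) ≡ (1ℚ , 0ℚ)
  p-head rewrite =ᶠ-false (noloop A₀) = refl

  sep₀ : Separated₄ p (tail d₀) (tail d₀) (head d₀) (head d₀)
  sep₀ = (1ℚ , 0ℚ) , (h , h) , (h , h)
    where
    h : 0ℚ < lin (1ℚ , 0ℚ) (p (head d₀) -ᵖ p (tail d₀))
    h = subst₂ (λ x y → 0ℚ < lin (1ℚ , 0ℚ) (x -ᵖ y)) (sym p-head) (sym p-tail) 0<1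

  drawn : ∃ λ p → Drawn M p
  drawn = p , record
    { ordered = λ b → ⊥-elim (true≢false (outer-ρ (Order.A-right M isMap b) (all-outer (Order.A-right M isMap b))) (Order.not-root M isMap b))
    ; hull = λ Ad _ Vu nt nh → ⊥-elim (pigeon Vu (tail-V Ad) (tail-V (αA Ad)) nt nh (≢-sym (noloop Ad)))
    ; apart = λ Ae Af n₁ n₂ _ _ → ⊥-elim (pigeon (tail-V Ae) (tail-V Af) (tail-V (αA Af)) n₁ n₂ (≢-sym (noloop Af)))
    ; distinct = dist
    }
    where
    dist : ∀ {u t} → V u ≡ true → V t ≡ true → u ≢ t → Separated₄ p u u t t
    dist Vu Vt n with ends Vu | ends Vt
    ... | inj₁ e | inj₁ f = ⊥-elim (n (trans e (sym f)))
    ... | inj₂ e | inj₂ f = ⊥-elim (n (trans e (sym f)))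
    ... | inj₁ refl | inj₂ refl = sep₀
    ... | inj₂ refl | inj₁ refl = separated-swap {p = p} {tail d₀} {tail d₀} {head d₀} {head d₀} sep₀

  sparse : Sparse M
  sparse X XV le = pair-sparse X (ℕP.≤-antisym (#-list-≤ (tail d₀ ∷ head d₀ ∷ []) X λ u Xu → case ends (XV u Xu) of λ
    { (inj₁ e) → here e ; (inj₂ e) → there (here e) }) le)

-- Contraction and ear removal both delete exactly one face, so the recursion is on the number of
-- faces. The edge bound is proved in the same recursion because it follows the same reductions.
draw : ∀ {D n F} m (M : Map D n F) → IsMap M → # (Map.Fc M) ≡ m → (∃ λ p → Drawn M p) × Sparse M
draw zero M isMap e = ⊥-elim (case subst (1 ≤ℕ_) e (#-pos (Map.outer M) (IsMap.outer-Fc isMap)) of λ ())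
draw {D} {n} {F} (suc m) M isMap e = inner-root (search λ d → (al d ∧ ρ d) ∧ not (face d =ᶠ outer))
  where
  open MapFacts M isMap
  Result = (∃ λ p → Drawn M p) × Sparse M
  base-or-ear : (∀ {d} → A d → face d ≢ outer → quad (face d) ≡ false) → (∃ λ d → al d ∧ not (face d =ᶠ outer) ≡ true) ⊎ (∀ d → al d ∧ not (face d =ᶠ outer) ≡ false) → Result
  base-or-ear noquad (inj₂ none) = OneEdge.drawn M isMap all , OneEdge.sparse M isMap all
    where
    all : ∀ {d} → A d → face d ≡ outer
    all {d} Ad = [ id , (λ h → ⊥-elim (true≢false (∧-intro Ad (not-intro (=ᶠ-false h))) (none d))) ]′ (eq? (face d) outer)
  base-or-ear noquad (inj₁ (d , h)) = finish (draw m R.M' R.isMap' (ℕP.suc-injective (trans (sym R.#Fc) e)))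
    where
    ear : Ear M
    ear = EarExists.ear M isMap noquad (∧-elim₁ {al d} h) (λ q → true≢false (=ᶠ-intro q) (not-elim (∧-elim₂ {al d} h)))
    module R = RemoveEar M isMap ear noquad
    finish : (∃ λ p → Drawn R.M' p) × Sparse R.M' → Result
    finish ((p , dr) , sp) = EarApart.drawn M isMap ear noquad p dr , EarSparse.sparse M isMap ear noquad sp
  inner-root : (∃ λ d → (al d ∧ ρ d) ∧ not (face d =ᶠ outer) ≡ true) ⊎ (∀ d → (al d ∧ ρ d) ∧ not (face d =ᶠ outer) ≡ false) → Result
  inner-root (inj₂ none) = base-or-ear noquad (search λ d → al d ∧ not (face d =ᶠ outer))
    where
    noquad : ∀ {d} → A d → face d ≢ outer → quad (face d) ≡ false
    noquad {d} Ad nd = false-intro λ q → let (r , Ar , fr , ρr) = quad-root Ad nd q in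
      true≢false (∧-intro (∧-intro Ar ρr) (not-intro (=ᶠ-false λ k → nd (trans (sym fr) k)))) (none r)
  inner-root (inj₁ (d , h)) = finish (draw m C.M' C.isMap' (ℕP.suc-injective (trans (sym C.#Fc) e)))
    where
    h' = ∧-elim₁ {al d ∧ ρ d} h
    red : Reducible M
    red = reducible M isMap (∧-elim₁ {al d} h') (∧-elim₂ {al d} h') (λ q → true≢false (=ᶠ-intro q) (not-elim (∧-elim₂ {al d ∧ ρ d} h)))
    module C = Contract M isMap red
    finish : (∃ λ p → Drawn C.M' p) × Sparse C.M' → Result
    finish ((p , dr) , sp) = SplitDrawn.drawn M isMap red p dr , ContractSparse.sparse M isMap red sp

-- From embeddings to tagged maps

iter-shift : ∀ {A : Set} (f : A → A) k x → iter f k (f x) ≡ f (iter f k x)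
iter-shift f zero x = refl
iter-shift f (suc k) x = cong f (iter-shift f k x)

module FromEmbedding {n : ℕ} (G : Embedding n) (reflex : Fin (Embedding.D G) → Bool) (H : IsComb4PPT G reflex) where
  open IsComb4PPT H
  open IsCombPT pt
  open IsPlaneSimple plane
  module G = Embedding G

  D F : ℕ
  D = G.D
  F = G.F

  φ-inj : ∀ {x y} → G.φ x ≡ G.φ y → x ≡ y
  φ-inj {x} {y} e = trans (sym (α-invol x)) (trans (cong G.α (σ-inj (G.α x) (G.α y) e)) (α-invol y))

  abstract
    -- Transitivity of the rotation gives a k with σᵏ (σ x) equal to x. As powers of σ commute with
    -- σ, the dart σᵏ x is a preimage of x.
    σ⁻ : Fin D → Fin D
    σ⁻ x = iter G.σ (proj₁ (σ-trans (G.σ x) x (σ-tail x))) x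

    σσ⁻ : ∀ x → G.σ (σ⁻ x) ≡ x
    σσ⁻ x = trans (sym (iter-shift G.σ (proj₁ (σ-trans (G.σ x) x (σ-tail x))) x)) (proj₂ (σ-trans (G.σ x) x (σ-tail x)))

  σ⁻σ : ∀ x → σ⁻ (G.σ x) ≡ x
  σ⁻σ x = σ-inj _ _ (σσ⁻ (G.σ x))

  tail-σ⁻ : ∀ x → G.tail (σ⁻ x) ≡ G.tail x
  tail-σ⁻ x = trans (sym (σ-tail (σ⁻ x))) (cong G.tail (σσ⁻ x))

  -- An embedding indexes the corner between `e` and `σ e` by `e`, a map by `σ e`, the dart that
  -- lies in the face of the corner.
  ρ : Fin D → Bool
  ρ x = reflex (σ⁻ x)

  ρσ : ∀ e → ρ (G.σ e) ≡ reflex e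
  ρσ e = cong reflex (σ⁻σ e)

  On : Fin F → Fin D → Bool
  On f x = G.face x =ᶠ f

  size : Fin F → ℕ
  size f = # (On f)

  M : Map D n F
  M = record { al = λ _ → true ; V = λ _ → true ; Fc = λ _ → true ; α = G.α ; φ = G.φ ; tail = G.tail ; face = G.face
             ; ρ = ρ ; quad = λ f → does (size f ℕP.≟ 4) ; outer = G.outer }

  σ≡ : ∀ e → Map.σ M e ≡ G.σ e
  σ≡ e = cong G.σ (α-invol e)

  star-iter : ∀ {A : Set} (f g : A → A) → (∀ x → g x ≡ f x) → ∀ k x → Star g x (iter f k x)
  star-iter f g e zero x = stop
  star-iter f g e (suc k) x = subst (Star g x) (e (iter f k x)) (next (star-iter f g e k x))

  sizes : ∀ {f} → f ≢ G.outer → size f ≡ 3 ⊎ size f ≡ 4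
  sizes {f} nf = [ (λ e → inj₁ (trans (sym (count≡# (On f))) e)) , (λ e → inj₂ (trans (sym (count≡# (On f))) e)) ]′ (proj₁ (faces34 f nf))

  convex-3 : ∀ {f} → f ≢ G.outer → # (λ x → On f x ∧ not (ρ x)) ≡ 3
  convex-3 {f} nf = trans (sym (#-perm (λ x → On f x ∧ not (ρ x)) G.σ σ⁻ σσ⁻ σ⁻σ))
    (trans (#-cong λ e → cong (λ b → On f (G.σ e) ∧ not b) (ρσ e)) (trans (sym (count≡# (λ e → (G.angleFace e =ᶠ f) ∧ not (reflex e)))) (three-convex f nf)))

  module Boundary {d : Fin D} (inner : G.face d ≢ G.outer) where
    f : Fin F
    f = G.face d
    x₂ x₃ x₄ x₅ : Fin D
    x₂ = G.φ d
    x₃ = G.φ x₂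
    x₄ = G.φ x₃
    x₅ = G.φ x₄

    covers : ∀ (xs : List (Fin D)) → d ∈ˡ xs → (∀ {x} → x ∈ˡ xs → G.φ x ∈ˡ xs) → ∀ {e} → G.face e ≡ f → e ∈ˡ xs
    covers xs dm cl {e} fe with face-orbit d e (sym fe)
    ... | k , refl = go k
      where
      go : ∀ k → iter G.φ k d ∈ˡ xs
      go zero = dm
      go (suc k) = cl (go k)

    size-≤ : ∀ (xs : List (Fin D)) → d ∈ˡ xs → (∀ {x} → x ∈ˡ xs → G.φ x ∈ˡ xs) → size f ≤ℕ length xs
    size-≤ xs dm cl = #-list-≤ xs (On f) λ x h → covers xs dm cl (=ᶠ-true (G.face x) f h)

    on₂ : G.face x₂ ≡ f
    on₂ = face-φ d
    on₃ : G.face x₃ ≡ f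
    on₃ = trans (face-φ x₂) on₂
    on₄ : G.face x₄ ≡ f
    on₄ = trans (face-φ x₃) on₃
    on₅ : G.face x₅ ≡ f
    on₅ = trans (face-φ x₄) on₄

    size≥3 : 3 ≤ℕ size f
    size≥3 = [ (λ e → ℕP.≤-reflexive (sym e)) , (λ e → ℕP.≤-trans (ℕP.n≤1+n 3) (ℕP.≤-reflexive (sym e))) ]′ (sizes inner)

    d≢x₂ : d ≢ x₂
    d≢x₂ e = no-loop d (trans (sym (σ-tail (G.α d))) (cong G.tail (sym e)))

    d≢x₃ : d ≢ x₃
    d≢x₃ e = ℕP.1+n≰n (ℕP.≤-trans size≥3 (size-≤ (d ∷ x₂ ∷ []) (here refl)
      λ { (here refl) → there (here refl) ; (there (here refl)) → here (sym e) }))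

    x₂≢x₃ : x₂ ≢ x₃
    x₂≢x₃ e = d≢x₂ (φ-inj e)

    -- Since `φ` is injective, a coincidence among later darts of the walk goes back to one
    -- involving `d`. If the walk did not close after three steps, it would exhibit four distinct
    -- darts in a face of size three.
    triangle : size f ≡ 3 → x₄ ≡ d
    triangle s with eq? x₄ d
    ... | inj₁ e = e
    ... | inj₂ n' = ⊥-elim (ℕP.1+n≰n (ℕP.≤-trans (#-list-≥ {ys = d ∷ x₂ ∷ x₃ ∷ x₄ ∷ []} (On f)
        ((λ { (here e) → d≢x₂ e ; (there (here e)) → d≢x₃ e ; (there (there (here e))) → n' (sym e) })
          ∷ (λ { (here e) → x₂≢x₃ e ; (there (here e)) → d≢x₃ (φ-inj e) }) ∷ (λ { (here e) → x₂≢x₃ (φ-inj e) }) ∷ (λ ()) ∷ [])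
        λ { (here refl) → =ᶠ-refl f ; (there (here refl)) → =ᶠ-intro on₂ ; (there (there (here refl))) → =ᶠ-intro on₃
          ; (there (there (there (here refl)))) → =ᶠ-intro on₄ }) (ℕP.≤-reflexive s)))

    quadrilateral : size f ≡ 4 → x₅ ≡ d
    quadrilateral s with eq? x₅ d
    ... | inj₁ e = e
    ... | inj₂ n' = ⊥-elim (ℕP.1+n≰n (ℕP.≤-trans (#-list-≥ {ys = d ∷ x₂ ∷ x₃ ∷ x₄ ∷ x₅ ∷ []} (On f)
        ((λ { (here e) → d≢x₂ e ; (there (here e)) → d≢x₃ e ; (there (there (here e))) → d≢x₄ e ; (there (there (there (here e)))) → n' (sym e) })
          ∷ (λ { (here e) → x₂≢x₃ e ; (there (here e)) → d≢x₃ (φ-inj e) ; (there (there (here e))) → d≢x₄ (φ-inj e) })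
          ∷ (λ { (here e) → x₂≢x₃ (φ-inj e) ; (there (here e)) → d≢x₃ (φ-inj (φ-inj e)) }) ∷ (λ { (here e) → x₂≢x₃ (φ-inj (φ-inj e)) }) ∷ (λ ()) ∷ [])
        λ { (here refl) → =ᶠ-refl f ; (there (here refl)) → =ᶠ-intro on₂ ; (there (there (here refl))) → =ᶠ-intro on₃
          ; (there (there (there (here refl)))) → =ᶠ-intro on₄ ; (there (there (there (there (here refl))))) → =ᶠ-intro on₅ }) (ℕP.≤-reflexive s)))
      where
      d≢x₄ : d ≢ x₄
      d≢x₄ e = ℕP.1+n≰n (ℕP.≤-trans (ℕP.≤-reflexive (sym s)) (size-≤ (d ∷ x₂ ∷ x₃ ∷ []) (here refl)
        λ { (here refl) → there (here refl) ; (there (here refl)) → there (there (here refl)) ; (there (there (here refl))) → here (sym e) }))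

    orbit₄ : ∀ {e} → G.face e ≡ f → e ≡ d ⊎ e ≡ x₂ ⊎ e ≡ x₃ ⊎ e ≡ x₄
    orbit₄ fe with covers (d ∷ x₂ ∷ x₃ ∷ x₄ ∷ []) (here refl) (closed (sizes inner)) fe
      where
      closed : size f ≡ 3 ⊎ size f ≡ 4 → ∀ {x} → x ∈ˡ d ∷ x₂ ∷ x₃ ∷ x₄ ∷ [] → G.φ x ∈ˡ d ∷ x₂ ∷ x₃ ∷ x₄ ∷ []
      closed _ (here refl) = there (here refl)
      closed _ (there (here refl)) = there (there (here refl))
      closed _ (there (there (here refl))) = there (there (there (here refl)))
      closed (inj₁ s) (there (there (there (here refl)))) = there (here (cong G.φ (triangle s)))
      closed (inj₂ s) (there (there (there (here refl)))) = here (quadrilateral s)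
    ... | here e = inj₁ e
    ... | there (here e) = inj₂ (inj₁ e)
    ... | there (there (here e)) = inj₂ (inj₂ (inj₁ e))
    ... | there (there (there (here e))) = inj₂ (inj₂ (inj₂ e))

    roots : Fin D → Bool
    roots x = On f x ∧ ρ x

    #roots : # roots +ℕ 3 ≡ size f
    #roots = trans (cong (# roots +ℕ_) (sym (convex-3 inner))) (sym (#-split (On f) ρ))

    no-root : size f ≡ 3 → ρ d ≡ false
    no-root s = false-intro λ h → ℕP.1+n≰n (ℕP.≤-trans (#-pos d (∧-intro (=ᶠ-refl f) h)) (ℕP.≤-reflexive (ℕP.+-cancelʳ-≡ 3 (# roots) 0 (trans #roots s))))

    some-root : size f ≡ 4 → ∃ λ r → G.face r ≡ f × ρ r ≡ true
    some-root s with search roots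
    ... | inj₁ (r , h) = r , =ᶠ-true (G.face r) f (∧-elim₁ h) , ∧-elim₂ {On f r} h
    ... | inj₂ none = ⊥-elim (case trans (sym (#-false none)) (ℕP.+-cancelʳ-≡ 3 (# roots) 1 (trans #roots s)) of λ ())

    one-root : ∀ {r s} → G.face r ≡ f → G.face s ≡ f → ρ r ≡ true → ρ s ≡ true → r ≡ s
    one-root {r} {s} fr fs ρr ρs with eq? r s
    ... | inj₁ e = e
    ... | inj₂ n' = ⊥-elim (ℕP.1+n≰n (ℕP.+-cancelʳ-≤ 3 2 1 (ℕP.≤-trans (ℕP.+-monoˡ-≤ 3 (#-list-≥ {ys = r ∷ s ∷ []} roots ((λ { (here e) → n' e }) ∷ (λ ()) ∷ [])
        λ { (here refl) → ∧-intro (=ᶠ-intro fr) ρr ; (there (here refl)) → ∧-intro (=ᶠ-intro fs) ρs }))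
        (ℕP.≤-trans (ℕP.≤-reflexive #roots) ([ (λ e → ℕP.≤-trans (ℕP.≤-reflexive e) (ℕP.n≤1+n 3)) , ℕP.≤-reflexive ]′ (sizes inner))))))

  size-3 : ∀ {f} → f ≢ G.outer → does (size f ℕP.≟ 4) ≡ false → size f ≡ 3
  size-3 {f} nf h = [ id , (λ e → ⊥-elim (true≢false (dec-true (size f ℕP.≟ 4) e) h)) ]′ (sizes nf)

  size-4 : ∀ {f} → does (size f ℕP.≟ 4) ≡ true → size f ≡ 4
  size-4 {f} = does-true (size f ℕP.≟ 4)

  isMap : IsMap M
  isMap = record
    { αA = λ _ → refl ; φA = λ _ → refl ; αα = λ {d} _ → α-invol d
    ; tail-φ = λ {d} _ → σ-tail (G.α d)
    ; face-φ = λ {d} _ → face-φ d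
    ; orbit = λ {d} {e} _ _ t → let (k , q) = σ-trans d e t in subst (Star (Map.σ M) d) q (star-iter G.σ (Map.σ M) σ≡ k d)
    ; tail-V = λ _ → refl ; face-Fc = λ _ → refl
    ; V-tail = λ {u} _ → let ((e , te , _) , _) = pointed u in e , refl , te
    ; Fc-face = λ {f} _ → let (d , fd) = face-surj f in d , refl , fd
    ; outer-Fc = refl
    ; tri = λ _ nd q → Boundary.triangle nd (size-3 nd q) , Boundary.no-root nd (size-3 nd q)
    ; quad-φ = λ _ nd q → Boundary.quadrilateral nd (size-4 q)
    ; quad-root = λ _ nd q → let (r , fr , ρr) = Boundary.some-root nd (size-4 q) in r , refl , fr , ρr
    ; face-root = λ _ _ fe nd → Boundary.one-root nd refl (sym fe)
    ; face-orbit = λ _ _ fe nd → Boundary.orbit₄ nd (sym fe)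
    ; outer-ρ = λ {d} _ fd → outer-reflex (σ⁻ d) (trans (cong G.face (σσ⁻ d)) fd)
    ; outer-return = λ {d} _ fd → let (k , q) = face-orbit (G.φ d) d (face-φ d) in
        subst (Star G.φ (G.φ d)) q (star-iter G.φ G.φ (λ _ → refl) k (G.φ d))
    ; root-unique = λ {d} {e} _ _ t ρd ρe → trans (sym (σσ⁻ d)) (trans (cong G.σ
        (one-reflex (σ⁻ d) (σ⁻ e) (trans (tail-σ⁻ d) (trans t (sym (tail-σ⁻ e)))) ρd ρe)) (σσ⁻ e))
    ; root = λ {d} _ → let ((e , te , re) , _) = pointed (G.tail d) in G.σ e , refl , trans (σ-tail e) te , trans (ρσ e) re
    ; noloop = λ {d} _ → no-loop d
    ; nomulti = λ {d} {e} _ _ → no-multi d e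
    ; conn = λ W cl {u} {w} _ _ Wu → reach W cl (connected u w) Wu
    ; euler = trans (cong₂ (λ x y → 2 *ℕ (x +ℕ y)) (#-all {p = λ (_ : Fin n) → true} λ _ → refl) (#-all {p = λ (_ : Fin F) → true} λ _ → refl))
        (trans euler (cong (_+ℕ 4) (sym (#-all {p = λ (_ : Fin D) → true} λ _ → refl))))
    }
    where
    reach : ∀ (W : Fin n → Bool) → (∀ {d} → true ≡ true → W (G.tail d) ≡ true → W (G.head d) ≡ true) →
      ∀ {u w} → Reach G u w → W u ≡ true → W w ≡ true
    reach W cl Reach.here h = h
    reach W cl (Reach.step d r e) h = cl refl (trans (cong W e) (reach W cl r h))

  drawing : ∃ λ p → Drawn M p
  drawing = proj₁ (draw (# (Map.Fc M)) M isMap refl)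

  sparse : Sparse M
  sparse = proj₂ (draw (# (Map.Fc M)) M isMap refl)

  -- All vertices are pointed, so x = 0 and the bound reads 2 y - 3. It is proved in doubled form:
  -- `α` maps the induced darts of smaller index injectively to the others, so each counted edge
  -- accounts for two darts.
  laman : GenLaman G reflex
  laman X le = ℕP.*-cancelˡ-≤ 2 (ℕP.≤-trans (ℕP.≤-reflexive (arith₁ (inducedEdges G reflex X))) (ℕP.≤-trans
      (ℕP.+-monoˡ-≤ 6 twice) (ℕP.≤-trans (sparse X' (λ _ _ → refl) le') (ℕP.≤-reflexive (trans (arith₂ (# X')) (cong₂ (λ x y → 2 *ℕ (3 *ℕ x +ℕ 2 *ℕ y)) (sym none) (sym all)))))))
    where
    X' : Fin n → Bool
    X' u = does (u ∈? X)
    small : Fin D → Bool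
    small d = does (toℕ d ℕP.<? toℕ (G.α d))
    arith₁ : ∀ e → 2 *ℕ (e +ℕ 3) ≡ 2 *ℕ e +ℕ 6
    arith₁ = solve-∀
    arith₂ : ∀ x → 4 *ℕ x ≡ 2 *ℕ (3 *ℕ 0 +ℕ 2 *ℕ x)
    arith₂ = solve-∀
    reflexAt-1 : ∀ v → reflexAt G reflex v ≡ 1
    reflexAt-1 v = let ((e , te , re) , uniq) = pointed v in trans (count≡# (λ e → (G.tail e =ᶠ v) ∧ reflex e)) (ℕP.≤-antisym
      (#-list-≤ (e ∷ []) _ λ x h → here (uniq x e (=ᶠ-true (G.tail x) v (∧-elim₁ h)) te (∧-elim₂ {G.tail x =ᶠ v} h) re))
      (#-pos e (∧-intro (=ᶠ-intro te) re)))
    is-1 : ∀ v → does (reflexAt G reflex v ℕP.≟ 1) ≡ true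
    is-1 v = dec-true (reflexAt G reflex v ℕP.≟ 1) (reflexAt-1 v)
    all : pointedIn G reflex X ≡ # X'
    all = trans (count≡# (λ v → X' v ∧ does (reflexAt G reflex v ℕP.≟ 1))) (#-cong λ v → trans (cong (X' v ∧_) (is-1 v)) (BoolP.∧-identityʳ (X' v)))
    none : nonPointedIn G reflex X ≡ 0
    none = trans (count≡# (λ v → X' v ∧ not (does (reflexAt G reflex v ℕP.≟ 1)))) (#-false λ v → trans (cong (λ b → X' v ∧ not b) (is-1 v)) (BoolP.∧-zeroʳ (X' v)))
    le' : 2 ≤ℕ # X'
    le' = subst (2 ≤ℕ_) (cong₂ _+ℕ_ none all) le
    E⁺ E⁻ : Fin D → Bool
    E⁺ d = induced M X' d ∧ small d
    E⁻ d = induced M X' d ∧ not (small d)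
    E⁺≤E⁻ : # E⁺ ≤ℕ # E⁻
    E⁺≤E⁻ = #-inj E⁺ E⁻ (λ d _ → G.α d)
      (λ d h → ∧-intro (∧-intro (∧-elim₂ {X' (G.tail d)} (∧-elim₁ h)) (trans (cong (X' ∘ G.tail) (α-invol d)) (∧-elim₁ {X' (G.tail d)} (∧-elim₁ h))))
        (not-intro (dec-false (toℕ (G.α d) ℕP.<? toℕ (G.α (G.α d))) λ lt → ℕP.<-asym (subst (λ z → toℕ (G.α d) ℕ.< toℕ z) (α-invol d) lt)
          (is-small d (∧-elim₂ {induced M X' d} h)))))
      (λ x y _ _ e → trans (sym (α-invol x)) (trans (cong G.α e) (α-invol y)))
      where
      is-small : ∀ d → small d ≡ true → toℕ d ℕ.< toℕ (G.α d)
      is-small d = does-true (toℕ d ℕP.<? toℕ (G.α d))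
    twice : 2 *ℕ inducedEdges G reflex X ≤ℕ # (induced M X')
    twice = ℕP.≤-trans (ℕP.≤-reflexive (cong (2 *ℕ_) (trans (count≡# (λ d → X' (G.tail d) ∧ X' (G.head d) ∧ small d))
        (#-cong λ d → sym (BoolP.∧-assoc (X' (G.tail d)) (X' (G.head d)) (small d))))))
      (ℕP.≤-trans (ℕP.+-monoʳ-≤ (# E⁺) (ℕP.≤-trans (ℕP.≤-reflexive (ℕP.+-identityʳ _)) E⁺≤E⁻)) (ℕP.≤-reflexive (sym (#-split (induced M X') small))))

-- From the drawing to a stretching

nonneg-cases : ∀ {t} → 0ℚ ≤ t → t ≡ 0ℚ ⊎ 0ℚ < t
nonneg-cases {t} h with ℚP.<-cmp 0ℚ t
... | tri< l _ _ = inj₂ l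
... | tri≈ _ e _ = inj₁ (sym e)
... | tri> _ _ g = ⊥-elim (ℚP.<-irrefl refl (ℚP.≤-<-trans h g))

convex-pos : ∀ {t x y} → 0ℚ ≤ t → t ≤ 1ℚ → 0ℚ < x → 0ℚ < y → 0ℚ < (1ℚ - t) * x + t * y
convex-pos {t} {x} {y} h h' hx hy with nonneg-cases h
... | inj₁ refl = subst (0ℚ <_) (solve 2 (λ x y → x := (con 1ℚ :- con 0ℚ) :* x :+ con 0ℚ :* y) refl x y) hx
... | inj₂ l = subst (0ℚ <_) (ℚP.+-comm (t * y) ((1ℚ - t) * x)) (pos-+-nonneg (pos-* l hy) (nonneg-* (diff-nonneg h') (ℚP.<⇒≤ hx)))

pos-irrefl : ∀ {x} → 0ℚ < x → x ≡ 0ℚ → ⊥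
pos-irrefl h e = ℚP.<-irrefl (sym e) h

seg-below : ∀ f {q a b r} → OnSeg q a b → 0ℚ < lin f (r -ᵖ a) → 0ℚ < lin f (r -ᵖ b) → 0ℚ < lin f (r -ᵖ q)
seg-below f {q} {a} {b} {r} (t , h , h' , refl) p p' = subst (0ℚ <_) (sym (eq f a b r t)) (convex-pos h h' p p')
  where
  eq : ∀ f a b r t → lin f (r -ᵖ (proj₁ a + t * (proj₁ b - proj₁ a) , proj₂ a + t * (proj₂ b - proj₂ a))) ≡ (1ℚ - t) * lin f (r -ᵖ a) + t * lin f (r -ᵖ b)
  eq (f , g) (a , a') (b , b') (r , r') t = solve 9 (λ f g a a' b b' r r' t →
    f :* (r :- (a :+ t :* (b :- a))) :+ g :* (r' :- (a' :+ t :* (b' :- a')))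
    := (con 1ℚ :- t) :* (f :* (r :- a) :+ g :* (r' :- a')) :+ t :* (f :* (r :- b) :+ g :* (r' :- b'))) refl f g a a' b b' r r' t

seg-above : ∀ f {q a b r} → OnSeg q a b → 0ℚ < lin f (a -ᵖ r) → 0ℚ < lin f (b -ᵖ r) → 0ℚ < lin f (q -ᵖ r)
seg-above f {q} {a} {b} {r} (t , h , h' , refl) p p' = subst (0ℚ <_) (sym (eq f a b r t)) (convex-pos h h' p p')
  where
  eq : ∀ f a b r t → lin f ((proj₁ a + t * (proj₁ b - proj₁ a) , proj₂ a + t * (proj₂ b - proj₂ a)) -ᵖ r) ≡ (1ℚ - t) * lin f (a -ᵖ r) + t * lin f (b -ᵖ r)
  eq (f , g) (a , a') (b , b') (r , r') t = solve 9 (λ f g a a' b b' r r' t →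
    f :* ((a :+ t :* (b :- a)) :- r) :+ g :* ((a' :+ t :* (b' :- a')) :- r')
    := (con 1ℚ :- t) :* (f :* (a :- r) :+ g :* (a' :- r')) :+ t :* (f :* (b :- r) :+ g :* (b' :- r'))) refl f g a a' b b' r r' t

seg-flip : ∀ {q a b} → OnSeg q a b → OnSeg q b a
seg-flip {q} {a} {b} (t , h , h' , refl) = 1ℚ - t , diff-nonneg h' , ℚP.≤-trans (ℚP.+-monoʳ-≤ 1ℚ (ℚP.neg-antimono-≤ h)) (ℚP.≤-reflexive (ℚP.+-identityʳ 1ℚ))
  , cong₂ _,_ (eq (proj₁ a) (proj₁ b) t) (eq (proj₂ a) (proj₂ b) t)
  where
  eq : ∀ a b t → a + t * (b - a) ≡ b + (1ℚ - t) * (a - b)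
  eq = solve 3 (λ a b t → a :+ t :* (b :- a) := b :+ (con 1ℚ :- t) :* (a :- b)) refl

-- For a common point with parameter t on the first segment, t times the cross product of the two
-- directions vanishes. The directions are independent, so t is zero.
seg-common : ∀ {q u a b} → OnSeg q u a → OnSeg q u b → 0ℚ < cross (a -ᵖ u) (b -ᵖ u) ⊎ 0ℚ < cross (b -ᵖ u) (a -ᵖ u) → q ≡ u
seg-common {q} {u} {a} {b} (t , h , _ , e) (s , _ , _ , e') c = by (nonneg-cases h)
  where
  det : (t * cross (a -ᵖ u) (b -ᵖ u)) ≡ 0ℚ
  det = trans (eq u a b t) (trans (cong₂ (λ p r → cross ((p , r) -ᵖ u) (b -ᵖ u)) (trans (sym (cong proj₁ e)) (cong proj₁ e')) (trans (sym (cong proj₂ e)) (cong proj₂ e')))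
      (eq' u b s))
    where
    eq : ∀ u a b t → t * cross (a -ᵖ u) (b -ᵖ u) ≡ cross ((proj₁ u + t * (proj₁ a - proj₁ u) , proj₂ u + t * (proj₂ a - proj₂ u)) -ᵖ u) (b -ᵖ u)
    eq (u , u') (a , a') (b , b') t = solve 7 (λ u u' a a' b b' t → t :* ((a :- u) :* (b' :- u') :- (a' :- u') :* (b :- u))
      := ((u :+ t :* (a :- u)) :- u) :* (b' :- u') :- ((u' :+ t :* (a' :- u')) :- u') :* (b :- u)) refl u u' a a' b b' t
    eq' : ∀ u b s → cross ((proj₁ u + s * (proj₁ b - proj₁ u) , proj₂ u + s * (proj₂ b - proj₂ u)) -ᵖ u) (b -ᵖ u) ≡ 0ℚ
    eq' (u , u') (b , b') s = solve 5 (λ u u' b b' s → ((u :+ s :* (b :- u)) :- u) :* (b' :- u') :- ((u' :+ s :* (b' :- u')) :- u') :* (b :- u) := con 0ℚ) refl u u' b b' s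
  by : t ≡ 0ℚ ⊎ 0ℚ < t → q ≡ u
  by (inj₁ refl) = trans e (cong₂ _,_ (z (proj₁ u) (proj₁ a)) (z (proj₂ u) (proj₂ a)))
    where
    z : ∀ u a → u + 0ℚ * (a - u) ≡ u
    z = solve 2 (λ u a → u :+ con 0ℚ :* (a :- u) := u) refl
  by (inj₂ l) = ⊥-elim ([ (λ k → pos-irrefl (pos-* l k) det)
    , (λ k → pos-irrefl (pos-* l k) (trans (cong (t *_) (cross-anti (b -ᵖ u) (a -ᵖ u))) (trans (sym (ℚP.neg-distribʳ-* t _)) (cong -_ det)))) ]′ c)

between-convex : ∀ {a c b} → 0ℚ < cross a b → StrictBetween a c b → 0ℚ < cross a c × 0ℚ < cross c b
between-convex {a} {c} {b} h s rewrite dec-true (0ℚ ℚP.<? cross a b) h = s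

between-reflex : ∀ {a c b} → ¬ (0ℚ < cross a b) → StrictBetween a c b → 0ℚ < cross a c ⊎ 0ℚ < cross c b
between-reflex {a} {c} {b} h s rewrite dec-false (0ℚ ℚP.<? cross a b) h = s

asym-cross : ∀ x y → 0ℚ < cross x y → 0ℚ < cross y x → ⊥
asym-cross x y h k = not-both h (subst (0ℚ <_) (cross-anti y x) k)

lex-diff : ∀ {x y} → LexLeq x y → 0ℚ ≤ proj₁ (y -ᵖ x) × (proj₁ (y -ᵖ x) ≡ 0ℚ → 0ℚ ≤ proj₂ (y -ᵖ x))
lex-diff {x , x'} {y , y'} (inj₁ l) = diff-nonneg (ℚP.<⇒≤ l) , λ e → ⊥-elim (pos-irrefl (diff-pos l) e)
lex-diff {x , x'} {y , y'} (inj₂ (refl , l)) = ℚP.≤-reflexive (sym (ℚP.+-inverseʳ x)) , λ _ → diff-nonneg l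

weighted-zero : ∀ {r s t x y z} → 0ℚ < r → 0ℚ < s → 0ℚ < t → 0ℚ ≤ x → 0ℚ ≤ y → 0ℚ ≤ z → r * x + (s * y + t * z) ≡ 0ℚ → x ≡ 0ℚ × y ≡ 0ℚ × z ≡ 0ℚ
weighted-zero {r} {s} {t} {x} {y} {z} hr hs ht hx hy hz e with nonneg-cases hx | nonneg-cases hy | nonneg-cases hz
... | inj₂ l | _ | _ = ⊥-elim (pos-irrefl (pos-+-nonneg (pos-* hr l) (nonneg-+ (nonneg-* (ℚP.<⇒≤ hs) hy) (nonneg-* (ℚP.<⇒≤ ht) hz))) e)
... | inj₁ _ | inj₂ l | _ = ⊥-elim (pos-irrefl (subst (0ℚ <_) (ℚP.+-comm _ (r * x)) (pos-+-nonneg (pos-+-nonneg (pos-* hs l) (nonneg-* (ℚP.<⇒≤ ht) hz)) (nonneg-* (ℚP.<⇒≤ hr) hx))) e)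
... | inj₁ _ | inj₁ _ | inj₂ l = ⊥-elim (pos-irrefl (subst (0ℚ <_) (ℚP.+-comm _ (r * x)) (pos-+-nonneg (subst (0ℚ <_) (ℚP.+-comm (t * z) (s * y)) (pos-+-nonneg (pos-* ht l) (nonneg-* (ℚP.<⇒≤ hs) hy))) (nonneg-* (ℚP.<⇒≤ hr) hx))) e)
... | inj₁ p | inj₁ q | inj₁ o = p , q , o

-- With the three areas as weights, the vectors from v to a, b, c have a vanishing positive
-- combination. If v is least, their first coordinates are nonnegative and hence all zero, then
-- likewise the second ones, so the areas would vanish.
inside-not-least : ∀ v a b c → 0ℚ < cross (b -ᵖ v) (a -ᵖ v) → 0ℚ < cross (c -ᵖ a) (v -ᵖ a) → 0ℚ < cross (v -ᵖ b) (c -ᵖ b) →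
  LexLeq v a → LexLeq v b → LexLeq v c → ⊥
inside-not-least (v , v') (a , a') (b , b') (c , c') h₁ h₂ h₃ la lb lc = pos-irrefl h₁
  (trans (cong₂ (λ p r → p * (a' - v') - r * (a - v)) (proj₁ (proj₂ zx)) (proj₁ (proj₂ zy))) (solve 2 (λ p r → con 0ℚ :* p :- con 0ℚ :* r := con 0ℚ) refl (a' - v') (a - v)))
  where
  wc = (b - v) * (a' - v') - (b' - v') * (a - v)
  wb = (c - a) * (v' - a') - (c' - a') * (v - a)
  wa = (v - b) * (c' - b') - (v' - b') * (c - b)
  sx : wa * (a - v) + (wb * (b - v) + wc * (c - v)) ≡ 0ℚ
  sx = solve 8 (λ v v' a a' b b' c c' → ((v :- b) :* (c' :- b') :- (v' :- b') :* (c :- b)) :* (a :- v)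
    :+ (((c :- a) :* (v' :- a') :- (c' :- a') :* (v :- a)) :* (b :- v) :+ ((b :- v) :* (a' :- v') :- (b' :- v') :* (a :- v)) :* (c :- v)) := con 0ℚ) refl v v' a a' b b' c c'
  sy : wa * (a' - v') + (wb * (b' - v') + wc * (c' - v')) ≡ 0ℚ
  sy = solve 8 (λ v v' a a' b b' c c' → ((v :- b) :* (c' :- b') :- (v' :- b') :* (c :- b)) :* (a' :- v')
    :+ (((c :- a) :* (v' :- a') :- (c' :- a') :* (v :- a)) :* (b' :- v') :+ ((b :- v) :* (a' :- v') :- (b' :- v') :* (a :- v)) :* (c' :- v')) := con 0ℚ) refl v v' a a' b b' c c'
  zx : a - v ≡ 0ℚ × b - v ≡ 0ℚ × c - v ≡ 0ℚ
  zx = weighted-zero h₃ h₂ h₁ (proj₁ (lex-diff la)) (proj₁ (lex-diff lb)) (proj₁ (lex-diff lc)) sx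
  zy : a' - v' ≡ 0ℚ × b' - v' ≡ 0ℚ × c' - v' ≡ 0ℚ
  zy = weighted-zero h₃ h₂ h₁ (proj₂ (lex-diff la) (proj₁ zx)) (proj₂ (lex-diff lb) (proj₁ (proj₂ zx))) (proj₂ (lex-diff lc) (proj₂ (proj₂ zx))) sy

module Stretching {n : ℕ} (G : Embedding n) (reflex : Fin (Embedding.D G) → Bool) (H : IsComb4PPT G reflex)
  (p : Fin n → Point) (drawn : Drawn (FromEmbedding.M G reflex H) p) where
  open FromEmbedding G reflex H
  open IsComb4PPT H
  open IsCombPT pt
  open IsPlaneSimple plane
  open Order M isMap
  open Drawn drawn

  before-σ : ∀ {e} → reflex e ≡ false → Before M e (G.σ e)
  before-σ {e} h = subst (Before M e) (σ≡ e) (base refl (trans (cong ρ (σ≡ e)) (trans (ρσ e) h)))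

  σ-first : ∀ {e f} → reflex e ≡ true → G.tail f ≡ G.tail e → G.σ e ≡ f ⊎ Before M (G.σ e) f
  σ-first {e} {f} h t = from-root {G.σ e} {f} refl (trans (ρσ e) h) refl (trans (σ-tail e) (sym t))

  is-last : ∀ {e f} → reflex e ≡ true → Before M e f → ⊥
  is-last {e} h b = no-after-last (trans (cong ρ (σ≡ e)) (trans (ρσ e) h)) b

  front-σ : ∀ {e f} → Before M e f → G.σ e ≡ f ⊎ Before M (G.σ e) f
  front-σ {e} {f} b = subst (λ z → z ≡ f ⊎ Before M z f) (σ≡ e) (proj₂ (front b))

  ordered-σ : ∀ {e} → reflex e ≡ false → 0ℚ < cross (vec e) (vec (G.σ e))
  ordered-σ h = ordered (before-σ h)

  reflex-σ : ∀ {e} → reflex e ≡ true → G.σ e ≡ e ⊎ 0ℚ < cross (vec (G.σ e)) (vec e)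
  reflex-σ h = [ inj₁ , (λ b → inj₂ (ordered b)) ]′ (σ-first h refl)

  reflex-not-pos : ∀ {e} → reflex e ≡ true → ¬ (0ℚ < cross (vec e) (vec (G.σ e)))
  reflex-not-pos {e} h k = [ (λ q → pos-irrefl k (trans (cong (λ z → cross (vec e) (vec z)) q) (cross-self (vec e))))
    , asym-cross (vec e) (vec (G.σ e)) k ]′ (reflex-σ h)

  injective : ∀ u v → p u ≡ p v → u ≡ v
  injective u v e with eq? u v
  ... | inj₁ q = q
  ... | inj₂ q with distinct {u} {v} refl refl q
  ...   | f , (h , _) , _ = ⊥-elim (pos-irrefl h (trans (cong (λ z → lin f (p v -ᵖ z)) e) (lin-self f (p v))))

  common-tail : ∀ d d' q → d ≢ d' → G.tail d ≡ G.tail d' → OnSeg q (p (G.tail d)) (p (G.head d)) →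
    OnSeg q (p (G.tail d')) (p (G.head d')) → q ≡ p (G.tail d)
  common-tail d d' q ne t on on' = seg-common {q} {p (G.tail d)} {p (G.head d)} {p (G.head d')} on (subst (λ u → OnSeg q (p u) (p (G.head d'))) (sym t) on')
      (side (total {d} {d'} refl refl t))
    where
    to : ∀ {x y} → 0ℚ < cross x (vec d') → y ≡ G.tail d' → 0ℚ < cross x (p (G.head d') -ᵖ p y)
    to h refl = h
    to' : ∀ {x y} → 0ℚ < cross (vec d') x → y ≡ G.tail d' → 0ℚ < cross (p (G.head d') -ᵖ p y) x
    to' h refl = h
    side : d ≡ d' ⊎ Before M d d' ⊎ Before M d' d → 0ℚ < cross (vec d) (p (G.head d') -ᵖ p (G.tail d)) ⊎ 0ℚ < cross (p (G.head d') -ᵖ p (G.tail d)) (vec d)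
    side (inj₁ e) = ⊥-elim (ne e)
    side (inj₂ (inj₁ b)) = inj₁ (to {vec d} (ordered b) t)
    side (inj₂ (inj₂ b)) = inj₂ (to' {vec d} (ordered b) t)

  flip-dart : ∀ {q} d → OnSeg q (p (G.tail d)) (p (G.head d)) → OnSeg q (p (G.tail (G.α d))) (p (G.head (G.α d)))
  flip-dart {q} d on = subst (λ u → OnSeg q (p (G.head d)) (p u)) (cong G.tail (sym (α-invol d))) (seg-flip {q} {p (G.tail d)} {p (G.head d)} on)

  disjoint : ∀ {q u₁ u₂ u₃ u₄} → Separated₄ p u₁ u₂ u₃ u₄ → OnSeg q (p u₁) (p u₂) → OnSeg q (p u₃) (p u₄) → ⊥
  disjoint {q} {u₁} {u₂} {u₃} {u₄} (f , (h₁ , h₂) , (h₃ , h₄)) on on' = pos-irrefl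
    (seg-above f {q} {p u₃} {p u₄} {q} on' (seg-below f {q} {p u₁} {p u₂} {p u₃} on h₁ h₃) (seg-below f {q} {p u₁} {p u₂} {p u₄} on h₂ h₄)) (lin-self f q)

  -- Edges without a common end are strictly separated. If they share an end, reversing darts makes
  -- it the common tail, where distinct darts have independent directions because they are ordered.
  noCrossing : ∀ d d' q → d' ≢ d → d' ≢ G.α d → OnSeg q (p (G.tail d)) (p (G.head d)) → OnSeg q (p (G.tail d')) (p (G.head d')) →
    ∃ λ u → q ≡ p u × (u ≡ G.tail d ⊎ u ≡ G.head d) × (u ≡ G.tail d' ⊎ u ≡ G.head d')
  noCrossing d d' q n n' on on' with eq? (G.tail d) (G.tail d') | eq? (G.tail d) (G.head d') | eq? (G.head d) (G.tail d') | eq? (G.head d) (G.head d')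
  ... | inj₁ t | _ | _ | _ = G.tail d , common-tail d d' q (≢-sym n) t on on' , inj₁ refl , inj₁ t
  ... | inj₂ _ | inj₁ t | _ | _ = G.tail d , common-tail d (G.α d') q (λ e → n' (trans (sym (α-invol d')) (cong G.α (sym e)))) t on (flip-dart d' on')
        , inj₁ refl , inj₂ t
  ... | inj₂ _ | inj₂ _ | inj₁ t | _ = G.head d , common-tail (G.α d) d' q (≢-sym n') t (flip-dart d on) on' , inj₂ refl , inj₁ t
  ... | inj₂ _ | inj₂ _ | inj₂ _ | inj₁ t = G.head d , common-tail (G.α d) (G.α d') q
        (λ e → n (trans (sym (α-invol d')) (trans (cong G.α (sym e)) (α-invol d)))) t (flip-dart d on) (flip-dart d' on') , inj₂ refl , inj₂ t
  ... | inj₂ a | inj₂ b | inj₂ c | inj₂ e = ⊥-elim (disjoint (apart {d} {d'} refl refl a b c e) on on')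

  rotation : ∀ e f → G.tail f ≡ G.tail e → f ≢ e → f ≢ G.σ e → ¬ StrictBetween (vec e) (vec f) (vec (G.σ e))
  rotation e f t n n' s = by (bool-cases (reflex e)) (total {e} {f} refl refl (sym t))
    where
    Γ = G.σ e
    convex : reflex e ≡ false → 0ℚ < cross (vec e) (vec f) × 0ℚ < cross (vec f) (vec Γ)
    convex h = between-convex {vec e} {vec f} {vec Γ} (ordered-σ h) s
    after : G.σ e ≡ f ⊎ Before M (G.σ e) f → 0ℚ < cross (vec f) (vec Γ) → ⊥
    after (inj₁ q) _ = n' (sym q)
    after (inj₂ b) k = asym-cross (vec f) (vec Γ) k (ordered b)
    by : reflex e ≡ true ⊎ reflex e ≡ false → e ≡ f ⊎ Before M e f ⊎ Before M f e → ⊥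
    by _ (inj₁ q) = n (sym q)
    by (inj₂ h) (inj₂ (inj₂ b)) = asym-cross (vec e) (vec f) (proj₁ (convex h)) (ordered b)
    by (inj₂ h) (inj₂ (inj₁ b)) = after (front-σ b) (proj₂ (convex h))
    by (inj₁ h) (inj₂ (inj₁ b)) = is-last h b
    -- At the reflex corner `e` is the last dart and `σ e` the first, so `f` is in between and both
    -- alternatives contradict the order.
    by (inj₁ h) (inj₂ (inj₂ b)) = [ (λ k → asym-cross (vec e) (vec f) k (ordered b)) , after (σ-first h t) ]′
      (between-reflex {vec e} {vec f} {vec Γ} (reflex-not-pos h) s)

  -- The reflex vertex of a quadrilateral lies inside the triangle formed by the other three, so it is not extreme.
  inner-not-least : ∀ r → G.face r ≢ G.outer → ρ r ≡ true → (∀ w → LexLeq (p (G.tail r)) (p w)) → ⊥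
  inner-not-least r nd h least = inside-not-least (p v) (p a) (p b) (p c)
      (cv h₃ (head-α A₂) h₂ (ordered (first (from-root {r} {G.α d₂} refl h refl (sym h₂)))))
      (cv' (head-α A₁) h₂ h₁ (ordered (subst (Before M (G.α d₁)) σα₁ (base refl (trans (cong ρ σα₁) ρ₂)))))
      (cv'' (cong G.tail (α-invol r)) h₄ h₃ (ordered (subst (Before M (G.α r)) σα₃ (base refl (trans (cong ρ σα₃) ρ₄)))))
      (least a) (least b) (least c)
    where
    open MapFacts M isMap using (head-α; σA)
    open Face4 M isMap r refl h nd
    first : r ≡ G.α d₂ ⊎ Before M r (G.α d₂) → Before M r (G.α d₂)
    first (inj₁ e) = ⊥-elim (a≢b (trans (sym (head-α A₂)) (trans (cong G.head (sym e)) h₃)))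
    first (inj₂ b) = b
    cv : ∀ {x y z} → x ≡ b → y ≡ a → z ≡ v → 0ℚ < cross (p x -ᵖ p v) (p y -ᵖ p z) → 0ℚ < cross (p b -ᵖ p v) (p a -ᵖ p v)
    cv refl refl refl k = k
    cv' : ∀ {x y z} → x ≡ c → y ≡ v → z ≡ a → 0ℚ < cross (p x -ᵖ p z) (p y -ᵖ p a) → 0ℚ < cross (p c -ᵖ p a) (p v -ᵖ p a)
    cv' refl refl refl k = k
    cv'' : ∀ {x y z} → x ≡ v → y ≡ c → z ≡ b → 0ℚ < cross (p x -ᵖ p z) (p y -ᵖ p b) → 0ℚ < cross (p v -ᵖ p b) (p c -ᵖ p b)
    cv'' refl refl refl k = k

  outerFace : ∀ v e → (∀ w → LexLeq (p v) (p w)) → G.tail e ≡ v → InAngle G reflex p e (- 1ℚ , 0ℚ) → G.angleFace e ≡ G.outer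
  outerFace v e least refl i with eq? (G.angleFace e) G.outer | bool-cases (reflex e)
  ... | inj₁ q | _ = q
  ... | inj₂ nd | inj₁ h = ⊥-elim (inner-not-least (G.σ e) nd (trans (ρσ e) h) (subst (λ u → ∀ w → LexLeq (p u) (p w)) (sym (σ-tail e)) least))
  ... | inj₂ nd | inj₂ h = ⊥-elim ([ (λ q → pos-irrefl (ordered-σ h) (trans (cong (λ z → cross (vec e) (vec z)) q) (cross-self (vec e)))) , convex ]′ i)
    where
    convex : StrictBetween (vec e) (- 1ℚ , 0ℚ) (vec (G.σ e)) → ⊥
    convex s with between-convex {vec e} {(- 1ℚ , 0ℚ)} {vec (G.σ e)} (ordered-σ h) s
    -- At the least vertex both darts have nonnegative first coordinates. Expanding the cross
    -- product of `e` and `σ e` through the direction to the left makes it the negative of a sum of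
    -- nonnegative products, although the corner is convex.
    ... | s₁ , s₂ = ℚP.<-irrefl refl (ℚP.<-≤-trans (ordered-σ h) (ℚP.≤-trans (ℚP.≤-reflexive (eq (proj₁ (vec e)) (proj₂ (vec e)) (proj₁ (vec (G.σ e))) (proj₂ (vec (G.σ e)))))
          (ℚP.neg-antimono-≤ (nonneg-+ (nonneg-* (proj₁ (lex-diff (least (G.head e)))) (ℚP.<⇒≤ s₂)) (nonneg-* (ℚP.<⇒≤ s₁) x'≥0)))))
      where
      x'≥0 : 0ℚ ≤ proj₁ (vec (G.σ e))
      x'≥0 = proj₁ (lex-diff (subst (λ u → LexLeq (p u) (p (G.head (G.σ e)))) (sym (σ-tail e)) (least (G.head (G.σ e)))))
      eq : ∀ x y x' y' → x * y' - y * x' ≡ - (x * (- 1ℚ * y' - 0ℚ * x') + (x * 0ℚ - y * (- 1ℚ)) * x')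
      eq = solve 4 (λ x y x' y' → x :* y' :- y :* x' := :- (x :* ((con (- 1ℚ)) :* y' :- con 0ℚ :* x') :+ (x :* con 0ℚ :- y :* (con (- 1ℚ))) :* x')) refl

  hull-weak : ∀ d w → G.face d ≡ G.outer → 0ℚ ≤ cross (vec d) (p w -ᵖ p (G.tail d))
  hull-weak d w fd with eq? w (G.tail d) | eq? w (G.head d)
  ... | inj₁ refl | _ = ℚP.≤-reflexive (sym (cross-null (vec d) (p w)))
  ... | inj₂ _ | inj₁ refl = ℚP.≤-reflexive (sym (cross-self (vec d)))
  ... | inj₂ n₁ | inj₂ n₂ = ℚP.<⇒≤ (hull {d} {w} refl fd refl n₁ n₂)

  geoConvex : ∀ e → geoConvexᵇ G reflex p e ≡ not (reflex e)
  geoConvex e with bool-cases (reflex e)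
  ... | inj₁ h = trans (dec-false (0ℚ ℚP.<? cross (vec e) (vec (G.σ e))) (reflex-not-pos h)) (cong not (sym h))
  ... | inj₂ h = trans (dec-true (0ℚ ℚP.<? cross (vec e) (vec (G.σ e))) (ordered-σ h)) (cong not (sym h))

  pseudoTri : ∀ f → f ≢ G.outer → count (λ e → (G.angleFace e =ᶠ f) ∧ geoConvexᵇ G reflex p e) ≡ 3
  pseudoTri f nf = trans (count≡# (λ e → (G.angleFace e =ᶠ f) ∧ geoConvexᵇ G reflex p e))
    (trans (#-cong λ e → cong ((G.angleFace e =ᶠ f) ∧_) (geoConvex e)) (trans (sym (count≡# (λ e → (G.angleFace e =ᶠ f) ∧ not (reflex e)))) (three-convex f nf)))

  geoReflex : ∀ e → reflex e ≡ true → GeoReflex G reflex p e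
  geoReflex e h = [ inj₁ , (λ k → inj₂ (ℚP.≤-<-trans (ℚP.≤-reflexive (cross-anti (vec e) (vec (G.σ e)))) (ℚP.neg-antimono-< k))) ]′ (reflex-σ h)

  geoReflex⁻ : ∀ e → GeoReflex G reflex p e → reflex e ≡ true
  geoReflex⁻ e g with bool-cases (reflex e)
  ... | inj₁ h = h
  ... | inj₂ h = ⊥-elim ([ (λ q → pos-irrefl (ordered-σ h) (trans (cong (λ z → cross (vec e) (vec z)) q) (cross-self (vec e)))) , ℚP.<-asym (ordered-σ h) ]′ g)

  stretching : IsStretching G reflex p
  stretching = record
    { injective = injective
    ; noCrossing = noCrossing
    ; rotation = rotation
    ; outerFace = outerFace
    ; hull = hull-weak
    ; pseudoTri = pseudoTri
    ; degree≤4 = λ f nf → [ (λ e → ℕP.≤-trans (ℕP.≤-reflexive e) (ℕP.n≤1+n 3)) , ℕP.≤-reflexive ]′ (proj₁ (faces34 f nf))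
    ; pointedGeo = λ v → let ((e , te , re) , _) = pointed v in e , te , geoReflex e re
    ; tagsMatch = λ e → mk⇔ (geoReflex⁻ e) (geoReflex e)
    }

theorem1 : ∀ (n : ℕ) (G : Embedding n) (reflex : Fin (Embedding.D G) → Bool) →
    IsComb4PPT G reflex →
    Stretchable G reflex × GenLaman G reflex
theorem1 n G reflex H = (proj₁ drawing , Stretching.stretching G reflex H (proj₁ drawing) (proj₂ drawing)) , laman
  where open FromEmbedding G reflex H
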